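{- Let $F\in\mathbb{Q}[x,y]$ satisfy: $F(\mathbb{R}\times\mathbb{R})=\mathbb{R}$; for all but finitely many $c\in\mathbb{C}$ the curve $F(x,y)=c$ is smooth and isomorphic to $\mathbb{A}^1_*$; the curve $C=\{F(x,y)=0\}$ is smooth and isomorphic over $\overline{\mathbb{Q}}$ to $\mathbb{A}^1_*$, via $\phi:\mathbb{P}^1\setminus\{a,b\}\to C$ with $a,b\in\mathbb{P}^1(\mathbb{R})$. Let $\tilde\phi:\mathbb{P}^1\to\mathbb{P}^2$ be the extension of $\phi$ to $\mathbb{P}^1$, where $\mathbb{A}^2\subset\mathbb{P}^2$ is the standard compactification. If $\tilde\phi(a)\neq\tilde\phi(b)$, then the set $\{(x,y)\in\mathbb{Q}^2 : F(x,y)<0\}$ satisfies the weak approximation property.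
   Context: $\mathbb{A}^1_*=\mathbb{A}^1\setminus\{0\}$. A set $R\subset\mathbb{Q}^2$ satisfies the weak approximation property if for every $(x_0,y_0)\in\mathbb{Q}^2$ and every positive integer $N$ there exists $(x,y)\in R$ with $x-x_0\in N\mathbb{Z}$ and $y-y_0\in N\mathbb{Z}$. -}

module Defs where

open import Level using (0ℓ)
open import Algebra.Bundles using (RawRing; CommutativeRing)
import Algebra.Definitions.RawSemiring as RawSemiringDefinitions
open import Data.Bool.Base using (if_then_else_)
open import Data.Fin.Base using (Fin)
open import Data.Integer.Base as ℤ using (ℤ; +_; -[1+_])
open import Data.List.Base as List using (List; []; _∷_)
open import Data.Nat.Base as ℕ using (ℕ; suc; pred)
import Data.Nat.Properties as ℕ
open import Data.Product.Base using (Σ; ∃; ∃₂; _×_; _,_; proj₁; proj₂; map₁)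
open import Data.Rational.Base as ℚ using (ℚ; ↥_; ↧ₙ_)
open import Data.Unit.Base using (tt)
open import Data.Vec.Base as Vec using (Vec; []; _∷_; lookup)
open import Data.Vec.Properties using (≡-dec)
open import Relation.Binary.Core using (Rel)
open import Relation.Binary.PropositionalEquality using (_≡_; _≢_)
open import Relation.Binary.Structures using (IsStrictTotalOrder)
open import Relation.Nullary.Decidable using (does)
open import Relation.Nullary.Negation using (¬_)
open import Relation.Unary using (Pred; U; _∈_)

-- Polynomials in n variables are finite formal sums of terms: a coefficient
-- and an exponent vector. Exponent vectors may be repeated and coefficients
-- may vanish, so properties of a polynomial are stated through `coeff`/`eval`.

Poly : Set → ℕ → Set
Poly A n = List (A × Vec ℕ n)

mapCoeff : {A B : Set} {n : ℕ} → (A → B) → Poly A n → Poly B n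
mapCoeff f = List.map (map₁ f)

module Polynomial (K : RawRing 0ℓ 0ℓ) where
  open RawRing K
  open RawSemiringDefinitions rawSemiring using (_^_) renaming (_×_ to _·_)

  monomial : {n : ℕ} → Vec ℕ n → Vec Carrier n → Carrier
  monomial e x = Vec.foldr′ _*_ 1# (Vec.zipWith _^_ x e)

  eval : {n : ℕ} → Poly Carrier n → Vec Carrier n → Carrier
  eval p x = List.foldr (λ (a , e) s → a * monomial e x + s) 0# p

  coeff : {n : ℕ} → Poly Carrier n → Vec ℕ n → Carrier
  coeff p e =
    List.foldr (λ (a , e′) s → if does (≡-dec ℕ._≟_ e′ e) then a + s else s) 0# p

  ∂ : {n : ℕ} → Fin n → Poly Carrier n → Poly Carrier n
  ∂ i = List.map (λ (a , e) → lookup e i · a , Vec.updateAt e i pred)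

  _-const_ : {n : ℕ} → Poly Carrier n → Carrier → Poly Carrier n
  _-const_ {n} p c = (- c , Vec.replicate n 0) ∷ p

  Homogeneous : {n : ℕ} → ℕ → Poly Carrier n → Set
  Homogeneous d p = ∀ e → coeff p e ≉ 0# → Vec.sum e ≡ d

-- Varieties are represented by their sets of K-points inside projective space;
-- this is adequate for reduced varieties over an algebraically closed K, and
-- the module is only instantiated at ℂ.

module Projective (K : RawRing 0ℓ 0ℓ) where
  open RawRing K
  open Polynomial K

  NonZeroVec : {n : ℕ} → Vec Carrier n → Set
  NonZeroVec v = ∃ λ i → lookup v i ≉ 0#

  ℙ : ℕ → Set
  ℙ n = Σ (Vec Carrier (suc n)) NonZeroVec

  infix 4 _∝_ _∼_
  _∝_ : {n : ℕ} → Vec Carrier n → Vec Carrier n → Set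
  v ∝ w = ∃ λ c → c ≉ 0# × (∀ i → lookup v i ≈ c * lookup w i)

  _∼_ : {n : ℕ} → ℙ n → ℙ n → Set
  (v , _) ∼ (w , _) = v ∝ w

  Subset : ℕ → Set₁
  Subset n = Pred (ℙ n) 0ℓ

  -- A regular map is one given, near each point of X, by a tuple G of
  -- homogeneous polynomials of equal degree without common zero there; "near p"
  -- is the Zariski neighbourhood of p where G does not vanish identically.
  -- The coefficients of G lie in k, which fixes the field of definition.
  record Morphism (k : Pred Carrier 0ℓ) {n m : ℕ} (X : Subset n) (Y : Subset m) : Set where
    field
      to      : ∃ X → ∃ Y
      cong    : ∀ x x′ → proj₁ x ∼ proj₁ x′ → proj₁ (to x) ∼ proj₁ (to x′)
      regular : (x : ∃ X) →
        Σ (Vec (Poly Carrier (suc n)) (suc m)) λ G →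
        ∃ λ d →
          (∀ i → Homogeneous d (lookup G i))
        × (∀ i e → coeff (lookup G i) e ∈ k)
        × NonZeroVec (Vec.map (λ g → eval g (proj₁ (proj₁ x))) G)
        × (∀ (y : ∃ X) (nz : NonZeroVec (Vec.map (λ g → eval g (proj₁ (proj₁ y))) G)) →
             proj₁ (to y) ∼ (Vec.map (λ g → eval g (proj₁ (proj₁ y))) G , nz))

    apply : ∃ X → ℙ m
    apply x = proj₁ (to x)

  record Isomorphism (k : Pred Carrier 0ℓ) {n m : ℕ} (X : Subset n) (Y : Subset m) : Set where
    field
      morphism : Morphism k X Y
      inverse  : Morphism k Y X
    private
      module f = Morphism morphism
      module g = Morphism inverse
    field
      inverseˡ : ∀ y → proj₁ (f.to (g.to y)) ∼ proj₁ y
      inverseʳ : ∀ x → proj₁ (g.to (f.to x)) ∼ proj₁ x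

  -- The affine curve p = 0 in 𝔸² = {[x:y:1]} ⊂ ℙ².
  Curve : Poly Carrier 2 → Subset 2
  Curve p (v , _) =
    ∃₂ λ x y → eval p (x ∷ y ∷ []) ≈ 0# × v ∝ (x ∷ y ∷ 1# ∷ [])

  -- 𝔸¹ ∖ {0}, with 𝔸¹ = {[t:1]} ⊂ ℙ¹.
  𝔸¹⋆ : Subset 1
  𝔸¹⋆ (v , _) = ∃ λ t → t ≉ 0# × v ∝ (t ∷ 1# ∷ [])

  ℙ¹∖ : ℙ 1 → ℙ 1 → Subset 1
  ℙ¹∖ a b p = ¬ (p ∼ a) × ¬ (p ∼ b)

  Smooth : Poly Carrier 2 → Set
  Smooth p = ∀ v → eval p v ≈ 0# → ∃ λ i → eval (∂ i p) v ≉ 0#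

-- Classically, the unique model up to isomorphism is ℝ.

record CompleteOrderedField : Set₁ where
  infix 4 _<_
  infix 8 _⁻¹
  field
    commutativeRing : CommutativeRing 0ℓ 0ℓ
  open CommutativeRing commutativeRing public
  field
    _<_                : Rel Carrier 0ℓ
    isStrictTotalOrder : IsStrictTotalOrder _≈_ _<_
    +-monoˡ-<          : ∀ {x y} z → x < y → x + z < y + z
    *-positive         : ∀ {x y} → 0# < x → 0# < y → 0# < x * y
    0#≉1#              : 0# ≉ 1#
    _⁻¹                : Carrier → Carrier  -- unspecified at 0
    ⁻¹-inverseʳ        : ∀ {x} → x ≉ 0# → x * x ⁻¹ ≈ 1#

  UpperBound : Pred Carrier 0ℓ → Pred Carrier 0ℓ
  UpperBound P u = ∀ x → x ∈ P → ¬ (u < x)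

  field
    supremum : (P : Pred Carrier 0ℓ) → ∃ P → ∃ (UpperBound P) →
               ∃ λ s → s ∈ UpperBound P × (∀ u → u ∈ UpperBound P → ¬ (u < s))

module RealComplex (𝓡 : CompleteOrderedField) where
  private module R = CompleteOrderedField 𝓡
  open RawSemiringDefinitions (RawRing.rawSemiring R.rawRing) using () renaming (_×_ to _·_)

  ℝ : Set
  ℝ = R.Carrier

  ℝ-rawRing : RawRing 0ℓ 0ℓ
  ℝ-rawRing = R.rawRing

  infix 4 _≈ℝ_
  _≈ℝ_ : Rel ℝ 0ℓ
  _≈ℝ_ = R._≈_

  ℤ→ℝ : ℤ → ℝ
  ℤ→ℝ (+ n)    = n · R.1#
  ℤ→ℝ -[1+ n ] = R.- (suc n · R.1#)

  ℚ→ℝ : ℚ → ℝ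
  ℚ→ℝ q = ℤ→ℝ (↥ q) R.* (↧ₙ q · R.1#) R.⁻¹

  ℂ : Set
  ℂ = ℝ × ℝ

  infix 4 _≈ℂ_
  _≈ℂ_ : Rel ℂ 0ℓ
  (a , b) ≈ℂ (c , d) = a ≈ℝ c × b ≈ℝ d

  ℂ-rawRing : RawRing 0ℓ 0ℓ
  ℂ-rawRing = record
    { Carrier = ℂ
    ; _≈_     = _≈ℂ_
    ; _+_     = λ (a , b) (c , d) → a R.+ c , b R.+ d
    ; _*_     = λ (a , b) (c , d) → a R.* c R.- b R.* d , a R.* d R.+ b R.* c
    ; -_      = λ (a , b) → R.- a , R.- b
    ; 0#      = R.0# , R.0#
    ; 1#      = R.1# , R.0#
    }

  ℝ→ℂ : ℝ → ℂ
  ℝ→ℂ x = x , R.0#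

  ℚ→ℂ : ℚ → ℂ
  ℚ→ℂ q = ℝ→ℂ (ℚ→ℝ q)

  open Polynomial ℂ-rawRing public using (_-const_)
  open Projective ℂ-rawRing public

  evalℝ : {n : ℕ} → Poly ℚ n → Vec ℝ n → ℝ
  evalℝ p = Polynomial.eval ℝ-rawRing (mapCoeff ℚ→ℝ p)

  infixl 9 _⊗ℂ
  _⊗ℂ : {n : ℕ} → Poly ℚ n → Poly ℂ n
  p ⊗ℂ = mapCoeff ℚ→ℂ p

  -- The subfield ℚ̄ ⊂ ℂ of algebraic numbers.
  ℚ̄ : Pred ℂ 0ℓ
  ℚ̄ z = Σ (Poly ℚ 1) λ p →
    (∃ λ e → Polynomial.coeff ℚ.+-*-rawRing p e ≢ ℚ.0ℚ)
    × Polynomial.eval ℂ-rawRing (p ⊗ℂ) (z ∷ []) ≈ℂ RawRing.0# ℂ-rawRing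

  allℂ : Pred ℂ 0ℓ
  allℂ = U

  IsRealPoint : {n : ℕ} → ℙ n → Set
  IsRealPoint {n} (v , _) = Σ (Vec ℝ (suc n)) λ r → v ∝ Vec.map ℝ→ℂ r

  fullℙ : (n : ℕ) → Subset n
  fullℙ n = U

  Extends : {k : Pred ℂ 0ℓ} {n m : ℕ} {X : Subset n} {Y : Subset m} →
            Morphism k (fullℙ n) (fullℙ m) → Morphism k X Y → Set
  Extends {X = X} f̃ f =
    ∀ (x : ∃ X) → Morphism.apply f̃ (proj₁ x , tt) ∼ Morphism.apply f x

evalℚ : {n : ℕ} → Poly ℚ n → Vec ℚ n → ℚ
evalℚ = Polynomial.eval ℚ.+-*-rawRing

infix 4 _∈_·ℤ
_∈_·ℤ : ℚ → ℕ → Set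
q ∈ N ·ℤ = ∃ λ (k : ℤ) → q ≡ ((+ N) ℤ.* k) ℚ./ 1

WeakApproximation : (ℚ → ℚ → Set) → Set
WeakApproximation S =
  ∀ (x₀ y₀ : ℚ) (N : ℕ) → 0 ℕ.< N →
  ∃₂ λ x y → S x y × (x ℚ.- x₀) ∈ N ·ℤ × (y ℚ.- y₀) ∈ N ·ℤ

{-# OPTIONS --safe #-}
module Submission where

-- Let H be the homogenisation of F and T = H(x, y, 0) its top form. If T(w) < 0
-- for some real w, then F is negative at the lattice points closest to large
-- multiples of w, and every class modulo N is met. Otherwise T ≥ 0 on ℝ², and this
-- is contradictory, as follows.
--
-- The points φ̃(a) ≠ φ̃(b) lie at infinity, because φ⁻¹ would otherwise send them back
-- to a and b; so T has two non-proportional zeros. A fibre F = c isomorphic to 𝔸¹⋆ is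
-- parametrised by Laurent polynomials in t. Complex conjugation on it, for real c, is
-- t ↦ λ t̄ⁿ with n = ±1, since by the fundamental theorem of algebra an invertible
-- regular function on ℂ⋆ is a monomial. If n = -1 the real points lie in a box; then
-- F < c outside the box because F is unbounded below, although T ≥ 0 makes F tend to
-- +∞ in some direction. If n = 1 a ray of parameters consists of real points, and its
-- ends point in directions P and Q. Every zero of T is the direction of one of the
-- ends (follow a small root of u ↦ H(v + uω, z) - c zᵈ as z → 0), so P and Q are the two
-- zeros of T and T > 0 on P ± Q. Hence F is bounded below on the lines ℝ(P ± Q). But for
-- c below these bounds the real curve F = c still runs from direction P to direction Q
-- and must cross one of the two lines.
open import Defs
open import Level using (0ℓ)
open import Algebra.Bundles using (CommutativeRing; RawRing)
import Algebra.Properties.CommutativeSemiring.Exp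
import Algebra.Properties.Ring
import Algebra.Properties.Semiring.Exp
import Algebra.Properties.Semiring.Mult
import Algebra.Properties.Semiring.Mult.TCOptimised
import Algebra.Solver.Ring
import Algebra.Solver.Ring.AlmostCommutativeRing as ACR
open import Axiom.ExcludedMiddle using (ExcludedMiddle)
open import Data.Empty using (⊥; ⊥-elim)
open import Data.Fin.Base using (Fin; zero; suc)
open import Data.Integer.Base as ℤ using (ℤ; +_; -[1+_])
import Data.Integer.Properties as ℤ
open import Data.List.Base as List using (List; []; _∷_; length)
open import Data.List.Relation.Unary.All as ListAll using ([]; _∷_) renaming (All to ListAll)
open import Data.List.Relation.Unary.Any using (Any; here; there)
open import Data.Maybe.Base using (Maybe; just; nothing)
open import Data.Nat.Base as ℕ using (ℕ; zero; suc)
import Data.Nat.Properties as ℕ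
open import Data.Product.Base using (Σ; ∃; ∃₂; _×_; _,_; proj₁; proj₂)
open import Data.Rational.Base as ℚ using (ℚ; mkℚ; 0ℚ; 1ℚ; toℚᵘ)
import Data.Rational.Properties as ℚ
open import Data.Rational.Unnormalised.Base as ℚᵘ using (ℚᵘ; mkℚᵘ)
open import Data.Sum.Base using (_⊎_; inj₁; inj₂; [_,_]′)
open import Data.Unit.Base using (tt)
open import Data.Vec.Base as Vec using (Vec; []; _∷_; lookup)
open import Data.Vec.Relation.Binary.Pointwise.Inductive using (Pointwise; []; _∷_)
open import Data.Vec.Relation.Unary.All using (All; []; _∷_)
open import Relation.Binary.Definitions using (Tri; tri<; tri≈; tri>)
open import Relation.Binary.PropositionalEquality as ≡ using (_≡_)
import Relation.Binary.Reasoning.Setoid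
open import Relation.Binary.Structures using (IsStrictTotalOrder)
open import Relation.Nullary.Decidable using (Dec; yes; no; decidable-stable)
open import Relation.Nullary.Negation using (¬_)
open import Relation.Unary using (Pred; U)

-- The two zeros of T that come from φ̃ are complex, whereas signs and crossings are real. A first
-- fibre F = c, with c negative and below the real parts of all exceptional values, bridges the gap:
-- its real ends P and Q are complex multiples of these zeros. They fix the two lines and the lower
-- bounds of F on them, independently of c. The contradiction comes from a second fibre, with c
-- below these bounds. Its ends are again multiples of P and Q, but with unknown signs; according to
-- these signs ℝ(P + Q) or ℝ(P - Q) separates them, which is why both lines are kept. Morphisms are
-- known only through local tuples of polynomials, so limits along a curve are not directly
-- available. They are replaced by polynomials in one variable: an identity that holds off finitely
-- many parameters holds everywhere, in particular at the missing one.

module IntegerCoefficients (R : CommutativeRing 0ℓ 0ℓ) where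
  open CommutativeRing R
  open Algebra.Properties.Ring ring
  open Algebra.Properties.Semiring.Mult semiring using (×-homo-+; ×1-homo-*) renaming (_×_ to _·_)
  open Algebra.Properties.Semiring.Mult.TCOptimised semiring using (×ᵤ≈×) renaming (_×_ to _×′_)
  open Relation.Binary.Reasoning.Setoid setoid

  -- Same recursion as `ℤ→ℝ`, so that over the real field the two agree by cases. The ring laws are
  -- proved for this form and then carried over to the one that the solver uses.
  ⟦_⟧ : ℤ → Carrier
  ⟦ + n ⟧      = n · 1#
  ⟦ -[1+ n ] ⟧ = - (suc n · 1#)

  ⟦⟧-⊖ : ∀ m n → ⟦ m ℤ.⊖ n ⟧ ≈ m · 1# - n · 1#
  ⟦⟧-⊖ zero    zero    = sym (-‿inverseʳ 0#)
  ⟦⟧-⊖ zero    (suc n) = sym (+-identityˡ _)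
  ⟦⟧-⊖ (suc m) zero    = begin
    suc m · 1#           ≈⟨ +-identityʳ _ ⟨
    suc m · 1# + 0#      ≈⟨ +-congˡ -0#≈0# ⟨
    suc m · 1# - 0#      ∎
  ⟦⟧-⊖ (suc m) (suc n) = begin
    ⟦ suc m ℤ.⊖ suc n ⟧                        ≡⟨ ≡.cong ⟦_⟧ (ℤ.[1+m]⊖[1+n]≡m⊖n m n) ⟩
    ⟦ m ℤ.⊖ n ⟧                                ≈⟨ ⟦⟧-⊖ m n ⟩
    m · 1# - n · 1#                            ≈⟨ +-identityˡ _ ⟨
    0# + (m · 1# - n · 1#)                     ≈⟨ +-congʳ (-‿inverseʳ 1#) ⟨
    (1# - 1#) + (m · 1# - n · 1#)              ≈⟨ +-assoc _ _ _ ⟩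
    1# + (- 1# + (m · 1# - n · 1#))            ≈⟨ +-congˡ (+-comm _ _) ⟩
    1# + ((m · 1# - n · 1#) - 1#)              ≈⟨ +-congˡ (+-assoc _ _ _) ⟩
    1# + (m · 1# + (- (n · 1#) - 1#))          ≈⟨ +-assoc _ _ _ ⟨
    suc m · 1# + (- (n · 1#) - 1#)             ≈⟨ +-congˡ (-‿+-comm _ _) ⟩
    suc m · 1# - (n · 1# + 1#)                 ≈⟨ +-congˡ (-‿cong (+-comm _ _)) ⟩
    suc m · 1# - suc n · 1#                    ∎

  ⟦⟧-+ : ∀ i j → ⟦ i ℤ.+ j ⟧ ≈ ⟦ i ⟧ + ⟦ j ⟧
  ⟦⟧-+ (+ m)    (+ n)    = ×-homo-+ 1# m n
  ⟦⟧-+ (+ m)    -[1+ n ] = ⟦⟧-⊖ m (suc n)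
  ⟦⟧-+ -[1+ m ] (+ n)    = trans (⟦⟧-⊖ n (suc m)) (+-comm _ _)
  ⟦⟧-+ -[1+ m ] -[1+ n ] = begin
    - (suc (suc (m ℕ.+ n)) · 1#)       ≡⟨ ≡.cong (λ k → - (k · 1#)) (≡.cong suc (≡.sym (ℕ.+-suc m n))) ⟩
    - ((suc m ℕ.+ suc n) · 1#)         ≈⟨ -‿cong (×-homo-+ 1# (suc m) (suc n)) ⟩
    - (suc m · 1# + suc n · 1#)        ≈⟨ -‿+-comm _ _ ⟨
    - (suc m · 1#) - suc n · 1#        ∎

  ⟦⟧-neg : ∀ i → ⟦ ℤ.- i ⟧ ≈ - ⟦ i ⟧
  ⟦⟧-neg (+ zero)  = sym -0#≈0#
  ⟦⟧-neg (+ suc n) = refl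
  ⟦⟧-neg -[1+ n ]  = sym (-‿involutive _)

  ⟦⟧-*⁺ : ∀ m n → ⟦ + m ℤ.* + n ⟧ ≈ ⟦ + m ⟧ * ⟦ + n ⟧
  ⟦⟧-*⁺ m n = trans (reflexive (≡.cong ⟦_⟧ (≡.sym (ℤ.pos-* m n)))) (×1-homo-* m n)

  ⟦⟧-* : ∀ i j → ⟦ i ℤ.* j ⟧ ≈ ⟦ i ⟧ * ⟦ j ⟧
  ⟦⟧-* (+ m)    (+ n)    = ⟦⟧-*⁺ m n
  ⟦⟧-* (+ m)    -[1+ n ] = begin
    ⟦ + m ℤ.* -[1+ n ] ⟧         ≡⟨ ≡.cong ⟦_⟧ (≡.sym (ℤ.neg-distribʳ-* (+ m) (+ suc n))) ⟩
    ⟦ ℤ.- (+ m ℤ.* + suc n) ⟧    ≈⟨ ⟦⟧-neg (+ m ℤ.* + suc n) ⟩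
    - ⟦ + m ℤ.* + suc n ⟧        ≈⟨ -‿cong (⟦⟧-*⁺ m (suc n)) ⟩
    - (⟦ + m ⟧ * ⟦ + suc n ⟧)    ≈⟨ -‿distribʳ-* _ _ ⟩
    ⟦ + m ⟧ * ⟦ -[1+ n ] ⟧       ∎
  ⟦⟧-* -[1+ m ] (+ n)    = begin
    ⟦ -[1+ m ] ℤ.* + n ⟧         ≡⟨ ≡.cong ⟦_⟧ (≡.sym (ℤ.neg-distribˡ-* (+ suc m) (+ n))) ⟩
    ⟦ ℤ.- (+ suc m ℤ.* + n) ⟧    ≈⟨ ⟦⟧-neg (+ suc m ℤ.* + n) ⟩
    - ⟦ + suc m ℤ.* + n ⟧        ≈⟨ -‿cong (⟦⟧-*⁺ (suc m) n) ⟩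
    - (⟦ + suc m ⟧ * ⟦ + n ⟧)    ≈⟨ -‿distribˡ-* _ _ ⟩
    ⟦ -[1+ m ] ⟧ * ⟦ + n ⟧       ∎
  ⟦⟧-* -[1+ m ] -[1+ n ] = begin
    ⟦ + suc m ℤ.* + suc n ⟧            ≈⟨ ⟦⟧-*⁺ (suc m) (suc n) ⟩
    ⟦ + suc m ⟧ * ⟦ + suc n ⟧          ≈⟨ -‿involutive _ ⟨
    - - (⟦ + suc m ⟧ * ⟦ + suc n ⟧)    ≈⟨ -‿cong (-‿distribˡ-* _ _) ⟩
    - (⟦ -[1+ m ] ⟧ * ⟦ + suc n ⟧)     ≈⟨ -‿distribʳ-* _ _ ⟩
    ⟦ -[1+ m ] ⟧ * ⟦ -[1+ n ] ⟧        ∎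

  -- The solver interprets its constants by ⟦_⟧′, for which ⟦ + 1 ⟧′ is 1#
  -- definitionally.
  ⟦_⟧′ : ℤ → Carrier
  ⟦ + n ⟧′      = n ×′ 1#
  ⟦ -[1+ n ] ⟧′ = - (suc n ×′ 1#)

  ⟦⟧≈⟦⟧′ : ∀ i → ⟦ i ⟧ ≈ ⟦ i ⟧′
  ⟦⟧≈⟦⟧′ (+ n)    = ×ᵤ≈× n 1#
  ⟦⟧≈⟦⟧′ -[1+ n ] = -‿cong (×ᵤ≈× (suc n) 1#)

  private
    almostCommutativeRing : ACR.AlmostCommutativeRing 0ℓ 0ℓ
    almostCommutativeRing = ACR.fromCommutativeRing R

    morphism : ℤ.+-*-rawRing ACR.-Raw-AlmostCommutative⟶ almostCommutativeRing
    morphism = record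
      { ⟦_⟧    = ⟦_⟧′
      ; +-homo = λ i j → trans (sym (⟦⟧≈⟦⟧′ (i ℤ.+ j))) (trans (⟦⟧-+ i j) (+-cong (⟦⟧≈⟦⟧′ i) (⟦⟧≈⟦⟧′ j)))
      ; *-homo = λ i j → trans (sym (⟦⟧≈⟦⟧′ (i ℤ.* j))) (trans (⟦⟧-* i j) (*-cong (⟦⟧≈⟦⟧′ i) (⟦⟧≈⟦⟧′ j)))
      ; -‿homo = λ i → trans (sym (⟦⟧≈⟦⟧′ (ℤ.- i))) (trans (⟦⟧-neg i) (-‿cong (⟦⟧≈⟦⟧′ i)))
      ; 0-homo = refl
      ; 1-homo = refl
      }

    _≟_ : ∀ i j → Maybe (⟦ i ⟧′ ≈ ⟦ j ⟧′)
    i ≟ j with i ℤ.≟ j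
    ... | yes i≡j = just (reflexive (≡.cong ⟦_⟧′ i≡j))
    ... | no  _   = nothing

  module Solver = Algebra.Solver.Ring ℤ.+-*-rawRing almostCommutativeRing morphism _≟_

-- Filters, algebras of functions and evaluation of polynomials

record Filter (A : Set) : Set₁ where
  field
    Ev     : (A → Set) → Set
    ev-all : ∀ {P : A → Set} → (∀ a → P a) → Ev P
    ev-map : ∀ {P Q : A → Set} → (∀ a → P a → Q a) → Ev P → Ev Q
    ev-∧   : ∀ {P Q : A → Set} → Ev P → Ev Q → Ev (λ a → P a × Q a)

  ev-map₂ : ∀ {P Q R : A → Set} → (∀ a → P a → Q a → R a) → Ev P → Ev Q → Ev R
  ev-map₂ f p q = ev-map (λ a (x , y) → f a x y) (ev-∧ p q)

-- Continuity at a point, boundedness and being polynomial are all closed under constants, sums and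
-- products. `eval-closed` then yields each of them for arbitrary polynomial expressions, so none
-- needs its own induction over `Poly`.
record IsSubalgebra (K : RawRing 0ℓ 0ℓ) {A : Set} (Q : (A → RawRing.Carrier K) → Set) : Set where
  open RawRing K
  field
    resp  : ∀ {f g} → (∀ a → f a ≈ g a) → Q f → Q g
    const : ∀ c → Q (λ _ → c)
    plus  : ∀ {f g} → Q f → Q g → Q (λ a → f a + g a)
    times : ∀ {f g} → Q f → Q g → Q (λ a → f a * g a)

module Evaluation (K : CommutativeRing 0ℓ 0ℓ) where
  open CommutativeRing K
  open Polynomial rawRing
  open Algebra.Properties.CommutativeSemiring.Exp commutativeSemiring public
    using (_^_; ^-congˡ; ^-homo-*; ^-assocʳ; ^-distrib-*)

  at : {A : Set} {n : ℕ} → Vec (A → Carrier) n → A → Vec Carrier n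
  at xs a = Vec.map (λ f → f a) xs

  module _ {A : Set} {Q : (A → Carrier) → Set} (S : IsSubalgebra rawRing Q) where
    open IsSubalgebra S

    ^-closed : ∀ {f} n → Q f → Q (λ a → f a ^ n)
    ^-closed zero    q = const 1#
    ^-closed (suc n) q = times q (^-closed n q)

    monomial-closed : ∀ {n} (e : Vec ℕ n) {xs : Vec (A → Carrier) n} → All Q xs → Q (λ a → monomial e (at xs a))
    monomial-closed []      []       = const 1#
    monomial-closed (k ∷ e) (q ∷ qs) = times (^-closed k q) (monomial-closed e qs)

    eval-closed : ∀ {n} (p : Poly Carrier n) {xs : Vec (A → Carrier) n} → All Q xs → Q (λ a → eval p (at xs a))
    eval-closed []            qs = const 0#
    eval-closed ((c , e) ∷ p) qs = plus (times (const c) (monomial-closed e qs)) (eval-closed p qs)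

  monomial-cong : ∀ {n} (e : Vec ℕ n) {v w} → Pointwise _≈_ v w → monomial e v ≈ monomial e w
  monomial-cong []      []       = refl
  monomial-cong (k ∷ e) (p ∷ ps) = *-cong (^-congˡ k p) (monomial-cong e ps)

  eval-cong : ∀ {n} (p : Poly Carrier n) {v w} → Pointwise _≈_ v w → eval p v ≈ eval p w
  eval-cong []            ps = refl
  eval-cong ((c , e) ∷ p) ps = +-cong (*-congˡ (monomial-cong e ps)) (eval-cong p ps)

module EvaluationHomomorphism (K L : CommutativeRing 0ℓ 0ℓ) where
  private
    module K = CommutativeRing K
    module L = CommutativeRing L
    module EK = Evaluation K
    module EL = Evaluation L
    module PK = Polynomial K.rawRing
    module PL = Polynomial L.rawRing
  open Relation.Binary.Reasoning.Setoid L.setoid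

  module _ (h : K.Carrier → L.Carrier)
           (h-0 : h K.0# L.≈ L.0#) (h-1 : h K.1# L.≈ L.1#)
           (h-+ : ∀ x y → h (x K.+ y) L.≈ h x L.+ h y)
           (h-* : ∀ x y → h (x K.* y) L.≈ h x L.* h y) where

    ^-hom : ∀ x n → h (x EK.^ n) L.≈ h x EL.^ n
    ^-hom x zero    = h-1
    ^-hom x (suc n) = L.trans (h-* x (x EK.^ n)) (L.*-congˡ (^-hom x n))

    monomial-hom : ∀ {n} (e : Vec ℕ n) v → h (PK.monomial e v) L.≈ PL.monomial e (Vec.map h v)
    monomial-hom []      []      = h-1
    monomial-hom (k ∷ e) (x ∷ v) = L.trans (h-* (x EK.^ k) (PK.monomial e v)) (L.*-cong (^-hom x k) (monomial-hom e v))

    -- The coefficients lie in a third set with maps to both rings. In all uses it is ℚ, sent to ℚ,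
    -- ℝ or ℂ; for conjugation the same map into ℂ appears on both sides.
    eval-hom : ∀ {A : Set} {n} (i : A → K.Carrier) (j : A → L.Carrier) → (∀ a → h (i a) L.≈ j a) →
               ∀ (p : Poly A n) v → h (PK.eval (mapCoeff i p) v) L.≈ PL.eval (mapCoeff j p) (Vec.map h v)
    eval-hom i j hi []            v = h-0
    eval-hom i j hi ((a , e) ∷ p) v = begin
      h (i a K.* PK.monomial e v K.+ PK.eval (mapCoeff i p) v)               ≈⟨ h-+ _ _ ⟩
      h (i a K.* PK.monomial e v) L.+ h (PK.eval (mapCoeff i p) v)           ≈⟨ L.+-cong (h-* _ _) (eval-hom i j hi p v) ⟩
      h (i a) L.* h (PK.monomial e v) L.+ PL.eval (mapCoeff j p) (Vec.map h v)
        ≈⟨ L.+-congʳ (L.*-cong (hi a) (monomial-hom e v)) ⟩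
      j a L.* PL.monomial e (Vec.map h v) L.+ PL.eval (mapCoeff j p) (Vec.map h v) ∎

-- Polynomials in one variable as coefficient lists

module Univariate (K : CommutativeRing 0ℓ 0ℓ) where
  open CommutativeRing K
  open IntegerCoefficients.Solver K using (solve; _:+_; _:*_; _:-_; :-_; _:=_; con)
  open Relation.Binary.Reasoning.Setoid setoid

  -- Constant term first, in Horner form. Trailing zeros are allowed, so the length of a list is an
  -- upper bound for a degree and not the degree itself.
  ev : List Carrier → Carrier → Carrier
  ev []      t = 0#
  ev (a ∷ p) t = a + t * ev p t

  ev-cong : ∀ p {s t} → s ≈ t → ev p s ≈ ev p t
  ev-cong []      s≈t = refl
  ev-cong (a ∷ p) s≈t = +-congˡ (*-cong s≈t (ev-cong p s≈t))

  infixl 6 _⊕_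
  infixl 7 _⊙_ _⊛_
  _⊕_ : List Carrier → List Carrier → List Carrier
  []      ⊕ q       = q
  (a ∷ p) ⊕ []      = a ∷ p
  (a ∷ p) ⊕ (b ∷ q) = a + b ∷ p ⊕ q

  ev-⊕ : ∀ p q t → ev (p ⊕ q) t ≈ ev p t + ev q t
  ev-⊕ []      q       t = sym (+-identityˡ _)
  ev-⊕ (a ∷ p) []      t = sym (+-identityʳ _)
  ev-⊕ (a ∷ p) (b ∷ q) t = trans (+-congˡ (*-congˡ (ev-⊕ p q t)))
    (solve 5 (λ a b t p q → a :+ b :+ t :* (p :+ q) := (a :+ t :* p) :+ (b :+ t :* q)) refl a b t (ev p t) (ev q t))

  length-⊕ : ∀ p q → length (p ⊕ q) ℕ.≤ length p ℕ.+ length q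
  length-⊕ []      q       = ℕ.≤-refl
  length-⊕ (a ∷ p) []      = ℕ.m≤m+n _ _
  length-⊕ (a ∷ p) (b ∷ q) = ℕ.s≤s (ℕ.≤-trans (length-⊕ p q) (ℕ.+-monoʳ-≤ (length p) (ℕ.n≤1+n (length q))))

  _⊙_ : Carrier → List Carrier → List Carrier
  c ⊙ p = List.map (c *_) p

  ev-⊙ : ∀ c p t → ev (c ⊙ p) t ≈ c * ev p t
  ev-⊙ c []      t = sym (zeroʳ c)
  ev-⊙ c (a ∷ p) t = trans (+-congˡ (*-congˡ (ev-⊙ c p t)))
    (solve 4 (λ c a t p → c :* a :+ t :* (c :* p) := c :* (a :+ t :* p)) refl c a t (ev p t))

  length-⊙ : ∀ c p → length (c ⊙ p) ≡ length p
  length-⊙ c []      = ≡.refl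
  length-⊙ c (a ∷ p) = ≡.cong suc (length-⊙ c p)

  _⊛_ : List Carrier → List Carrier → List Carrier
  []      ⊛ q = []
  (a ∷ p) ⊛ q = a ⊙ q ⊕ (0# ∷ p ⊛ q)

  ev-⊛ : ∀ p q t → ev (p ⊛ q) t ≈ ev p t * ev q t
  ev-⊛ []      q t = sym (zeroˡ _)
  ev-⊛ (a ∷ p) q t = begin
    ev (a ⊙ q ⊕ (0# ∷ p ⊛ q)) t                ≈⟨ ev-⊕ (a ⊙ q) (0# ∷ p ⊛ q) t ⟩
    ev (a ⊙ q) t + (0# + t * ev (p ⊛ q) t)     ≈⟨ +-cong (ev-⊙ a q t) (+-congˡ (*-congˡ (ev-⊛ p q t))) ⟩
    a * ev q t + (0# + t * (ev p t * ev q t))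
      ≈⟨ solve 4 (λ a q t p → a :* q :+ (con (+ 0) :+ t :* (p :* q)) := (a :+ t :* p) :* q) refl a (ev q t) t (ev p t) ⟩
    (a + t * ev p t) * ev q t                  ∎


  -- The factor `suc n` pays for the one entry by which each step may lengthen the list. A bound
  -- uniform in the inputs is the goal, not a sharp one.
  length-⊛ : ∀ {m n} p q → length p ℕ.≤ m → length q ℕ.≤ n → length (p ⊛ q) ℕ.≤ m ℕ.* suc n
  length-⊛ []      q _           _   = ℕ.z≤n
  length-⊛ {suc m} {n} (a ∷ p) q (ℕ.s≤s p≤m) q≤n = ℕ.≤-trans (length-⊕ (a ⊙ q) (0# ∷ p ⊛ q))
    (ℕ.≤-trans (ℕ.+-mono-≤ (ℕ.≤-trans (ℕ.≤-reflexive (length-⊙ a q)) q≤n) (ℕ.s≤s (length-⊛ p q p≤m q≤n)))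
               (ℕ.≤-reflexive (ℕ.+-suc n (m ℕ.* suc n))))

  -- Synthetic division. The quotient is one entry shorter, which lets `factorise` recurse on a
  -- length bound.
  divideRoot : ∀ p r → ∃ λ q → length q ℕ.≤ ℕ.pred (length p) × (∀ t → ev p t ≈ ev p r + (t - r) * ev q t)
  divideRoot []          r = [] , ℕ.z≤n , λ t → sym (trans (+-congˡ (zeroʳ _)) (+-identityʳ _))
  divideRoot (a ∷ [])    r = [] , ℕ.z≤n , λ t →
    solve 3 (λ a r t → a :+ t :* con (+ 0) := (a :+ r :* con (+ 0)) :+ (t :- r) :* con (+ 0)) refl a r t
  divideRoot (a ∷ b ∷ p) r with divideRoot (b ∷ p) r
  ... | q , len , eq = ev (b ∷ p) r ∷ q , ℕ.s≤s len , λ t → begin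
    a + t * ev (b ∷ p) t                             ≈⟨ +-congˡ (*-congˡ (eq t)) ⟩
    a + t * (ev (b ∷ p) r + (t - r) * ev q t)
      ≈⟨ solve 5 (λ a t e r q → a :+ t :* (e :+ (t :- r) :* q) := (a :+ r :* e) :+ (t :- r) :* (e :+ t :* q)) refl a t (ev (b ∷ p) r) r (ev q t) ⟩
    a + r * ev (b ∷ p) r + (t - r) * (ev (b ∷ p) r + t * ev q t) ∎

  -- Polynomial in the last variable, with a length bound n chosen before the parameter z.
  -- `curve-near-zero` depends on this order: its constant Cⁿ comes from the bound, and z is then
  -- chosen small in terms of Cⁿ.
  PolyFamily : {Z : Set} → (Z × Carrier → Carrier) → Set
  PolyFamily {Z} f = ∃ λ n → ∀ (z : Z) → ∃ λ p → length p ℕ.≤ n × (∀ t → f (z , t) ≈ ev p t)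

  polyFamily-isSubalgebra : {Z : Set} → IsSubalgebra rawRing (PolyFamily {Z})
  polyFamily-isSubalgebra = record
    { resp  = λ f≈g (n , φ) → n , λ z → let (p , l , e) = φ z in p , l , λ t → trans (sym (f≈g (z , t))) (e t)
    ; const = λ c → 1 , λ z → c ∷ [] , ℕ.≤-refl , λ t → sym (trans (+-congˡ (zeroʳ t)) (+-identityʳ c))
    ; plus  = λ (m , φ) (n , ψ) → m ℕ.+ n , λ z →
        let (p , lp , ep) = φ z ; (q , lq , eq) = ψ z in
        p ⊕ q , ℕ.≤-trans (length-⊕ p q) (ℕ.+-mono-≤ lp lq) ,
        λ t → trans (+-cong (ep t) (eq t)) (sym (ev-⊕ p q t))
    ; times = λ (m , φ) (n , ψ) → m ℕ.* suc n , λ z →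
        let (p , lp , ep) = φ z ; (q , lq , eq) = ψ z in
        p ⊛ q , length-⊛ p q lp lq ,
        λ t → trans (*-cong (ep t) (eq t)) (sym (ev-⊛ p q t))
    }

  polyFamily-var : {Z : Set} → PolyFamily {Z} proj₂
  polyFamily-var = 2 , λ z → 0# ∷ 1# ∷ [] , ℕ.≤-refl ,
    λ t → solve 1 (λ t → t := con (+ 0) :+ t :* (con (+ 1) :+ t :* con (+ 0))) refl t

  polyFamily-param : {Z : Set} (g : Z → Carrier) → PolyFamily (λ (z , _) → g z)
  polyFamily-param g = 1 , λ z → g z ∷ [] , ℕ.≤-refl , λ t → sym (trans (+-congˡ (zeroʳ t)) (+-identityʳ _))

  IsPoly : (Carrier → Carrier) → Set
  IsPoly f = ∃ λ p → ∀ t → f t ≈ ev p t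

  isPoly-isSubalgebra : IsSubalgebra rawRing IsPoly
  isPoly-isSubalgebra = record
    { resp  = λ f≈g (p , e) → p , λ t → trans (sym (f≈g t)) (e t)
    ; const = λ c → c ∷ [] , λ t → sym (trans (+-congˡ (zeroʳ t)) (+-identityʳ c))
    ; plus  = λ (p , ep) (q , eq) → p ⊕ q , λ t → trans (+-cong (ep t) (eq t)) (sym (ev-⊕ p q t))
    ; times = λ (p , ep) (q , eq) → p ⊛ q , λ t → trans (*-cong (ep t) (eq t)) (sym (ev-⊛ p q t))
    }

  isPoly-var : IsPoly (λ t → t)
  isPoly-var = 0# ∷ 1# ∷ [] , λ t → solve 1 (λ t → t := con (+ 0) :+ t :* (con (+ 1) :+ t :* con (+ 0))) refl t

  isPoly-ev : ∀ p → IsPoly (ev p)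
  isPoly-ev p = p , λ t → refl

  ev-closed : {A : Set} {Q : (A → Carrier) → Set} → IsSubalgebra rawRing Q → ∀ p {f} → Q f → Q (λ a → ev p (f a))
  ev-closed S []      q = IsSubalgebra.const S 0#
  ev-closed S (c ∷ p) q = IsSubalgebra.plus S (IsSubalgebra.const S c) (IsSubalgebra.times S q (ev-closed S p q))

  prodRoots : List Carrier → Carrier → Carrier
  prodRoots []       t = 1#
  prodRoots (r ∷ rs) t = (t - r) * prodRoots rs t

-- Ordered field, completeness and real analysis

module Real (em : ExcludedMiddle 0ℓ) (𝓡 : CompleteOrderedField) where
  open CompleteOrderedField 𝓡
  open RealComplex 𝓡 using (ℤ→ℝ; ℚ→ℝ; evalℝ)
  open Algebra.Properties.Semiring.Mult semiring using (×1-homo-*) renaming (_×_ to _·_)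
  open Evaluation commutativeRing using (_^_; eval-closed; eval-cong)
  module ST = IsStrictTotalOrder isStrictTotalOrder
  module IC = IntegerCoefficients commutativeRing
  open IC using (⟦_⟧; ⟦⟧-+; ⟦⟧-*)
  open IC.Solver using (solve; _:+_; _:*_; _:-_; :-_; _:=_; con)
  open Relation.Binary.Reasoning.Setoid setoid

  module OrderedField where
    infix 4 _≤_ _⊲_
    _≤_ : Carrier → Carrier → Set
    x ≤ y = ¬ (y < x)

    -- This is |x| < ε without an absolute value.
    record _⊲_ (x ε : Carrier) : Set where
      constructor within
      field
        lower : - ε < x
        upper : x < ε

    <-resp : ∀ {x y x′ y′} → x ≈ x′ → y ≈ y′ → x < y → x′ < y′
    <-resp p q x<y = ST.<-respˡ-≈ p (ST.<-respʳ-≈ q x<y)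

    <-trans : ∀ {x y z} → x < y → y < z → x < z
    <-trans = ST.trans

    <⇒≉ : ∀ {x y} → x < y → ¬ (x ≈ y)
    <⇒≉ x<y x≈y = ST.irrefl x≈y x<y

    <⇒≤ : ∀ {x y} → x < y → x ≤ y
    <⇒≤ p q = ST.irrefl refl (<-trans p q)

    ≤⇒<⊎≈ : ∀ {x y} → x ≤ y → x < y ⊎ x ≈ y
    ≤⇒<⊎≈ {x} {y} p with ST.compare x y
    ... | tri< a _ _ = inj₁ a
    ... | tri≈ _ b _ = inj₂ b
    ... | tri> _ _ c = ⊥-elim (p c)

    <-≤-connex : ∀ x y → x < y ⊎ y ≤ x
    <-≤-connex x y with ST._<?_ x y
    ... | yes p = inj₁ p
    ... | no  p = inj₂ p

    ≈⇒≤ : ∀ {x y} → x ≈ y → x ≤ y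
    ≈⇒≤ x≈y = ST.irrefl (sym x≈y)

    <-≤-trans : ∀ {x y z} → x < y → y ≤ z → x < z
    <-≤-trans p q with ≤⇒<⊎≈ q
    ... | inj₁ r = <-trans p r
    ... | inj₂ r = ST.<-respʳ-≈ r p

    ≤-<-trans : ∀ {x y z} → x ≤ y → y < z → x < z
    ≤-<-trans p q with ≤⇒<⊎≈ p
    ... | inj₁ r = <-trans r q
    ... | inj₂ r = ST.<-respˡ-≈ (sym r) q

    ≤-trans : ∀ {x y z} → x ≤ y → y ≤ z → x ≤ z
    ≤-trans p q r = p (≤-<-trans q r)

    ≤-resp : ∀ {x y x′ y′} → x ≈ x′ → y ≈ y′ → x ≤ y → x′ ≤ y′
    ≤-resp p q r s = r (<-resp (sym q) (sym p) s)

    -- Strict inequalities are proved by exhibiting the difference as an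
    -- expression that is visibly positive.
    0<-⇒< : ∀ {x y e} → 0# < e → e ≈ y - x → x < y
    0<-⇒< {x} {y} 0<e e≈ =
      <-resp (+-identityˡ x) (trans (+-congʳ e≈) (solve 2 (λ a b → (b :- a) :+ a := b) refl x y)) (+-monoˡ-< x 0<e)

    <⇒0<- : ∀ {x y} → x < y → 0# < y - x
    <⇒0<- {x} {y} x<y = <-resp (-‿inverseʳ x) refl (+-monoˡ-< (- x) x<y)

    0≤-⇒≤ : ∀ {x y e} → 0# ≤ e → e ≈ y - x → x ≤ y
    0≤-⇒≤ {x} {y} {e} 0≤e e≈ y<x =
      0≤e (0<-⇒< (<⇒0<- y<x) (trans (solve 2 (λ a b → a :- b := con (+ 0) :- (b :- a)) refl x y) (+-congˡ (-‿cong (sym e≈)))))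

    ≤⇒0≤- : ∀ {x y} → x ≤ y → 0# ≤ y - x
    ≤⇒0≤- {x} {y} x≤y p = x≤y (0<-⇒< (<⇒0<- p) (solve 2 (λ a b → con (+ 0) :- (b :- a) := a :- b) refl x y))

    +-pos : ∀ {x y} → 0# < x → 0# < y → 0# < x + y
    +-pos {x} {y} p q = <-trans q (<-resp (+-identityˡ y) refl (+-monoˡ-< y p))

    +-nonneg : ∀ {x y} → 0# ≤ x → 0# ≤ y → 0# ≤ x + y
    +-nonneg {x} {y} p q r with <-≤-connex x 0#
    ... | inj₁ x<0 = p x<0
    ... | inj₂ 0≤x = q (≤-<-trans (0≤-⇒≤ 0≤x (solve 2 (λ a b → a := (a :+ b) :- b) refl x y)) r)

    +-pos-nonneg : ∀ {x y} → 0# < x → 0# ≤ y → 0# < x + y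
    +-pos-nonneg {x} {y} p q with ≤⇒<⊎≈ q
    ... | inj₁ 0<y = +-pos p 0<y
    ... | inj₂ 0≈y = <-resp refl (trans (sym (+-identityʳ x)) (+-congˡ 0≈y)) p

    *-nonneg : ∀ {x y} → 0# ≤ x → 0# ≤ y → 0# ≤ x * y
    *-nonneg {x} {y} p q with ≤⇒<⊎≈ p | ≤⇒<⊎≈ q
    ... | inj₁ a | inj₁ b = <⇒≤ (*-positive a b)
    ... | inj₂ a | _      = ≈⇒≤ (trans (sym (zeroˡ y)) (*-congʳ a))
    ... | inj₁ _ | inj₂ b = ≈⇒≤ (trans (sym (zeroʳ x)) (*-congˡ b))

    <0⇒0<- : ∀ {x} → x < 0# → 0# < - x
    <0⇒0<- {x} p = <-resp refl (+-identityˡ _) (<⇒0<- p)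

    0<⇒-<0 : ∀ {x} → 0# < x → - x < 0#
    0<⇒-<0 {x} p = 0<-⇒< p (solve 1 (λ a → a := con (+ 0) :- (:- a)) refl x)

    sq-pos : ∀ {x} → x ≉ 0# → 0# < x * x
    sq-pos {x} x≉0 with ST.compare x 0#
    ... | tri< a _ _ = <-resp refl (solve 1 (λ a → (:- a) :* (:- a) := a :* a) refl x) (*-positive (<0⇒0<- a) (<0⇒0<- a))
    ... | tri≈ _ b _ = ⊥-elim (x≉0 b)
    ... | tri> _ _ c = *-positive c c

    sq-nonneg : ∀ x → 0# ≤ x * x
    sq-nonneg x with ST._≟_ x 0#
    ... | yes p = ≈⇒≤ (sym (trans (*-congʳ p) (zeroˡ x)))
    ... | no  p = <⇒≤ (sq-pos p)

    0<1 : 0# < 1#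
    0<1 = <-resp refl (*-identityˡ 1#) (sq-pos (λ p → 0#≉1# (sym p)))

    2# : Carrier
    2# = 1# + 1#

    0<2 : 0# < 2#
    0<2 = +-pos 0<1 0<1

    integral : ∀ {x y} → x * y ≈ 0# → x ≈ 0# ⊎ y ≈ 0#
    integral {x} {y} p with ST._≟_ x 0#
    ... | yes x≈0 = inj₁ x≈0
    ... | no  x≉0 = inj₂ (begin
      y                   ≈⟨ *-identityˡ y ⟨
      1# * y              ≈⟨ *-congʳ (⁻¹-inverseʳ x≉0) ⟨
      x * x ⁻¹ * y        ≈⟨ solve 3 (λ a b c → a :* b :* c := (a :* c) :* b) refl x (x ⁻¹) y ⟩
      x * y * x ⁻¹        ≈⟨ *-congʳ p ⟩
      0# * x ⁻¹           ≈⟨ zeroˡ _ ⟩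
      0#                  ∎)

    *-≉0 : ∀ {x y} → x ≉ 0# → y ≉ 0# → x * y ≉ 0#
    *-≉0 p q r with integral r
    ... | inj₁ a = p a
    ... | inj₂ b = q b

    *-cancelʳ-pos : ∀ {x y} → 0# < y → 0# < x * y → 0# < x
    *-cancelʳ-pos {x} {y} 0<y 0<xy with ST.compare 0# x
    ... | tri< a _ _ = a
    ... | tri≈ _ b _ = ⊥-elim (<⇒≉ 0<xy (sym (trans (*-congʳ (sym b)) (zeroˡ y))))
    ... | tri> _ _ c = ⊥-elim (<⇒≤ 0<xy (0<-⇒< (*-positive (<0⇒0<- c) 0<y)
        (solve 2 (λ a b → (:- a) :* b := con (+ 0) :- a :* b) refl x y)))

    ⁻¹-pos : ∀ {x} → 0# < x → 0# < x ⁻¹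
    ⁻¹-pos {x} 0<x = *-cancelʳ-pos 0<x (<-resp refl
      (sym (trans (*-comm _ _) (⁻¹-inverseʳ (λ p → <⇒≉ 0<x (sym p))))) 0<1)

    0<⇒≉0 : ∀ {x} → 0# < x → x ≉ 0#
    0<⇒≉0 p q = <⇒≉ p (sym q)

    ^-pos : ∀ {x} n → 0# < x → 0# < x ^ n
    ^-pos zero    p = 0<1
    ^-pos (suc n) p = *-positive p (^-pos n p)

    ·1-nonneg : ∀ n → 0# ≤ n · 1#
    ·1-nonneg zero    = ≈⇒≤ refl
    ·1-nonneg (suc n) = <⇒≤ (+-pos-nonneg 0<1 (·1-nonneg n))

    ·1-pos : ∀ n → 0# < suc n · 1#
    ·1-pos n = +-pos-nonneg 0<1 (·1-nonneg n)

    -- Otherwise the multiples of 1 have a supremum s. Each multiple has a successor, which is at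
    -- most s, so s - 1 is an upper bound as well.
    archimedean : ∀ x → ∃ λ n → x < n · 1#
    archimedean x with em {∃ λ n → x < n · 1#}
    ... | yes p = p
    ... | no ¬p = ⊥-elim (s-least (s - 1#) below (0<-⇒< 0<1 (solve 1 (λ a → con (+ 1) := a :- (a :- con (+ 1))) refl s)))
      where
      P : Carrier → Set
      P y = ∃ λ n → y ≈ n · 1#
      sup = supremum P (0# , 0 , refl) (x , λ y (n , y≈n) x<y → ¬p (n , <-resp refl y≈n x<y))
      s       = proj₁ sup
      s-bound = proj₁ (proj₂ sup)
      s-least = proj₂ (proj₂ sup)
      below : UpperBound P (s - 1#)
      below y (n , y≈n) s-1<y = s-bound (suc n · 1#) (suc n , refl) (0<-⇒< (<⇒0<- (<-resp refl y≈n s-1<y))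
        (solve 2 (λ s n → n :- (s :- con (+ 1)) := (con (+ 1) :+ n) :- s) refl s (n · 1#)))

    abstract
      floor⁺ : ∀ n x → 0# ≤ x → x < n · 1# → ∃ λ m → (m · 1# ≤ x) × (x < suc m · 1#)
      floor⁺ zero    x 0≤x x<n = ⊥-elim (0≤x x<n)
      floor⁺ (suc n) x 0≤x x<n with <-≤-connex x (n · 1#)
      ... | inj₁ p = floor⁺ n x 0≤x p
      ... | inj₂ p = n , p , x<n

    abstract
      minimum : ∀ {x y} → 0# < x → 0# < y → ∃ λ m → 0# < m × m ≤ x × m ≤ y
      minimum {x} {y} p q with <-≤-connex x y
      ... | inj₁ x<y = x , p , ≈⇒≤ refl , <⇒≤ x<y
      ... | inj₂ y≤x = y , q , y≤x , ≈⇒≤ refl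

    ⊲-resp : ∀ {x x′ ε ε′} → x ≈ x′ → ε ≈ ε′ → x ⊲ ε → x′ ⊲ ε′
    ⊲-resp p q (within a b) = within (<-resp (-‿cong q) p a) (<-resp p q b)

    ⊲-mono : ∀ {x ε ε′} → ε ≤ ε′ → x ⊲ ε → x ⊲ ε′
    ⊲-mono {ε = ε} {ε′} p (within a b) = within
      (≤-<-trans (0≤-⇒≤ (≤⇒0≤- p) (solve 2 (λ a b → b :- a := (:- a) :- (:- b)) refl ε ε′)) a) (<-≤-trans b p)

    ⊲-+ : ∀ {x y ε δ} → x ⊲ ε → y ⊲ δ → (x + y) ⊲ (ε + δ)
    ⊲-+ {x} {y} {ε} {δ} (within a b) (within c d) = within
      (0<-⇒< (+-pos (<⇒0<- a) (<⇒0<- c)) (solve 4 (λ x y e d → (x :- (:- e)) :+ (y :- (:- d)) := (x :+ y) :- (:- (e :+ d))) refl x y ε δ))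
      (0<-⇒< (+-pos (<⇒0<- b) (<⇒0<- d)) (solve 4 (λ x y e d → (e :- x) :+ (d :- y) := (e :+ d) :- (x :+ y)) refl x y ε δ))

    -- (ε − x)(δ + y) + (ε + x)(δ − y) = 2 (εδ − xy), and similarly for εδ + xy.
    ⊲-* : ∀ {x y ε δ} → x ⊲ ε → y ⊲ δ → (x * y) ⊲ (ε * δ)
    ⊲-* {x} {y} {ε} {δ} (within a b) (within c d) = within (half lower) (half upper)
      where
      half : ∀ {u v} → 0# < (v - u) * 2# → u < v
      half p = 0<-⇒< (*-cancelʳ-pos 0<2 p) refl
      lower = <-resp refl (solve 4 (λ x y e d → (e :- x) :* (d :- y) :+ (x :- (:- e)) :* (y :- (:- d))
                                := (x :* y :- (:- (e :* d))) :* (con (+ 1) :+ con (+ 1))) refl x y ε δ)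
                (+-pos (*-positive (<⇒0<- b) (<⇒0<- d)) (*-positive (<⇒0<- a) (<⇒0<- c)))
      upper = <-resp refl (solve 4 (λ x y e d → (e :- x) :* (y :- (:- d)) :+ (x :- (:- e)) :* (d :- y)
                                := (e :* d :- x :* y) :* (con (+ 1) :+ con (+ 1))) refl x y ε δ)
                (+-pos (*-positive (<⇒0<- b) (<⇒0<- c)) (*-positive (<⇒0<- a) (<⇒0<- d)))

    ⊲-0<bound : ∀ {x ε} → x ⊲ ε → 0# < ε
    ⊲-0<bound {x} {ε} (within a b) = *-cancelʳ-pos 0<2 (<-resp refl
      (solve 2 (λ x e → (e :- x) :+ (x :- (:- e)) := e :* (con (+ 1) :+ con (+ 1))) refl x ε) (+-pos (<⇒0<- b) (<⇒0<- a)))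

    ⊲-refl0 : ∀ {x ε} → x ≈ 0# → 0# < ε → x ⊲ ε
    ⊲-refl0 p q = within (<-resp refl (sym p) (0<⇒-<0 q)) (<-resp (sym p) refl q)

    ⊲-neg : ∀ {x ε} → x ⊲ ε → (- x) ⊲ ε
    ⊲-neg {x} {ε} (within a b) = within
      (0<-⇒< (<⇒0<- b) (solve 2 (λ x e → e :- x := (:- x) :- (:- e)) refl x ε))
      (0<-⇒< (<⇒0<- a) (solve 2 (λ x e → x :- (:- e) := e :- (:- x)) refl x ε))

    abstract
      round⁺ : ∀ x → 0# ≤ x → ∃ λ m → (x - m · 1#) ⊲ 2#
      round⁺ x 0≤x =
        let (n , x<n) = archimedean x
            (m , p , q) = floor⁺ n x 0≤x x<n
        in m , within
           (0<-⇒< (+-pos-nonneg 0<2 (≤⇒0≤- p)) (solve 3 (λ x m t → t :+ (x :- m) := (x :- m) :- (:- t)) refl x (m · 1#) 2#))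
           (0<-⇒< (+-pos 0<1 (<⇒0<- q)) (solve 2 (λ x m → con (+ 1) :+ ((con (+ 1) :+ m) :- x) := (con (+ 1) :+ con (+ 1)) :- (x :- m)) refl x (m · 1#)))

    abstract
      -- The point is a bounded error, which is later divided by a large m. A negative x is rounded
      -- through -x.
      round : ∀ x → ∃ λ (i : ℤ) → (x - IC.⟦ i ⟧) ⊲ 2#
      round x with <-≤-connex x 0#
      ... | inj₂ 0≤x = let (m , p) = round⁺ x 0≤x in + m , p
      ... | inj₁ x<0 = let (m , p) = round⁺ (- x) (<⇒≤ (<0⇒0<- x<0)) in ℤ.- (+ m) ,
        ⊲-resp (trans (solve 2 (λ x m → :- ((:- x) :- m) := x :- (:- m)) refl x (m · 1#))
                      (+-congˡ (-‿cong (sym (IC.⟦⟧-neg (+ m))))))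
               refl (⊲-neg p)

    abstract
      ⊲-exists : ∀ x → ∃ λ B → x ⊲ B
      ⊲-exists x with <-≤-connex x 0#
      ... | inj₁ p = 1# - x , within (0<-⇒< 0<1 (solve 1 (λ x → con (+ 1) := x :- (:- (con (+ 1) :- x))) refl x))
                     (<-trans p (+-pos 0<1 (<0⇒0<- p)))
      ... | inj₂ p = 1# + x , within (<-≤-trans (0<⇒-<0 (+-pos-nonneg 0<1 p)) p)
                     (0<-⇒< 0<1 (solve 1 (λ x → con (+ 1) := (con (+ 1) :+ x) :- x) refl x))

    abstract
      divide : ∀ {ε B} → 0# < ε → 0# < B → ∃ λ η → 0# < η × η * B ≈ ε
      divide {ε} {B} p q = ε * B ⁻¹ , *-positive p (⁻¹-pos q) , (begin
        ε * B ⁻¹ * B     ≈⟨ solve 3 (λ a b c → a :* b :* c := a :* (c :* b)) refl ε (B ⁻¹) B ⟩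
        ε * (B * B ⁻¹)   ≈⟨ *-congˡ (⁻¹-inverseʳ (0<⇒≉0 q)) ⟩
        ε * 1#           ≈⟨ *-identityʳ ε ⟩
        ε                ∎)

    *-monoˡ-≤ : ∀ {x y} z → 0# ≤ z → x ≤ y → x * z ≤ y * z
    *-monoˡ-≤ {x} {y} z 0≤z x≤y = 0≤-⇒≤ (*-nonneg (≤⇒0≤- x≤y) 0≤z)
      (solve 3 (λ x y z → (y :- x) :* z := y :* z :- x :* z) refl x y z)

    +-mono-≤ : ∀ {x y u v} → x ≤ y → u ≤ v → x + u ≤ y + v
    +-mono-≤ {x} {y} {u} {v} p q = 0≤-⇒≤ (+-nonneg (≤⇒0≤- p) (≤⇒0≤- q))
      (solve 4 (λ x y u v → (y :- x) :+ (v :- u) := (y :+ v) :- (x :+ u)) refl x y u v)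

    module Limits {A : Set} (𝓕 : Filter A) where
      open Filter 𝓕

      Tends : (A → Carrier) → Carrier → Set
      Tends f l = ∀ ε → 0# < ε → Ev (λ a → (f a - l) ⊲ ε)

      tends-resp : ∀ {f g l m} → (∀ a → f a ≈ g a) → l ≈ m → Tends f l → Tends g m
      tends-resp p q t ε 0<ε = ev-map (λ a → ⊲-resp (+-cong (p a) (-‿cong q)) refl) (t ε 0<ε)

      tends-const : ∀ c → Tends (λ _ → c) c
      tends-const c ε 0<ε = ev-all (λ _ → ⊲-refl0 (-‿inverseʳ c) 0<ε)

      tends-+ : ∀ {f g l m} → Tends f l → Tends g m → Tends (λ a → f a + g a) (l + m)
      tends-+ {f} {g} {l} {m} s t ε 0<ε =
        let (η , 0<η , η2) = divide 0<ε 0<2 in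
        ev-map₂ (λ a p q → ⊲-resp (solve 4 (λ f g l m → (f :- l) :+ (g :- m) := (f :+ g) :- (l :+ m)) refl (f a) (g a) l m)
                                  (trans (solve 1 (λ e → e :+ e := e :* (con (+ 1) :+ con (+ 1))) refl η) η2) (⊲-+ p q))
                (s η 0<η) (t η 0<η)

      -- From fg - lm = (f - l)(g - m) + l(g - m) + m(f - l): if both differences are below η ≤ 1,
      -- the total is below η(1 + B + C), where B and C bound |l| and |m|.
      tends-* : ∀ {f g l m} → Tends f l → Tends g m → Tends (λ a → f a * g a) (l * m)
      tends-* {f} {g} {l} {m} s t ε 0<ε =
        let (B , l⊲B) = ⊲-exists l
            (C , m⊲C) = ⊲-exists m
            0<S = +-pos 0<1 (+-pos (⊲-0<bound l⊲B) (⊲-0<bound m⊲C))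
            (ζ , 0<ζ , ζS) = divide 0<ε 0<S
            (η , 0<η , η≤ζ , η≤1) = minimum 0<ζ 0<1
        in ev-map₂ (λ a p q → ⊲-mono
             (≤-resp (solve 3 (λ e b c → e :* (con (+ 1) :+ (b :+ c)) := con (+ 1) :* e :+ (b :* e :+ c :* e)) refl η B C) ζS
                (*-monoˡ-≤ (1# + (B + C)) (<⇒≤ 0<S) η≤ζ))
             (⊲-resp (solve 4 (λ f g l m → (f :- l) :* (g :- m) :+ (l :* (g :- m) :+ m :* (f :- l)) := f :* g :- l :* m) refl (f a) (g a) l m)
                refl
                (⊲-+ (⊲-* (⊲-mono η≤1 p) q) (⊲-+ (⊲-* l⊲B q) (⊲-* m⊲C p)))))
           (s η 0<η) (t η 0<η)

      tends-pos : ∀ {f l} → Tends f l → 0# < l → Ev (λ a → 0# < f a)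
      tends-pos {f} {l} t 0<l = ev-map (λ a (within p _) → 0<-⇒< (<⇒0<- p)
        (solve 2 (λ f l → (f :- l) :- (:- l) := f :- con (+ 0)) refl (f a) l)) (t l 0<l)

      tends-neg : ∀ {f l} → Tends f l → Tends (λ a → - f a) (- l)
      tends-neg {f} {l} t ε 0<ε = ev-map (λ a p → ⊲-resp (solve 2 (λ f l → :- (f :- l) := (:- f) :- (:- l)) refl (f a) l) refl (⊲-neg p)) (t ε 0<ε)

  open OrderedField public

  module RealAnalysis where
    nhds : Carrier → Filter Carrier
    nhds x = record
      { Ev     = λ P → ∃ λ δ → 0# < δ × (∀ y → (y - x) ⊲ δ → P y)
      ; ev-all = λ p → 1# , 0<1 , λ y _ → p y
      ; ev-map = λ f (δ , 0<δ , p) → δ , 0<δ , λ y y∈ → f y (p y y∈)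
      ; ev-∧   = λ (δ , 0<δ , p) (ε , 0<ε , q) →
          let (m , 0<m , m≤δ , m≤ε) = minimum 0<δ 0<ε in
          m , 0<m , λ y y∈ → p y (⊲-mono m≤δ y∈) , q y (⊲-mono m≤ε y∈)
      }

    Continuous-at : (Carrier → Carrier) → Carrier → Set
    Continuous-at f x = Limits.Tends (nhds x) f (f x)

    tends-id : ∀ x → Continuous-at (λ y → y) x
    tends-id x ε 0<ε = ε , 0<ε , λ y y∈ → y∈

    module _ {A : Set} (𝓕 : Filter A) (a₀ : A) where
      open Limits 𝓕
      tends-isSubalgebra : IsSubalgebra rawRing (λ f → Tends f (f a₀))
      tends-isSubalgebra = record
        { resp  = λ {f} {g} p → tends-resp {f} {g} p (p a₀)
        ; const = tends-const
        ; plus  = λ {f} {g} → tends-+ {f} {g}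
        ; times = λ {f} {g} → tends-* {f} {g}
        }

    abstract
      half : ∀ {x} → 0# < x → ∃ λ h → 0# < h × h < x
      half {x} 0<x =
        let (h , 0<h , h2) = divide 0<x 0<2 in
        h , 0<h , 0<-⇒< 0<h (trans (solve 1 (λ h → h := h :* (con (+ 1) :+ con (+ 1)) :- h) refl h) (+-congʳ h2))

      within-right : ∀ {s y δ} → 0# < δ → s ≤ y → y < s + δ → (y - s) ⊲ δ
      within-right {s} {y} {δ} 0<δ s≤y y< = within
        (<-≤-trans (0<⇒-<0 0<δ) (≤⇒0≤- s≤y))
        (0<-⇒< (<⇒0<- y<) (solve 3 (λ s y d → (s :+ d) :- y := d :- (y :- s)) refl s y δ))

      within-left : ∀ {s x δ} → 0# < δ → s - δ < x → x ≤ s → (x - s) ⊲ δ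
      within-left {s} {x} {δ} 0<δ <x x≤s = within
        (0<-⇒< (<⇒0<- <x) (solve 3 (λ s x d → x :- (s :- d) := (x :- s) :- (:- d)) refl s x δ))
        (≤-<-trans (0≤-⇒≤ (≤⇒0≤- x≤s) (solve 2 (λ s x → s :- x := con (+ 0) :- (x :- s)) refl s x)) 0<δ)

    -- Induction along an interval: a property of the right end point that can be
    -- pushed across every point spreads from a to b.
    creep : (G : Carrier → Set) → ∀ a b → a ≤ b → G a →
            (∀ s → a ≤ s → s ≤ b → ∃ λ δ → 0# < δ ×
               (∀ x y → s - δ < x → x ≤ s → s ≤ y → y < s + δ → G x → G y)) →
            G b
    creep G a b a≤b Ga push = Gb
      where
      E : Carrier → Set
      E s = a ≤ s × s ≤ b × G s
      sup : ∃ λ s → UpperBound E s × (∀ u → UpperBound E u → ¬ (u < s))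
      sup = supremum E (a , ≈⇒≤ refl , a≤b , Ga) (b , λ x (_ , x≤b , _) → x≤b)
      s = proj₁ sup
      s-bound : UpperBound E s
      s-bound = proj₁ (proj₂ sup)
      s-least : ∀ u → UpperBound E u → ¬ (u < s)
      s-least = proj₂ (proj₂ sup)
      a≤s : a ≤ s
      a≤s = s-bound a (≈⇒≤ refl , a≤b , Ga)
      s≤b : s ≤ b
      s≤b = s-least b (λ x (_ , x≤b , _) → x≤b)
      δ = proj₁ (push s a≤s s≤b)
      0<δ : 0# < δ
      0<δ = proj₁ (proj₂ (push s a≤s s≤b))
      near : ∃ λ x → E x × s - δ < x
      near with em {∃ λ x → E x × s - δ < x}
      ... | yes p = p
      ... | no ¬p = ⊥-elim (s-least (s - δ) (λ x x∈E s-δ<x → ¬p (x , x∈E , s-δ<x))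
                      (0<-⇒< 0<δ (solve 2 (λ s d → d := s :- (s :- d)) refl s δ)))
      good : ∀ y → s ≤ y → y < s + δ → G y
      good y s≤y y< = let (x , x∈E@(_ , _ , Gx) , x>) = near in
        proj₂ (proj₂ (push s a≤s s≤b)) x y x> (s-bound x x∈E) s≤y y< Gx
      s<s+ : ∀ {ε} → 0# < ε → s < s + ε
      s<s+ {ε} 0<ε = 0<-⇒< 0<ε (solve 2 (λ s d → d := (s :+ d) :- s) refl s ε)
      Gb : G b
      Gb with ≤⇒<⊎≈ s≤b
      ... | inj₂ s≈b = good b s≤b (<-resp s≈b refl (s<s+ 0<δ))
      -- With h = δ/2 there are two cases. If s + h < b, then s + h belongs to E although it exceeds
      -- the supremum; otherwise b lies within δ of s and is reached directly.
      ... | inj₁ s<b with half 0<δ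
      ... | h , 0<h , h<δ with <-≤-connex (s + h) b
      ... | inj₂ b≤ = good b s≤b (≤-<-trans b≤ (0<-⇒< (<⇒0<- h<δ) (solve 3 (λ s h d → d :- h := (s :+ d) :- (s :+ h)) refl s h δ)))
      ... | inj₁ <b = ⊥-elim (s-bound (s + h) (≤-trans a≤s (<⇒≤ (s<s+ 0<h)) , <⇒≤ <b ,
                        good (s + h) (<⇒≤ (s<s+ 0<h)) (0<-⇒< (<⇒0<- h<δ) (solve 3 (λ s h d → d :- h := (s :+ d) :- (s :+ h)) refl s h δ)))
                        (s<s+ 0<h))

    abstract
      -- If f has no zero, negativity spreads from a to b by `creep`: near a point with f < 0
      -- continuity gives it on the right, and near a point with f > 0 it already fails on the left.
      ivt : (f : Carrier → Carrier) → ∀ a b → a ≤ b → (∀ s → a ≤ s → s ≤ b → Continuous-at f s) →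
            f a < 0# → 0# < f b → ∃ λ s → a ≤ s × s ≤ b × f s ≈ 0#
      ivt f a b a≤b cts fa<0 0<fb with em {∃ λ s → a ≤ s × s ≤ b × f s ≈ 0#}
      ... | yes p = p
      ... | no ¬p = ⊥-elim (<⇒≤ 0<fb (creep (λ s → f s < 0#) a b a≤b fa<0 push))
        where
        push : ∀ s → a ≤ s → s ≤ b → ∃ λ δ → 0# < δ ×
               (∀ x y → s - δ < x → x ≤ s → s ≤ y → y < s + δ → f x < 0# → f y < 0#)
        push s a≤s s≤b with ST.compare (f s) 0#
        ... | tri≈ _ e _ = ⊥-elim (¬p (s , a≤s , s≤b , e))
        ... | tri< l _ _ =
          let (δ , 0<δ , q) = Limits.tends-pos (nhds s) {λ y → - f y} (Limits.tends-neg (nhds s) {f} (cts s a≤s s≤b)) (<0⇒0<- l) in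
          δ , 0<δ , λ x y _ _ s≤y y< _ → 0<-⇒< (q y (within-right 0<δ s≤y y<)) (sym (+-identityˡ _))
        ... | tri> _ _ g =
          let (δ , 0<δ , q) = Limits.tends-pos (nhds s) {f} (cts s a≤s s≤b) g in
          δ , 0<δ , λ x y <x x≤s _ _ fx<0 → ⊥-elim (<⇒≤ fx<0 (q x (within-left 0<δ <x x≤s)))

    abstract
      -- A zero of x² - a on [0, a + 1], where the value at the right end is a² + a + 1.
      sqrt : ∀ a → 0# ≤ a → ∃ λ s → 0# ≤ s × s * s ≈ a
      sqrt a 0≤a with ≤⇒<⊎≈ 0≤a
      ... | inj₂ 0≈a = 0# , ≈⇒≤ refl , trans (zeroˡ 0#) 0≈a
      ... | inj₁ 0<a = let (s , 0≤s , _ , e) = root in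
        s , 0≤s , trans (solve 2 (λ s a → s :* s := (s :* s :- a) :+ a) refl s a) (trans (+-congʳ e) (+-identityˡ a))
        where
        f : Carrier → Carrier
        f x = x * x - a
        cts : ∀ s → Continuous-at f s
        cts s = plus {λ x → x * x} {λ _ → - a} (times {λ x → x} {λ x → x} (tends-id s) (tends-id s)) (const (- a))
          where open IsSubalgebra (tends-isSubalgebra (nhds s) s)
        root : ∃ λ s → 0# ≤ s × s ≤ a + 1# × f s ≈ 0#
        root = ivt f 0# (a + 1#) (<⇒≤ (+-pos 0<a 0<1)) (λ s _ _ → cts s)
          (0<-⇒< 0<a (solve 1 (λ a → a := con (+ 0) :- (con (+ 0) :* con (+ 0) :- a)) refl a))
          (<-resp refl (solve 1 (λ a → a :* a :+ (a :+ con (+ 1)) := (a :+ con (+ 1)) :* (a :+ con (+ 1)) :- a) refl a)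
            (+-pos (*-positive 0<a 0<a) (+-pos 0<a 0<1)))

    sq≤⇒0≤+ : ∀ {r a} → 0# ≤ r → a * a ≤ r * r → 0# ≤ r + a
    sq≤⇒0≤+ {r} {a} 0≤r a²≤r² r+a<0 = ≤⇒0≤- a²≤r² (0<-⇒< (*-positive (<0⇒0<- r+a<0) 0<r-a)
        (solve 2 (λ r a → (:- (r :+ a)) :* (r :- a) := con (+ 0) :- (r :* r :- a :* a)) refl r a))
      where
      0<r-a : 0# < r - a
      0<r-a = <-resp refl (solve 2 (λ r a → :- (r :+ a) :+ (r :+ r) := r :- a) refl r a)
                (+-pos-nonneg (<0⇒0<- r+a<0) (+-nonneg 0≤r 0≤r))

    sq<⇒⊲ : ∀ {x δ} → 0# < δ → x * x < δ * δ → x ⊲ δ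
    sq<⇒⊲ {x} {δ} 0<δ x²<δ² = within
      (0<-⇒< (strict {x} x²<δ²) (solve 2 (λ x d → d :+ x := x :- (:- d)) refl x δ))
      (0<-⇒< (strict { - x} (<-resp (solve 1 (λ x → x :* x := (:- x) :* (:- x)) refl x) refl x²<δ²)) refl)
      where
      strict : ∀ {y} → y * y < δ * δ → 0# < δ + y
      strict {y} y²< with <-≤-connex 0# (δ + y)
      ... | inj₁ p = p
      ... | inj₂ p = ⊥-elim (0≤-⇒≤ (*-nonneg (≤⇒0≤- p) (<⇒≤ 0<δ-y)) diff y²<)
        where
        0<δ-y : 0# < δ - y
        0<δ-y = <-resp refl (solve 2 (λ d y → d :+ d :+ (con (+ 0) :- (d :+ y)) := d :- y) refl δ y)
                  (+-pos-nonneg (+-pos 0<δ 0<δ) (≤⇒0≤- p))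
        diff : (0# - (δ + y)) * (δ - y) ≈ y * y - δ * δ
        diff = solve 2 (λ d y → (con (+ 0) :- (d :+ y)) :* (d :- y) := y :* y :- d :* d) refl δ y

  open RealAnalysis public

  -- The embedding of ℚ into ℝ

  module RationalEmbedding where
    ℤ→ℝ≡⟦⟧ : ∀ i → ℤ→ℝ i ≡ ⟦ i ⟧
    ℤ→ℝ≡⟦⟧ (+ n)    = ≡.refl
    ℤ→ℝ≡⟦⟧ -[1+ n ] = ≡.refl

    denominator : ℚᵘ → Carrier
    denominator p = ℚᵘ.↧ₙ p · 1#

    denominator≉0 : ∀ p → denominator p ≉ 0#
    denominator≉0 (mkℚᵘ n d) = 0<⇒≉0 (·1-pos d)

    ℚᵘ→ℝ : ℚᵘ → Carrier
    ℚᵘ→ℝ p = ⟦ ℚᵘ.↥ p ⟧ * denominator p ⁻¹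

    *-cancelʳ : ∀ {x y z} → z ≉ 0# → x * z ≈ y * z → x ≈ y
    *-cancelʳ {x} {y} {z} z≉0 p = trans (expand x) (trans (*-congʳ p) (sym (expand y)))
      where
      expand : ∀ x → x ≈ x * z * z ⁻¹
      expand x = sym (trans (*-assoc x z (z ⁻¹)) (trans (*-congˡ (⁻¹-inverseʳ z≉0)) (*-identityʳ x)))

    ℚᵘ→ℝ-* : ∀ p → ℚᵘ→ℝ p * denominator p ≈ ⟦ ℚᵘ.↥ p ⟧
    ℚᵘ→ℝ-* p = trans (*-assoc _ _ _) (trans (*-congˡ (trans (*-comm _ _) (⁻¹-inverseʳ (denominator≉0 p)))) (*-identityʳ _))

    -- A fraction is recognised by clearing its denominator, which avoids computing with inverses.
    -- The laws are checked in this way for unnormalised fractions and then transferred, because the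
    -- operations of ℚ reduce to lowest terms.
    unique : ∀ {x} p → x * denominator p ≈ ⟦ ℚᵘ.↥ p ⟧ → x ≈ ℚᵘ→ℝ p
    unique p e = *-cancelʳ (denominator≉0 p) (trans e (sym (ℚᵘ→ℝ-* p)))

    ℚᵘ→ℝ-cong : ∀ {p q} → p ℚᵘ.≃ q → ℚᵘ→ℝ p ≈ ℚᵘ→ℝ q
    ℚᵘ→ℝ-cong {p} {q} (ℚᵘ.*≡* e) = unique q (*-cancelʳ (denominator≉0 p) (begin
      ℚᵘ→ℝ p * denominator q * denominator p    ≈⟨ solve 3 (λ a b c → a :* b :* c := (a :* c) :* b) refl (ℚᵘ→ℝ p) (denominator q) (denominator p) ⟩
      ℚᵘ→ℝ p * denominator p * denominator q    ≈⟨ *-congʳ (ℚᵘ→ℝ-* p) ⟩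
      ⟦ ℚᵘ.↥ p ⟧ * ⟦ ℚᵘ.↧ q ⟧                   ≈⟨ ⟦⟧-* (ℚᵘ.↥ p) (ℚᵘ.↧ q) ⟨
      ⟦ ℚᵘ.↥ p ℤ.* ℚᵘ.↧ q ⟧                     ≡⟨ ≡.cong ⟦_⟧ e ⟩
      ⟦ ℚᵘ.↥ q ℤ.* ℚᵘ.↧ p ⟧                     ≈⟨ ⟦⟧-* (ℚᵘ.↥ q) (ℚᵘ.↧ p) ⟩
      ⟦ ℚᵘ.↥ q ⟧ * denominator p                ∎))

    ℚᵘ→ℝ-+ : ∀ p q → ℚᵘ→ℝ (p ℚᵘ.+ q) ≈ ℚᵘ→ℝ p + ℚᵘ→ℝ q
    ℚᵘ→ℝ-+ p@(mkℚᵘ m c) q@(mkℚᵘ n d) = sym (unique (p ℚᵘ.+ q) (begin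
      (ℚᵘ→ℝ p + ℚᵘ→ℝ q) * denominator (p ℚᵘ.+ q)           ≈⟨ *-congˡ (×1-homo-* (suc c) (suc d)) ⟩
      (ℚᵘ→ℝ p + ℚᵘ→ℝ q) * (denominator p * denominator q)
        ≈⟨ solve 4 (λ x y a b → (x :+ y) :* (a :* b) := (x :* a) :* b :+ (y :* b) :* a) refl (ℚᵘ→ℝ p) (ℚᵘ→ℝ q) (denominator p) (denominator q) ⟩
      ℚᵘ→ℝ p * denominator p * denominator q + ℚᵘ→ℝ q * denominator q * denominator p
        ≈⟨ +-cong (*-congʳ (ℚᵘ→ℝ-* p)) (*-congʳ (ℚᵘ→ℝ-* q)) ⟩
      ⟦ m ⟧ * ⟦ + suc d ⟧ + ⟦ n ⟧ * ⟦ + suc c ⟧            ≈⟨ +-cong (⟦⟧-* m (+ suc d)) (⟦⟧-* n (+ suc c)) ⟨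
      ⟦ m ℤ.* + suc d ⟧ + ⟦ n ℤ.* + suc c ⟧                ≈⟨ ⟦⟧-+ (m ℤ.* + suc d) (n ℤ.* + suc c) ⟨
      ⟦ m ℤ.* + suc d ℤ.+ n ℤ.* + suc c ⟧                  ∎))

    ℚᵘ→ℝ-homo-* : ∀ p q → ℚᵘ→ℝ (p ℚᵘ.* q) ≈ ℚᵘ→ℝ p * ℚᵘ→ℝ q
    ℚᵘ→ℝ-homo-* p@(mkℚᵘ m c) q@(mkℚᵘ n d) = sym (unique (p ℚᵘ.* q) (begin
      (ℚᵘ→ℝ p * ℚᵘ→ℝ q) * denominator (p ℚᵘ.* q)           ≈⟨ *-congˡ (×1-homo-* (suc c) (suc d)) ⟩
      (ℚᵘ→ℝ p * ℚᵘ→ℝ q) * (denominator p * denominator q)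
        ≈⟨ solve 4 (λ x y a b → (x :* y) :* (a :* b) := (x :* a) :* (y :* b)) refl (ℚᵘ→ℝ p) (ℚᵘ→ℝ q) (denominator p) (denominator q) ⟩
      ℚᵘ→ℝ p * denominator p * (ℚᵘ→ℝ q * denominator q)    ≈⟨ *-cong (ℚᵘ→ℝ-* p) (ℚᵘ→ℝ-* q) ⟩
      ⟦ m ⟧ * ⟦ n ⟧                                        ≈⟨ ⟦⟧-* m n ⟨
      ⟦ m ℤ.* n ⟧                                          ∎))

    ℚ→ℝ-toℚᵘ : ∀ q → ℚ→ℝ q ≈ ℚᵘ→ℝ (toℚᵘ q)
    ℚ→ℝ-toℚᵘ (mkℚ n d _) = *-congʳ (reflexive (ℤ→ℝ≡⟦⟧ n))

    ℚ→ℝ-+ : ∀ p q → ℚ→ℝ (p ℚ.+ q) ≈ ℚ→ℝ p + ℚ→ℝ q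
    ℚ→ℝ-+ p q = trans (ℚ→ℝ-toℚᵘ (p ℚ.+ q)) (trans (ℚᵘ→ℝ-cong (ℚ.toℚᵘ-homo-+ p q))
      (trans (ℚᵘ→ℝ-+ (toℚᵘ p) (toℚᵘ q)) (+-cong (sym (ℚ→ℝ-toℚᵘ p)) (sym (ℚ→ℝ-toℚᵘ q)))))

    ℚ→ℝ-* : ∀ p q → ℚ→ℝ (p ℚ.* q) ≈ ℚ→ℝ p * ℚ→ℝ q
    ℚ→ℝ-* p q = trans (ℚ→ℝ-toℚᵘ (p ℚ.* q)) (trans (ℚᵘ→ℝ-cong (ℚ.toℚᵘ-homo-* p q))
      (trans (ℚᵘ→ℝ-homo-* (toℚᵘ p) (toℚᵘ q)) (*-cong (sym (ℚ→ℝ-toℚᵘ p)) (sym (ℚ→ℝ-toℚᵘ q)))))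

    ℚ→ℝ-/1 : ∀ i → ℚ→ℝ (i ℚ./ 1) ≈ ⟦ i ⟧
    ℚ→ℝ-/1 i = trans (ℚ→ℝ-toℚᵘ (i ℚ./ 1)) (trans (ℚᵘ→ℝ-cong (ℚ.toℚᵘ-fromℚᵘ (mkℚᵘ i 0)))
      (sym (unique (mkℚᵘ i 0) (trans (*-congˡ (+-identityʳ 1#)) (*-identityʳ ⟦ i ⟧)))))

    ℚ→ℝ-0 : ℚ→ℝ 0ℚ ≈ 0#
    ℚ→ℝ-0 = zeroˡ _

    ℚ→ℝ-1 : ℚ→ℝ 1ℚ ≈ 1#
    ℚ→ℝ-1 = trans (ℚ→ℝ-/1 (+ 1)) (+-identityʳ 1#)

    ℚ→ℝ-reflects-<0 : ∀ q → ℚ→ℝ q < 0# → q ℚ.< 0ℚ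
    ℚ→ℝ-reflects-<0 q@(mkℚ -[1+ n ] d _) _ = ℚ.negative⁻¹ q
    ℚ→ℝ-reflects-<0 (mkℚ (+ n) d _)      p = ⊥-elim (*-nonneg (·1-nonneg n) (<⇒≤ (⁻¹-pos (·1-pos d))) p)

    evalℝ-ℚ : ∀ {n} (p : Poly ℚ n) v → ℚ→ℝ (evalℚ p v) ≈ evalℝ p (Vec.map ℚ→ℝ v)
    evalℝ-ℚ p v = trans (reflexive (≡.cong (λ p → ℚ→ℝ (evalℚ p v)) (≡.sym (mapCoeff-id p))))
      (EvaluationHomomorphism.eval-hom ℚ.+-*-commutativeRing commutativeRing ℚ→ℝ ℚ→ℝ-0 ℚ→ℝ-1 ℚ→ℝ-+ ℚ→ℝ-* (λ q → q) ℚ→ℝ (λ _ → refl) p v)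
      where
      mapCoeff-id : ∀ {n} (p : Poly ℚ n) → mapCoeff (λ q → q) p ≡ p
      mapCoeff-id []      = ≡.refl
      mapCoeff-id (t ∷ p) = ≡.cong (t ∷_) (mapCoeff-id p)

  -- Weak approximation from a negative value of the top form

  module NegativeDirection where
    open RationalEmbedding

    ℝ³ : Set
    ℝ³ = Carrier × Carrier × Carrier

    nhds³ : ℝ³ → Filter ℝ³
    nhds³ (a , b , c) = record
      { Ev     = λ P → ∃ λ δ → 0# < δ × (∀ x y z → (x - a) ⊲ δ → (y - b) ⊲ δ → (z - c) ⊲ δ → P (x , y , z))
      ; ev-all = λ p → 1# , 0<1 , λ x y z _ _ _ → p (x , y , z)
      ; ev-map = λ f (δ , 0<δ , p) → δ , 0<δ , λ x y z i j k → f (x , y , z) (p x y z i j k)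
      ; ev-∧   = λ (δ , 0<δ , p) (ε , 0<ε , q) →
          let (m , 0<m , m≤δ , m≤ε) = minimum 0<δ 0<ε in
          m , 0<m , λ x y z i j k → p x y z (⊲-mono m≤δ i) (⊲-mono m≤δ j) (⊲-mono m≤δ k) ,
                                    q x y z (⊲-mono m≤ε i) (⊲-mono m≤ε j) (⊲-mono m≤ε k)
      }

    eval-negative-nearby : (H : Poly ℚ 3) → ∀ a b c → evalℝ H (a ∷ b ∷ c ∷ []) < 0# →
      ∃ λ δ → 0# < δ × (∀ x y z → (x - a) ⊲ δ → (y - b) ⊲ δ → (z - c) ⊲ δ → evalℝ H (x ∷ y ∷ z ∷ []) < 0#)
    eval-negative-nearby H a b c H<0 =
      let (δ , 0<δ , p) = tends-pos {λ v → - eval v} (tends-neg {eval} eval-tends) (<0⇒0<- H<0)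
      in δ , 0<δ , λ x y z i j k → 0<-⇒< (p x y z i j k) (sym (+-identityˡ _))
      where
      open Limits (nhds³ (a , b , c))
      eval : ℝ³ → Carrier
      eval (x , y , z) = evalℝ H (x ∷ y ∷ z ∷ [])
      eval-tends : Tends eval (eval (a , b , c))
      eval-tends = eval-closed (tends-isSubalgebra (nhds³ (a , b , c)) (a , b , c)) (mapCoeff ℚ→ℝ H)
        {(λ (x , _ , _) → x) ∷ (λ (_ , y , _) → y) ∷ (λ (_ , _ , z) → z) ∷ []}
        ( (λ ε 0<ε → ε , 0<ε , λ x y z i j k → i)
        ∷ (λ ε 0<ε → ε , 0<ε , λ x y z i j k → j)
        ∷ (λ ε 0<ε → ε , 0<ε , λ x y z i j k → k) ∷ [])

    -- The lattice point x₀ + n i with i the integer nearest to m w, rescaled by z = 1/m, tends to n w.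
    rescaled-close : ∀ {x₀ w n i m z B δ} → m * z ≈ 1# → 0# < n → 0# < z → x₀ ⊲ B → (w * m - i) ⊲ 2# →
                     z * (B + n * 2#) < δ → ((x₀ + n * i) * z - n * w) ⊲ δ
    rescaled-close {x₀} {w} {n} {i} {m} {z} {B} {δ} mz≈1 0<n 0<z x₀⊲B i⊲2 small =
      ⊲-mono (<⇒≤ small) (⊲-resp eq refl (⊲-*-pos 0<z (⊲-+ x₀⊲B (⊲-neg (⊲-*-pos 0<n i⊲2)))))
      where
      ⊲-*-pos : ∀ {c x ε} → 0# < c → x ⊲ ε → (c * x) ⊲ (c * ε)
      ⊲-*-pos {c} {x} {ε} 0<c (within a b) = within
        (0<-⇒< (*-positive 0<c (<⇒0<- a)) (solve 3 (λ c x e → c :* (x :- (:- e)) := c :* x :- (:- (c :* e))) refl c x ε))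
        (0<-⇒< (*-positive 0<c (<⇒0<- b)) (solve 3 (λ c x e → c :* (e :- x) := c :* e :- c :* x) refl c x ε))
      eq : z * (x₀ + - (n * (w * m - i))) ≈ (x₀ + n * i) * z - n * w
      eq = begin
        z * (x₀ + - (n * (w * m - i)))
          ≈⟨ solve 6 (λ x n w m i z → z :* (x :+ :- (n :* (w :* m :- i))) := (x :+ n :* i) :* z :- (n :* w) :* (m :* z)) refl x₀ n w m i z ⟩
        (x₀ + n * i) * z - (n * w) * (m * z)   ≈⟨ +-congˡ (-‿cong (trans (*-congˡ mz≈1) (*-identityʳ _))) ⟩
        (x₀ + n * i) * z - n * w               ∎

    module _ (F : Poly ℚ 2) (d : ℕ) (H : Poly ℚ 3)
             (dehomogenise : ∀ x y → evalℝ H (x ∷ y ∷ 1# ∷ []) ≈ evalℝ F (x ∷ y ∷ []))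
             (homogeneous : ∀ s x y z → evalℝ H (s * x ∷ s * y ∷ s * z ∷ []) ≈ s ^ d * evalℝ H (x ∷ y ∷ z ∷ [])) where

      weak-approximation : ∀ u v → evalℝ H (u ∷ v ∷ 0# ∷ []) < 0# → WeakApproximation (λ x y → evalℚ F (x ∷ y ∷ []) ℚ.< 0ℚ)
      weak-approximation u v H<0 x₀ y₀ N@(suc N′) 0<N =
        lattice x₀ i , lattice y₀ j , ℚ→ℝ-reflects-<0 _ F<0 , difference x₀ i , difference y₀ j
        where
        n : Carrier
        n = N · 1#
        0<n : 0# < n
        0<n = ·1-pos N′
        -- The base point is N(u, v) and not (u, v): a lattice point x₀ + N i with i close to m u
        -- comes close to N u after division by m. By homogeneity H is negative there too.
        nearby : ∃ λ δ → 0# < δ × (∀ x y z → (x - n * u) ⊲ δ → (y - n * v) ⊲ δ → (z - 0#) ⊲ δ → evalℝ H (x ∷ y ∷ z ∷ []) < 0#)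
        nearby = eval-negative-nearby H (n * u) (n * v) 0#
          (<-resp (trans (sym (homogeneous n u v 0#)) (eval-cong (mapCoeff ℚ→ℝ H) (refl ∷ refl ∷ zeroʳ n ∷ []))) refl
            (0<-⇒< (*-positive (^-pos d 0<n) (<0⇒0<- H<0))
              (solve 2 (λ a b → a :* (:- b) := con (+ 0) :- a :* b) refl (n ^ d) (evalℝ H (u ∷ v ∷ 0# ∷ [])))))
        δ : Carrier
        δ = proj₁ nearby
        0<δ : 0# < δ
        0<δ = proj₁ (proj₂ nearby)
        boundx : ∃ λ B → ℚ→ℝ x₀ ⊲ B
        boundx = ⊲-exists (ℚ→ℝ x₀)
        boundy : ∃ λ B → ℚ→ℝ y₀ ⊲ B
        boundy = ⊲-exists (ℚ→ℝ y₀)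
        Bx By : Carrier
        Bx = proj₁ boundx
        By = proj₁ boundy
        0<Bx : 0# < Bx
        0<Bx = ⊲-0<bound (proj₂ boundx)
        0<By : 0# < By
        0<By = ⊲-0<bound (proj₂ boundy)
        -- The sum of all errors before division by m: the offsets x₀ and y₀, the rounding error 2N,
        -- and 1 for the third coordinate z = 1/m itself. The one inequality z C < δ then gives all
        -- three estimates.
        C : Carrier
        C = 1# + (Bx + (By + n * 2#))
        0<n2 : 0# < n * 2#
        0<n2 = *-positive 0<n 0<2
        0<C : 0# < C
        0<C = +-pos 0<1 (+-pos 0<Bx (+-pos 0<By 0<n2))
        quotient : ∃ λ M → 0# < M × M * δ ≈ C
        quotient = divide 0<C 0<δ
        large : ∃ λ k → proj₁ quotient < k · 1#
        large = archimedean (proj₁ quotient)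
        m : Carrier
        m = proj₁ large · 1#
        0<m : 0# < m
        0<m = <-trans (proj₁ (proj₂ quotient)) (proj₂ large)
        z : Carrier
        z = m ⁻¹
        0<z : 0# < z
        0<z = ⁻¹-pos 0<m
        mz≈1 : m * z ≈ 1#
        mz≈1 = ⁻¹-inverseʳ (0<⇒≉0 0<m)
        zC<δ : z * C < δ
        zC<δ = <-resp (*-congˡ (proj₂ (proj₂ quotient)))
          (trans (solve 3 (λ z m d → z :* (m :* d) := (m :* z) :* d) refl z m δ) (trans (*-congʳ mz≈1) (*-identityˡ δ)))
          (0<-⇒< (*-positive 0<z (*-positive (<⇒0<- (proj₂ large)) 0<δ))
            (solve 4 (λ z m q d → z :* ((m :- q) :* d) := z :* (m :* d) :- z :* (q :* d)) refl z m (proj₁ quotient) δ))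
        smaller : ∀ {a b} → 0# < b → a + b ≈ C → z * a < δ
        smaller {a} {b} 0<b e = <-trans (0<-⇒< (*-positive 0<z 0<b) (trans (solve 3 (λ z a b → z :* b := z :* (a :+ b) :- z :* a) refl z a b)
          (+-congʳ (*-congˡ e)))) zC<δ
        roundx : ∃ λ (i : ℤ) → (u * m - ⟦ i ⟧) ⊲ 2#
        roundx = round (u * m)
        roundy : ∃ λ (i : ℤ) → (v * m - ⟦ i ⟧) ⊲ 2#
        roundy = round (v * m)
        i j : ℤ
        i = proj₁ roundx
        j = proj₁ roundy
        lattice : ℚ → ℤ → ℚ
        lattice q i = q ℚ.+ ((+ N) ℤ.* i) ℚ./ 1
        difference : ∀ q i → (lattice q i ℚ.- q) ∈ N ·ℤ
        difference q i = i , cancel q (((+ N) ℤ.* i) ℚ./ 1)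
          where
          cancel : ∀ q r → (q ℚ.+ r) ℚ.- q ≡ r
          cancel q r = ≡.trans (≡.cong (ℚ._- q) (ℚ.+-comm q r)) (≡.trans (ℚ.+-assoc r q (ℚ.- q))
            (≡.trans (≡.cong (r ℚ.+_) (ℚ.+-inverseʳ q)) (ℚ.+-identityʳ r)))
        lattice-ℝ : ∀ q i → ℚ→ℝ (lattice q i) ≈ ℚ→ℝ q + n * ⟦ i ⟧
        lattice-ℝ q i = trans (ℚ→ℝ-+ q (((+ N) ℤ.* i) ℚ./ 1)) (+-congˡ (trans (ℚ→ℝ-/1 ((+ N) ℤ.* i)) (⟦⟧-* (+ N) i)))
        X Y : Carrier
        X = ℚ→ℝ x₀ + n * ⟦ i ⟧
        Y = ℚ→ℝ y₀ + n * ⟦ j ⟧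
        scaled : ∀ x → m * (x * z) ≈ x
        scaled x = trans (solve 3 (λ m x z → m :* (x :* z) := x :* (m :* z)) refl m x z) (trans (*-congˡ mz≈1) (*-identityʳ x))
        H<0′ : evalℝ H (X * z ∷ Y * z ∷ z ∷ []) < 0#
        H<0′ = proj₂ (proj₂ nearby) (X * z) (Y * z) z
          (rescaled-close mz≈1 0<n 0<z (proj₂ boundx) (proj₂ roundx)
            (smaller (+-pos 0<1 0<By) (solve 3 (λ a b c → (a :+ c) :+ (con (+ 1) :+ b) := con (+ 1) :+ (a :+ (b :+ c))) refl Bx By (n * 2#))))
          (rescaled-close mz≈1 0<n 0<z (proj₂ boundy) (proj₂ roundy)
            (smaller (+-pos 0<1 0<Bx) (solve 3 (λ a b c → (b :+ c) :+ (con (+ 1) :+ a) := con (+ 1) :+ (a :+ (b :+ c))) refl Bx By (n * 2#))))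
          (⊲-resp (solve 1 (λ z → z := z :- con (+ 0)) refl z) refl (within (<-trans (0<⇒-<0 0<δ) 0<z)
            (<-resp (*-identityʳ z) refl (smaller (+-pos 0<Bx (+-pos 0<By 0<n2)) refl))))
        F<0 : ℚ→ℝ (evalℚ F (lattice x₀ i ∷ lattice y₀ j ∷ [])) < 0#
        F<0 = <-resp (sym (begin
            ℚ→ℝ (evalℚ F (lattice x₀ i ∷ lattice y₀ j ∷ []))                ≈⟨ evalℝ-ℚ F (lattice x₀ i ∷ lattice y₀ j ∷ []) ⟩
            evalℝ F (ℚ→ℝ (lattice x₀ i) ∷ ℚ→ℝ (lattice y₀ j) ∷ [])          ≈⟨ eval-cong (mapCoeff ℚ→ℝ F) (lattice-ℝ x₀ i ∷ lattice-ℝ y₀ j ∷ []) ⟩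
            evalℝ F (X ∷ Y ∷ [])                                              ≈⟨ dehomogenise X Y ⟨
            evalℝ H (X ∷ Y ∷ 1# ∷ [])                                         ≈⟨ eval-cong (mapCoeff ℚ→ℝ H) (scaled X ∷ scaled Y ∷ mz≈1 ∷ []) ⟨
            evalℝ H (m * (X * z) ∷ m * (Y * z) ∷ m * z ∷ [])                  ≈⟨ homogeneous m (X * z) (Y * z) z ⟩
            m ^ d * evalℝ H (X * z ∷ Y * z ∷ z ∷ [])                          ∎)) refl
          (0<-⇒< (*-positive (^-pos d 0<m) (<0⇒0<- H<0′))
            (solve 2 (λ a b → a :* (:- b) := con (+ 0) :- a :* b) refl (m ^ d) (evalℝ H (X * z ∷ Y * z ∷ z ∷ []))))

-- An axiomatic copy of ℂ; keeping its equality abstract keeps unification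
-- from unfolding it into pairs of real equations.
record ComplexStructure (𝓡 : CompleteOrderedField) : Set₁ where
  private module R = CompleteOrderedField 𝓡
  field
    commutativeRing : CommutativeRing 0ℓ 0ℓ
  open CommutativeRing commutativeRing hiding (zero)
  field
    re im   : Carrier → R.Carrier
    mk      : R.Carrier → R.Carrier → Carrier
    re-cong : ∀ {x y} → x ≈ y → re x R.≈ re y
    im-cong : ∀ {x y} → x ≈ y → im x R.≈ im y
    ext     : ∀ {x y} → re x R.≈ re y → im x R.≈ im y → x ≈ y
    re-mk   : ∀ a b → re (mk a b) R.≈ a
    im-mk   : ∀ a b → im (mk a b) R.≈ b
    re-0    : re 0# R.≈ R.0#
    im-0    : im 0# R.≈ R.0#
    re-1    : re 1# R.≈ R.1#
    im-1    : im 1# R.≈ R.0#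
    re-neg  : ∀ x → re (- x) R.≈ R.- re x
    im-neg  : ∀ x → im (- x) R.≈ R.- im x
    re-+    : ∀ x y → re (x + y) R.≈ re x R.+ re y
    im-+    : ∀ x y → im (x + y) R.≈ im x R.+ im y
    re-*    : ∀ x y → re (x * y) R.≈ re x R.* re y R.- im x R.* im y
    im-*    : ∀ x y → im (x * y) R.≈ re x R.* im y R.+ im x R.* re y

module Complex (em : ExcludedMiddle 0ℓ) (𝓡 : CompleteOrderedField) (𝓒 : ComplexStructure 𝓡) where
  module R = CompleteOrderedField 𝓡
  open R using (_<_) renaming
    (Carrier to ℝ; _≈_ to _≈ᴿ_; _+_ to _+ᴿ_; _*_ to _*ᴿ_; -_ to -ᴿ_; _-_ to _-ᴿ_; 0# to 0ᴿ; 1# to 1ᴿ; _⁻¹ to _⁻¹ᴿ)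
  open Real em 𝓡
  open RealComplex 𝓡 using (ℚ→ℝ; evalℝ)
  open ComplexStructure 𝓒
  open CommutativeRing commutativeRing hiding (zero)
  open Evaluation commutativeRing
    using (_^_; ^-congˡ; ^-homo-*; ^-distrib-*; ^-closed; eval-closed; eval-cong)
  open Univariate commutativeRing
  open Polynomial rawRing using (eval; _-const_)
  open Projective rawRing
  module RE = Evaluation R.commutativeRing
  open RE using () renaming (_^_ to _^ᴿ_)
  open IntegerCoefficients.Solver commutativeRing using (solve; _:+_; _:*_; _:-_; :-_; _:=_; con)
  open IC.Solver using () renaming
    (solve to solveᴾ; _:+_ to _+ᴾ_; _:*_ to _*ᴾ_; _:-_ to _-ᴾ_; :-_ to -ᴾ_; _:=_ to _=ᴾ_; con to conᴾ)
  open Relation.Binary.Reasoning.Setoid setoid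

  -- The field ℂ, conjugation and the squared modulus

  module ComplexField where
    ℂ : Set
    ℂ = Carrier

    _≟_ : ∀ (x y : ℂ) → Dec (x ≈ y)
    x ≟ y = em

    ι : ℝ → ℂ
    ι r = mk r 0ᴿ

    conj : ℂ → ℂ
    conj z = mk (re z) (-ᴿ im z)

    mk-cong : ∀ {a b c d} → a ≈ᴿ c → b ≈ᴿ d → mk a b ≈ mk c d
    mk-cong {a} {b} {c} {d} p q = ext (R.trans (re-mk a b) (R.trans p (R.sym (re-mk c d))))
                                      (R.trans (im-mk a b) (R.trans q (R.sym (im-mk c d))))

    ι-0 : ι 0ᴿ ≈ 0#
    ι-0 = ext (R.trans (re-mk _ _) (R.sym re-0)) (R.trans (im-mk _ _) (R.sym im-0))

    ι-1 : ι 1ᴿ ≈ 1#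
    ι-1 = ext (R.trans (re-mk _ _) (R.sym re-1)) (R.trans (im-mk _ _) (R.sym im-1))

    ι-+ : ∀ a b → ι (a +ᴿ b) ≈ ι a + ι b
    ι-+ a b = ext
      (R.trans (re-mk _ _) (R.sym (R.trans (re-+ _ _) (R.+-cong (re-mk _ _) (re-mk _ _)))))
      (R.trans (im-mk _ _) (R.sym (R.trans (im-+ _ _) (R.trans (R.+-cong (im-mk _ _) (im-mk _ _)) (R.+-identityˡ _)))))

    ι-neg : ∀ a → ι (-ᴿ a) ≈ - ι a
    ι-neg a = ext (R.trans (re-mk _ _) (R.sym (R.trans (re-neg _) (R.-‿cong (re-mk _ _)))))
                  (R.trans (im-mk _ _) (R.sym (R.trans (im-neg _) (R.trans (R.-‿cong (im-mk _ _)) RP.-0#≈0#))))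
      where module RP = Algebra.Properties.Ring R.ring

    ι-* : ∀ a b → ι (a *ᴿ b) ≈ ι a * ι b
    ι-* a b = ext
      (R.trans (re-mk _ _) (R.sym (R.trans (re-* _ _) (R.trans
        (R.+-cong (R.*-cong (re-mk _ _) (re-mk _ _)) (R.-‿cong (R.*-cong (im-mk _ _) (im-mk _ _))))
        (solveᴾ 2 (λ a b → a *ᴾ b -ᴾ conᴾ (+ 0) *ᴾ conᴾ (+ 0) =ᴾ a *ᴾ b) R.refl a b)))))
      (R.trans (im-mk _ _) (R.sym (R.trans (im-* _ _) (R.trans
        (R.+-cong (R.*-cong (re-mk _ _) (im-mk _ _)) (R.*-cong (im-mk _ _) (re-mk _ _)))
        (solveᴾ 2 (λ a b → a *ᴾ conᴾ (+ 0) +ᴾ conᴾ (+ 0) *ᴾ b =ᴾ conᴾ (+ 0)) R.refl a b)))))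

    ι-cong : ∀ {a b} → a ≈ᴿ b → ι a ≈ ι b
    ι-cong p = mk-cong p R.refl

    ι-injective : ∀ {a b} → ι a ≈ ι b → a ≈ᴿ b
    ι-injective p = R.trans (R.sym (re-mk _ _)) (R.trans (re-cong p) (re-mk _ _))

    ι≉0 : ∀ {a} → ¬ (a ≈ᴿ 0ᴿ) → ι a ≉ 0#
    ι≉0 p q = p (ι-injective (trans q (sym ι-0)))

    im≈0⇒ι : ∀ {z} → im z ≈ᴿ 0ᴿ → z ≈ ι (re z)
    im≈0⇒ι p = ext (R.sym (re-mk _ _)) (R.trans p (R.sym (im-mk _ _)))

    conj-cong : ∀ {x y} → x ≈ y → conj x ≈ conj y
    conj-cong p = mk-cong (re-cong p) (R.-‿cong (im-cong p))

    conj-+ : ∀ x y → conj (x + y) ≈ conj x + conj y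
    conj-+ x y = ext
      (R.trans (re-mk _ _) (R.trans (re-+ x y) (R.sym (R.trans (re-+ _ _) (R.+-cong (re-mk _ _) (re-mk _ _))))))
      (R.trans (im-mk _ _) (R.trans (R.-‿cong (im-+ x y)) (R.sym (R.trans (im-+ _ _) (R.trans (R.+-cong (im-mk _ _) (im-mk _ _))
        (solveᴾ 2 (λ a b → (-ᴾ a) +ᴾ (-ᴾ b) =ᴾ -ᴾ (a +ᴾ b)) R.refl (im x) (im y)))))))

    conj-* : ∀ x y → conj (x * y) ≈ conj x * conj y
    conj-* x y = ext
      (R.trans (re-mk _ _) (R.trans (re-* x y) (R.sym (R.trans (re-* _ _) (R.trans
        (R.+-cong (R.*-cong (re-mk _ _) (re-mk _ _)) (R.-‿cong (R.*-cong (im-mk _ _) (im-mk _ _))))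
        (solveᴾ 4 (λ a b c d → (a *ᴾ c) -ᴾ ((-ᴾ b) *ᴾ (-ᴾ d)) =ᴾ (a *ᴾ c) -ᴾ (b *ᴾ d)) R.refl (re x) (im x) (re y) (im y)))))))
      (R.trans (im-mk _ _) (R.trans (R.-‿cong (im-* x y)) (R.sym (R.trans (im-* _ _) (R.trans
        (R.+-cong (R.*-cong (re-mk _ _) (im-mk _ _)) (R.*-cong (im-mk _ _) (re-mk _ _)))
        (solveᴾ 4 (λ a b c d → (a *ᴾ (-ᴾ d)) +ᴾ ((-ᴾ b) *ᴾ c) =ᴾ -ᴾ ((a *ᴾ d) +ᴾ (b *ᴾ c))) R.refl (re x) (im x) (re y) (im y)))))))

    conj-involutive : ∀ z → conj (conj z) ≈ z
    conj-involutive z = ext (R.trans (re-mk _ _) (re-mk _ _))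
      (R.trans (im-mk _ _) (R.trans (R.-‿cong (im-mk _ _)) (RP.-‿involutive _)))
      where module RP = Algebra.Properties.Ring R.ring

    conj-ι : ∀ r → conj (ι r) ≈ ι r
    conj-ι r = mk-cong (re-mk _ _) (R.trans (R.-‿cong (im-mk _ _)) RP.-0#≈0#)
      where module RP = Algebra.Properties.Ring R.ring

    conj-fixed⇒im≈0 : ∀ {z} → conj z ≈ z → im z ≈ᴿ 0ᴿ
    conj-fixed⇒im≈0 {z} p = [ (λ q → ⊥-elim (0<⇒≉0 0<2 q)) , (λ q → q) ]′ (integral double)
      where
      double : 2# *ᴿ im z ≈ᴿ 0ᴿ
      double = R.trans
        (solveᴾ 1 (λ b → (conᴾ (+ 1) +ᴾ conᴾ (+ 1)) *ᴾ b =ᴾ b -ᴾ (-ᴾ b)) R.refl (im z))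
        (R.trans (R.+-congˡ (R.-‿cong (R.trans (R.sym (im-mk _ _)) (im-cong p)))) (R.-‿inverseʳ _))

    conj-0 : conj 0# ≈ 0#
    conj-0 = trans (conj-cong (sym ι-0)) (trans (conj-ι 0ᴿ) ι-0)

    conj≉0 : ∀ {z} → z ≉ 0# → conj z ≉ 0#
    conj≉0 {z} p q = p (trans (sym (conj-involutive z)) (trans (conj-cong q) conj-0))

    conj-^ : ∀ z n → conj (z ^ n) ≈ conj z ^ n
    conj-^ z zero    = trans (conj-cong (sym ι-1)) (trans (conj-ι 1ᴿ) ι-1)
    conj-^ z (suc n) = trans (conj-* z (z ^ n)) (*-congˡ (conj-^ z n))

    ev-conj : ∀ p z → conj (ev p z) ≈ ev (List.map conj p) (conj z)
    ev-conj []      z = conj-0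
    ev-conj (a ∷ p) z = trans (conj-+ a (z * ev p z)) (+-congˡ (trans (conj-* z (ev p z)) (*-congˡ (ev-conj p z))))

    -- The squared modulus: it is multiplicative and polynomial in `re` and `im`, so the estimates
    -- are free of square roots.
    N : ℂ → ℝ
    N z = re z *ᴿ re z +ᴿ im z *ᴿ im z

    N-cong : ∀ {x y} → x ≈ y → N x ≈ᴿ N y
    N-cong p = R.+-cong (R.*-cong (re-cong p) (re-cong p)) (R.*-cong (im-cong p) (im-cong p))

    N-* : ∀ x y → N (x * y) ≈ᴿ N x *ᴿ N y
    N-* x y = R.trans (R.+-cong (R.*-cong (re-* x y) (re-* x y)) (R.*-cong (im-* x y) (im-* x y)))
      (solveᴾ 4 (λ a b c d → 
          (a *ᴾ c -ᴾ b *ᴾ d) *ᴾ (a *ᴾ c -ᴾ b *ᴾ d) +ᴾ (a *ᴾ d +ᴾ b *ᴾ c) *ᴾ (a *ᴾ d +ᴾ b *ᴾ c)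
          =ᴾ (a *ᴾ a +ᴾ b *ᴾ b) *ᴾ (c *ᴾ c +ᴾ d *ᴾ d)) R.refl (re x) (im x) (re y) (im y))

    N-nonneg : ∀ z → 0ᴿ ≤ N z
    N-nonneg z = +-nonneg (sq-nonneg (re z)) (sq-nonneg (im z))

    N-0 : N 0# ≈ᴿ 0ᴿ
    N-0 = R.trans (R.+-cong (R.*-cong re-0 re-0) (R.*-cong im-0 im-0))
      (solveᴾ 0 (conᴾ (+ 0) *ᴾ conᴾ (+ 0) +ᴾ conᴾ (+ 0) *ᴾ conᴾ (+ 0) =ᴾ conᴾ (+ 0)) R.refl)

    N-1 : N 1# ≈ᴿ 1ᴿ
    N-1 = R.trans (R.+-cong (R.*-cong re-1 re-1) (R.*-cong im-1 im-1))
      (solveᴾ 0 (conᴾ (+ 1) *ᴾ conᴾ (+ 1) +ᴾ conᴾ (+ 0) *ᴾ conᴾ (+ 0) =ᴾ conᴾ (+ 1)) R.refl)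

    N-ι : ∀ r → N (ι r) ≈ᴿ r *ᴿ r
    N-ι r = R.trans (R.+-cong (R.*-cong (re-mk _ _) (re-mk _ _)) (R.*-cong (im-mk _ _) (im-mk _ _)))
      (solveᴾ 1 (λ r → r *ᴾ r +ᴾ conᴾ (+ 0) *ᴾ conᴾ (+ 0) =ᴾ r *ᴾ r) R.refl r)

    N-pos : ∀ {z} → z ≉ 0# → 0ᴿ < N z
    N-pos {z} z≉0 with ≤⇒<⊎≈ (N-nonneg z)
    ... | inj₁ p = p
    ... | inj₂ p with em {re z ≈ᴿ 0ᴿ} | em {im z ≈ᴿ 0ᴿ}
    ... | yes a | yes b = ⊥-elim (z≉0 (ext (R.trans a (R.sym re-0)) (R.trans b (R.sym im-0))))
    ... | no  a | _     = +-pos-nonneg (sq-pos a) (sq-nonneg (im z))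
    ... | yes _ | no  b = <-resp R.refl (R.+-comm _ _) (+-pos-nonneg (sq-pos b) (sq-nonneg (re z)))

    -- Parallelogram law; the difference of the two sides is the squared modulus of x - y. This
    -- takes the place of the triangle inequality.
    N-+ : ∀ x y → N (x + y) ≤ 2# *ᴿ (N x +ᴿ N y)
    N-+ x y = 0≤-⇒≤ (+-nonneg (sq-nonneg (re x -ᴿ re y)) (sq-nonneg (im x -ᴿ im y)))
      (R.trans (solveᴾ 4 (λ a b c d → 
          (a -ᴾ c) *ᴾ (a -ᴾ c) +ᴾ (b -ᴾ d) *ᴾ (b -ᴾ d)
          =ᴾ (conᴾ (+ 1) +ᴾ conᴾ (+ 1)) *ᴾ ((a *ᴾ a +ᴾ b *ᴾ b) +ᴾ (c *ᴾ c +ᴾ d *ᴾ d)) -ᴾ ((a +ᴾ c) *ᴾ (a +ᴾ c) +ᴾ (b +ᴾ d) *ᴾ (b +ᴾ d)))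
          R.refl (re x) (im x) (re y) (im y))
        (R.+-congˡ (R.-‿cong (R.sym (R.+-cong (R.*-cong (re-+ x y) (re-+ x y)) (R.*-cong (im-+ x y) (im-+ x y)))))))

    N-neg : ∀ x → N (- x) ≈ᴿ N x
    N-neg x = R.trans (R.+-cong (R.*-cong (re-neg x) (re-neg x)) (R.*-cong (im-neg x) (im-neg x)))
      (solveᴾ 2 (λ a b → (-ᴾ a) *ᴾ (-ᴾ a) +ᴾ (-ᴾ b) *ᴾ (-ᴾ b) =ᴾ a *ᴾ a +ᴾ b *ᴾ b) R.refl (re x) (im x))

    N<⇒re⊲ : ∀ {z δ} → 0ᴿ < δ → N z < δ *ᴿ δ → re z ⊲ δ
    N<⇒re⊲ {z} 0<δ p = sq<⇒⊲ 0<δ (≤-<-trans (0≤-⇒≤ (sq-nonneg (im z))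
      (solveᴾ 2 (λ a b → b *ᴾ b =ᴾ (a *ᴾ a +ᴾ b *ᴾ b) -ᴾ a *ᴾ a) R.refl (re z) (im z))) p)

    N<⇒im⊲ : ∀ {z δ} → 0ᴿ < δ → N z < δ *ᴿ δ → im z ⊲ δ
    N<⇒im⊲ {z} 0<δ p = sq<⇒⊲ 0<δ (≤-<-trans (0≤-⇒≤ (sq-nonneg (re z))
      (solveᴾ 2 (λ a b → a *ᴾ a =ᴾ (a *ᴾ a +ᴾ b *ᴾ b) -ᴾ b *ᴾ b) R.refl (re z) (im z))) p)

    conj*≈N : ∀ z → z * conj z ≈ ι (N z)
    conj*≈N z = ext
      (R.trans (re-* _ _) (R.trans (R.+-cong (R.*-congˡ (re-mk _ _)) (R.-‿cong (R.*-congˡ (im-mk _ _))))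
        (R.trans (solveᴾ 2 (λ a b → a *ᴾ a -ᴾ b *ᴾ (-ᴾ b) =ᴾ a *ᴾ a +ᴾ b *ᴾ b) R.refl (re z) (im z)) (R.sym (re-mk _ _)))))
      (R.trans (im-* _ _) (R.trans (R.+-cong (R.*-congˡ (im-mk _ _)) (R.*-congˡ (re-mk _ _)))
        (R.trans (solveᴾ 2 (λ a b → a *ᴾ (-ᴾ b) +ᴾ b *ᴾ a =ᴾ conᴾ (+ 0)) R.refl (re z) (im z)) (R.sym (im-mk _ _)))))

    infix 8 _⁻¹
    _⁻¹ : ℂ → ℂ
    z ⁻¹ = conj z * ι (N z ⁻¹ᴿ)

    ⁻¹-inverse : ∀ {z} → z ≉ 0# → z * z ⁻¹ ≈ 1#
    ⁻¹-inverse {z} z≉0 = trans (sym (*-assoc _ _ _)) (trans (*-congʳ (conj*≈N z))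
      (trans (sym (ι-* _ _)) (trans (ι-cong (R.⁻¹-inverseʳ (0<⇒≉0 (N-pos z≉0)))) ι-1)))

    1≉0 : 1# ≉ 0#
    1≉0 p = R.0#≉1# (R.trans (R.sym re-0) (R.trans (re-cong (sym p)) re-1))

    ⁻¹≉0 : ∀ {z} → z ≉ 0# → z ⁻¹ ≉ 0#
    ⁻¹≉0 {z} z≉0 p = 1≉0 (trans (sym (⁻¹-inverse z≉0)) (trans (*-congˡ p) (zeroʳ z)))

    *-integral : ∀ {x y} → x * y ≈ 0# → x ≈ 0# ⊎ y ≈ 0#
    *-integral {x} {y} p with x ≟ 0#
    ... | yes x≈0 = inj₁ x≈0
    ... | no  x≉0 = inj₂ (trans (sym (*-identityˡ y)) (trans (*-congʳ (sym (⁻¹-inverse x≉0)))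
      (trans (solve 3 (λ a b c → a :* b :* c := (a :* c) :* b) refl x (x ⁻¹) y) (trans (*-congʳ p) (zeroˡ _)))))

    *≉0 : ∀ {x y} → x ≉ 0# → y ≉ 0# → x * y ≉ 0#
    *≉0 p q r with *-integral r
    ... | inj₁ a = p a
    ... | inj₂ b = q b

    x-y≈0⇒x≈y : ∀ {x y} → x - y ≈ 0# → x ≈ y
    x-y≈0⇒x≈y {x} {y} b = trans (solve 2 (λ x y → x := (x :- y) :+ y) refl x y) (trans (+-congʳ b) (+-identityˡ y))

    x≈y⇒x-y≈0 : ∀ {x y} → x ≈ y → x - y ≈ 0#
    x≈y⇒x-y≈0 {x} {y} p = trans (+-congʳ p) (-‿inverseʳ y)

    *-cancelˡ : ∀ {z x y} → z ≉ 0# → z * x ≈ z * y → x ≈ y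
    *-cancelˡ {z} {x} {y} z≉0 p = [ (λ a → ⊥-elim (z≉0 a)) , x-y≈0⇒x≈y ]′ (*-integral zero-product)
      where
      zero-product : z * (x - y) ≈ 0#
      zero-product = trans (solve 3 (λ z x y → z :* (x :- y) := z :* x :- z :* y) refl z x y) (x≈y⇒x-y≈0 p)

    ^≉0 : ∀ {z} n → z ≉ 0# → z ^ n ≉ 0#
    ^≉0 zero    p = 1≉0
    ^≉0 (suc n) p = *≉0 p (^≉0 n p)

    ι-^ : ∀ r n → ι r ^ n ≈ ι (r ^ᴿ n)
    ι-^ r zero    = sym ι-1
    ι-^ r (suc n) = trans (*-congˡ (ι-^ r n)) (sym (ι-* r (r ^ᴿ n)))

    1^n≈1 : ∀ n → 1# ^ n ≈ 1#
    1^n≈1 zero    = refl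
    1^n≈1 (suc n) = trans (*-identityˡ _) (1^n≈1 n)

  open ComplexField public

  -- Limits in ℂ and attainment of minima

  module ComplexAnalysis where
    module ComplexLimits {A : Set} (𝓕 : Filter A) where
      open Filter 𝓕
      open Limits 𝓕 public

      record Tendsℂ (f : A → ℂ) (l : ℂ) : Set where
        constructor tendsℂ
        field
          tends-re : Tends (λ a → re (f a)) (re l)
          tends-im : Tends (λ a → im (f a)) (im l)
      open Tendsℂ public

      Tendsℂ-resp : ∀ {f g l m} → (∀ a → f a ≈ g a) → l ≈ m → Tendsℂ f l → Tendsℂ g m
      Tendsℂ-resp p q (tendsℂ s t) = tendsℂ (tends-resp (λ a → re-cong (p a)) (re-cong q) s) (tends-resp (λ a → im-cong (p a)) (im-cong q) t)

      Tendsℂ-isSubalgebra : ∀ a₀ → IsSubalgebra rawRing (λ f → Tendsℂ f (f a₀))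
      Tendsℂ-isSubalgebra a₀ = record
        { resp  = λ p → Tendsℂ-resp p (p a₀)
        ; const = λ c → tendsℂ (tends-const (re c)) (tends-const (im c))
        ; plus  = λ {f} {g} (tendsℂ s t) (tendsℂ s′ t′) → tendsℂ
            (tends-resp (λ a → R.sym (re-+ (f a) (g a))) (R.sym (re-+ (f a₀) (g a₀))) (tends-+ s s′))
            (tends-resp (λ a → R.sym (im-+ (f a) (g a))) (R.sym (im-+ (f a₀) (g a₀))) (tends-+ t t′))
        ; times = λ {f} {g} (tendsℂ s t) (tendsℂ s′ t′) → tendsℂ
            (tends-resp (λ a → R.sym (re-* (f a) (g a))) (R.sym (re-* (f a₀) (g a₀))) (tends-+ (tends-* s s′) (tends-neg (tends-* t t′))))
            (tends-resp (λ a → R.sym (im-* (f a) (g a))) (R.sym (im-* (f a₀) (g a₀))) (tends-+ (tends-* s t′) (tends-* t s′)))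
        }

      tends-N : ∀ {f l} → Tendsℂ f l → Tends (λ a → N (f a)) (N l)
      tends-N (tendsℂ s t) = tends-+ (tends-* s s) (tends-* t t)

      tends-≉0 : ∀ {f l} → Tendsℂ f l → l ≉ 0# → Ev (λ a → f a ≉ 0#)
      tends-≉0 t l≉0 = ev-map (λ a 0<N f≈0 → <⇒≉ 0<N (R.sym (R.trans (N-cong f≈0) N-0))) (tends-pos (tends-N t) (N-pos l≉0))

    nhdsℂ : ℂ → Filter ℂ
    nhdsℂ z = record
      { Ev     = λ P → ∃ λ δ → 0ᴿ < δ × (∀ w → (re w -ᴿ re z) ⊲ δ → (im w -ᴿ im z) ⊲ δ → P w)
      ; ev-all = λ p → 1ᴿ , 0<1 , λ w _ _ → p w
      ; ev-map = λ f (δ , 0<δ , p) → δ , 0<δ , λ w a b → f w (p w a b)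
      ; ev-∧   = λ (δ , 0<δ , p) (ε , 0<ε , q) →
          let (m , 0<m , m≤δ , m≤ε) = minimum 0<δ 0<ε in
          m , 0<m , λ w a b → p w (⊲-mono m≤δ a) (⊲-mono m≤δ b) , q w (⊲-mono m≤ε a) (⊲-mono m≤ε b)
      }

    Tendsℂ-id : ∀ z → ComplexLimits.Tendsℂ (nhdsℂ z) (λ w → w) z
    Tendsℂ-id z = record { tends-re = λ ε 0<ε → ε , 0<ε , λ w a b → a ; tends-im = λ ε 0<ε → ε , 0<ε , λ w a b → b }

    Tendsℂ-ι : ∀ x → ComplexLimits.Tendsℂ (nhds x) ι (ι x)
    Tendsℂ-ι x = record
      { tends-re = Limits.tends-resp (nhds x) (λ a → R.sym (re-mk _ _)) (R.sym (re-mk _ _)) (tends-id x)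
      ; tends-im = Limits.tends-resp (nhds x) (λ a → R.sym (im-mk _ _)) (R.sym (im-mk _ _)) (Limits.tends-const (nhds x) 0ᴿ)
      }

    module _ (f : ℂ → ℝ) (f-nonneg : ∀ z → 0ᴿ ≤ f z)
             (cts : ∀ z → Limits.Tends (nhdsℂ z) f (f z)) where

      LowerBound : ℝ → Set
      LowerBound l = ∀ z → l ≤ f z

      private
        -- Compactness of a square through two applications of `creep`. As f > m everywhere, each
        -- point has a neighbourhood with f ≥ m + ε. These are joined along a vertical segment and
        -- then across the square, which leaves one common ε.
        module Infimum (m : ℝ) (m<f : ∀ z → m < f z) (ρ : ℝ) (0<ρ : 0ᴿ < ρ) where
          _≲_ : ℝ → ℝ → Set
          ε ≲ v = m +ᴿ ε ≤ v

          ≲-mono : ∀ {ε ε′ v} → ε′ ≤ ε → ε ≲ v → ε′ ≲ v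
          ≲-mono p q = ≤-trans (+-mono-≤ (≈⇒≤ R.refl) p) q

          -ρ≤ρ : -ᴿ ρ ≤ ρ
          -ρ≤ρ = <⇒≤ (<-trans (0<⇒-<0 0<ρ) 0<ρ)

          abstract
            local : ∀ z → ∃₂ λ ε δ → 0ᴿ < ε × 0ᴿ < δ × (∀ w → (re w -ᴿ re z) ⊲ δ → (im w -ᴿ im z) ⊲ δ → ε ≲ f w)
            local z =
              -- ε is half the gap f z - m: near z the function stays within ε of f z, hence ε above
              -- m.
              let (ε , 0<ε , 2ε) = divide (<⇒0<- (m<f z)) 0<2
                  (δ , 0<δ , p) = cts z ε 0<ε
              in ε , δ , 0<ε , 0<δ , λ w a b → <⇒≤ (0<-⇒< (<⇒0<- (_⊲_.lower (p w a b)))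
                   (R.trans (solveᴾ 3 (λ w z e → (w -ᴾ z) -ᴾ (-ᴾ e) =ᴾ (w -ᴾ z) +ᴾ e) R.refl (f w) (f z) ε)
                   (R.trans (R.+-congʳ (R.+-congˡ (R.-‿cong (R.trans
                       (solveᴾ 2 (λ z m → z =ᴾ (z -ᴾ m) +ᴾ m) R.refl (f z) m) (R.+-congʳ (R.sym 2ε))))))
                     (solveᴾ 3 (λ w m e → (w -ᴾ (e *ᴾ (conᴾ (+ 1) +ᴾ conᴾ (+ 1)) +ᴾ m)) +ᴾ e =ᴾ w -ᴾ (m +ᴾ e)) R.refl (f w) m ε))))

          abstract
            near : ∀ {s x y v δ} → 0ᴿ < δ → s -ᴿ δ < x → x ≤ v → v < y → y < s +ᴿ δ → (v -ᴿ s) ⊲ δ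
            near {s} {x} {y} {v} {δ} 0<δ s-δ<x x≤v v<y y<s+δ = within
              (0<-⇒< (<⇒0<- (<-≤-trans s-δ<x x≤v)) (solveᴾ 3 (λ s v d → v -ᴾ (s -ᴾ d) =ᴾ (v -ᴾ s) -ᴾ (-ᴾ d)) R.refl s v δ))
              (0<-⇒< (<⇒0<- (<-trans v<y y<s+δ)) (solveᴾ 3 (λ s v d → (s +ᴾ d) -ᴾ v =ᴾ d -ᴾ (v -ᴾ s)) R.refl s v δ))

          -- A strip around re = x₀, from height -ρ up to s, on which one ε works. Its width δ may
          -- shrink as s grows.
          Column : ℝ → ℝ → Set
          Column x₀ s = ∃₂ λ ε δ → 0ᴿ < ε × 0ᴿ < δ ×
            (∀ w → (re w -ᴿ x₀) ⊲ δ → -ᴿ ρ ≤ im w → im w < s → ε ≲ f w)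

          abstract
            column : ∀ x₀ → Column x₀ ρ
            column x₀ = creep (Column x₀) (-ᴿ ρ) ρ -ρ≤ρ
              (1ᴿ , 1ᴿ , 0<1 , 0<1 , λ w _ a b → ⊥-elim (a b))
              (λ s _ _ → let (ε , δ , 0<ε , 0<δ , p) = local (mk x₀ s) in
                δ , 0<δ , λ x y s-δ<x x≤s s≤y y<s+δ (ε′ , δ′ , 0<ε′ , 0<δ′ , q) →
                  let (η , 0<η , η≤ε , η≤ε′) = minimum 0<ε 0<ε′
                      (ζ , 0<ζ , ζ≤δ , ζ≤δ′) = minimum 0<δ 0<δ′
                  in η , ζ , 0<η , 0<ζ , λ w a b c →
                    [ (λ im<x → ≲-mono η≤ε′ (q w (⊲-mono ζ≤δ′ a) b im<x))
                    , (λ x≤im → ≲-mono η≤ε (p w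
                         (⊲-resp (R.+-congˡ (R.-‿cong (R.sym (re-mk x₀ s)))) R.refl (⊲-mono ζ≤δ a))
                         (⊲-resp (R.+-congˡ (R.-‿cong (R.sym (im-mk x₀ s)))) R.refl (near 0<δ s-δ<x x≤im c y<s+δ))))
                    ]′ (<-≤-connex (im w) x))

          Box : ℝ → Set
          Box s = ∃ λ ε → 0ᴿ < ε × (∀ w → -ᴿ ρ ≤ re w → re w < s → -ᴿ ρ ≤ im w → im w < ρ → ε ≲ f w)

          abstract
            box : Box ρ
            box = creep Box (-ᴿ ρ) ρ -ρ≤ρ
              (1ᴿ , 0<1 , λ w a b → ⊥-elim (a b))
              (λ s _ _ → let (ε , δ , 0<ε , 0<δ , p) = column s in
                δ , 0<δ , λ x y s-δ<x x≤s s≤y y<s+δ (ε′ , 0<ε′ , q) →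
                  let (η , 0<η , η≤ε , η≤ε′) = minimum 0<ε 0<ε′
                  in η , 0<η , λ w a b c d →
                    [ (λ re<x → ≲-mono η≤ε′ (q w a re<x c d))
                    , (λ x≤re → ≲-mono η≤ε (p w (near 0<δ s-δ<x x≤re b y<s+δ) c d))
                    ]′ (<-≤-connex (re w) x))

      abstract
        -- The infimum m is the supremum of the lower bounds. If it is not attained, f ≥ m + ε on
        -- the square and f ≥ f 0 + 1 ≥ m + 1 outside, so m + min(ε, 1) is a larger lower bound.
        attains-minimum : ∀ ρ → 0ᴿ < ρ → (∀ z → ¬ (re z ⊲ ρ × im z ⊲ ρ) → f 0# +ᴿ 1ᴿ ≤ f z) →
                          ∃ λ z₀ → ∀ z → f z₀ ≤ f z
        attains-minimum ρ 0<ρ outside with R.supremum LowerBound (0ᴿ , f-nonneg) (f 0# , λ l lb → lb 0#)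
        ... | m , m-bound , m-least with em {∃ λ z → f z ≈ᴿ m}
        ...   | yes (z , fz≈m) = z , λ w → ≤-resp (R.sym fz≈m) R.refl (m-least (f w) (λ l lb → lb w))
        ...   | no ¬attained = ⊥-elim (m-bound (m +ᴿ η) below
                  (0<-⇒< 0<η (solveᴾ 2 (λ m e → e =ᴾ (m +ᴾ e) -ᴾ m) R.refl m η)))
          where
          m≤f : ∀ z → m ≤ f z
          m≤f z = m-least (f z) (λ l lb → lb z)
          m<f : ∀ z → m < f z
          m<f z = [ (λ p → p) , (λ e → ⊥-elim (¬attained (z , R.sym e))) ]′ (≤⇒<⊎≈ (m≤f z))
          open Infimum m m<f ρ 0<ρ
          ε : ℝ
          ε = proj₁ box
          smaller : ∃ λ η → 0ᴿ < η × η ≤ ε × η ≤ 1ᴿ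
          smaller = minimum (proj₁ (proj₂ box)) 0<1
          η : ℝ
          η = proj₁ smaller
          0<η : 0ᴿ < η
          0<η = proj₁ (proj₂ smaller)
          below : LowerBound (m +ᴿ η)
          below z with em {re z ⊲ ρ × im z ⊲ ρ}
          ... | yes (within a b , within c d) = ≲-mono (proj₁ (proj₂ (proj₂ smaller))) (proj₂ (proj₂ box) z (<⇒≤ a) b (<⇒≤ c) d)
          ... | no ¬in = ≤-trans (+-mono-≤ (m≤f 0#) (proj₂ (proj₂ (proj₂ smaller)))) (outside z ¬in)

  open ComplexAnalysis public

  -- Square roots in ℂ and powers with negative real part

  module Directions where
    -- With r = |z| and a = re z the root is p ± iq, where p² = (r + a)/2 and q² = (r - a)/2. Then
    -- (2pq)² = r² - a² = (im z)², so one of the signs gives the right imaginary part.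
    sqrtℂ : ∀ z → ∃ λ w → w * w ≈ z
    sqrtℂ z = [ (λ e → mk p q , ext (real-part q R.refl) (imaginary-part q e))
              , (λ e → mk p (-ᴿ q) , ext (real-part (-ᴿ q) neg²) (imaginary-part (-ᴿ q) (R.trans neg2pq e)))
              ]′ 2pq≈±im
      where
      a = re z
      b = im z
      root : ∃ λ r → 0ᴿ ≤ r × r *ᴿ r ≈ᴿ N z
      root = sqrt (N z) (N-nonneg z)
      r = proj₁ root
      a²≤r² : a *ᴿ a ≤ r *ᴿ r
      a²≤r² = ≤-resp R.refl (R.sym (proj₂ (proj₂ root)))
        (0≤-⇒≤ (sq-nonneg b) (solveᴾ 2 (λ a b → b *ᴾ b =ᴾ (a *ᴾ a +ᴾ b *ᴾ b) -ᴾ a *ᴾ a) R.refl a b))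
      h = 2# ⁻¹ᴿ
      2h : 2# *ᴿ h ≈ᴿ 1ᴿ
      2h = R.⁻¹-inverseʳ (0<⇒≉0 0<2)
      rootp : ∃ λ p → 0ᴿ ≤ p × p *ᴿ p ≈ᴿ (r +ᴿ a) *ᴿ h
      rootp = sqrt ((r +ᴿ a) *ᴿ h) (*-nonneg (sq≤⇒0≤+ {r} {a} (proj₁ (proj₂ root)) a²≤r²) (<⇒≤ (⁻¹-pos 0<2)))
      rootq : ∃ λ q → 0ᴿ ≤ q × q *ᴿ q ≈ᴿ (r +ᴿ -ᴿ a) *ᴿ h
      rootq = sqrt ((r +ᴿ -ᴿ a) *ᴿ h) (*-nonneg (sq≤⇒0≤+ {r} { -ᴿ a} (proj₁ (proj₂ root))
                (≤-resp (solveᴾ 1 (λ a → a *ᴾ a =ᴾ (-ᴾ a) *ᴾ (-ᴾ a)) R.refl a) R.refl a²≤r²)) (<⇒≤ (⁻¹-pos 0<2)))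
      p = proj₁ rootp
      q = proj₁ rootq
      p² = proj₂ (proj₂ rootp)
      q² = proj₂ (proj₂ rootq)
      neg² : (-ᴿ q) *ᴿ (-ᴿ q) ≈ᴿ q *ᴿ q
      neg² = solveᴾ 1 (λ q → (-ᴾ q) *ᴾ (-ᴾ q) =ᴾ q *ᴾ q) R.refl q
      neg2pq : p *ᴿ (-ᴿ q) +ᴿ (-ᴿ q) *ᴿ p ≈ᴿ -ᴿ (p *ᴿ q +ᴿ q *ᴿ p)
      neg2pq = solveᴾ 2 (λ p q → p *ᴾ (-ᴾ q) +ᴾ (-ᴾ q) *ᴾ p =ᴾ -ᴾ (p *ᴾ q +ᴾ q *ᴾ p)) R.refl p q
      real-part : ∀ q′ → q′ *ᴿ q′ ≈ᴿ q *ᴿ q → re (mk p q′ * mk p q′) ≈ᴿ a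
      real-part q′ e = R.trans (re-* _ _) (R.trans
        (R.+-cong (R.*-cong (re-mk _ _) (re-mk _ _)) (R.-‿cong (R.*-cong (im-mk _ _) (im-mk _ _))))
        (R.trans (R.+-cong p² (R.-‿cong (R.trans e q²)))
        (R.trans (solveᴾ 3 (λ r a h → (r +ᴾ a) *ᴾ h -ᴾ (r -ᴾ a) *ᴾ h =ᴾ a *ᴾ ((conᴾ (+ 1) +ᴾ conᴾ (+ 1)) *ᴾ h)) R.refl r a h)
        (R.trans (R.*-congˡ 2h) (R.*-identityʳ a)))))
      imaginary-part : ∀ q′ → p *ᴿ q′ +ᴿ q′ *ᴿ p ≈ᴿ b → im (mk p q′ * mk p q′) ≈ᴿ b
      imaginary-part q′ e = R.trans (im-* _ _) (R.trans
        (R.+-cong (R.*-cong (re-mk _ _) (im-mk _ _)) (R.*-cong (im-mk _ _) (re-mk _ _))) e)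
      squares : (p *ᴿ q +ᴿ q *ᴿ p) *ᴿ (p *ᴿ q +ᴿ q *ᴿ p) ≈ᴿ b *ᴿ b
      squares = R.trans (solveᴾ 2 (λ p q → (p *ᴾ q +ᴾ q *ᴾ p) *ᴾ (p *ᴾ q +ᴾ q *ᴾ p)
                            =ᴾ conᴾ (+ 4) *ᴾ ((p *ᴾ p) *ᴾ (q *ᴾ q))) R.refl p q)
        (R.trans (R.*-congˡ (R.*-cong p² q²))
        (R.trans (solveᴾ 3 (λ r a h → conᴾ (+ 4) *ᴾ (((r +ᴾ a) *ᴾ h) *ᴾ ((r -ᴾ a) *ᴾ h))
            =ᴾ (r *ᴾ r -ᴾ a *ᴾ a) *ᴾ (((conᴾ (+ 1) +ᴾ conᴾ (+ 1)) *ᴾ h) *ᴾ ((conᴾ (+ 1) +ᴾ conᴾ (+ 1)) *ᴾ h))) R.refl r a h)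
        (R.trans (R.*-cong (R.+-congʳ (proj₂ (proj₂ root))) (R.*-cong 2h 2h))
          (solveᴾ 2 (λ a b → ((a *ᴾ a +ᴾ b *ᴾ b) -ᴾ a *ᴾ a) *ᴾ (conᴾ (+ 1) *ᴾ conᴾ (+ 1)) =ᴾ b *ᴾ b) R.refl a b))))
      2pq = p *ᴿ q +ᴿ q *ᴿ p
      vanishing : (2pq -ᴿ b) *ᴿ (2pq +ᴿ b) ≈ᴿ 0ᴿ
      vanishing = R.trans (solveᴾ 2 (λ x y → (x -ᴾ y) *ᴾ (x +ᴾ y) =ᴾ x *ᴾ x -ᴾ y *ᴾ y) R.refl 2pq b)
                          (R.trans (R.+-congʳ squares) (R.-‿inverseʳ (b *ᴿ b)))
      plus-case : 2pq -ᴿ b ≈ᴿ 0ᴿ → 2pq ≈ᴿ b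
      plus-case e = R.trans (solveᴾ 2 (λ x y → x =ᴾ (x -ᴾ y) +ᴾ y) R.refl 2pq b) (R.trans (R.+-congʳ e) (R.+-identityˡ b))
      minus-case : 2pq +ᴿ b ≈ᴿ 0ᴿ → -ᴿ 2pq ≈ᴿ b
      minus-case e = R.trans (solveᴾ 2 (λ x y → -ᴾ x =ᴾ y -ᴾ (x +ᴾ y)) R.refl 2pq b)
        (R.trans (R.+-congˡ (R.-‿cong e)) (solveᴾ 1 (λ y → y -ᴾ conᴾ (+ 0) =ᴾ y) R.refl b))
      2pq≈±im : 2pq ≈ᴿ b ⊎ -ᴿ 2pq ≈ᴿ b
      2pq≈±im = [ (λ e → inj₁ (plus-case e)) , (λ e → inj₂ (minus-case e)) ]′ (integral vanishing)

    parity : ∀ k → ∃ λ m → k ≡ m ℕ.+ m ⊎ k ≡ suc (m ℕ.+ m)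
    parity zero    = 0 , inj₁ ≡.refl
    parity (suc k) with parity k
    ... | m , inj₁ e = m , inj₂ (≡.cong suc e)
    ... | m , inj₂ e = suc m , inj₁ (≡.trans (≡.cong suc e) (≡.cong suc (≡.sym (ℕ.+-suc m m))))

    𝐢 : ℂ
    𝐢 = mk 0ᴿ 1ᴿ

    𝐢²≈-1 : 𝐢 * 𝐢 ≈ - 1#
    𝐢²≈-1 = ext
      (R.trans (re-* _ _) (R.trans (R.+-cong (R.*-cong (re-mk _ _) (re-mk _ _)) (R.-‿cong (R.*-cong (im-mk _ _) (im-mk _ _))))
        (R.trans (solveᴾ 0 (conᴾ (+ 0) *ᴾ conᴾ (+ 0) -ᴾ conᴾ (+ 1) *ᴾ conᴾ (+ 1) =ᴾ -ᴾ conᴾ (+ 1)) R.refl)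
          (R.sym (R.trans (re-neg _) (R.-‿cong re-1))))))
      (R.trans (im-* _ _) (R.trans (R.+-cong (R.*-cong (re-mk _ _) (im-mk _ _)) (R.*-cong (im-mk _ _) (re-mk _ _)))
        (R.trans (solveᴾ 0 (conᴾ (+ 0) *ᴾ conᴾ (+ 1) +ᴾ conᴾ (+ 1) *ᴾ conᴾ (+ 0) =ᴾ -ᴾ conᴾ (+ 0)) R.refl)
          (R.sym (R.trans (im-neg _) (R.-‿cong im-1))))))

    re-*𝐢 : ∀ a → re (a * 𝐢) ≈ᴿ -ᴿ im a
    re-*𝐢 a = R.trans (re-* _ _) (R.trans (R.+-cong (R.*-congˡ (re-mk _ _)) (R.-‿cong (R.*-congˡ (im-mk _ _))))
      (solveᴾ 2 (λ a b → a *ᴾ conᴾ (+ 0) -ᴾ b *ᴾ conᴾ (+ 1) =ᴾ -ᴾ b) R.refl (re a) (im a)))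

    ^-double : ∀ z m → z ^ (m ℕ.+ m) ≈ (z * z) ^ m
    ^-double z m = trans (^-homo-* z m m) (sym (^-distrib-* z z m))

    ±1^m : ∀ m → (- 1#) ^ m ≈ 1# ⊎ (- 1#) ^ m ≈ - 1#
    ±1^m zero    = inj₁ refl
    ±1^m (suc m) with ±1^m m
    ... | inj₁ e = inj₂ (trans (*-congˡ e) (*-identityʳ _))
    ... | inj₂ e = inj₁ (trans (*-congˡ e) (solve 0 ((:- con (+ 1)) :* (:- con (+ 1)) := con (+ 1)) refl))

    neg-zero : ∀ {x} → -ᴿ x ≈ᴿ 0ᴿ → x ≈ᴿ 0ᴿ
    neg-zero {x} e = R.trans (solveᴾ 1 (λ x → x =ᴾ -ᴾ (-ᴾ x)) R.refl x) (R.trans (R.-‿cong e) (solveᴾ 0 (-ᴾ conᴾ (+ 0) =ᴾ conᴾ (+ 0)) R.refl))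

    re-*- : ∀ a w → re (a * - w) ≈ᴿ -ᴿ re (a * w)
    re-*- a w = R.trans (re-cong (solve 2 (λ a w → a :* (:- w) := :- (a :* w)) refl a w)) (re-neg (a * w))

    re-*-cong : ∀ a {v w} → v ≈ w → re (a * v) ≈ᴿ re (a * w)
    re-*-cong a {v} {w} p = re-cong {a * v} {a * w} (*-congˡ {a} p)

    module OddPower (m : ℕ) where
      n : ℕ
      n = suc (m ℕ.+ m)

      odd-^ : ∀ ζ → ζ ^ n ≈ ζ * (ζ * ζ) ^ m
      odd-^ ζ = *-congˡ {ζ} (^-double ζ m)

      neg-^ : ∀ ζ → (- ζ) ^ n ≈ - (ζ ^ n)
      neg-^ ζ = trans (odd-^ (- ζ)) (trans (*-congˡ { - ζ} (^-congˡ m (solve 1 (λ z → (:- z) :* (:- z) := z :* z) refl ζ)))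
        (trans (solve 2 (λ z w → (:- z) :* w := :- (z :* w)) refl ζ ((ζ * ζ) ^ m)) (-‿cong (sym (odd-^ ζ)))))

      𝐢-^ : 𝐢 ^ n ≈ 𝐢 ⊎ 𝐢 ^ n ≈ - 𝐢
      𝐢-^ = [ (λ e → inj₁ (trans (power e) (*-identityʳ 𝐢)))
            , (λ e → inj₂ (trans (power e) (solve 1 (λ i → i :* (:- con (+ 1)) := :- i) refl 𝐢))) ]′ (±1^m m)
        where
        power : ∀ {s} → (- 1#) ^ m ≈ s → 𝐢 ^ n ≈ 𝐢 * s
        power e = trans (odd-^ 𝐢) (*-congˡ {𝐢} (trans (^-congˡ m 𝐢²≈-1) e))

      -- An odd power changes sign with ζ, so a nonzero real part can be made negative.
      choose : ∀ a ζ → ¬ (re (a * ζ ^ n) ≈ᴿ 0ᴿ) → ∃ λ ζ → re (a * ζ ^ n) < 0ᴿ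
      choose a ζ p with ST.compare (re (a * ζ ^ n)) 0ᴿ
      ... | tri< l _ _ = ζ , l
      ... | tri≈ _ e _ = ⊥-elim (p e)
      ... | tri> _ _ g = - ζ , <-resp (R.sym (R.trans (re-*-cong a (neg-^ ζ)) (re-*- a (ζ ^ n)))) R.refl (0<⇒-<0 g)

      imaginary : ∀ a {w} → w ≈ 𝐢 ⊎ w ≈ - 𝐢 → re (a * w) ≈ᴿ 0ᴿ → im a ≈ᴿ 0ᴿ
      imaginary a (inj₁ f) e = neg-zero (R.trans (R.sym (R.trans (re-*-cong a f) (re-*𝐢 a))) e)
      imaginary a (inj₂ f) e = neg-zero (neg-zero
        (R.trans (R.sym (R.trans (re-*-cong a f) (R.trans (re-*- a 𝐢) (R.-‿cong (re-*𝐢 a))))) e))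

      -- An odd power of 1, -1, 𝐢 or -𝐢 runs through the same four values.
      odd-direction : ∀ a → a ≉ 0# → ∃ λ ζ → re (a * ζ ^ n) < 0ᴿ
      odd-direction a a≉0 with em {re a ≈ᴿ 0ᴿ}
      ... | no  p = choose a 1# (λ e → p (R.trans (re-cong (trans (sym (*-identityʳ a)) (*-congˡ (sym (1^n≈1 n))))) e))
      ... | yes p = choose a 𝐢 (λ e → a≉0 (ext (R.trans p (R.sym re-0)) (R.trans (imaginary a 𝐢-^ e) (R.sym im-0))))

    abstract
      -- A k-th root would provide ζ at once, but the existence of such roots is a case of the
      -- theorem being proved. Square roots halve an even k instead, until the exponent is odd;
      -- `fuel` bounds the halvings.
      direction : ∀ fuel k → 0 ℕ.< k → k ℕ.≤ fuel → ∀ a → a ≉ 0# → ∃ λ ζ → re (a * ζ ^ k) < 0ᴿ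
      direction zero    k 0<k k≤ a a≉0 = ⊥-elim (ℕ.<⇒≱ 0<k k≤)
      direction (suc n) k 0<k k≤ a a≉0 with parity k
      ... | zero  , inj₁ ≡.refl = ⊥-elim (ℕ.<-irrefl ≡.refl 0<k)
      ... | suc m , inj₁ ≡.refl =
        let (η , p) = direction n (suc m) (ℕ.s≤s ℕ.z≤n)
              (ℕ.≤-trans (ℕ.≤-trans (ℕ.s≤s (ℕ.m≤m+n m m)) (ℕ.≤-reflexive (≡.sym (ℕ.+-suc m m)))) (ℕ.s≤s⁻¹ k≤)) a a≉0
            (ζ , ζ²) = sqrtℂ η
        in ζ , <-resp (re-*-cong a (sym (trans (^-double ζ (suc m)) (^-congˡ (suc m) ζ²)))) R.refl p
      ... | m , inj₂ ≡.refl = OddPower.odd-direction m a a≉0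

  -- The fundamental theorem of algebra

  module Factorisation where
    open Directions using (direction)

    Growing : List ℂ → Set
    Growing p = ∀ B → 0ᴿ < B → ∃ λ r → 0ᴿ < r × (∀ z → r ≤ N z → B ≤ N (ev p z))

    -- With w = a + z p(z), the bound of `N-+` gives N(z p(z)) ≤ 2(N w + N a). The left side is at
    -- least C = 2(B + N a) once N z ≥ C/β, and then N w ≥ B.
    growing-∷ : ∀ a p {β r} → 0ᴿ < β → 0ᴿ < r → (∀ z → r ≤ N z → β ≤ N (ev p z)) → Growing (a ∷ p)
    growing-∷ a p {β} {r} 0<β 0<r bound B 0<B = r₀ +ᴿ r , +-pos 0<r₀ 0<r , grows
      where
      C = 2# *ᴿ (B +ᴿ N a)
      quotient : ∃ λ r₀ → 0ᴿ < r₀ × r₀ *ᴿ β ≈ᴿ C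
      quotient = divide (R.*-positive 0<2 (+-pos-nonneg 0<B (N-nonneg a))) 0<β
      r₀ = proj₁ quotient
      0<r₀ : 0ᴿ < r₀
      0<r₀ = proj₁ (proj₂ quotient)
      grows : ∀ z → r₀ +ᴿ r ≤ N z → B ≤ N (ev (a ∷ p) z)
      grows z r≤Nz N<B = upper (≤-<-trans C≤ (≤-<-trans triangle strict))
        where
        w = a + z * ev p z
        upper : ¬ (C < C)
        upper = ST.irrefl R.refl
        β≤ : β ≤ N (ev p z)
        β≤ = bound z (≤-trans (0≤-⇒≤ (<⇒≤ 0<r₀) (solveᴾ 2 (λ a b → a =ᴾ (a +ᴾ b) -ᴾ b) R.refl r₀ r)) r≤Nz)
        r₀≤ : r₀ ≤ N z
        r₀≤ = ≤-trans (0≤-⇒≤ (<⇒≤ 0<r) (solveᴾ 2 (λ a b → b =ᴾ (a +ᴾ b) -ᴾ a) R.refl r₀ r)) r≤Nz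
        C≤ : C ≤ N (z * ev p z)
        C≤ = ≤-resp (proj₂ (proj₂ quotient)) (R.sym (N-* z (ev p z)))
          (≤-trans (*-monoˡ-≤ β (<⇒≤ 0<β) r₀≤)
            (≤-resp (R.*-comm β (N z)) (R.*-comm (N (ev p z)) (N z)) (*-monoˡ-≤ (N z) (N-nonneg z) β≤)))
        triangle : N (z * ev p z) ≤ 2# *ᴿ (N w +ᴿ N a)
        triangle = ≤-resp (N-cong (solve 2 (λ a b → (a :+ b) :+ (:- a) := b) refl a (z * ev p z)))
          (R.*-congˡ (R.+-congˡ (N-neg a))) (N-+ w (- a))
        strict : 2# *ᴿ (N w +ᴿ N a) < C
        strict = 0<-⇒< (R.*-positive 0<2 (<⇒0<- N<B))
          (solveᴾ 4 (λ t B w a → t *ᴾ (B -ᴾ w) =ᴾ t *ᴾ (B +ᴾ a) -ᴾ t *ᴾ (w +ᴾ a)) R.refl 2# B (N w) (N a))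

    -- This split avoids speaking of a leading coefficient: a tail that is constantly 0 makes the
    -- whole list constant, and any other tail makes it grow.
    constant-or-growing : ∀ p → (∃ λ κ → ∀ t → ev p t ≈ κ) ⊎ Growing p
    constant-or-growing []      = inj₁ (0# , λ t → refl)
    constant-or-growing (a ∷ p) with constant-or-growing p
    ... | inj₂ g = let (r , 0<r , b) = g 1ᴿ 0<1 in inj₂ (growing-∷ a p 0<1 0<r b)
    ... | inj₁ (κ , e) with κ ≟ 0#
    ...   | yes κ≈0 = inj₁ (a , λ t → trans (+-congˡ (trans (*-congˡ (trans (e t) κ≈0)) (zeroʳ t))) (+-identityʳ a))
    ...   | no  κ≉0 = inj₂ (growing-∷ a p (N-pos κ≉0) 0<1 (λ z _ → ≈⇒≤ (N-cong (sym (e z)))))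

    lowest-term : ∀ q → (∀ t → ev q t ≈ 0#) ⊎ (∃₂ λ j q′ → (∀ t → ev q t ≈ t ^ j * ev q′ t) × ev q′ 0# ≉ 0#)
    lowest-term []      = inj₁ (λ t → refl)
    lowest-term (a ∷ q) with a ≟ 0#
    ... | no a≉0 = inj₂ (0 , a ∷ q , (λ t → sym (*-identityˡ _)) ,
                         λ e → a≉0 (trans (sym (trans (+-congˡ (zeroˡ _)) (+-identityʳ a))) e))
    ... | yes a≈0 with lowest-term q
    ...   | inj₁ e = inj₁ (λ t → trans (+-cong a≈0 (trans (*-congˡ (e t)) (zeroʳ t))) (+-identityʳ 0#))
    ...   | inj₂ (j , q′ , e , q′0≉0) = inj₂ (suc j , q′ ,
              (λ t → trans (+-cong a≈0 (*-congˡ (e t))) (trans (+-identityˡ _) (sym (*-assoc _ _ _)))) , q′0≉0)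

    module _ (c : ℂ) where
      -- |c + σw|² = |c|² + σ · first-order σ w
      first-order : ℝ → ℂ → ℝ
      first-order σ w = 2# *ᴿ re (conj c * w) +ᴿ σ *ᴿ N w

      N-expand : ∀ σ w → N (c + ι σ * w) ≈ᴿ N c +ᴿ σ *ᴿ first-order σ w
      N-expand σ w = R.trans (R.+-cong (R.*-cong re-eq re-eq) (R.*-cong im-eq im-eq))
        (R.trans (solveᴾ 5 (λ a b s u v → (a +ᴾ s *ᴾ u) *ᴾ (a +ᴾ s *ᴾ u) +ᴾ (b +ᴾ s *ᴾ v) *ᴾ (b +ᴾ s *ᴾ v)
            =ᴾ (a *ᴾ a +ᴾ b *ᴾ b) +ᴾ s *ᴾ ((conᴾ (+ 1) +ᴾ conᴾ (+ 1)) *ᴾ (a *ᴾ u -ᴾ (-ᴾ b) *ᴾ v) +ᴾ s *ᴾ (u *ᴾ u +ᴾ v *ᴾ v)))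
            R.refl (re c) (im c) σ (re w) (im w))
          (R.+-congˡ (R.*-congˡ (R.+-congʳ (R.*-congˡ (R.sym re-conj))))))
        where
        re-eq : re (c + ι σ * w) ≈ᴿ re c +ᴿ σ *ᴿ re w
        re-eq = R.trans (re-+ _ _) (R.+-congˡ (R.trans (re-* _ _) (R.trans (R.+-cong (R.*-congʳ (re-mk _ _)) (R.-‿cong (R.*-congʳ (im-mk _ _))))
          (solveᴾ 3 (λ s u v → s *ᴾ u -ᴾ conᴾ (+ 0) *ᴾ v =ᴾ s *ᴾ u) R.refl σ (re w) (im w)))))
        im-eq : im (c + ι σ * w) ≈ᴿ im c +ᴿ σ *ᴿ im w
        im-eq = R.trans (im-+ _ _) (R.+-congˡ (R.trans (im-* _ _) (R.trans (R.+-cong (R.*-congʳ (re-mk _ _)) (R.*-congʳ (im-mk _ _)))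
          (solveᴾ 3 (λ s u v → s *ᴾ v +ᴾ conᴾ (+ 0) *ᴾ u =ᴾ s *ᴾ v) R.refl σ (re w) (im w)))))
        re-conj : re (conj c * w) ≈ᴿ re c *ᴿ re w -ᴿ (-ᴿ im c) *ᴿ im w
        re-conj = R.trans (re-* _ _) (R.+-cong (R.*-congʳ (re-mk _ _)) (R.-‿cong (R.*-congʳ (im-mk _ _))))

      -- Along h = sζ, with k = j + 1, the added term is s^k W(s) and N changes by s^k Br(s). At s =
      -- 0 the factor Br is 2 re(conj c · q(0) · ζ^k), negative by the choice of ζ; by continuity it
      -- stays negative for small s > 0.
      descent : c ≉ 0# → ∀ j q → ev q 0# ≉ 0# → ∃ λ h → N (c + h ^ suc j * ev q h) < N c
      descent c≉0 j q q0≉0 = ι s * ζ , <-resp (R.sym (R.trans (N-cong (+-congˡ h^k)) (N-expand (s ^ᴿ k) (W s)))) R.refl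
          (0<-⇒< (R.*-positive (^-pos k 0<s) negative)
             (solveᴾ 3 (λ n s b → s *ᴾ (-ᴾ b) =ᴾ n -ᴾ (n +ᴾ s *ᴾ b)) R.refl (N c) (s ^ᴿ k) (Br s)))
        where
        k : ℕ
        k = suc j
        chosen : ∃ λ ζ → re ((conj c * ev q 0#) * ζ ^ k) < 0ᴿ
        chosen = direction k k (ℕ.s≤s ℕ.z≤n) ℕ.≤-refl (conj c * ev q 0#) (*≉0 (conj≉0 c≉0) q0≉0)
        ζ = proj₁ chosen
        W : ℝ → ℂ
        W s = ζ ^ k * ev q (ι s * ζ)
        Br : ℝ → ℝ
        Br s = first-order (s ^ᴿ k) (W s)
        open ComplexLimits (nhds 0ᴿ)
        W-tends : Tendsℂ W (W 0ᴿ)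
        W-tends = times (const (ζ ^ k)) (ev-closed S q (times (Tendsℂ-ι 0ᴿ) (const ζ)))
          where S = Tendsℂ-isSubalgebra 0ᴿ
                open IsSubalgebra S
        cW-tends : Tendsℂ (λ s → conj c * W s) (conj c * W 0ᴿ)
        cW-tends = IsSubalgebra.times (Tendsℂ-isSubalgebra 0ᴿ) (IsSubalgebra.const (Tendsℂ-isSubalgebra 0ᴿ) (conj c)) W-tends
        Br-tends : Tends Br (Br 0ᴿ)
        Br-tends = tends-+ (tends-* (tends-const 2#) (tends-re cW-tends))
          (tends-* (RE.^-closed (tends-isSubalgebra (nhds 0ᴿ) 0ᴿ) {λ x → x} k (tends-id 0ᴿ)) (tends-N W-tends))
        W0 : conj c * W 0ᴿ ≈ (conj c * ev q 0#) * ζ ^ k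
        W0 = trans (*-congˡ (*-congˡ (ev-cong q (trans (*-congʳ ι-0) (zeroˡ ζ)))))
          (solve 3 (λ c z q → c :* (z :* q) := (c :* q) :* z) refl (conj c) (ζ ^ k) (ev q 0#))
        Br0<0 : 0ᴿ < -ᴿ Br 0ᴿ
        Br0<0 = <-resp R.refl (R.trans (solveᴾ 4 (λ t x y n → t *ᴾ (-ᴾ x) =ᴾ -ᴾ (t *ᴾ x +ᴾ (conᴾ (+ 0) *ᴾ y) *ᴾ n)) R.refl 2# (re ((conj c * ev q 0#) * ζ ^ k)) (0ᴿ ^ᴿ j) (N (W 0ᴿ)))
            (R.-‿cong (R.+-congʳ (R.*-congˡ (re-cong (sym W0))))))
          (R.*-positive 0<2 (<0⇒0<- (proj₂ chosen)))
        found : ∃ λ δ → 0ᴿ < δ × (∀ y → (y -ᴿ 0ᴿ) ⊲ δ → 0ᴿ < -ᴿ Br y)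
        found = tends-pos (tends-neg Br-tends) Br0<0
        δ = proj₁ found
        smaller : ∃ λ s → 0ᴿ < s × s < δ
        smaller = half (proj₁ (proj₂ found))
        s = proj₁ smaller
        0<s : 0ᴿ < s
        0<s = proj₁ (proj₂ smaller)
        negative : 0ᴿ < -ᴿ Br s
        negative = proj₂ (proj₂ found) s (⊲-resp (solveᴾ 1 (λ s → s =ᴾ s -ᴾ conᴾ (+ 0)) R.refl s) R.refl
          (within (<-trans (0<⇒-<0 (proj₁ (proj₂ found))) 0<s) (proj₂ (proj₂ smaller))))
        h^k : (ι s * ζ) ^ k * ev q (ι s * ζ) ≈ ι (s ^ᴿ k) * W s
        h^k = trans (*-congʳ (trans (^-distrib-* (ι s) ζ k) (*-congʳ (ι-^ s k)))) (*-assoc _ _ _)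

    abstract
      taylor : ∀ p z₀ → ∃₂ λ c q → ∀ h → ev p (z₀ + h) ≈ c + h * ev q h
      taylor p z₀ =
        let (q , e) = ev-closed isPoly-isSubalgebra p
              (IsSubalgebra.plus isPoly-isSubalgebra (IsSubalgebra.const isPoly-isSubalgebra z₀) isPoly-var)
            (q′ , _ , d) = divideRoot q 0#
        in ev q 0# , q′ , λ h → trans (e h) (trans (d h) (+-congˡ (*-congʳ (solve 1 (λ h → h :- con (+ 0) := h) refl h))))

      minimum-modulus : ∀ p → Growing p → ∃ λ z₀ → ∀ z → N (ev p z₀) ≤ N (ev p z)
      minimum-modulus p g = attains-minimum f (λ z → N-nonneg _) cts (r +ᴿ 1ᴿ) 0<ρ outside
        where
        f : ℂ → ℝ
        f z = N (ev p z)
        cts : ∀ z → Limits.Tends (nhdsℂ z) f (f z)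
        cts z = tends-N (ev-closed (Tendsℂ-isSubalgebra z) p (Tendsℂ-id z))
          where open ComplexLimits (nhdsℂ z)
        far : ∃ λ r → 0ᴿ < r × (∀ z → r ≤ N z → f 0# +ᴿ 1ᴿ ≤ f z)
        far = g (f 0# +ᴿ 1ᴿ) (<-resp R.refl (R.+-comm _ _) (+-pos-nonneg 0<1 (N-nonneg _)))
        r : ℝ
        r = proj₁ far
        0<r : 0ᴿ < r
        0<r = proj₁ (proj₂ far)
        0<ρ : 0ᴿ < r +ᴿ 1ᴿ
        0<ρ = +-pos 0<r 0<1
        r<ρ² : r < (r +ᴿ 1ᴿ) *ᴿ (r +ᴿ 1ᴿ)
        r<ρ² = 0<-⇒< (+-pos (R.*-positive 0<r 0<r) (+-pos 0<r 0<1))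
          (solveᴾ 1 (λ r → r *ᴾ r +ᴾ (r +ᴾ conᴾ (+ 1)) =ᴾ (r +ᴾ conᴾ (+ 1)) *ᴾ (r +ᴾ conᴾ (+ 1)) -ᴾ r) R.refl r)
        outside : ∀ z → ¬ (re z ⊲ (r +ᴿ 1ᴿ) × im z ⊲ (r +ᴿ 1ᴿ)) → f 0# +ᴿ 1ᴿ ≤ f z
        outside z ¬in = proj₂ (proj₂ far) z (λ Nz<r → ¬in (N<⇒re⊲ 0<ρ (<-trans Nz<r r<ρ²) , N<⇒im⊲ 0<ρ (<-trans Nz<r r<ρ²)))

    RootOrConstant : List ℂ → Set
    RootOrConstant p = (∃ λ r → ev p r ≈ 0#) ⊎ (∃ λ κ → ∀ t → ev p t ≈ κ)

    module _ (p : List ℂ) (z₀ : ℂ) (minimal : ∀ z → N (ev p z₀) ≤ N (ev p z))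
             (c : ℂ) (q : List ℂ) (expansion : ∀ h → ev p (z₀ + h) ≈ c + h * ev q h) where
      private
        value : ev p z₀ ≈ c
        value = trans (ev-cong p (sym (+-identityʳ z₀))) (trans (expansion 0#) (trans (+-congˡ (zeroˡ (ev q 0#))) (+-identityʳ c)))

        constant : (∀ t → ev q t ≈ 0#) → ∀ t → ev p t ≈ c
        constant e t = trans (ev-cong p (solve 2 (λ t z → t := z :+ (t :- z)) refl t z₀))
          (trans (expansion (t - z₀)) (trans (+-congˡ (trans (*-congˡ (e (t - z₀))) (zeroʳ (t - z₀)))) (+-identityʳ c)))

        no-descent : ∀ j q′ → (∀ t → ev q t ≈ t ^ j * ev q′ t) → ¬ (∃ λ h → N (c + h ^ suc j * ev q′ h) < N c)
        no-descent j q′ e (h , h<) = minimal (z₀ + h) (<-resp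
          (N-cong (sym (trans (expansion h) (+-congˡ (trans (*-congˡ (e h)) (sym (*-assoc h (h ^ j) (ev q′ h))))))))
          (N-cong (sym value)) h<)

      -- A nonzero minimum c could be lowered by `descent`, applied to the lowest term of p(z₀ + h)
      -- - c, unless this difference vanishes identically.
      minimum-root-or-constant : RootOrConstant p
      minimum-root-or-constant with c ≟ 0# | lowest-term q
      ... | yes c≈0 | _      = inj₁ (z₀ , trans value c≈0)
      ... | no  _   | inj₁ e = inj₂ (c , constant e)
      ... | no  c≉0 | inj₂ (j , q′ , e , q′0≉0) = ⊥-elim (no-descent j q′ e (descent c c≉0 j q′ q′0≉0))

    growing-root-or-constant : ∀ p → Growing p → RootOrConstant p
    growing-root-or-constant p g =
      let (z₀ , minimal) = minimum-modulus p g
          (c , q , expansion) = taylor p z₀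
      in minimum-root-or-constant p z₀ minimal c q expansion

    abstract
      root-or-constant : ∀ p → RootOrConstant p
      root-or-constant p = [ inj₂ , growing-root-or-constant p ]′ (constant-or-growing p)

    Factors : List ℂ → ℕ → Set
    Factors p n = (∀ t → ev p t ≈ 0#) ⊎
      (∃₂ λ κ rs → κ ≉ 0# × length rs ℕ.≤ n × (∀ t → ev p t ≈ κ * prodRoots rs t))

    factors-constant : ∀ p n κ → (∀ t → ev p t ≈ κ) → Factors p n
    factors-constant p n κ e with κ ≟ 0#
    ... | yes κ≈0 = inj₁ (λ t → trans (e t) κ≈0)
    ... | no  κ≉0 = inj₂ (κ , [] , κ≉0 , ℕ.z≤n , λ t → trans (e t) (sym (*-identityʳ κ)))

    factors-∷ : ∀ p q n r → (∀ t → ev p t ≈ (t - r) * ev q t) → Factors q n → Factors p (suc n)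
    factors-∷ p q n r d (inj₁ z) = inj₁ (λ t → trans (d t) (trans (*-congˡ (z t)) (zeroʳ (t - r))))
    factors-∷ p q n r d (inj₂ (κ , rs , κ≉0 , l , f)) = inj₂ (κ , r ∷ rs , κ≉0 , ℕ.s≤s l , λ t →
      trans (d t) (trans (*-congˡ (f t)) (solve 3 (λ x k y → x :* (k :* y) := k :* (x :* y)) refl (t - r) κ (prodRoots rs t))))

    root-factor : ∀ p r → ev p r ≈ 0# → ∃ λ q → length q ℕ.≤ ℕ.pred (length p) × (∀ t → ev p t ≈ (t - r) * ev q t)
    root-factor p r e = let (q , l , d) = divideRoot p r in q , l , λ t → trans (d t) (trans (+-congʳ e) (+-identityˡ _))

    abstract
      factorise : ∀ n p → length p ℕ.≤ n → Factors p n
      factorise n       []      p≤n         = inj₁ (λ t → refl)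
      factorise (suc n) (a ∷ p) (ℕ.s≤s p≤n) =
        [ (λ (r , e) → let (q , l , d) = root-factor (a ∷ p) r e in
             factors-∷ (a ∷ p) q n r d (factorise n q (ℕ.≤-trans l p≤n)))
        , (λ (κ , e) → factors-constant (a ∷ p) (suc n) κ e)
        ]′ (root-or-constant (a ∷ p))

  open Factorisation public

  -- Regular functions on ℂ⋆ and the ends of a parametrised curve

  module LaurentPolynomials where
    abstract
      nonroot-bound : ∀ rs → ∃ λ B → ∀ t → B < re t → prodRoots rs t ≉ 0#
      nonroot-bound []       = 0ᴿ , λ t _ → 1≉0
      nonroot-bound (r ∷ rs) = let (B , p) = nonroot-bound rs in
        [ (λ r<B → B , λ t B< → *≉0 (t≉r t (<-trans r<B B<)) (p t B<))
        , (λ B≤r → re r , λ t r< → *≉0 (t≉r t r<) (p t (≤-<-trans B≤r r<)))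
        ]′ (<-≤-connex (re r) B)
        where
        t≉r : ∀ t → re r < re t → t - r ≉ 0#
        t≉r t p q = <⇒≉ p (re-cong (sym (x-y≈0⇒x≈y q)))

      above : ∀ x y → ∃ λ z → x < z × y < z
      above x y = [ (λ x<y → y +ᴿ 1ᴿ , <-trans x<y (up y) , up y)
                  , (λ y≤x → x +ᴿ 1ᴿ , up x , ≤-<-trans y≤x (up x)) ]′ (<-≤-connex x y)
        where
        up : ∀ x → x < x +ᴿ 1ᴿ
        up x = 0<-⇒< 0<1 (solveᴾ 1 (λ x → conᴾ (+ 1) =ᴾ (x +ᴾ conᴾ (+ 1)) -ᴾ x) R.refl x)

      -- A nonzero polynomial has finitely many roots, and beyond their real parts none lies on the
      -- real axis.
      identity-theorem : ∀ p B → (∀ x → B < x → ev p (ι x) ≈ 0#) → ∀ t → ev p t ≈ 0#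
      identity-theorem p B vanish = [ (λ z → z) , (λ (κ , rs , κ≉0 , _ , e) →
        let (B′ , nonroot) = nonroot-bound rs
            (x , B<x , B′<x) = above B B′
        in ⊥-elim (*≉0 κ≉0 (nonroot (ι x) (<-resp R.refl (R.sym (re-mk x 0ᴿ)) B′<x))
                     (trans (sym (e (ι x))) (vanish x B<x)))) ]′ (factorise (length p) p ℕ.≤-refl)

      nonzero-bound : ∀ q t₀ → ev q t₀ ≉ 0# → ∃ λ B → ∀ x → B < x → ev q (ι x) ≉ 0#
      nonzero-bound q t₀ q≉0 = [ (λ z → ⊥-elim (q≉0 (z t₀))) , (λ (κ , rs , κ≉0 , _ , e) →
        let (B , nonroot) = nonroot-bound rs
        in B , λ x B<x q≈0 → *≉0 κ≉0 (nonroot (ι x) (<-resp R.refl (R.sym (re-mk x 0ᴿ)) B<x)) (trans (sym (e (ι x))) q≈0))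
        ]′ (factorise (length q) q ℕ.≤-refl)

    isPoly-identity : ∀ {f} → IsPoly f → ∀ B → (∀ x → B < x → f (ι x) ≈ 0#) → ∀ t → f t ≈ 0#
    isPoly-identity (p , e) B vanish t = trans (e t) (identity-theorem p B (λ x B<x → trans (sym (e (ι x))) (vanish x B<x)) t)

    -- Passage to the limit in algebraic form: g is nonzero on a real half-line, so f vanishes there
    -- and hence everywhere, also at the zeros of g.
    isPoly-density : ∀ {f g} → IsPoly f → IsPoly g → ∀ t₀ → g t₀ ≉ 0# → (∀ t → g t ≉ 0# → f t ≈ 0#) → ∀ t → f t ≈ 0#
    isPoly-density fp (q , e) t₀ g≉0 vanish =
      let (B , nz) = nonzero-bound q t₀ (λ z → g≉0 (trans (e t₀) z))
      in isPoly-identity fp B (λ x B<x → vanish (ι x) (λ z → nz x B<x (trans (sym (e (ι x))) z)))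

    isPoly-prodRoots : ∀ rs → IsPoly (prodRoots rs)
    isPoly-prodRoots []       = IsSubalgebra.const isPoly-isSubalgebra 1#
    isPoly-prodRoots (r ∷ rs) = times (plus isPoly-var (const (- r))) (isPoly-prodRoots rs)
      where open IsSubalgebra isPoly-isSubalgebra

    ℂ⋆ : Set
    ℂ⋆ = Σ ℂ (λ t → t ≉ 0#)

    -- Locally a quotient u/v with v nonzero at t₀. The cleared equation v f = u is demanded at
    -- every t, including those where v vanishes.
    Regular : (ℂ⋆ → ℂ) → Set
    Regular f = ∀ (t₀ : ℂ⋆) → ∃₂ λ u v → ev v (proj₁ t₀) ≉ 0# × (∀ (t : ℂ⋆) → ev v (proj₁ t) * f t ≈ ev u (proj₁ t))

    IsLaurent : (ℂ⋆ → ℂ) → Set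
    IsLaurent f = ∃₂ λ k h → ∀ (t : ℂ⋆) → proj₁ t ^ k * f t ≈ ev h (proj₁ t)

    private
      -- Away from r the factor t - r simply cancels. To include r, a representation v f = w with
      -- v(t) ≠ 0 is compared: v u′ - P w vanishes off 0 and r, hence everywhere, and then v
      -- cancels.
      cancel-root : ∀ r rs f u u′ → r ≉ 0# → Regular f → (∀ t → ev u t ≈ (t - r) * ev u′ t) →
                    (∀ (t : ℂ⋆) → prodRoots (r ∷ rs) (proj₁ t) * f t ≈ ev u (proj₁ t)) →
                    ∀ (t : ℂ⋆) → prodRoots rs (proj₁ t) * f t ≈ ev u′ (proj₁ t)
      cancel-root r rs f u u′ r≉0 reg d e t⋆@(t , _) = *-cancelˡ v≉0 (begin
        ev v t * (P t * f t⋆)    ≈⟨ solve 3 (λ a b c → a :* (b :* c) := b :* (a :* c)) refl (ev v t) (P t) (f t⋆) ⟩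
        P t * (ev v t * f t⋆)    ≈⟨ *-congˡ (rep t⋆) ⟩
        P t * ev w t             ≈⟨ x-y≈0⇒x≈y (difference t) ⟨
        ev v t * ev u′ t         ∎)
        where
        P = prodRoots rs
        w = proj₁ (reg t⋆)
        v = proj₁ (proj₂ (reg t⋆))
        v≉0 : ev v t ≉ 0#
        v≉0 = proj₁ (proj₂ (proj₂ (reg t⋆)))
        rep : ∀ (s : ℂ⋆) → ev v (proj₁ s) * f s ≈ ev w (proj₁ s)
        rep = proj₂ (proj₂ (proj₂ (reg t⋆)))
        D : ℂ → ℂ
        D s = ev v s * ev u′ s + (- 1#) * (P s * ev w s)
        isPoly-D : IsPoly D
        isPoly-D = plus (times (isPoly-ev v) (isPoly-ev u′)) (times (const (- 1#)) (times (isPoly-prodRoots rs) (isPoly-ev w)))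
          where open IsSubalgebra isPoly-isSubalgebra
        g : ℂ → ℂ
        g s = s * (s + (- r))
        isPoly-g : IsPoly g
        isPoly-g = times isPoly-var (plus isPoly-var (const (- r)))
          where open IsSubalgebra isPoly-isSubalgebra
        g-nonzero : ∃ λ s → g s ≉ 0#
        -- Any point other than 0 and r serves; 2r is one because r ≠ 0.
        g-nonzero = r + r , *≉0 (λ z → *≉0 2≉0 r≉0 (trans (solve 1 (λ r → (con (+ 1) :+ con (+ 1)) :* r := r :+ r) refl r) z))
                                (λ z → r≉0 (trans (solve 1 (λ r → r := (r :+ r) :+ (:- r)) refl r) z))
          where
          2≉0 : 1# + 1# ≉ 0#
          2≉0 z = ι≉0 (0<⇒≉0 0<2) (trans (ι-+ 1ᴿ 1ᴿ) (trans (+-cong ι-1 ι-1) z))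
        off : ∀ s → g s ≉ 0# → D s ≈ 0#
        off s g≉0 = [ (λ z → ⊥-elim (g≉0 (trans (*-congˡ z) (zeroʳ s)))) , (λ z → z) ]′ (*-integral (begin
          (s + - r) * (ev v s * ev u′ s + (- 1#) * (P s * ev w s))
            ≈⟨ *-congˡ (+-congˡ (*-congˡ (*-congˡ (rep s⋆)))) ⟨
          (s + - r) * (ev v s * ev u′ s + (- 1#) * (P s * (ev v s * f s⋆)))
            ≈⟨ solve 5 (λ x v u p f → x :* (v :* u :+ (:- con (+ 1)) :* (p :* (v :* f))) := v :* (x :* u :- (x :* p) :* f)) refl (s + - r) (ev v s) (ev u′ s) (P s) (f s⋆) ⟩
          ev v s * ((s + - r) * ev u′ s - ((s + - r) * P s) * f s⋆)
            ≈⟨ *-congˡ (x≈y⇒x-y≈0 (trans (sym (d s)) (sym (e s⋆)))) ⟩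
          ev v s * 0#   ≈⟨ zeroʳ _ ⟩
          0#            ∎))
          where
          s⋆ : ℂ⋆
          s⋆ = s , λ z → g≉0 (trans (*-congʳ z) (zeroˡ _))
        difference : ∀ s → ev v s * ev u′ s - P s * ev w s ≈ 0#
        difference s = trans (+-congˡ (solve 1 (λ x → :- x := (:- con (+ 1)) :* x) refl (P s * ev w s)))
          (isPoly-density isPoly-D isPoly-g (proj₁ g-nonzero) (proj₂ g-nonzero) off s)

      -- A nonzero root of the denominator is also a root of u and cancels. A root at 0 lies outside
      -- ℂ⋆, where regularity says nothing; passing from f to t f moves it into the power of t.
      laurent-from-roots : ∀ rs f u → Regular f → (∀ (t : ℂ⋆) → prodRoots rs (proj₁ t) * f t ≈ ev u (proj₁ t)) → IsLaurent f
      laurent-from-roots []       f u reg e = 0 , u , e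
      laurent-from-roots (r ∷ rs) f u reg e with r ≟ 0#
      ... | no r≉0 =
        let (u′ , _ , d) = root-factor u r (trans (sym (e (r , r≉0))) (trans (*-congʳ (trans (*-congʳ (-‿inverseʳ r)) (zeroˡ _))) (zeroˡ _)))
        in laurent-from-roots rs f u′ reg (cancel-root r rs f u u′ r≉0 reg d e)
      ... | yes r≈0 =
        let (k , h , l) = laurent-from-roots rs (λ t → proj₁ t * f t) u
              (λ t₀ → let (u , v , v≉0 , e) = reg t₀ in 0# ∷ u , v , v≉0 , λ (t , t≉0) →
                 trans (solve 3 (λ v t f → v :* (t :* f) := con (+ 0) :+ t :* (v :* f)) refl (ev v t) t (f (t , t≉0)))
                       (+-congˡ (*-congˡ (e (t , t≉0)))))
              (λ (t , t≉0) → trans (solve 4 (λ p t r f → p :* (t :* f) := ((t :- r) :* p) :* f :+ r :* (p :* f)) refl (prodRoots rs t) t r (f (t , t≉0)))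
                 (trans (+-cong (e (t , t≉0)) (trans (*-congʳ r≈0) (zeroˡ _))) (+-identityʳ _)))
        in suc k , h , λ (t , t≉0) → trans (solve 3 (λ t a f → (t :* a) :* f := a :* (t :* f)) refl t (t ^ k) (f (t , t≉0))) (l (t , t≉0))

    abstract
      regular⇒laurent : ∀ f → Regular f → IsLaurent f
      regular⇒laurent f reg =
        let (u , v , v≉0 , e) = reg (1# , 1≉0) in
        [ (λ z → ⊥-elim (v≉0 (z 1#)))
        , (λ (κ , rs , κ≉0 , _ , d) → laurent-from-roots rs f (κ ⁻¹ ⊙ u) reg (λ (t , t≉0) → *-cancelˡ κ≉0
            (trans (sym (*-assoc _ _ _)) (trans (*-congʳ (sym (d t))) (trans (e (t , t≉0))
              (sym (trans (*-congˡ (ev-⊙ (κ ⁻¹) u t)) (trans (sym (*-assoc _ _ _)) (trans (*-congʳ (⁻¹-inverse κ≉0)) (*-identityˡ _)))))))))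
          ) ]′ (factorise (length v) v ℕ.≤-refl)

    prodRoots-monomial : ∀ rs → (∀ t → t ≉ 0# → prodRoots rs t ≉ 0#) → ∀ t → prodRoots rs t ≈ t ^ length rs
    prodRoots-monomial []       nz t = refl
    prodRoots-monomial (r ∷ rs) nz t with r ≟ 0#
    ... | no  r≉0 = ⊥-elim (nz r r≉0 (trans (*-congʳ (-‿inverseʳ r)) (zeroˡ _)))
    ... | yes r≈0 = *-cong (trans (+-congˡ (-‿cong r≈0)) (solve 1 (λ t → t :- con (+ 0) := t) refl t))
                           (prodRoots-monomial rs (λ s s≉0 z → nz s s≉0 (trans (*-congˡ z) (zeroʳ _))) t)

    abstract
      nonvanishing⇒monomial : ∀ h → (∀ t → t ≉ 0# → ev h t ≉ 0#) → ∃₂ λ c b → c ≉ 0# × (∀ t → ev h t ≈ c * t ^ b)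
      nonvanishing⇒monomial h nz =
        [ (λ z → ⊥-elim (nz 1# 1≉0 (z 1#)))
        , (λ (κ , rs , κ≉0 , _ , e) → κ , length rs , κ≉0 , λ t → trans (e t) (*-congˡ
            (prodRoots-monomial rs (λ s s≉0 z → nz s s≉0 (trans (e s) (trans (*-congˡ z) (zeroʳ κ)))) t)))
        ]′ (factorise (length h) h ℕ.≤-refl)

    shift : ℕ → List ℂ → List ℂ
    shift zero    q = q
    shift (suc m) q = 0# ∷ shift m q

    ev-shift : ∀ m q t → ev (shift m q) t ≈ t ^ m * ev q t
    ev-shift zero    q t = sym (*-identityˡ _)
    ev-shift (suc m) q t = trans (+-identityˡ _) (trans (*-congˡ (ev-shift m q t)) (sym (*-assoc _ _ _)))

    -- The reversed polynomial in s = 1/t, the counterpart of `lowest-term` at infinity.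
    highest-term : ∀ q → (∀ t → ev q t ≈ 0#) ⊎
      (∃₂ λ A q′ → (∀ t s → t * s ≈ 1# → ev q t ≈ t ^ A * ev q′ s) × ev q′ 0# ≉ 0#)
    highest-term []      = inj₁ (λ t → refl)
    highest-term (a ∷ q) = [ vanishing , nonvanishing ]′ (highest-term q)
      where
      Claim : Set
      Claim = (∀ t → ev (a ∷ q) t ≈ 0#) ⊎ (∃₂ λ A q′ → (∀ t s → t * s ≈ 1# → ev (a ∷ q) t ≈ t ^ A * ev q′ s) × ev q′ 0# ≉ 0#)
      only-a : (∀ t → ev q t ≈ 0#) → ∀ t → ev (a ∷ q) t ≈ a
      only-a e t = trans (+-congˡ (trans (*-congˡ (e t)) (zeroʳ t))) (+-identityʳ a)
      vanishing : (∀ t → ev q t ≈ 0#) → Claim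
      vanishing e with a ≟ 0#
      ... | yes a≈0 = inj₁ (λ t → trans (only-a e t) a≈0)
      ... | no  a≉0 = inj₂ (0 , a ∷ [] ,
            (λ t s _ → trans (only-a e t) (solve 2 (λ a s → a := con (+ 1) :* (a :+ s :* con (+ 0))) refl a s)) ,
            λ z → a≉0 (trans (solve 1 (λ a → a := a :+ con (+ 0) :* con (+ 0)) refl a) z))
      nonvanishing : (∃₂ λ A q′ → (∀ t s → t * s ≈ 1# → ev q t ≈ t ^ A * ev q′ s) × ev q′ 0# ≉ 0#) → Claim
      nonvanishing (A , q′ , e , nz) = inj₂ (suc A , q′ ⊕ shift (suc A) (a ∷ []) , eq , λ z → nz (trans (sym at-0) z))
        where
        at-0 : ev (q′ ⊕ shift (suc A) (a ∷ [])) 0# ≈ ev q′ 0#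
        at-0 = trans (ev-⊕ q′ (shift (suc A) (a ∷ [])) 0#)
          (trans (+-congˡ (trans (+-identityˡ _) (zeroˡ _))) (+-identityʳ _))
        eq : ∀ t s → t * s ≈ 1# → ev (a ∷ q) t ≈ t ^ suc A * ev (q′ ⊕ shift (suc A) (a ∷ [])) s
        eq t s ts≈1 = sym (trans (*-congˡ (trans (ev-⊕ q′ (shift (suc A) (a ∷ [])) s) (+-congˡ (ev-shift (suc A) (a ∷ []) s))))
          (trans (solve 6 (λ t ta sa a s q → (t :* ta) :* (q :+ sa :* (a :+ s :* con (+ 0))) := ((t :* ta) :* sa) :* a :+ t :* (ta :* q))
                    refl t (t ^ A) (s ^ suc A) a s (ev q′ s))
            (+-cong (trans (*-congʳ (trans (sym (^-distrib-* t s (suc A))) (trans (^-congˡ (suc A) ts≈1) (1^n≈1 (suc A))))) (*-identityˡ a))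
                    (*-congˡ (sym (e t s ts≈1))))))

    -- Q relates t to the local parameter s at one end of ℂ⋆: s = t at 0, s = 1/t at ∞.
    record End (Q : ℂ → ℂ → Set) (X Y : List ℂ) : Set where
      field
        exponent : ℕ
        X′ Y′    : List ℂ
        X-eq     : ∀ t s → Q t s → ev X t ≈ t ^ exponent * ev X′ s
        Y-eq     : ∀ t s → Q t s → ev Y t ≈ t ^ exponent * ev Y′ s
        nonzero  : ¬ (ev X′ 0# ≈ 0# × ev Y′ 0# ≈ 0#)

    end-swap : ∀ {Q X Y} → End Q X Y → End Q Y X
    end-swap E = record { exponent = exponent ; X′ = Y′ ; Y′ = X′ ; X-eq = Y-eq ; Y-eq = X-eq ; nonzero = λ (a , b) → nonzero (b , a) }
      where open End E

    end-vanishing : ∀ {Q X Y} → (∀ t → ev X t ≈ 0#) →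
      (∃₂ λ A q → (∀ t s → Q t s → ev Y t ≈ t ^ A * ev q s) × ev q 0# ≉ 0#) → End Q X Y
    end-vanishing z (A , q , e , nz) = record
      { exponent = A ; X′ = [] ; Y′ = q ; X-eq = λ t s _ → trans (z t) (sym (zeroʳ _)) ; Y-eq = e ; nonzero = λ (_ , b) → nz b }

    -- The smaller of the two orders at 0 is split off, so that (X′, Y′)(0) is nonzero. It is the
    -- direction of the curve at this end.
    low-end : ∀ X Y → ¬ ((∀ t → ev X t ≈ 0#) × (∀ t → ev Y t ≈ 0#)) → End _≈_ X Y
    low-end X Y ¬z = combine (lowest-term X) (lowest-term Y)
      where
      Low : List ℂ → Set
      Low X = ∃₂ λ j q → (∀ t → ev X t ≈ t ^ j * ev q t) × ev q 0# ≉ 0#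
      general : ∀ X → Low X → ∃₂ λ j q → (∀ t s → t ≈ s → ev X t ≈ t ^ j * ev q s) × ev q 0# ≉ 0#
      general X (j , q , e , nz) = j , q , (λ t s t≈s → trans (e t) (*-congˡ (ev-cong q t≈s))) , nz
      ordered : ∀ X Y (l : Low X) (m : Low Y) → proj₁ l ℕ.≤ proj₁ m → End _≈_ X Y
      ordered X Y l@(i , p , e , nz) (j , q , f , _) i≤j = record
        { exponent = i ; X′ = p ; Y′ = shift (j ℕ.∸ i) q
        ; X-eq = proj₁ (proj₂ (proj₂ (general X l)))
        ; Y-eq = λ t s t≈s → trans (f t) (trans (*-congʳ (trans (reflexive (≡.cong (t ^_) (≡.sym (ℕ.m+[n∸m]≡n i≤j)))) (^-homo-* t i (j ℕ.∸ i))))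
                   (trans (*-assoc _ _ _) (*-congˡ (trans (sym (ev-shift (j ℕ.∸ i) q t)) (ev-cong (shift (j ℕ.∸ i) q) t≈s)))))
        ; nonzero = λ (a , _) → nz a }
      combine : (∀ t → ev X t ≈ 0#) ⊎ Low X → (∀ t → ev Y t ≈ 0#) ⊎ Low Y → End _≈_ X Y
      combine (inj₁ a) (inj₁ b) = ⊥-elim (¬z (a , b))
      combine (inj₁ a) (inj₂ m) = end-vanishing a (general Y m)
      combine (inj₂ l) (inj₁ b) = end-swap (end-vanishing b (general X l))
      combine (inj₂ l) (inj₂ m) = [ ordered X Y l m , (λ o → end-swap (ordered Y X m l o)) ]′ (ℕ.≤-total (proj₁ l) (proj₁ m))

    -- Here the larger of the two degrees is split off.
    high-end : ∀ X Y → ¬ ((∀ t → ev X t ≈ 0#) × (∀ t → ev Y t ≈ 0#)) → End (λ t s → t * s ≈ 1#) X Y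
    high-end X Y ¬z = combine (highest-term X) (highest-term Y)
      where
      Q : ℂ → ℂ → Set
      Q t s = t * s ≈ 1#
      High : List ℂ → Set
      High X = ∃₂ λ A q → (∀ t s → t * s ≈ 1# → ev X t ≈ t ^ A * ev q s) × ev q 0# ≉ 0#
      ordered : ∀ X Y (l : High X) (m : High Y) → proj₁ m ℕ.≤ proj₁ l → End Q X Y
      ordered X Y (i , p , e , nz) (j , q , f , _) j≤i = record
        { exponent = i ; X′ = p ; Y′ = shift (i ℕ.∸ j) q ; X-eq = e
        ; Y-eq = λ t s ts → sym (begin
            t ^ i * ev (shift (i ℕ.∸ j) q) s
              ≈⟨ *-cong (trans (reflexive (≡.cong (t ^_) (≡.sym (ℕ.m+[n∸m]≡n j≤i)))) (^-homo-* t j (i ℕ.∸ j))) (ev-shift (i ℕ.∸ j) q s) ⟩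
            (t ^ j * t ^ (i ℕ.∸ j)) * (s ^ (i ℕ.∸ j) * ev q s)
              ≈⟨ solve 4 (λ a b c d → (a :* b) :* (c :* d) := a :* ((b :* c) :* d)) refl (t ^ j) (t ^ (i ℕ.∸ j)) (s ^ (i ℕ.∸ j)) (ev q s) ⟩
            t ^ j * ((t ^ (i ℕ.∸ j) * s ^ (i ℕ.∸ j)) * ev q s)
              ≈⟨ *-congˡ (trans (*-congʳ (trans (sym (^-distrib-* t s (i ℕ.∸ j))) (trans (^-congˡ (i ℕ.∸ j) ts) (1^n≈1 (i ℕ.∸ j))))) (*-identityˡ _)) ⟩
            t ^ j * ev q s ≈⟨ f t s ts ⟨
            ev Y t ∎)
        ; nonzero = λ (a , _) → nz a }
      combine : (∀ t → ev X t ≈ 0#) ⊎ High X → (∀ t → ev Y t ≈ 0#) ⊎ High Y → End Q X Y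
      combine (inj₁ a) (inj₁ b) = ⊥-elim (¬z (a , b))
      combine (inj₁ a) (inj₂ m) = end-vanishing a m
      combine (inj₂ l) (inj₁ b) = end-swap (end-vanishing b l)
      combine (inj₂ l) (inj₂ m) = [ (λ o → end-swap (ordered Y X m l o)) , ordered X Y l m ]′ (ℕ.≤-total (proj₁ l) (proj₁ m))

  open LaurentPolynomials public

  -- Homogenisation and the top form

  module Homogenisation where
    coefficient : ℚ → ℂ
    coefficient q = ι (ℚ→ℝ q)

    evalℂ : {n : ℕ} → Poly ℚ n → Vec ℂ n → ℂ
    evalℂ p = eval (mapCoeff coefficient p)

    module Hι = EvaluationHomomorphism R.commutativeRing commutativeRing
    module Hconj = EvaluationHomomorphism commutativeRing commutativeRing

    evalℂ-ι : ∀ {n} (p : Poly ℚ n) v → ι (evalℝ p v) ≈ evalℂ p (Vec.map ι v)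
    evalℂ-ι = Hι.eval-hom ι ι-0 ι-1 ι-+ ι-* ℚ→ℝ coefficient (λ _ → refl)

    evalℂ-conj : ∀ {n} (p : Poly ℚ n) v → conj (evalℂ p v) ≈ evalℂ p (Vec.map conj v)
    evalℂ-conj = Hconj.eval-hom conj conj-0 (conj-^ 1# 0) conj-+ conj-* coefficient coefficient (λ q → conj-ι (ℚ→ℝ q))

    evalℂ-cong : ∀ {n} (p : Poly ℚ n) {v w} → Pointwise _≈_ v w → evalℂ p v ≈ evalℂ p w
    evalℂ-cong p = eval-cong (mapCoeff coefficient p)

    degree : Vec ℕ 2 → ℕ
    degree (i ∷ j ∷ []) = i ℕ.+ j

    -- d is a bound for the degrees of the terms; under `Bounded d` the truncated subtraction is
    -- exact.
    homogenise : ℕ → Poly ℚ 2 → Poly ℚ 3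
    homogenise d = List.map (λ (a , e) → a , homogeniseExponent e)
      where
      homogeniseExponent : Vec ℕ 2 → Vec ℕ 3
      homogeniseExponent (i ∷ j ∷ []) = i ∷ j ∷ d ℕ.∸ (i ℕ.+ j) ∷ []

    Bounded : ℕ → Poly ℚ 2 → Set
    Bounded d = ListAll (λ (a , e) → degree e ℕ.≤ d)

    homogenise-dehomogenise : ∀ d p x y → evalℂ (homogenise d p) (x ∷ y ∷ 1# ∷ []) ≈ evalℂ p (x ∷ y ∷ [])
    homogenise-dehomogenise d []                        x y = refl
    homogenise-dehomogenise d ((a , i ∷ j ∷ []) ∷ p) x y = +-cong
      (*-congˡ {coefficient a} (*-congˡ {x ^ i} (*-congˡ {y ^ j} (trans (*-identityʳ _) (1^n≈1 (d ℕ.∸ (i ℕ.+ j)))))))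
      (homogenise-dehomogenise d p x y)

    homogenise-homogeneous : ∀ d p → Bounded d p → ∀ s x y z →
      evalℂ (homogenise d p) (s * x ∷ s * y ∷ s * z ∷ []) ≈ s ^ d * evalℂ (homogenise d p) (x ∷ y ∷ z ∷ [])
    homogenise-homogeneous d []                     []         s x y z = sym (zeroʳ _)
    homogenise-homogeneous d ((a , i ∷ j ∷ []) ∷ p) (le ∷ les) s x y z = trans
      (+-cong (*-congˡ {coefficient a} (begin
          (s * x) ^ i * ((s * y) ^ j * ((s * z) ^ k * 1#))
            ≈⟨ *-cong (^-distrib-* s x i) (*-cong (^-distrib-* s y j) (*-congʳ (^-distrib-* s z k))) ⟩
          (s ^ i * x ^ i) * ((s ^ j * y ^ j) * ((s ^ k * z ^ k) * 1#))
            ≈⟨ solve 6 (λ a b c x y z → (a :* x) :* ((b :* y) :* ((c :* z) :* con (+ 1))) := ((a :* b) :* c) :* (x :* (y :* (z :* con (+ 1)))))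
                  refl (s ^ i) (s ^ j) (s ^ k) (x ^ i) (y ^ j) (z ^ k) ⟩
          ((s ^ i * s ^ j) * s ^ k) * m
            ≈⟨ *-congʳ power ⟩
          s ^ d * m ∎))
        (homogenise-homogeneous d p les s x y z))
      (solve 4 (λ c sd m r → c :* (sd :* m) :+ sd :* r := sd :* (c :* m :+ r)) refl (coefficient a) (s ^ d) m
        (evalℂ (homogenise d p) (x ∷ y ∷ z ∷ [])))
      where
      k = d ℕ.∸ (i ℕ.+ j)
      m = x ^ i * (y ^ j * (z ^ k * 1#))
      power : (s ^ i * s ^ j) * s ^ k ≈ s ^ d
      power = trans (*-congʳ (sym (^-homo-* s i j))) (trans (sym (^-homo-* s (i ℕ.+ j) k))
        (reflexive (≡.cong (s ^_) (ℕ.m+[n∸m]≡n le))))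

    lower : ℕ → Poly ℚ 2 → Poly ℚ 2
    lower d []            = []
    lower d ((a , e) ∷ p) with degree e ℕ.<? d
    ... | yes _ = (a , e) ∷ lower d p
    ... | no  _ = lower d p

    lower-bounded : ∀ d p → Bounded d (lower (suc d) p)
    lower-bounded d []            = []
    lower-bounded d ((a , e) ∷ p) with degree e ℕ.<? suc d
    ... | yes (ℕ.s≤s q) = q ∷ lower-bounded d p
    ... | no  _         = lower-bounded d p

    lower-0 : ∀ p → lower 0 p ≡ []
    lower-0 []            = ≡.refl
    lower-0 ((a , e) ∷ p) = lower-0 p

    0^suc : ∀ {n} → 0 ℕ.< n → 0# ^ n ≈ 0#
    0^suc {suc n} _ = zeroˡ _

    top : ℕ → Poly ℚ 2 → ℂ → ℂ → ℂ
    top d p x y = evalℂ (homogenise d p) (x ∷ y ∷ 0# ∷ [])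

    lower+top : ∀ d p → Bounded d p → ∀ x y → evalℂ p (x ∷ y ∷ []) ≈ evalℂ (lower d p) (x ∷ y ∷ []) + top d p x y
    lower+top d []                     []         x y = sym (+-identityʳ 0#)
    lower+top d ((a , i ∷ j ∷ []) ∷ p) (le ∷ les) x y with i ℕ.+ j ℕ.<? d
    ... | yes lt = trans (+-congˡ (lower+top d p les x y)) (sym (trans (+-congˡ (+-congʳ vanishing))
          (solve 4 (λ c m l t → (c :* m :+ l) :+ (con (+ 0) :+ t) := c :* m :+ (l :+ t)) refl (coefficient a) (x ^ i * (y ^ j * 1#))
             (evalℂ (lower d p) (x ∷ y ∷ [])) (top d p x y))))
      where
      vanishing : coefficient a * (x ^ i * (y ^ j * (0# ^ (d ℕ.∸ (i ℕ.+ j)) * 1#))) ≈ 0#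
      vanishing = trans (*-congˡ (*-congˡ (*-congˡ (*-congʳ (0^suc (ℕ.m<n⇒0<n∸m lt))))))
        (solve 3 (λ c a b → c :* (a :* (b :* (con (+ 0) :* con (+ 1)))) := con (+ 0)) refl (coefficient a) (x ^ i) (y ^ j))
    ... | no ¬lt = trans (+-congˡ (lower+top d p les x y)) (sym (trans (+-congˡ (+-congʳ leading))
          (solve 4 (λ c m l t → l :+ (c :* m :+ t) := c :* m :+ (l :+ t)) refl (coefficient a) (x ^ i * (y ^ j * 1#))
             (evalℂ (lower d p) (x ∷ y ∷ [])) (top d p x y))))
      where
      leading : coefficient a * (x ^ i * (y ^ j * (0# ^ (d ℕ.∸ (i ℕ.+ j)) * 1#))) ≈ coefficient a * (x ^ i * (y ^ j * 1#))
      leading = *-congˡ (*-congˡ (*-congˡ (trans (*-congʳ (reflexive (≡.cong (0# ^_) (ℕ.m≤n⇒m∸n≡0 (ℕ.≮⇒≥ ¬lt))))) (*-identityʳ 1#))))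

    bounded-exists : ∀ p → ∃ λ d → Bounded d p
    bounded-exists []            = 0 , []
    bounded-exists ((a , e) ∷ p) = let (d , b) = bounded-exists p in
      degree e ℕ.+ d , ℕ.m≤m+n (degree e) d ∷ ListAll.map (λ q → ℕ.≤-trans q (ℕ.m≤n+m d (degree e))) b

    -- That d is the true degree is certified by a real point at which the top form is nonzero. This
    -- point also serves as the direction w of the later arguments.
    record TopForm (F : Poly ℚ 2) : Set where
      field
        d           : ℕ
        H           : Poly ℚ 3
        dehomogenise : ∀ x y → evalℂ H (x ∷ y ∷ 1# ∷ []) ≈ evalℂ F (x ∷ y ∷ [])
        homogeneous : ∀ s x y z → evalℂ H (s * x ∷ s * y ∷ s * z ∷ []) ≈ s ^ d * evalℂ H (x ∷ y ∷ z ∷ [])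
        nonzero     : ∃₂ λ (u v : ℝ) → evalℂ H (ι u ∷ ι v ∷ 0# ∷ []) ≉ 0#

    module _ (H : Poly ℚ 3) where
      polynomial-in : ∀ {f g h : ℂ → ℂ} → IsPoly f → IsPoly g → IsPoly h → IsPoly (λ t → evalℂ H (f t ∷ g t ∷ h t ∷ []))
      polynomial-in p q r = eval-closed isPoly-isSubalgebra (mapCoeff coefficient H) (p ∷ q ∷ r ∷ [])

      -- The identity theorem in one variable after the other.
      vanishes-on-ℝ²⇒vanishes : (∀ u v → evalℂ H (ι u ∷ ι v ∷ 0# ∷ []) ≈ 0#) → ∀ x y → evalℂ H (x ∷ y ∷ 0# ∷ []) ≈ 0#
      vanishes-on-ℝ²⇒vanishes z x y =
        isPoly-identity (polynomial-in (const x) isPoly-var (const 0#)) 0ᴿ (λ v _ →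
          isPoly-identity (polynomial-in isPoly-var (const (ι v)) (const 0#)) 0ᴿ (λ u _ → z u v) x) y
        where open IsSubalgebra isPoly-isSubalgebra using (const)

    private
      Result : Poly ℚ 2 → Set
      Result F = (∀ x y → evalℂ F (x ∷ y ∷ []) ≈ 0#) ⊎ TopForm F

      transfer : ∀ {F G} → (∀ x y → evalℂ F (x ∷ y ∷ []) ≈ evalℂ G (x ∷ y ∷ [])) → Result G → Result F
      transfer e (inj₁ z) = inj₁ (λ x y → trans (e x y) (z x y))
      transfer e (inj₂ t) = inj₂ (record { TopForm t ; dehomogenise = λ x y → trans (TopForm.dehomogenise t x y) (sym (e x y)) })

      drop-top : ∀ d F → Bounded d F → (∀ x y → top d F x y ≈ 0#) → ∀ x y → evalℂ F (x ∷ y ∷ []) ≈ evalℂ (lower d F) (x ∷ y ∷ [])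
      drop-top d F b z x y = trans (lower+top d F b x y) (trans (+-congˡ (z x y)) (+-identityʳ _))

      -- Repeated terms may cancel and coefficients may be 0, so d can exceed the true degree. As
      -- long as the top form vanishes at all real points it vanishes identically; its terms are
      -- then dropped and d decreases.
      topForm-bounded : ∀ d F → Bounded d F → Result F
      topForm-bounded d F b with em {∃₂ λ (u v : ℝ) → top d F (ι u) (ι v) ≉ 0#}
      ... | yes nz = inj₂ (record { d = d ; H = homogenise d F ; dehomogenise = homogenise-dehomogenise d F
                                  ; homogeneous = homogenise-homogeneous d F b ; nonzero = nz })
      topForm-bounded zero F b | no ¬nz = inj₁ (λ x y → trans (drop-top 0 F b vanish x y)
                                    (reflexive (≡.cong (λ p → evalℂ p (x ∷ y ∷ [])) (lower-0 F))))
        where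
        vanish : ∀ x y → top 0 F x y ≈ 0#
        vanish = vanishes-on-ℝ²⇒vanishes (homogenise 0 F) (λ u v → decidable-stable em (λ p → ¬nz (u , v , p)))
      topForm-bounded (suc d) F b | no ¬nz =
        transfer {F} {lower (suc d) F} (drop-top (suc d) F b vanish) (topForm-bounded d (lower (suc d) F) (lower-bounded d F))
        where
        vanish : ∀ x y → top (suc d) F x y ≈ 0#
        vanish = vanishes-on-ℝ²⇒vanishes (homogenise (suc d) F) (λ u v → decidable-stable em (λ p → ¬nz (u , v , p)))

    topForm : ∀ F → (∀ x y → evalℂ F (x ∷ y ∷ []) ≈ 0#) ⊎ TopForm F
    topForm F = let (d , b) = bounded-exists F in topForm-bounded d F b

  open Homogenisation public

  -- Zeros of the top form are directions of ends of the fibre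

  module PointsAtInfinity where
    det : ℂ → ℂ → ℂ → ℂ → ℂ
    det a b x y = a * y + - b * x

    nhds0² : Filter (ℂ × ℂ)
    nhds0² = record
      { Ev     = λ P → ∃ λ δ → 0ᴿ < δ × (∀ s u → N s < δ → N u < δ → P (s , u))
      ; ev-all = λ p → 1ᴿ , 0<1 , λ s u _ _ → p (s , u)
      ; ev-map = λ f (δ , 0<δ , p) → δ , 0<δ , λ s u i j → f (s , u) (p s u i j)
      ; ev-∧   = λ (δ , 0<δ , p) (ε , 0<ε , q) →
          let (m , 0<m , m≤δ , m≤ε) = minimum 0<δ 0<ε in
          m , 0<m , λ s u i j → p s u (<-≤-trans i m≤δ) (<-≤-trans j m≤δ) , q s u (<-≤-trans i m≤ε) (<-≤-trans j m≤ε)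
      }

    open ComplexLimits nhds0²

    private
      x-0 : ∀ {x z} → z ≈ᴿ 0ᴿ → x ≈ᴿ x -ᴿ z
      x-0 {x} {z} e = R.trans (solveᴾ 1 (λ x → x =ᴾ x -ᴾ conᴾ (+ 0)) R.refl x) (R.+-congˡ (R.-‿cong (R.sym e)))

    continuous : IsSubalgebra rawRing (λ f → Tendsℂ f (f (0# , 0#)))
    continuous = Tendsℂ-isSubalgebra (0# , 0#)

    continuous-fst : Tendsℂ proj₁ 0#
    continuous-fst = tendsℂ
      (λ ε 0<ε → ε *ᴿ ε , R.*-positive 0<ε 0<ε , λ s u i j → ⊲-resp (x-0 re-0) R.refl (N<⇒re⊲ 0<ε i))
      (λ ε 0<ε → ε *ᴿ ε , R.*-positive 0<ε 0<ε , λ s u i j → ⊲-resp (x-0 im-0) R.refl (N<⇒im⊲ 0<ε i))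

    continuous-snd : Tendsℂ proj₂ 0#
    continuous-snd = tendsℂ
      (λ ε 0<ε → ε *ᴿ ε , R.*-positive 0<ε 0<ε , λ s u i j → ⊲-resp (x-0 re-0) R.refl (N<⇒re⊲ 0<ε j))
      (λ ε 0<ε → ε *ᴿ ε , R.*-positive 0<ε 0<ε , λ s u i j → ⊲-resp (x-0 im-0) R.refl (N<⇒im⊲ 0<ε j))

    BoundedOn : {A : Set} → (A → ℂ) → Set
    BoundedOn {A} f = ∃ λ M → 0ᴿ ≤ M × (∀ (a : A) → N (f a) ≤ M)

    boundedOn-isSubalgebra : {A : Set} → IsSubalgebra rawRing (BoundedOn {A})
    boundedOn-isSubalgebra = record
      { resp  = λ e (M , 0≤M , b) → M , 0≤M , λ a → ≤-resp (N-cong (e a)) R.refl (b a)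
      ; const = λ c → N c , N-nonneg c , λ _ → ≈⇒≤ R.refl
      ; plus  = λ {f} {g} (M , 0≤M , b) (M′ , 0≤M′ , b′) → 2# *ᴿ (M +ᴿ M′) , *-nonneg (<⇒≤ 0<2) (+-nonneg 0≤M 0≤M′) ,
          λ a → ≤-trans (N-+ (f a) (g a)) (≤-resp (R.*-comm _ 2#) (R.*-comm _ 2#) (*-monoˡ-≤ 2# (<⇒≤ 0<2) (+-mono-≤ (b a) (b′ a))))
      ; times = λ {f} {g} (M , 0≤M , b) (M′ , 0≤M′ , b′) → M *ᴿ M′ , *-nonneg 0≤M 0≤M′ ,
          λ a → ≤-resp (R.sym (N-* (f a) (g a))) R.refl
            (≤-trans (*-monoˡ-≤ (N (g a)) (N-nonneg (g a)) (b a))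
                     (≤-resp (R.*-comm _ M) (R.*-comm _ M) (*-monoˡ-≤ M 0≤M (b′ a))))
      }

    module SmallRoots (ε : ℝ) (0<ε : 0ᴿ < ε) where
      private
        inverse : ∃ λ e → 0ᴿ < e × e *ᴿ ε ≈ᴿ 1ᴿ
        inverse = divide 0<1 0<ε
        e = proj₁ inverse

      -- A bound for N(1 - r)/N(r) over all r with N r ≥ ε, because N(1 - r) ≤ 2(1 + N r) and 1 ≤
      -- N(r)/ε. Each root contributes one such factor to the comparison of the values at 1 and at
      -- 0.
      C : ℝ
      C = 2# *ᴿ (e +ᴿ 1ᴿ)

      1≤C : 1ᴿ ≤ C
      1≤C = <⇒≤ (0<-⇒< (+-pos 0<1 (R.*-positive 0<2 (proj₁ (proj₂ inverse))))
        (solveᴾ 1 (λ e → conᴾ (+ 1) +ᴾ (conᴾ (+ 1) +ᴾ conᴾ (+ 1)) *ᴾ e =ᴾ (conᴾ (+ 1) +ᴾ conᴾ (+ 1)) *ᴾ (e +ᴾ conᴾ (+ 1)) -ᴾ conᴾ (+ 1)) R.refl e))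

      0≤C : 0ᴿ ≤ C
      0≤C = ≤-trans (<⇒≤ 0<1) 1≤C

      0≤C^ : ∀ n → 0ᴿ ≤ C ^ᴿ n
      0≤C^ zero    = <⇒≤ 0<1
      0≤C^ (suc n) = *-nonneg 0≤C (0≤C^ n)

      C^-mono : ∀ {m n} → m ℕ.≤ n → C ^ᴿ m ≤ C ^ᴿ n
      C^-mono {n = zero}  ℕ.z≤n = ≈⇒≤ R.refl
      C^-mono {n = suc n} ℕ.z≤n = ≤-trans (C^-mono {n = n} ℕ.z≤n)
        (≤-resp (R.*-identityˡ _) R.refl (*-monoˡ-≤ (C ^ᴿ n) (0≤C^ n) 1≤C))
      C^-mono {suc m} {suc n} (ℕ.s≤s m≤n) = ≤-resp (R.*-comm _ C) (R.*-comm _ C) (*-monoˡ-≤ C 0≤C (C^-mono m≤n))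

      factor-bound : ∀ r → ε ≤ N r → N (1# - r) ≤ C *ᴿ N (0# - r)
      factor-bound r ε≤Nr = ≤-trans (N-+ 1# (- r)) (≤-resp (R.*-congˡ (R.+-cong (R.sym N-1) (R.sym (N-neg r))))
        (R.*-congˡ (R.sym (R.trans (N-cong (solve 1 (λ r → con (+ 0) :- r := :- r) refl r)) (N-neg r)))) bound)
        where
        1≤eN : 1ᴿ ≤ e *ᴿ N r
        1≤eN = ≤-resp (R.trans (R.*-comm ε e) (proj₂ (proj₂ inverse))) (R.*-comm (N r) e) (*-monoˡ-≤ e (<⇒≤ (proj₁ (proj₂ inverse))) ε≤Nr)
        bound : 2# *ᴿ (1ᴿ +ᴿ N r) ≤ C *ᴿ N r
        bound = 0≤-⇒≤ (*-nonneg (<⇒≤ 0<2) (≤⇒0≤- 1≤eN))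
          (solveᴾ 3 (λ t e n → t *ᴾ (e *ᴾ n -ᴾ conᴾ (+ 1)) =ᴾ (t *ᴾ (e +ᴾ conᴾ (+ 1))) *ᴾ n -ᴾ t *ᴾ (conᴾ (+ 1) +ᴾ n)) R.refl 2# e (N r))

      product-bound : ∀ rs → (∀ u → prodRoots rs u ≈ 0# → ε ≤ N u) → N (prodRoots rs 1#) ≤ C ^ᴿ length rs *ᴿ N (prodRoots rs 0#)
      product-bound []       _  = ≈⇒≤ (R.sym (R.*-identityˡ _))
      product-bound (r ∷ rs) ge = ≤-resp (R.sym (N-* _ _)) (R.trans
          (solveᴾ 4 (λ c n d m → (c *ᴾ n) *ᴾ (d *ᴾ m) =ᴾ (c *ᴾ d) *ᴾ (n *ᴾ m)) R.refl C (N (0# - r)) (C ^ᴿ length rs) (N (prodRoots rs 0#)))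
          (R.*-congˡ (R.sym (N-* (0# - r) (prodRoots rs 0#)))))
        (≤-trans (*-monoˡ-≤ (N (prodRoots rs 1#)) (N-nonneg _) (factor-bound r (ge r (trans (*-congʳ (-‿inverseʳ r)) (zeroˡ _)))))
          (≤-resp (R.*-comm _ (C *ᴿ N (0# - r))) (R.*-comm _ (C *ᴿ N (0# - r)))
            (*-monoˡ-≤ (C *ᴿ N (0# - r)) (*-nonneg 0≤C (N-nonneg _)) (product-bound rs (λ u z → ge u (trans (*-congˡ z) (zeroʳ _)))))))

      -- If all roots had norm ≥ ε, the value at 1 would be at most Cⁿ times the value at 0.
      small-root : ∀ n p → length p ℕ.≤ n → C ^ᴿ n *ᴿ N (ev p 0#) < N (ev p 1#) → ∃ λ u → N u < ε × ev p u ≈ 0#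
      small-root n p p≤n lt = decidable-stable em λ none →
        let far : ∀ u → ev p u ≈ 0# → ε ≤ N u
            far = λ u z Nu<ε → none (u , Nu<ε , z)
        in [ (λ z → *-nonneg (0≤C^ n) (N-nonneg (ev p 0#)) (<-resp R.refl (R.trans (N-cong (z 1#)) N-0) lt))
           , (λ (κ , rs , κ≉0 , l , e) → contradict κ rs l e (product-bound rs (λ u z → far u (trans (e u) (trans (*-congˡ z) (zeroʳ κ)))))) ]′
           (factorise n p p≤n)
        where
        contradict : ∀ κ rs → length rs ℕ.≤ n → (∀ t → ev p t ≈ κ * prodRoots rs t) →
                     N (prodRoots rs 1#) ≤ C ^ᴿ length rs *ᴿ N (prodRoots rs 0#) → ⊥
        contradict κ rs l e b = ST.irrefl R.refl (<-≤-trans lt (≤-resp (R.sym (N-value 1#)) (R.sym rhs)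
            (≤-resp (R.*-comm _ (N κ)) (R.*-comm _ (N κ)) (*-monoˡ-≤ (N κ) (N-nonneg κ)
              (≤-trans b (*-monoˡ-≤ (N (prodRoots rs 0#)) (N-nonneg _) (C^-mono l)))))))
          where
          N-value : ∀ t → N (ev p t) ≈ᴿ N κ *ᴿ N (prodRoots rs t)
          N-value t = R.trans (N-cong (e t)) (N-* κ (prodRoots rs t))
          rhs : C ^ᴿ n *ᴿ N (ev p 0#) ≈ᴿ N κ *ᴿ (C ^ᴿ n *ᴿ N (prodRoots rs 0#))
          rhs = R.trans (R.*-congˡ (N-value 0#)) (solveᴾ 3 (λ c k m → c *ᴾ (k *ᴾ m) =ᴾ k *ᴾ (c *ᴾ m)) R.refl (C ^ᴿ n) (N κ) (N (prodRoots rs 0#)))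

    module Covering {F : Poly ℚ 2} (T : TopForm F) (c : ℂ) where
      open TopForm T

      Hc : ℂ → ℂ → ℂ → ℂ
      Hc x y z = evalℂ H (x ∷ y ∷ z ∷ [])

      Hc-cong : ∀ {x y z x′ y′ z′} → x ≈ x′ → y ≈ y′ → z ≈ z′ → Hc x y z ≈ Hc x′ y′ z′
      Hc-cong p q r = evalℂ-cong H (p ∷ q ∷ r ∷ [])

      w₁ w₂ : ℂ
      w₁ = ι (proj₁ nonzero)
      w₂ = ι (proj₁ (proj₂ nonzero))

      T[w]≉0 : Hc w₁ w₂ 0# ≉ 0#
      T[w]≉0 = proj₂ (proj₂ nonzero)

      -- The line v + uω meets the zero v of T at u = 0 and the point w with T(w) ≠ 0 at u = 1.
      module AtZero (v₁ v₂ : ℂ) (T[v]≈0 : Hc v₁ v₂ 0# ≈ 0#) where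
        ω₁ ω₂ : ℂ
        ω₁ = w₁ - v₁
        ω₂ = w₂ - v₂

        -- d is positive: a form of degree 0 is constant and would take the same value at v and at
        -- w.
        0^d : 0# ^ d ≈ 0#
        0^d with d in eq
        ... | suc _ = zeroˡ _
        ... | zero  = ⊥-elim (T[w]≉0 (trans (trans (sym (const w₁ w₂)) (const v₁ v₂)) T[v]≈0))
          where
          const : ∀ x y → Hc 0# 0# 0# ≈ Hc x y 0#
          const x y = trans (Hc-cong (sym (zeroˡ x)) (sym (zeroˡ y)) (sym (zeroˡ 0#)))
            (trans (homogeneous 0# x y 0#) (trans (*-congʳ (reflexive (≡.cong (0# ^_) eq))) (*-identityˡ _)))

        -- A zero (z, u) of f with z ≠ 0 stands for the point (v + uω)/z of the fibre F = c.
        f : ℂ × ℂ → ℂ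
        f (z , u) = Hc (v₁ + u * ω₁) (v₂ + u * ω₂) z + (- c) * z ^ d

        module _ {Q : (ℂ × ℂ → ℂ) → Set} (S : IsSubalgebra rawRing Q) where
          open IsSubalgebra S
          f-closed : ∀ {ζ υ : ℂ × ℂ → ℂ} → Q ζ → Q υ → Q (λ a → f (ζ a , υ a))
          f-closed ζ υ = plus (eval-closed S (mapCoeff coefficient H)
              (plus (const v₁) (times υ (const ω₁)) ∷ plus (const v₂) (times υ (const ω₂)) ∷ ζ ∷ []))
            (times (const (- c)) (^-closed S d ζ))

        abstract
          -- As z tends to 0, f(z, 0) tends to T(v) = 0 and f(z, 1) to T(w) ≠ 0. For small z the
          -- value at 0 is then too small against the value at 1 for all roots u to keep away from
          -- 0, and `small-root` applies.
          curve-near-zero : ∀ ε η → 0ᴿ < ε → 0ᴿ < η → ∃₂ λ z u → z ≉ 0# × N z < η × N u < ε × f (z , u) ≈ 0#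
          curve-near-zero ε η 0<ε 0<η = ι z , u , ι≉0 (0<⇒≉0 (proj₁ (proj₂ square))) , <-≤-trans Nz< (proj₂ (proj₂ (proj₂ smaller))) ,
              proj₁ (proj₂ root) , trans (p-ev u) (proj₂ (proj₂ root))
            where
            open SmallRoots ε 0<ε
            f[0,0] : f (0# , 0#) ≈ 0#
            f[0,0] = trans (+-cong (trans (Hc-cong (solve 2 (λ v o → v :+ con (+ 0) :* o := v) refl v₁ ω₁) (solve 2 (λ v o → v :+ con (+ 0) :* o := v) refl v₂ ω₂) refl) T[v]≈0)
              (trans (*-congˡ 0^d) (zeroʳ _))) (+-identityʳ 0#)
            f[0,1] : f (0# , 1#) ≈ Hc w₁ w₂ 0#
            f[0,1] = trans (+-cong (Hc-cong (solve 2 (λ v w → v :+ con (+ 1) :* (w :- v) := w) refl v₁ w₁) (solve 2 (λ v w → v :+ con (+ 1) :* (w :- v) := w) refl v₂ w₂) refl)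
              (trans (*-congˡ 0^d) (zeroʳ _))) (+-identityʳ _)
            limit : ∀ n → 0ᴿ < N (f (0# , 1#)) +ᴿ -ᴿ (C ^ᴿ n *ᴿ N (f (0# , 0#)))
            limit n = <-resp R.refl (R.trans (R.trans (N-cong (sym f[0,1])) (solveᴾ 2 (λ x c → x =ᴾ x +ᴾ -ᴾ (c *ᴾ conᴾ (+ 0))) R.refl (N (f (0# , 1#))) (C ^ᴿ n)))
              (R.+-congˡ (R.-‿cong (R.*-congˡ (R.sym (R.trans (N-cong f[0,0]) N-0)))))) (N-pos T[w]≉0)
            small-square : ∀ δ → 0ᴿ < δ → ∃ λ z → 0ᴿ < z × z *ᴿ z < δ
            small-square δ 0<δ = let (m , 0<m , m≤δ , m≤1) = minimum 0<δ 0<1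
                                     (h , 0<h , h<m) = half 0<m in
              h , 0<h , <-trans (0<-⇒< (R.*-positive 0<h (<⇒0<- (<-≤-trans h<m m≤1)))
                (solveᴾ 1 (λ h → h *ᴾ (conᴾ (+ 1) -ᴾ h) =ᴾ h -ᴾ h *ᴾ h) R.refl h)) (<-≤-trans h<m m≤δ)
            family : PolyFamily f
            family = f-closed polyFamily-isSubalgebra (polyFamily-param (λ z → z)) polyFamily-var
            n : ℕ
            n = proj₁ family
            g : ℂ × ℂ → ℝ
            g (z , _) = N (f (z , 1#)) +ᴿ -ᴿ (C ^ᴿ n *ᴿ N (f (z , 0#)))
            g-tends : Tends g (g (0# , 0#))
            g-tends = tends-+ (tends-N (f-closed continuous continuous-fst (IsSubalgebra.const continuous 1#)))
              (tends-neg (tends-* (tends-const (C ^ᴿ n)) (tends-N (f-closed continuous continuous-fst (IsSubalgebra.const continuous 0#)))))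
            good : ∃ λ δ → 0ᴿ < δ × (∀ z u → N z < δ → N u < δ → 0ᴿ < g (z , u))
            good = tends-pos {g} g-tends (limit n)
            smaller : ∃ λ m → 0ᴿ < m × m ≤ proj₁ good × m ≤ η
            smaller = minimum (proj₁ (proj₂ good)) 0<η
            square : ∃ λ z → 0ᴿ < z × z *ᴿ z < proj₁ smaller
            square = small-square (proj₁ smaller) (proj₁ (proj₂ smaller))
            z : ℝ
            z = proj₁ square
            Nz< : N (ι z) < proj₁ smaller
            Nz< = <-resp (R.sym (N-ι z)) R.refl (proj₂ (proj₂ square))
            positive : 0ᴿ < g (ι z , 0#)
            positive = proj₂ (proj₂ good) (ι z) 0# (<-≤-trans Nz< (proj₁ (proj₂ (proj₂ smaller)))) (<-resp (R.sym N-0) R.refl (proj₁ (proj₂ good)))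
            p : List ℂ
            p = proj₁ (proj₂ family (ι z))
            p-ev : ∀ t → f (ι z , t) ≈ ev p t
            p-ev = proj₂ (proj₂ (proj₂ family (ι z)))
            root : ∃ λ u → N u < ε × ev p u ≈ 0#
            root = small-root n p (proj₁ (proj₂ (proj₂ family (ι z))))
              (0<-⇒< positive (R.+-cong (N-cong (p-ev 1#)) (R.-‿cong (R.*-congˡ (N-cong (p-ev 0#))))))
            u : ℂ
            u = proj₁ root

        module _ {X Y : List ℂ} {Q : ℂ → ℂ → Set} (E : End Q X Y) (a b : ℂ) where
          open End E hiding (nonzero)

          -- Vanishes when (X′, Y′)(s) is a multiple of v + uω.
          obstruction : ℂ × ℂ → ℂ
          obstruction (s , u) = (v₁ * ev Y′ s + - (v₂) * ev X′ s) * (a * (v₁ + u * ω₁) + b * (v₂ + u * ω₂))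
                              + - (v₁ * ω₂ + - (v₂) * ω₁) * (u * (a * ev X′ s + b * ev Y′ s))

          -- At (0, 0) the obstruction equals det(v, (X′, Y′)(0)) · L(v) with L = a x + b y; it is
          -- nonzero, and continuity does the rest.
          end-avoids : det v₁ v₂ (ev X′ 0#) (ev Y′ 0#) ≉ 0# → a * v₁ + b * v₂ ≉ 0# →
            ∃ λ δ → 0ᴿ < δ × (∀ s u → N s < δ → N u < δ → obstruction (s , u) ≉ 0#)
          end-avoids det≉0 L≉0 = tends-≉0 obstruction-tends λ z → *≉0 det≉0 L≉0 (trans (sym value) z)
            where
            open IsSubalgebra continuous
            X′-cts = ev-closed continuous X′ continuous-fst
            Y′-cts = ev-closed continuous Y′ continuous-fst
            obstruction-tends : Tendsℂ obstruction (obstruction (0# , 0#))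
            obstruction-tends = plus
              (times (plus (times (const v₁) Y′-cts) (times (const (- v₂)) X′-cts))
                     (plus (times (const a) (plus (const v₁) (times continuous-snd (const ω₁))))
                           (times (const b) (plus (const v₂) (times continuous-snd (const ω₂))))))
              (times (const _) (times continuous-snd (plus (times (const a) X′-cts) (times (const b) Y′-cts))))
            value : obstruction (0# , 0#) ≈ (v₁ * ev Y′ 0# + - v₂ * ev X′ 0#) * (a * v₁ + b * v₂)
            value = solve 9 (λ a b v₁ v₂ o₁ o₂ x y m →
                (v₁ :* y :+ (:- v₂) :* x) :* (a :* (v₁ :+ con (+ 0) :* o₁) :+ b :* (v₂ :+ con (+ 0) :* o₂)) :+ m :* (con (+ 0) :* (a :* x :+ b :* y))
                := (v₁ :* y :+ (:- v₂) :* x) :* (a :* v₁ :+ b :* v₂))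
              refl a b v₁ v₂ ω₁ ω₂ (ev X′ 0#) (ev Y′ 0#) (- (v₁ * ω₂ + - (v₂) * ω₁))

          -- Division by the nonzero power t^exponent turns the relation (X, Y)(t) = ν(v + uω) into
          -- one of the same shape for (X′, Y′)(s).
          obstruction-vanishes : ∀ t s u ν → Q t s → t ≉ 0# →
            ev X t ≈ ν * (v₁ + u * ω₁) → ev Y t ≈ ν * (v₂ + u * ω₂) → obstruction (s , u) ≈ 0#
          obstruction-vanishes t s u ν q t≉0 ex ey = trans
            (+-cong (*-congʳ (+-cong (*-congˡ (multiple (Y-eq t s q) ey)) (*-congˡ (multiple (X-eq t s q) ex))))
                    (*-congˡ (*-congˡ (+-cong (*-congˡ (multiple (X-eq t s q) ex)) (*-congˡ (multiple (Y-eq t s q) ey))))))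
            (solve 8 (λ a b v₁ v₂ o₁ o₂ u m →
                (v₁ :* (m :* (v₂ :+ u :* o₂)) :+ (:- v₂) :* (m :* (v₁ :+ u :* o₁))) :* (a :* (v₁ :+ u :* o₁) :+ b :* (v₂ :+ u :* o₂))
                :+ (:- (v₁ :* o₂ :+ (:- v₂) :* o₁)) :* (u :* (a :* (m :* (v₁ :+ u :* o₁)) :+ b :* (m :* (v₂ :+ u :* o₂)))) := con (+ 0))
              refl a b v₁ v₂ ω₁ ω₂ u μ)
            where
            τ = t ^ exponent
            μ = τ ⁻¹ * ν
            multiple : ∀ {e e′ m} → e ≈ τ * e′ → e ≈ ν * m → e′ ≈ μ * m
            multiple {e} {e′} {m} p q = *-cancelˡ (^≉0 exponent t≉0) (trans (sym p) (trans q (sym (trans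
              (solve 4 (λ t i n m → t :* ((i :* n) :* m) := (t :* i) :* (n :* m)) refl τ (τ ⁻¹) ν m)
              (trans (*-congʳ (⁻¹-inverse (^≉0 exponent t≉0))) (*-identityˡ _))))))

      Surjective : ℕ → List ℂ → List ℂ → Set
      Surjective k X Y = ∀ x y → evalℂ F (x ∷ y ∷ []) ≈ c → ∃ λ t → t ≉ 0# × t ^ k * x ≈ ev X t × t ^ k * y ≈ ev Y t

      module _ {k : ℕ} {X Y : List ℂ} (surjective : Surjective k X Y)
               (E₀ : End _≈_ X Y) (E∞ : End (λ t s → t * s ≈ 1#) X Y) where
        private
          module E₀ = End E₀
          module E∞ = End E∞

        module _ (v₁ v₂ : ℂ) (T[v]≈0 : Hc v₁ v₂ 0# ≈ 0#) where
          open AtZero v₁ v₂ T[v]≈0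

          -- L = a x + b y is a linear form with L(v) ≠ 0, so L is unbounded on the points (v +
          -- uω)/z of the fibre as z tends to 0. If neither end had direction v, the parameters of
          -- these points would stay in an annulus, on which L is bounded.
          module _ (a b : ℂ) (L≉0 : a * v₁ + b * v₂ ≉ 0#)
                   (det₀≉0 : det v₁ v₂ (ev E₀.X′ 0#) (ev E₀.Y′ 0#) ≉ 0#)
                   (det∞≉0 : det v₁ v₂ (ev E∞.X′ 0#) (ev E∞.Y′ 0#) ≉ 0#) where
            private
              avoid₀ : ∃ λ δ → 0ᴿ < δ × (∀ s u → N s < δ → N u < δ → obstruction E₀ a b (s , u) ≉ 0#)
              avoid₀ = end-avoids E₀ a b det₀≉0 L≉0
              avoid∞ : ∃ λ δ → 0ᴿ < δ × (∀ s u → N s < δ → N u < δ → obstruction E∞ a b (s , u) ≉ 0#)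
              avoid∞ = end-avoids E∞ a b det∞≉0 L≉0
              δ₀ = proj₁ avoid₀
              δ∞ = proj₁ avoid∞

              L : ℂ → ℂ
              L u = a * (v₁ + u * ω₁) + b * (v₂ + u * ω₂)
              halved : ∃ λ β → 0ᴿ < β × β < N (L 0#)
              halved = half (N-pos λ z → L≉0 (trans (solve 6 (λ a b v w o p → a :* v :+ b :* w := a :* (v :+ con (+ 0) :* o) :+ b :* (w :+ con (+ 0) :* p)) refl a b v₁ v₂ ω₁ ω₂) z))
              β = proj₁ halved
              large : ∃ λ δ → 0ᴿ < δ × (∀ s u → N s < δ → N u < δ → 0ᴿ < N (L u) +ᴿ -ᴿ β)
              large = tends-pos {λ (_ , u) → N (L u) +ᴿ -ᴿ β} (tends-+ (tends-N L-tends) (tends-const (-ᴿ β))) (<⇒0<- (proj₂ (proj₂ halved)))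
                where
                open IsSubalgebra continuous
                L-tends : Tendsℂ (λ (_ , u) → L u) (L 0#)
                L-tends = plus (times (const a) (plus (const v₁) (times continuous-snd (const ω₁))))
                               (times (const b) (plus (const v₂) (times continuous-snd (const ω₂))))

              inverse₀ : ∃ λ M → 0ᴿ < M × M *ᴿ δ₀ ≈ᴿ 1ᴿ
              inverse₀ = divide 0<1 (proj₁ (proj₂ avoid₀))
              inverse∞ : ∃ λ M → 0ᴿ < M × M *ᴿ δ∞ ≈ᴿ 1ᴿ
              inverse∞ = divide 0<1 (proj₁ (proj₂ avoid∞))

              Annulus : Set
              Annulus = Σ ℂ λ t → N t ≤ proj₁ inverse∞ × N (t ⁻¹) ≤ proj₁ inverse₀

              Lφ : ℂ → ℂ
              Lφ t = a * ((t ⁻¹) ^ k * ev X t) + b * ((t ⁻¹) ^ k * ev Y t)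
              bounded : BoundedOn {Annulus} (λ (t , _) → Lφ t)
              bounded = plus (times (const a) (times (^-closed S k t⁻¹-bounded) (ev-closed S X t-bounded)))
                             (times (const b) (times (^-closed S k t⁻¹-bounded) (ev-closed S Y t-bounded)))
                where
                S = boundedOn-isSubalgebra {Annulus}
                open IsSubalgebra S
                t-bounded : BoundedOn {Annulus} proj₁
                t-bounded = proj₁ inverse∞ , <⇒≤ (proj₁ (proj₂ inverse∞)) , λ (_ , p , _) → p
                t⁻¹-bounded : BoundedOn {Annulus} (λ (t , _) → t ⁻¹)
                t⁻¹-bounded = proj₁ inverse₀ , <⇒≤ (proj₁ (proj₂ inverse₀)) , λ (_ , _ , p) → p
              M = proj₁ bounded

              0<M+1 : 0ᴿ < M +ᴿ 1ᴿ
              0<M+1 = <-resp R.refl (R.+-comm 1ᴿ M) (+-pos-nonneg 0<1 (proj₁ (proj₂ bounded)))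
              -- M bounds N(L) on the annulus and β bounds N(L(v + uω)) from below. For N z < β/(M +
              -- 1) the product N z · M drops under β.
              quotient : ∃ λ η → 0ᴿ < η × η *ᴿ (M +ᴿ 1ᴿ) ≈ᴿ β
              quotient = divide (proj₁ (proj₂ halved)) 0<M+1
              smaller : ∃ λ ε → 0ᴿ < ε × ε ≤ δ₀ × ε ≤ δ∞
              smaller = minimum (proj₁ (proj₂ avoid₀)) (proj₁ (proj₂ avoid∞))
              smallest : ∃ λ ε → 0ᴿ < ε × ε ≤ proj₁ smaller × ε ≤ proj₁ large
              smallest = minimum (proj₁ (proj₂ smaller)) (proj₁ (proj₂ large))

              bound-inverse : ∀ {x y δ M} → 0ᴿ < M → M *ᴿ δ ≈ᴿ 1ᴿ → x *ᴿ y ≈ᴿ 1ᴿ → 0ᴿ ≤ x → δ ≤ y → x ≤ M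
              bound-inverse {x} {y} {δ} {M} 0<M Mδ xy 0≤x δ≤y = ≤-resp
                (R.trans (solveᴾ 3 (λ d x m → d *ᴾ (x *ᴾ m) =ᴾ x *ᴾ (m *ᴾ d)) R.refl δ x M) (R.trans (R.*-congˡ Mδ) (R.*-identityʳ x)))
                (R.trans (solveᴾ 3 (λ y x m → y *ᴾ (x *ᴾ m) =ᴾ (x *ᴾ y) *ᴾ m) R.refl y x M) (R.trans (R.*-congʳ xy) (R.*-identityˡ M)))
                (*-monoˡ-≤ (x *ᴿ M) (*-nonneg 0≤x (<⇒≤ 0<M)) δ≤y)

              contradiction : ∀ z u → z ≉ 0# → N z < proj₁ quotient → N u < proj₁ smallest → f (z , u) ≈ 0# → ⊥
              contradiction z u z≉0 Nz< Nu< f≈0 = ST.irrefl R.refl (<-trans β< (≤-<-trans N≤ <β))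
                where
                x = z ⁻¹ * (v₁ + u * ω₁)
                y = z ⁻¹ * (v₂ + u * ω₂)
                on-curve : evalℂ F (x ∷ y ∷ []) ≈ c
                on-curve = begin
                  evalℂ F (x ∷ y ∷ [])              ≈⟨ dehomogenise x y ⟨
                  Hc x y 1#                         ≈⟨ Hc-cong refl refl (trans (*-comm _ _) (⁻¹-inverse z≉0)) ⟨
                  Hc x y (z ⁻¹ * z)                 ≈⟨ homogeneous (z ⁻¹) _ _ z ⟩
                  (z ⁻¹) ^ d * Hc (v₁ + u * ω₁) (v₂ + u * ω₂) z
                    ≈⟨ *-congˡ (x-y≈0⇒x≈y (trans (+-congˡ (solve 2 (λ c z → :- (c :* z) := (:- c) :* z) refl c (z ^ d))) f≈0)) ⟩
                  (z ⁻¹) ^ d * (c * z ^ d)          ≈⟨ solve 3 (λ i c z → i :* (c :* z) := (z :* i) :* c) refl ((z ⁻¹) ^ d) c (z ^ d) ⟩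
                  (z ^ d * (z ⁻¹) ^ d) * c          ≈⟨ *-congʳ (trans (sym (^-distrib-* z (z ⁻¹) d)) (trans (^-congˡ d (⁻¹-inverse z≉0)) (1^n≈1 d))) ⟩
                  1# * c                            ≈⟨ *-identityˡ c ⟩
                  c                                 ∎
                point : ∃ λ t → t ≉ 0# × t ^ k * x ≈ ev X t × t ^ k * y ≈ ev Y t
                point = surjective x y on-curve
                t = proj₁ point
                t≉0 : t ≉ 0#
                t≉0 = proj₁ (proj₂ point)
                ex : ev X t ≈ (t ^ k * z ⁻¹) * (v₁ + u * ω₁)
                ex = trans (sym (proj₁ (proj₂ (proj₂ point)))) (sym (*-assoc _ _ _))
                ey : ev Y t ≈ (t ^ k * z ⁻¹) * (v₂ + u * ω₂)
                ey = trans (sym (proj₂ (proj₂ (proj₂ point)))) (sym (*-assoc _ _ _))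
                Nu<′ : N u < proj₁ smaller
                Nu<′ = <-≤-trans Nu< (proj₁ (proj₂ (proj₂ smallest)))
                δ₀≤ : δ₀ ≤ N t
                δ₀≤ Nt< = proj₂ (proj₂ avoid₀) t u Nt< (<-≤-trans Nu<′ (proj₁ (proj₂ (proj₂ smaller))))
                  (obstruction-vanishes E₀ a b t t u (t ^ k * z ⁻¹) refl t≉0 ex ey)
                δ∞≤ : δ∞ ≤ N (t ⁻¹)
                δ∞≤ Nt< = proj₂ (proj₂ avoid∞) (t ⁻¹) u Nt< (<-≤-trans Nu<′ (proj₂ (proj₂ (proj₂ smaller))))
                  (obstruction-vanishes E∞ a b t (t ⁻¹) u (t ^ k * z ⁻¹) (⁻¹-inverse t≉0) t≉0 ex ey)
                NtNt⁻¹ : N t *ᴿ N (t ⁻¹) ≈ᴿ 1ᴿ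
                NtNt⁻¹ = R.trans (R.sym (N-* t (t ⁻¹))) (R.trans (N-cong (⁻¹-inverse t≉0)) N-1)
                t∈A : Annulus
                t∈A = t , bound-inverse (proj₁ (proj₂ inverse∞)) (proj₂ (proj₂ inverse∞)) NtNt⁻¹ (N-nonneg t) δ∞≤
                        , bound-inverse (proj₁ (proj₂ inverse₀)) (proj₂ (proj₂ inverse₀)) (R.trans (R.*-comm _ _) NtNt⁻¹) (N-nonneg _) δ₀≤
                component : ∀ {e m} → e ≈ (t ^ k * z ⁻¹) * m → z * ((t ⁻¹) ^ k * e) ≈ m
                component {e} {m} p = trans (*-congˡ (*-congˡ p)) (trans
                  (solve 5 (λ z i p j m → z :* (i :* ((p :* j) :* m)) := ((z :* j) :* (p :* i)) :* m) refl z ((t ⁻¹) ^ k) (t ^ k) (z ⁻¹) m)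
                  (trans (*-congʳ (*-cong (⁻¹-inverse z≉0) (trans (sym (^-distrib-* t (t ⁻¹) k)) (trans (^-congˡ k (⁻¹-inverse t≉0)) (1^n≈1 k)))))
                    (solve 1 (λ m → (con (+ 1) :* con (+ 1)) :* m := m) refl m)))
                L-eq : L u ≈ z * Lφ t
                L-eq = sym (trans (solve 5 (λ z a b p q → z :* (a :* p :+ b :* q) := a :* (z :* p) :+ b :* (z :* q)) refl z a b ((t ⁻¹) ^ k * ev X t) ((t ⁻¹) ^ k * ev Y t))
                  (+-cong (*-congˡ (component ex)) (*-congˡ (component ey))))
                β< : β < N (L u)
                β< = 0<-⇒< (proj₂ (proj₂ large) 0# u (<-resp (R.sym N-0) R.refl (proj₁ (proj₂ large)))
                              (<-≤-trans Nu< (proj₂ (proj₂ (proj₂ smallest))))) R.refl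
                N≤ : N (L u) ≤ N z *ᴿ M
                N≤ = ≤-resp (R.sym (R.trans (N-cong L-eq) (R.trans (N-* z (Lφ t)) (R.*-comm _ _)))) (R.*-comm M (N z))
                  (*-monoˡ-≤ (N z) (N-nonneg z) (proj₂ (proj₂ bounded) t∈A))
                <β : N z *ᴿ M < β
                <β = ≤-<-trans (*-monoˡ-≤ M (proj₁ (proj₂ bounded)) (<⇒≤ Nz<)) (0<-⇒< (proj₁ (proj₂ quotient))
                  (R.trans (solveᴾ 2 (λ e m → e =ᴾ e *ᴾ (m +ᴾ conᴾ (+ 1)) -ᴾ e *ᴾ m) R.refl (proj₁ quotient) M) (R.+-congʳ (proj₂ (proj₂ quotient)))))

            zero-not-at-ends : ⊥
            zero-not-at-ends =
              let (z , u , z≉0 , Nz< , Nu< , f≈0) = curve-near-zero (proj₁ smallest) (proj₁ quotient) (proj₁ (proj₂ smallest)) (proj₁ (proj₂ quotient))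
              in contradiction z u z≉0 Nz< Nu< f≈0

          -- The linear form is the first coordinate if v₁ ≠ 0 and the second one otherwise.
          covering : ¬ (v₁ ≈ 0# × v₂ ≈ 0#) →
            det v₁ v₂ (ev E₀.X′ 0#) (ev E₀.Y′ 0#) ≈ 0# ⊎ det v₁ v₂ (ev E∞.X′ 0#) (ev E∞.Y′ 0#) ≈ 0#
          covering v≉0 with em {det v₁ v₂ (ev E₀.X′ 0#) (ev E₀.Y′ 0#) ≈ 0#} | em {det v₁ v₂ (ev E∞.X′ 0#) (ev E∞.Y′ 0#) ≈ 0#} | v₁ ≟ 0#
          ... | yes p | _     | _       = inj₁ p
          ... | no  _ | yes q | _       = inj₂ q
          ... | no  p | no  q | no v₁≉0 = ⊥-elim (zero-not-at-ends 1# 0#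
                (λ z → v₁≉0 (trans (solve 2 (λ v w → v := con (+ 1) :* v :+ con (+ 0) :* w) refl v₁ v₂) z)) p q)
          ... | no  p | no  q | yes v₁≈0 = ⊥-elim (zero-not-at-ends 0# 1#
                (λ z → v≉0 (v₁≈0 , trans (solve 2 (λ v w → w := con (+ 0) :* v :+ con (+ 1) :* w) refl v₁ v₂) z)) p q)

  open PointsAtInfinity public

  -- Affine coordinates on a fibre isomorphic to 𝔸¹⋆

  module CurveParametrisation where
    -- Proportionality wrapped in a record: _∝_ unfolds and hides its arguments
    -- from unification.
    infix 4 _∥_
    record _∥_ {n : ℕ} (v w : Vec ℂ n) : Set where
      constructor proportional
      field
        unwrap : v ∝ w
    open _∥_

    ∥-refl : ∀ {n} {v : Vec ℂ n} → v ∥ v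
    ∥-refl = proportional (1# , 1≉0 , λ i → sym (*-identityˡ _))

    ∥-sym : ∀ {n} {v w : Vec ℂ n} → v ∥ w → w ∥ v
    ∥-sym {v = v} {w} (proportional (c , c≉0 , e)) = proportional (c ⁻¹ , ⁻¹≉0 c≉0 , λ i → sym (trans (*-congˡ (e i))
      (trans (solve 3 (λ i c w → i :* (c :* w) := (c :* i) :* w) refl (c ⁻¹) c (lookup w i)) (trans (*-congʳ (⁻¹-inverse c≉0)) (*-identityˡ _)))))

    ∥-trans : ∀ {n} {u v w : Vec ℂ n} → u ∥ v → v ∥ w → u ∥ w
    ∥-trans (proportional (c , c≉0 , e)) (proportional (d , d≉0 , f)) =
      proportional (c * d , *≉0 c≉0 d≉0 , λ i → trans (e i) (trans (*-congˡ (f i)) (sym (*-assoc _ _ _))))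

    ∥-affine₁ : ∀ {a b s} → (a ∷ b ∷ []) ∥ (s ∷ 1# ∷ []) → b ≉ 0# × b * s ≈ a
    ∥-affine₁ {a} {b} {s} (proportional (c , c≉0 , e)) = (λ z → c≉0 (trans (sym b≈c) z)) , trans (*-congʳ b≈c) (sym (e zero))
      where
      b≈c : b ≈ c
      b≈c = trans (e (suc zero)) (*-identityʳ c)

    ∥-affine₂ : ∀ {a b d x y} → (a ∷ b ∷ d ∷ []) ∥ (x ∷ y ∷ 1# ∷ []) → d ≉ 0# × d * x ≈ a × d * y ≈ b
    ∥-affine₂ {d = d} (proportional (c , c≉0 , e)) =
      (λ z → c≉0 (trans (sym d≈c) z)) , trans (*-congʳ d≈c) (sym (e zero)) , trans (*-congʳ d≈c) (sym (e (suc zero)))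
      where
      d≈c : d ≈ c
      d≈c = trans (e (suc (suc zero))) (*-identityʳ c)

    ∥-affine₁-≈ : ∀ {s t} → (s ∷ 1# ∷ []) ∥ (t ∷ 1# ∷ []) → s ≈ t
    ∥-affine₁-≈ p = sym (trans (sym (*-identityˡ _)) (proj₂ (∥-affine₁ p)))

    ∥-affine₂-≈ : ∀ {x y x′ y′} → (x ∷ y ∷ 1# ∷ []) ∥ (x′ ∷ y′ ∷ 1# ∷ []) → x ≈ x′ × y ≈ y′
    ∥-affine₂-≈ p = let (_ , e , f) = ∥-affine₂ p in sym (trans (sym (*-identityˡ _)) e) , sym (trans (sym (*-identityˡ _)) f)

    ≈⇒∥₂ : ∀ {x y x′ y′} → x ≈ x′ → y ≈ y′ → (x ∷ y ∷ 1# ∷ []) ∥ (x′ ∷ y′ ∷ 1# ∷ [])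
    ≈⇒∥₂ p q = proportional (1# , 1≉0 , λ { zero → trans p (sym (*-identityˡ _)) ; (suc zero) → trans q (sym (*-identityˡ _))
                                          ; (suc (suc zero)) → sym (*-identityˡ _) })

    ≈⇒∥₁ : ∀ {s t} → s ≈ t → (s ∷ 1# ∷ []) ∥ (t ∷ 1# ∷ [])
    ≈⇒∥₁ p = proportional (1# , 1≉0 , λ { zero → trans p (sym (*-identityˡ _)) ; (suc zero) → sym (*-identityˡ _) })

    -- The isomorphism in affine terms: (x, y) is the map and θ its inverse, which takes the
    -- equation as an argument because it is defined on the curve alone. `θ-regular` composes θ with
    -- a moving point (X : Y : Z), the form in which the conjugate curve arises.
    record CurveParam (F : Poly ℚ 2) (c : ℂ) : Set where
      field
        x y       : ℂ⋆ → ℂ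
        on-curve  : ∀ t → evalℂ F (x t ∷ y t ∷ []) ≈ c
        θ         : ∀ a b → evalℂ F (a ∷ b ∷ []) ≈ c → ℂ⋆
        x-θ       : ∀ a b e → x (θ a b e) ≈ a
        y-θ       : ∀ a b e → y (θ a b e) ≈ b
        injective : ∀ s t → x s ≈ x t → y s ≈ y t → proj₁ s ≈ proj₁ t
        x-cong    : ∀ s t → proj₁ s ≈ proj₁ t → x s ≈ x t
        y-cong    : ∀ s t → proj₁ s ≈ proj₁ t → y s ≈ y t
        x-regular : Regular x
        y-regular : Regular y
        θ-regular : ∀ (X Y Z : List ℂ) (a b : ℂ⋆ → ℂ) (e : ∀ t → evalℂ F (a t ∷ b t ∷ []) ≈ c) →
                    (∀ (t : ℂ⋆) → ev Z (proj₁ t) ≉ 0#) →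
                    (∀ t → ev X (proj₁ t) ≈ ev Z (proj₁ t) * a t) → (∀ t → ev Y (proj₁ t) ≈ ev Z (proj₁ t) * b t) →
                    Regular (λ t → proj₁ (θ (a t) (b t) (e t)))

    module _ {k : Pred ℂ 0ℓ} (F : Poly ℚ 2) (c : ℂ) (I : Isomorphism k 𝔸¹⋆ (Curve (mapCoeff coefficient F -const c))) where
      private
        module I = Isomorphism I
        module f = Morphism I.morphism
        module g = Morphism I.inverse

        P : Poly ℂ 2
        P = mapCoeff coefficient F -const c

        P≈ : ∀ x y → eval P (x ∷ y ∷ []) ≈ evalℂ F (x ∷ y ∷ []) - c
        P≈ x y = solve 2 (λ c e → (:- c) :* (con (+ 1) :* (con (+ 1) :* con (+ 1))) :+ e := e :- c) refl c (evalℂ F (x ∷ y ∷ []))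

        vec : ∀ {n} {X : Subset n} → ∃ X → Vec ℂ (suc n)
        vec p = proj₁ (proj₁ p)

        f-cong : ∀ p q → vec p ∥ vec q → vec (f.to p) ∥ vec (f.to q)
        f-cong p q e = proportional (f.cong p q (unwrap e))

        g-cong : ∀ p q → vec p ∥ vec q → vec (g.to p) ∥ vec (g.to q)
        g-cong p q e = proportional (g.cong p q (unwrap e))

        f∘g : ∀ q → vec (f.to (g.to q)) ∥ vec q
        f∘g q = proportional (I.inverseˡ q)

        g∘f : ∀ p → vec (g.to (f.to p)) ∥ vec p
        g∘f p = proportional (I.inverseʳ p)

        line-point : ℂ⋆ → ∃ 𝔸¹⋆
        line-point (t , t≉0) = (t ∷ 1# ∷ [] , suc zero , 1≉0) , t , t≉0 , unwrap (∥-refl {v = t ∷ 1# ∷ []})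

        curve-point : ∀ a b → evalℂ F (a ∷ b ∷ []) ≈ c → ∃ (Curve P)
        curve-point a b e = (a ∷ b ∷ 1# ∷ [] , suc (suc zero) , 1≉0) , a , b , trans (P≈ a b) (x≈y⇒x-y≈0 e) , unwrap (∥-refl {v = a ∷ b ∷ 1# ∷ []})

        curve-point-scaled : ∀ X Y Z a b → evalℂ F (a ∷ b ∷ []) ≈ c → Z ≉ 0# → X ≈ Z * a → Y ≈ Z * b → ∃ (Curve P)
        curve-point-scaled X Y Z a b e Z≉0 p q = (X ∷ Y ∷ Z ∷ [] , suc (suc zero) , Z≉0) , a , b , trans (P≈ a b) (x≈y⇒x-y≈0 e) ,
          Z , Z≉0 , λ { zero → p ; (suc zero) → q ; (suc (suc zero)) → sym (*-identityʳ Z) }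

        xφ yφ : ℂ⋆ → ℂ
        xφ t = proj₁ (proj₂ (f.to (line-point t)))
        yφ t = proj₁ (proj₂ (proj₂ (f.to (line-point t))))

        φ-∥ : ∀ t → vec (f.to (line-point t)) ∥ (xφ t ∷ yφ t ∷ 1# ∷ [])
        φ-∥ t = proportional (proj₂ (proj₂ (proj₂ (proj₂ (f.to (line-point t))))))

        parameter : ∃ (Curve P) → ℂ⋆
        parameter q = proj₁ (proj₂ (g.to q)) , proj₁ (proj₂ (proj₂ (g.to q)))

        parameter-∥ : ∀ q → vec (g.to q) ∥ (proj₁ (parameter q) ∷ 1# ∷ [])
        parameter-∥ q = proportional (proj₂ (proj₂ (proj₂ (g.to q))))

        θφ : ∀ a b → evalℂ F (a ∷ b ∷ []) ≈ c → ℂ⋆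
        θφ a b e = parameter (curve-point a b e)

        inverse-eq : ∀ a b e → xφ (θφ a b e) ≈ a × yφ (θφ a b e) ≈ b
        inverse-eq a b e = ∥-affine₂-≈ (∥-trans (∥-sym (φ-∥ (θφ a b e))) (∥-trans
          (f-cong (line-point (θφ a b e)) (g.to (curve-point a b e)) (∥-sym (parameter-∥ (curve-point a b e))))
          (f∘g (curve-point a b e))))

        φ-injective : ∀ s t → xφ s ≈ xφ t → yφ s ≈ yφ t → proj₁ s ≈ proj₁ t
        φ-injective s t p q = ∥-affine₁-≈ (∥-trans (∥-sym (g∘f (line-point s))) (∥-trans
          (g-cong (f.to (line-point s)) (f.to (line-point t)) (∥-trans (φ-∥ s) (∥-trans (≈⇒∥₂ p q) (∥-sym (φ-∥ t)))))
          (g∘f (line-point t))))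

        φ-cong : ∀ s t → proj₁ s ≈ proj₁ t → xφ s ≈ xφ t × yφ s ≈ yφ t
        φ-cong s t p = ∥-affine₂-≈ (∥-trans (∥-sym (φ-∥ s)) (∥-trans (f-cong (line-point s) (line-point t) (≈⇒∥₁ p)) (φ-∥ t)))

        zero-vector : ∀ {n} {v : Vec ℂ n} → ¬ NonZeroVec v → ∀ i → lookup v i ≈ 0#
        zero-vector ¬nz i = decidable-stable em (λ p → ¬nz (i , p))

        poly₁ : ∀ G → IsPoly (λ t → eval G (t ∷ 1# ∷ []))
        poly₁ G = eval-closed isPoly-isSubalgebra G {(λ t → t) ∷ (λ _ → 1#) ∷ []} (isPoly-var ∷ IsSubalgebra.const isPoly-isSubalgebra 1# ∷ [])

        module _ (G₀ G₁ G₂ : Poly ℂ 2) (t : ℂ⋆) where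
          value : Vec ℂ 3
          value = eval G₀ (proj₁ t ∷ 1# ∷ []) ∷ eval G₁ (proj₁ t ∷ 1# ∷ []) ∷ eval G₂ (proj₁ t ∷ 1# ∷ []) ∷ []

          -- Where the local tuple vanishes it says nothing about the map, but then both sides of
          -- the cleared equations are 0. They hold for all t, as `Regular` demands.
          φ-equations : (NonZeroVec value → value ∥ (xφ t ∷ yφ t ∷ 1# ∷ [])) →
            ev (proj₁ (poly₁ G₂)) (proj₁ t) * xφ t ≈ ev (proj₁ (poly₁ G₀)) (proj₁ t) ×
            ev (proj₁ (poly₁ G₂)) (proj₁ t) * yφ t ≈ ev (proj₁ (poly₁ G₁)) (proj₁ t)
          φ-equations values = as-lists G₀ (proj₁ (by em)) , as-lists G₁ (proj₂ (by em))
            where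
            as-lists : ∀ G {m} → eval G₂ (proj₁ t ∷ 1# ∷ []) * m ≈ eval G (proj₁ t ∷ 1# ∷ []) →
                       ev (proj₁ (poly₁ G₂)) (proj₁ t) * m ≈ ev (proj₁ (poly₁ G)) (proj₁ t)
            as-lists G p = trans (*-congʳ (sym (proj₂ (poly₁ G₂) (proj₁ t)))) (trans p (proj₂ (poly₁ G) (proj₁ t)))
            by : Dec (NonZeroVec value) → eval G₂ (proj₁ t ∷ 1# ∷ []) * xφ t ≈ eval G₀ (proj₁ t ∷ 1# ∷ []) ×
                                          eval G₂ (proj₁ t ∷ 1# ∷ []) * yφ t ≈ eval G₁ (proj₁ t ∷ 1# ∷ [])
            by (yes nz) = proj₂ (∥-affine₂ (values nz))
            by (no ¬nz) = trans (*-congʳ z₂) (trans (zeroˡ (xφ t)) (sym (zero-vector {v = value} ¬nz zero))) ,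
                          trans (*-congʳ z₂) (trans (zeroˡ (yφ t)) (sym (zero-vector {v = value} ¬nz (suc zero))))
              where
              z₂ : eval G₂ (proj₁ t ∷ 1# ∷ []) ≈ 0#
              z₂ = zero-vector {v = value} ¬nz (suc (suc zero))

        φ-regular : ∀ (t₀ : ℂ⋆) → ∃₂ λ u v → ∃ λ w → ev w (proj₁ t₀) ≉ 0# ×
          (∀ (t : ℂ⋆) → ev w (proj₁ t) * xφ t ≈ ev u (proj₁ t) × ev w (proj₁ t) * yφ t ≈ ev v (proj₁ t))
        φ-regular t₀ = let (G , _ , _ , _ , nz , rep) = f.regular (line-point t₀) in local G nz rep
          where
          local : (G : Vec (Poly ℂ 2) 3) → NonZeroVec (Vec.map (λ h → eval h (proj₁ t₀ ∷ 1# ∷ [])) G) →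
            (∀ (q : ∃ 𝔸¹⋆) (nz : NonZeroVec (Vec.map (λ h → eval h (vec q)) G)) →
               proj₁ (f.to q) ∼ (Vec.map (λ h → eval h (vec q)) G , nz)) →
            ∃₂ λ u v → ∃ λ w → ev w (proj₁ t₀) ≉ 0# ×
            (∀ (t : ℂ⋆) → ev w (proj₁ t) * xφ t ≈ ev u (proj₁ t) × ev w (proj₁ t) * yφ t ≈ ev v (proj₁ t))
          local (G₀ ∷ G₁ ∷ G₂ ∷ []) nz rep = proj₁ (poly₁ G₀) , proj₁ (poly₁ G₁) , proj₁ (poly₁ G₂) ,
              (λ z → proj₁ (∥-affine₂ (values t₀ nz)) (trans (proj₂ (poly₁ G₂) (proj₁ t₀)) z)) ,
              λ t → φ-equations G₀ G₁ G₂ t (values t)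
            where
            values : ∀ t → NonZeroVec (value G₀ G₁ G₂ t) → value G₀ G₁ G₂ t ∥ (xφ t ∷ yφ t ∷ 1# ∷ [])
            values t nz = ∥-trans (∥-sym (proportional {v = vec (f.to (line-point t))} (rep (line-point t) nz))) (φ-∥ t)

        module _ (X Y Z : List ℂ) (a b : ℂ⋆ → ℂ) (e : ∀ t → evalℂ F (a t ∷ b t ∷ []) ≈ c)
                 (Z≉0 : ∀ (t : ℂ⋆) → ev Z (proj₁ t) ≉ 0#)
                 (X-eq : ∀ t → ev X (proj₁ t) ≈ ev Z (proj₁ t) * a t)
                 (Y-eq : ∀ t → ev Y (proj₁ t) ≈ ev Z (proj₁ t) * b t) where
          scaled-vec : ℂ → Vec ℂ 3
          scaled-vec t = ev X t ∷ ev Y t ∷ ev Z t ∷ []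

          scaled : ℂ⋆ → ∃ (Curve P)
          scaled t = curve-point-scaled (ev X (proj₁ t)) (ev Y (proj₁ t)) (ev Z (proj₁ t)) (a t) (b t) (e t) (Z≉0 t) (X-eq t) (Y-eq t)

          τ : ℂ⋆ → ℂ
          τ t = proj₁ (θφ (a t) (b t) (e t))

          τ-∥ : ∀ t → vec (g.to (scaled t)) ∥ (τ t ∷ 1# ∷ [])
          τ-∥ t = ∥-trans
            (g-cong (scaled t) (curve-point (a t) (b t) (e t)) (proportional (proj₂ (proj₂ (proj₂ (proj₂ (scaled t)))))))
            (parameter-∥ (curve-point (a t) (b t) (e t)))

          poly : ∀ G → IsPoly (λ t → eval G (scaled-vec t))
          poly G = eval-closed isPoly-isSubalgebra G {ev X ∷ ev Y ∷ ev Z ∷ []} (isPoly-ev X ∷ isPoly-ev Y ∷ isPoly-ev Z ∷ [])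

          module _ (A B : Poly ℂ 3)
                   (values : ∀ (t : ℂ⋆) → NonZeroVec (eval A (scaled-vec (proj₁ t)) ∷ eval B (scaled-vec (proj₁ t)) ∷ []) →
                             (eval A (scaled-vec (proj₁ t)) ∷ eval B (scaled-vec (proj₁ t)) ∷ []) ∥ (τ t ∷ 1# ∷ [])) where
            equation : ∀ (t : ℂ⋆) → ev (proj₁ (poly B)) (proj₁ t) * τ t ≈ ev (proj₁ (poly A)) (proj₁ t)
            equation t = trans (*-congʳ (sym (proj₂ (poly B) (proj₁ t)))) (trans pair-equation (proj₂ (poly A) (proj₁ t)))
              where
              pair : Vec ℂ 2
              pair = eval A (scaled-vec (proj₁ t)) ∷ eval B (scaled-vec (proj₁ t)) ∷ []
              pair-equation : eval B (scaled-vec (proj₁ t)) * τ t ≈ eval A (scaled-vec (proj₁ t))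
              pair-equation = by em
                where
                by : Dec (NonZeroVec pair) → eval B (scaled-vec (proj₁ t)) * τ t ≈ eval A (scaled-vec (proj₁ t))
                by (yes nz) = proj₂ (∥-affine₁ (values t nz))
                by (no ¬nz) = trans (*-congʳ (zero-vector {v = pair} ¬nz (suc zero))) (trans (zeroˡ (τ t)) (sym (zero-vector {v = pair} ¬nz zero)))

          θφ-regular : Regular τ
          θφ-regular t₀ = let (G , _ , _ , _ , nz , rep) = g.regular (scaled t₀) in local G nz rep
            where
            local : (G : Vec (Poly ℂ 3) 2) → NonZeroVec (Vec.map (λ h → eval h (scaled-vec (proj₁ t₀))) G) →
              (∀ (q : ∃ (Curve P)) (nz : NonZeroVec (Vec.map (λ h → eval h (vec q)) G)) →
                 proj₁ (g.to q) ∼ (Vec.map (λ h → eval h (vec q)) G , nz)) →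
              ∃₂ λ u v → ev v (proj₁ t₀) ≉ 0# × (∀ (t : ℂ⋆) → ev v (proj₁ t) * τ t ≈ ev u (proj₁ t))
            local (A ∷ B ∷ []) nz rep = proj₁ (poly A) , proj₁ (poly B) ,
                (λ z → proj₁ (∥-affine₁ (values t₀ nz)) (trans (proj₂ (poly B) (proj₁ t₀)) z)) , equation A B values
              where
              values : ∀ (t : ℂ⋆) → NonZeroVec (eval A (scaled-vec (proj₁ t)) ∷ eval B (scaled-vec (proj₁ t)) ∷ []) →
                       (eval A (scaled-vec (proj₁ t)) ∷ eval B (scaled-vec (proj₁ t)) ∷ []) ∥ (τ t ∷ 1# ∷ [])
              values t nz = ∥-trans (∥-sym (proportional {v = vec (g.to (scaled t))} (rep (scaled t) nz))) (τ-∥ t)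

      curveParam : CurveParam F c
      curveParam = record
        { x = xφ ; y = yφ
        ; on-curve = λ t → x-y≈0⇒x≈y (trans (sym (P≈ _ _)) (proj₁ (proj₂ (proj₂ (proj₂ (f.to (line-point t)))))))
        ; θ = θφ ; x-θ = λ a b e → proj₁ (inverse-eq a b e) ; y-θ = λ a b e → proj₂ (inverse-eq a b e)
        ; injective = φ-injective
        ; x-cong = λ s t p → proj₁ (φ-cong s t p) ; y-cong = λ s t p → proj₂ (φ-cong s t p)
        ; x-regular = λ t₀ → let (u , v , w , nz , e) = φ-regular t₀ in u , w , nz , λ t → proj₁ (e t)
        ; y-regular = λ t₀ → let (u , v , w , nz , e) = φ-regular t₀ in v , w , nz , λ t → proj₂ (e t)
        ; θ-regular = θφ-regular
        }

  open CurveParametrisation public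

  -- Complex conjugation on the parameters of a real fibre

  module RealStructure where
    N-conj : ∀ z → N (conj z) ≈ᴿ N z
    N-conj z = R.trans (R.+-cong (R.*-cong (re-mk _ _) (re-mk _ _)) (R.*-cong (im-mk _ _) (im-mk _ _)))
      (solveᴾ 2 (λ a b → a *ᴾ a +ᴾ (-ᴾ b) *ᴾ (-ᴾ b) =ᴾ a *ᴾ a +ᴾ b *ᴾ b) R.refl (re z) (im z))

    N-^ : ∀ z n → N (z ^ n) ≈ᴿ N z ^ᴿ n
    N-^ z zero    = N-1
    N-^ z (suc n) = R.trans (N-* z (z ^ n)) (R.*-congˡ (N-^ z n))

    1≤^ : ∀ {q} n → 1ᴿ ≤ q → 1ᴿ ≤ q ^ᴿ n
    1≤^ zero    p = ≈⇒≤ R.refl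
    1≤^ {q} (suc n) p = ≤-trans (≤-resp R.refl (R.sym (R.*-identityˡ _)) (1≤^ n p))
      (*-monoˡ-≤ (q ^ᴿ n) (≤-trans (<⇒≤ 0<1) (1≤^ n p)) p)

    -- If q > 1 + L, then q ≥ 1 and so q ≤ q^(n+1) = L, which is absurd.
    root-bound : ∀ {q L} n → 0ᴿ ≤ L → q ^ᴿ suc n ≈ᴿ L → q ≤ 1ᴿ +ᴿ L
    root-bound {q} {L} n 0≤L e 1+L<q = ≤-resp R.refl e q≤ (<-trans (0<-⇒< 0<1 (solveᴾ 1 (λ l → conᴾ (+ 1) =ᴾ (conᴾ (+ 1) +ᴾ l) -ᴾ l) R.refl L)) 1+L<q)
      where
      1≤q : 1ᴿ ≤ q
      1≤q = ≤-trans (0≤-⇒≤ 0≤L (solveᴾ 1 (λ l → l =ᴾ (conᴾ (+ 1) +ᴾ l) -ᴾ conᴾ (+ 1)) R.refl L)) (<⇒≤ 1+L<q)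
      q≤ : q ≤ q ^ᴿ suc n
      q≤ = ≤-resp (R.*-identityˡ q) (R.*-comm _ q) (*-monoˡ-≤ q (≤-trans (<⇒≤ 0<1) 1≤q) (1≤^ n 1≤q))

    -- Applied to m = n · n, it determines the exponent of conjugation.
    2^m≈2⇒m≡1 : ∀ m → 2# ^ᴿ m ≈ᴿ 2# → m ≡ 1
    2^m≈2⇒m≡1 zero          e = ⊥-elim (<⇒≉ (0<-⇒< 0<1 (solveᴾ 0 (conᴾ (+ 1) =ᴾ (conᴾ (+ 1) +ᴾ conᴾ (+ 1)) -ᴾ conᴾ (+ 1)) R.refl)) e)
    2^m≈2⇒m≡1 (suc zero)    e = ≡.refl
    2^m≈2⇒m≡1 (suc (suc m)) e = ⊥-elim (≤-resp R.refl e bound (0<-⇒< 0<2 (solveᴾ 0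
        (conᴾ (+ 1) +ᴾ conᴾ (+ 1) =ᴾ (conᴾ (+ 1) +ᴾ conᴾ (+ 1)) *ᴾ (conᴾ (+ 1) +ᴾ conᴾ (+ 1)) -ᴾ (conᴾ (+ 1) +ᴾ conᴾ (+ 1))) R.refl)))
      where
      1≤2 : 1ᴿ ≤ 2#
      1≤2 = <⇒≤ (0<-⇒< 0<1 (solveᴾ 0 (conᴾ (+ 1) =ᴾ (conᴾ (+ 1) +ᴾ conᴾ (+ 1)) -ᴾ conᴾ (+ 1)) R.refl))
      bound : 2# *ᴿ 2# ≤ 2# ^ᴿ suc (suc m)
      bound = ≤-resp (R.*-identityˡ _) (solveᴾ 2 (λ t p → p *ᴾ (t *ᴾ t) =ᴾ t *ᴾ (t *ᴾ p)) R.refl 2# (2# ^ᴿ m))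
        (*-monoˡ-≤ (2# *ᴿ 2#) (<⇒≤ (R.*-positive 0<2 0<2)) (1≤^ m 1≤2))

    n*n≡1⇒n≡1 : ∀ n → n ℕ.* n ≡ 1 → n ≡ 1
    n*n≡1⇒n≡1 (suc zero)    e = ≡.refl
    n*n≡1⇒n≡1 (suc (suc n)) ()

    _·⋆_ : ℂ⋆ → ℂ⋆ → ℂ⋆
    (s , s≉0) ·⋆ (t , t≉0) = s * t , *≉0 s≉0 t≉0

    conj⋆ : ℂ⋆ → ℂ⋆
    conj⋆ (t , t≉0) = conj t , conj≉0 t≉0

    -- The parameter is normalised so that the positive half-line consists of real points, and both
    -- coordinates share the denominator t^k.
    record RealParam (F : Poly ℚ 2) (c : ℝ) : Set where
      field
        k          : ℕ
        X Y        : List ℂ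
        surjective : ∀ x y → evalℂ F (x ∷ y ∷ []) ≈ ι c → ∃ λ t → t ≉ 0# × t ^ k * x ≈ ev X t × t ^ k * y ≈ ev Y t
        nontrivial : ¬ ((∀ t → ev X t ≈ 0#) × (∀ t → ev Y t ≈ 0#))
        real       : ∀ r → 0ᴿ < r → ∃₂ λ (ξ η : ℝ) → evalℂ F (ι ξ ∷ ι η ∷ []) ≈ ι c ×
                       ev X (ι r) ≈ ι (r ^ᴿ k *ᴿ ξ) × ev Y (ι r) ≈ ι (r ^ᴿ k *ᴿ η)

    BoundedRealPoints : Poly ℚ 2 → ℝ → Set
    BoundedRealPoints F c = ∃ λ M → ∀ ξ η → evalℂ F (ι ξ ∷ ι η ∷ []) ≈ ι c → ξ *ᴿ ξ ≤ M × η *ᴿ η ≤ M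

    module _ (F : Poly ℚ 2) (c : ℝ) (CP : CurveParam F (ι c))
             (k : ℕ) (X Y : List ℂ)
             (X-eq : ∀ (t : ℂ⋆) → proj₁ t ^ k * CurveParam.x CP t ≈ ev X (proj₁ t))
             (Y-eq : ∀ (t : ℂ⋆) → proj₁ t ^ k * CurveParam.y CP t ≈ ev Y (proj₁ t))
             (ξ₀ η₀ : ℝ) (e₀ : evalℂ F (ι ξ₀ ∷ ι η₀ ∷ []) ≈ ι c) where
      open CurveParam CP

      private
        conj-on-curve : ∀ (t : ℂ⋆) → evalℂ F (conj (x t) ∷ conj (y t) ∷ []) ≈ ι c
        conj-on-curve t = trans (sym (evalℂ-conj F (x t ∷ y t ∷ []))) (trans (conj-cong (on-curve t)) (conj-ι c))

        -- Conjugation enters twice, before and after the parametrisation, which makes this a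
        -- regular function of t. Conjugation on parameters is σ, obtained from it by conjugating
        -- the argument once more.
        τ⋆ : ℂ⋆ → ℂ⋆
        τ⋆ t = θ (conj (x (conj⋆ t))) (conj (y (conj⋆ t))) (conj-on-curve (conj⋆ t))

        σ : ℂ⋆ → ℂ⋆
        σ t = τ⋆ (conj⋆ t)

        x-σ : ∀ t → x (σ t) ≈ conj (x t)
        x-σ t = trans (x-θ _ _ (conj-on-curve (conj⋆ (conj⋆ t)))) (conj-cong (x-cong (conj⋆ (conj⋆ t)) t (conj-involutive _)))

        y-σ : ∀ t → y (σ t) ≈ conj (y t)
        y-σ t = trans (y-θ _ _ (conj-on-curve (conj⋆ (conj⋆ t)))) (conj-cong (y-cong (conj⋆ (conj⋆ t)) t (conj-involutive _)))

        σ-involutive : ∀ t → proj₁ (σ (σ t)) ≈ proj₁ t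
        σ-involutive t = injective (σ (σ t)) t
          (trans (x-σ (σ t)) (trans (conj-cong (x-σ t)) (conj-involutive _)))
          (trans (y-σ (σ t)) (trans (conj-cong (y-σ t)) (conj-involutive _)))

        σ-fixes : ∀ ξ η e → proj₁ (σ (θ (ι ξ) (ι η) e)) ≈ proj₁ (θ (ι ξ) (ι η) e)
        σ-fixes ξ η e = injective (σ t) t
          (trans (x-σ t) (trans (conj-cong (x-θ _ _ e)) (trans (conj-ι ξ) (sym (x-θ _ _ e)))))
          (trans (y-σ t) (trans (conj-cong (y-θ _ _ e)) (trans (conj-ι η) (sym (y-θ _ _ e)))))
          where t = θ (ι ξ) (ι η) e

        -- Conjugated coefficients represent t ↦ conj(L(conj t)), so the conjugate curve has
        -- polynomial coordinates again.
        conj-list : ∀ L (f : ℂ⋆ → ℂ) → (∀ (t : ℂ⋆) → proj₁ t ^ k * f t ≈ ev L (proj₁ t)) →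
                    ∀ (t : ℂ⋆) → ev (List.map conj L) (proj₁ t) ≈ ev (shift k (1# ∷ [])) (proj₁ t) * conj (f (conj⋆ t))
        conj-list L f e t⋆@(t , _) = begin
          ev (List.map conj L) t                      ≈⟨ ev-cong (List.map conj L) (conj-involutive t) ⟨
          ev (List.map conj L) (conj (conj t))        ≈⟨ ev-conj L (conj t) ⟨
          conj (ev L (conj t))                        ≈⟨ conj-cong (e (conj⋆ t⋆)) ⟨
          conj (conj t ^ k * f (conj⋆ t⋆))            ≈⟨ conj-* _ _ ⟩
          conj (conj t ^ k) * conj (f (conj⋆ t⋆))     ≈⟨ *-congʳ (trans (conj-^ (conj t) k) (^-congˡ k (conj-involutive t))) ⟩
          t ^ k * conj (f (conj⋆ t⋆))                 ≈⟨ *-congʳ (t^k t) ⟨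
          ev (shift k (1# ∷ [])) t * conj (f (conj⋆ t⋆)) ∎
          where
          t^k : ∀ t → ev (shift k (1# ∷ [])) t ≈ t ^ k
          t^k t = trans (ev-shift k (1# ∷ []) t) (solve 2 (λ p t → p :* (con (+ 1) :+ t :* con (+ 0)) := p) refl (t ^ k) t)

        τ-regular : Regular (λ t → proj₁ (τ⋆ t))
        τ-regular = θ-regular (List.map conj X) (List.map conj Y) (shift k (1# ∷ [])) _ _ _
          (λ (t , t≉0) z → *≉0 (^≉0 k t≉0) 1≉0 (trans (solve 2 (λ p t → p :* con (+ 1) := p :* (con (+ 1) :+ t :* con (+ 0))) refl (t ^ k) t) (trans (sym (ev-shift k (1# ∷ []) t)) z)))
          (conj-list X x X-eq) (conj-list Y y Y-eq)

        laurent : IsLaurent (λ t → proj₁ (τ⋆ t))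
        laurent = regular⇒laurent _ τ-regular

        a : ℕ
        a = proj₁ laurent
        h : List ℂ
        h = proj₁ (proj₂ laurent)

        monomial : ∃₂ λ l b → l ≉ 0# × (∀ t → ev h t ≈ l * t ^ b)
        monomial = nonvanishing⇒monomial h (λ t t≉0 z →
          *≉0 (^≉0 a t≉0) (proj₂ (τ⋆ (t , t≉0))) (trans (proj₂ (proj₂ laurent) (t , t≉0)) z))

        l : ℂ
        l = proj₁ monomial
        b : ℕ
        b = proj₁ (proj₂ monomial)
        l≉0 : l ≉ 0#
        l≉0 = proj₁ (proj₂ (proj₂ monomial))

        τ-eq : ∀ (t : ℂ⋆) → proj₁ t ^ a * proj₁ (τ⋆ t) ≈ l * proj₁ t ^ b
        τ-eq t = trans (proj₂ (proj₂ laurent) t) (proj₂ (proj₂ (proj₂ monomial)) (proj₁ t))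

        ^-split : ∀ t {m n} → m ℕ.≤ n → t ^ n ≈ t ^ m * t ^ (n ℕ.∸ m)
        ^-split t {m} {n} m≤n = trans (reflexive (≡.cong (t ^_) (≡.sym (ℕ.m+[n∸m]≡n m≤n)))) (^-homo-* t m (n ℕ.∸ m))

        -- The parameter t of a real point is fixed by σ, so t · conj(t)^n = l and N(t)^(n+1) =
        -- N(l). This bounds t and 1/t, and with them both coordinates.
        module Inverting (n : ℕ) (σ-eq : ∀ (t : ℂ⋆) → proj₁ t ^ n * proj₁ (τ⋆ t) ≈ l) where
          L : ℝ
          L = N l
          0<L : 0ᴿ < L
          0<L = N-pos l≉0

          Shell : Set
          Shell = Σ ℂ λ t → N t ≤ 1ᴿ +ᴿ L × N (t ⁻¹) ≤ 1ᴿ +ᴿ L R.⁻¹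

          shell-bounded : ∀ Z → BoundedOn {Shell} (λ (t , _) → (t ⁻¹) ^ k * ev Z t)
          shell-bounded Z = times (^-closed S k t⁻¹-bounded) (ev-closed S Z t-bounded)
            where
            S = boundedOn-isSubalgebra {Shell}
            open IsSubalgebra S
            t-bounded : BoundedOn {Shell} proj₁
            t-bounded = 1ᴿ +ᴿ L , <⇒≤ (+-pos 0<1 0<L) , λ (_ , p , _) → p
            t⁻¹-bounded : BoundedOn {Shell} (λ (t , _) → t ⁻¹)
            t⁻¹-bounded = 1ᴿ +ᴿ L R.⁻¹ , <⇒≤ (+-pos 0<1 (⁻¹-pos 0<L)) , λ (_ , _ , p) → p

          in-shell : ∀ (t : ℂ⋆) → proj₁ (σ t) ≈ proj₁ t → N (proj₁ t) ≤ 1ᴿ +ᴿ L × N (proj₁ t ⁻¹) ≤ 1ᴿ +ᴿ L R.⁻¹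
          in-shell t⋆@(t , t≉0) fixed = root-bound n (<⇒≤ 0<L) power , root-bound n (<⇒≤ (⁻¹-pos 0<L)) inverse-power
            where
            power : N t ^ᴿ suc n ≈ᴿ L
            power = R.trans (R.*-comm _ _) (R.trans (R.*-congʳ (R.sym (R.trans (N-^ (conj t) n) (RE.^-congˡ n (N-conj t)))))
              (R.trans (R.sym (N-* _ _)) (N-cong (trans (*-congˡ (sym fixed)) (σ-eq (conj⋆ t⋆))))))
            1^ᴿ : ∀ n → 1ᴿ ^ᴿ n ≈ᴿ 1ᴿ
            1^ᴿ zero    = R.refl
            1^ᴿ (suc n) = R.trans (R.*-identityˡ _) (1^ᴿ n)
            product : N t *ᴿ N (t ⁻¹) ≈ᴿ 1ᴿ
            product = R.trans (R.sym (N-* t (t ⁻¹))) (R.trans (N-cong (⁻¹-inverse t≉0)) N-1)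
            q : ℝ
            q = N (t ⁻¹) ^ᴿ suc n
            Lq≈1 : L *ᴿ q ≈ᴿ 1ᴿ
            Lq≈1 = R.trans (R.*-congʳ (R.sym power)) (R.trans (R.sym (RE.^-distrib-* (N t) (N (t ⁻¹)) (suc n)))
              (R.trans (RE.^-congˡ (suc n) product) (1^ᴿ (suc n))))
            inverse-power : N (t ⁻¹) ^ᴿ suc n ≈ᴿ L R.⁻¹
            inverse-power = R.trans (R.sym (R.*-identityˡ q)) (R.trans (R.*-congʳ (R.sym (R.⁻¹-inverseʳ (0<⇒≉0 0<L))))
              (R.trans (solveᴾ 3 (λ l i q → (l *ᴾ i) *ᴾ q =ᴾ i *ᴾ (l *ᴾ q)) R.refl L (L R.⁻¹) q) (R.trans (R.*-congˡ Lq≈1) (R.*-identityʳ _))))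

          recover : ∀ (t : ℂ⋆) Z {m} → proj₁ t ^ k * m ≈ ev Z (proj₁ t) → (proj₁ t ⁻¹) ^ k * ev Z (proj₁ t) ≈ m
          recover (t , t≉0) Z {m} p = trans (*-congˡ (sym p)) (trans (solve 3 (λ i p m → i :* (p :* m) := (p :* i) :* m) refl ((t ⁻¹) ^ k) (t ^ k) m)
            (trans (*-congʳ (trans (sym (^-distrib-* t (t ⁻¹) k)) (trans (^-congˡ k (⁻¹-inverse t≉0)) (1^n≈1 k)))) (*-identityˡ m)))

          bounded-real-points : BoundedRealPoints F c
          bounded-real-points = M₁ +ᴿ M₂ , λ ξ η e →
            let t = θ (ι ξ) (ι η) e
                s : Shell
                s = proj₁ t , in-shell t (σ-fixes ξ η e)
                ξ≈ = trans (recover t X (X-eq t)) (x-θ _ _ e)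
                η≈ = trans (recover t Y (Y-eq t)) (y-θ _ _ e)
            in ≤-trans (≤-resp (R.trans (N-cong ξ≈) (N-ι ξ)) R.refl (proj₂ (proj₂ (shell-bounded X)) s))
                       (0≤-⇒≤ (proj₁ (proj₂ (shell-bounded Y))) (solveᴾ 2 (λ a b → b =ᴾ (a +ᴾ b) -ᴾ a) R.refl M₁ M₂)) ,
               ≤-trans (≤-resp (R.trans (N-cong η≈) (N-ι η)) R.refl (proj₂ (proj₂ (shell-bounded Y)) s))
                       (0≤-⇒≤ (proj₁ (proj₂ (shell-bounded X))) (solveᴾ 2 (λ a b → a =ᴾ (a +ᴾ b) -ᴾ b) R.refl M₁ M₂))
            where
            M₁ = proj₁ (shell-bounded X)
            M₂ = proj₁ (shell-bounded Y)

        -- t₀ is the parameter of a real point. On the ray through it conjugation is t₀ r ↦ t₀ r^n;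
        -- being an involution it satisfies r^(n·n) = r. At r = 2 this forces n = 1, and then every
        -- point of the ray is fixed.
        module Preserving (n : ℕ) (σ-eq : ∀ (t : ℂ⋆) → proj₁ (τ⋆ t) ≈ l * proj₁ t ^ n) where
          t₀ : ℂ⋆
          t₀ = θ (ι ξ₀) (ι η₀) e₀

          ray : ∀ r → 0ᴿ < r → ℂ⋆
          ray r 0<r = t₀ ·⋆ (ι r , ι≉0 (0<⇒≉0 0<r))

          σ-cong : ∀ s t → proj₁ s ≈ proj₁ t → proj₁ (σ s) ≈ proj₁ (σ t)
          σ-cong s t p = trans (σ-eq (conj⋆ s)) (trans (*-congˡ (^-congˡ n (conj-cong p))) (sym (σ-eq (conj⋆ t))))

          σ-ray : ∀ r 0<r → proj₁ (σ (ray r 0<r)) ≈ proj₁ t₀ * ι (r ^ᴿ n)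
          σ-ray r 0<r = begin
            proj₁ (σ (ray r 0<r))                           ≈⟨ σ-eq (conj⋆ (ray r 0<r)) ⟩
            l * conj (proj₁ t₀ * ι r) ^ n                   ≈⟨ *-congˡ (^-congˡ n (trans (conj-* _ _) (*-congˡ (conj-ι r)))) ⟩
            l * (conj (proj₁ t₀) * ι r) ^ n                 ≈⟨ *-congˡ (^-distrib-* _ _ n) ⟩
            l * (conj (proj₁ t₀) ^ n * ι r ^ n)             ≈⟨ *-assoc _ _ _ ⟨
            (l * conj (proj₁ t₀) ^ n) * ι r ^ n             ≈⟨ *-cong (trans (sym (σ-eq (conj⋆ t₀))) (σ-fixes ξ₀ η₀ e₀)) (ι-^ r n) ⟩
            proj₁ t₀ * ι (r ^ᴿ n)                           ∎

          n≡1 : n ≡ 1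
          n≡1 = n*n≡1⇒n≡1 n (2^m≈2⇒m≡1 (n ℕ.* n) (R.trans (R.sym (RE.^-assocʳ 2# n n)) (ι-injective (*-cancelˡ (proj₂ t₀) (begin
            proj₁ t₀ * ι ((2# ^ᴿ n) ^ᴿ n)                   ≈⟨ σ-ray (2# ^ᴿ n) (^-pos n 0<2) ⟨
            proj₁ (σ (ray (2# ^ᴿ n) (^-pos n 0<2)))         ≈⟨ σ-cong (σ (ray 2# 0<2)) (ray (2# ^ᴿ n) (^-pos n 0<2)) (σ-ray 2# 0<2) ⟨
            proj₁ (σ (σ (ray 2# 0<2)))                      ≈⟨ σ-involutive (ray 2# 0<2) ⟩
            proj₁ t₀ * ι 2#                                 ∎)))))

          ray-fixed : ∀ r 0<r → proj₁ (σ (ray r 0<r)) ≈ proj₁ (ray r 0<r)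
          ray-fixed r 0<r = trans (σ-ray r 0<r) (*-congˡ (ι-cong (R.trans (R.reflexive (≡.cong (r ^ᴿ_) n≡1)) (R.*-identityʳ r))))

          x-real : ∀ r 0<r → im (x (ray r 0<r)) ≈ᴿ 0ᴿ
          x-real r 0<r = conj-fixed⇒im≈0 (trans (sym (x-σ (ray r 0<r))) (x-cong _ _ (ray-fixed r 0<r)))

          y-real : ∀ r 0<r → im (y (ray r 0<r)) ≈ᴿ 0ᴿ
          y-real r 0<r = conj-fixed⇒im≈0 (trans (sym (y-σ (ray r 0<r))) (y-cong _ _ (ray-fixed r 0<r)))

          -- The coefficients of Z(t₀ t)/t₀^k: the parameter 1 now belongs to the known real point,
          -- and t^k remains the denominator.
          rescale : List ℂ → List ℂ
          rescale Z = proj₁ (rescaled Z)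
            where
            rescaled : ∀ Z → IsPoly (λ t → (proj₁ t₀ ^ k) ⁻¹ * ev Z (proj₁ t₀ * t))
            rescaled Z = times (const _) (ev-closed isPoly-isSubalgebra Z (times (const (proj₁ t₀)) isPoly-var))
              where open IsSubalgebra isPoly-isSubalgebra

          rescale-ev : ∀ Z t → (proj₁ t₀ ^ k) ⁻¹ * ev Z (proj₁ t₀ * t) ≈ ev (rescale Z) t
          rescale-ev Z t = proj₂ (times (const _) (ev-closed isPoly-isSubalgebra Z (times (const (proj₁ t₀)) isPoly-var))) t
            where open IsSubalgebra isPoly-isSubalgebra

          rescale-eq : ∀ Z (f : ℂ⋆ → ℂ) → (∀ (t : ℂ⋆) → proj₁ t ^ k * f t ≈ ev Z (proj₁ t)) →
                       ∀ (t : ℂ⋆) → proj₁ t ^ k * f (t₀ ·⋆ t) ≈ ev (rescale Z) (proj₁ t)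
          rescale-eq Z f e t⋆@(t , _) = sym (begin
            ev (rescale Z) t                                 ≈⟨ rescale-ev Z t ⟨
            (proj₁ t₀ ^ k) ⁻¹ * ev Z (proj₁ t₀ * t)          ≈⟨ *-congˡ (e (t₀ ·⋆ t⋆)) ⟨
            (proj₁ t₀ ^ k) ⁻¹ * ((proj₁ t₀ * t) ^ k * m)     ≈⟨ *-congˡ (*-congʳ (^-distrib-* (proj₁ t₀) t k)) ⟩
            (proj₁ t₀ ^ k) ⁻¹ * ((proj₁ t₀ ^ k * t ^ k) * m)
              ≈⟨ solve 4 (λ i p t m → i :* ((p :* t) :* m) := (p :* i) :* (t :* m)) refl ((proj₁ t₀ ^ k) ⁻¹) (proj₁ t₀ ^ k) (t ^ k) m ⟩
            (proj₁ t₀ ^ k * (proj₁ t₀ ^ k) ⁻¹) * (t ^ k * m) ≈⟨ *-congʳ (⁻¹-inverse (^≉0 k (proj₂ t₀))) ⟩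
            1# * (t ^ k * m)                                 ≈⟨ *-identityˡ _ ⟩
            t ^ k * m                                        ∎)
            where m = f (t₀ ·⋆ t⋆)

          real-param : RealParam F c
          real-param = record
            { k = k ; X = rescale X ; Y = rescale Y
            ; surjective = λ u v e → let s = s⋆ u v e in proj₁ s , proj₂ s ,
                trans (*-congˡ (trans (sym (x-θ u v e)) (x-cong (θ u v e) (t₀ ·⋆ s) (undo (θ u v e))))) (rescale-eq X x X-eq s) ,
                trans (*-congˡ (trans (sym (y-θ u v e)) (y-cong (θ u v e) (t₀ ·⋆ s) (undo (θ u v e))))) (rescale-eq Y y Y-eq s)
            ; nontrivial = λ (zx , zy) → one≉two (injective (t₀ ·⋆ 1⋆) (t₀ ·⋆ 2⋆)
                (trans (vanish X x X-eq zx 1⋆) (sym (vanish X x X-eq zx 2⋆)))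
                (trans (vanish Y y Y-eq zy 1⋆) (sym (vanish Y y Y-eq zy 2⋆))))
            ; real = λ r 0<r → re (x (ray r 0<r)) , re (y (ray r 0<r)) ,
                trans (evalℂ-cong F (sym (im≈0⇒ι (x-real r 0<r)) ∷ sym (im≈0⇒ι (y-real r 0<r)) ∷ [])) (on-curve (ray r 0<r)) ,
                real-coordinate X x X-eq r 0<r (x-real r 0<r) ,
                real-coordinate Y y Y-eq r 0<r (y-real r 0<r)
            }
            where
            undo : ∀ (t : ℂ⋆) → proj₁ t ≈ proj₁ t₀ * (proj₁ t * proj₁ t₀ ⁻¹)
            undo (t , _) = sym (trans (solve 3 (λ s t i → s :* (t :* i) := t :* (s :* i)) refl (proj₁ t₀) t (proj₁ t₀ ⁻¹))
              (trans (*-congˡ (⁻¹-inverse (proj₂ t₀))) (*-identityʳ t)))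
            s⋆ : ∀ u v → evalℂ F (u ∷ v ∷ []) ≈ ι c → ℂ⋆
            s⋆ u v e = θ u v e ·⋆ (proj₁ t₀ ⁻¹ , ⁻¹≉0 (proj₂ t₀))
            1⋆ 2⋆ : ℂ⋆
            1⋆ = 1# , 1≉0
            2⋆ = ι 2# , ι≉0 (0<⇒≉0 0<2)
            one≉two : proj₁ t₀ * 1# ≉ proj₁ t₀ * ι 2#
            one≉two p = <⇒≉ (0<-⇒< 0<1 (solveᴾ 0 (conᴾ (+ 1) =ᴾ (conᴾ (+ 1) +ᴾ conᴾ (+ 1)) -ᴾ conᴾ (+ 1)) R.refl))
              (ι-injective (trans ι-1 (*-cancelˡ (proj₂ t₀) p)))
            vanish : ∀ Z (f : ℂ⋆ → ℂ) → (∀ (t : ℂ⋆) → proj₁ t ^ k * f t ≈ ev Z (proj₁ t)) →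
                     (∀ t → ev (rescale Z) t ≈ 0#) → ∀ t → f (t₀ ·⋆ t) ≈ 0#
            vanish Z f e z t = *-cancelˡ (^≉0 k (proj₂ t)) (trans (rescale-eq Z f e t) (trans (z (proj₁ t)) (sym (zeroʳ _))))
            real-coordinate : ∀ Z (f : ℂ⋆ → ℂ) → (∀ (t : ℂ⋆) → proj₁ t ^ k * f t ≈ ev Z (proj₁ t)) →
              ∀ r 0<r → im (f (ray r 0<r)) ≈ᴿ 0ᴿ → ev (rescale Z) (ι r) ≈ ι (r ^ᴿ k *ᴿ re (f (ray r 0<r)))
            real-coordinate Z f e r 0<r p = trans (sym (rescale-eq Z f e (ι r , ι≉0 (0<⇒≉0 0<r))))
              (trans (*-cong (ι-^ r k) (im≈0⇒ι p)) (sym (ι-* _ _)))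

      real-dichotomy : BoundedRealPoints F c ⊎ RealParam F c
      real-dichotomy = [ (λ a≤b → inj₂ (Preserving.real-param (b ℕ.∸ a) (λ t → *-cancelˡ (^≉0 a (proj₂ t))
            (trans (τ-eq t) (trans (*-congˡ (^-split (proj₁ t) a≤b)) (solve 3 (λ l p q → l :* (p :* q) := p :* (l :* q)) refl l (proj₁ t ^ a) (proj₁ t ^ (b ℕ.∸ a))))))))
        , (λ b≤a → inj₁ (Inverting.bounded-real-points (a ℕ.∸ b) (λ t → *-cancelˡ (^≉0 b (proj₂ t))
            (trans (sym (*-assoc _ _ _)) (trans (*-congʳ (sym (^-split (proj₁ t) b≤a))) (trans (τ-eq t) (*-comm _ _)))))))
        ]′ (ℕ.≤-total a b)

    -- The Laurent forms of x and y come with different powers of t; both lists are shifted to the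
    -- common power kx + ky.
    dichotomy : ∀ F c → CurveParam F (ι c) → ∀ ξ₀ η₀ → evalℂ F (ι ξ₀ ∷ ι η₀ ∷ []) ≈ ι c → BoundedRealPoints F c ⊎ RealParam F c
    dichotomy F c CP = real-dichotomy F c CP (kx ℕ.+ ky) (shift ky (proj₁ (proj₂ laurent-x))) (shift kx (proj₁ (proj₂ laurent-y)))
      (λ t → trans (*-congʳ (trans (^-homo-* (proj₁ t) kx ky) (*-comm _ _))) (common t ky (proj₁ (proj₂ laurent-x)) (proj₂ (proj₂ laurent-x) t)))
      (λ t → trans (*-congʳ (^-homo-* (proj₁ t) kx ky)) (common t kx (proj₁ (proj₂ laurent-y)) (proj₂ (proj₂ laurent-y) t)))
      where
      open CurveParam CP
      laurent-x : IsLaurent x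
      laurent-x = regular⇒laurent x x-regular
      laurent-y : IsLaurent y
      laurent-y = regular⇒laurent y y-regular
      kx = proj₁ laurent-x
      ky = proj₁ laurent-y
      common : ∀ (t : ℂ⋆) j Z {p m} → p * m ≈ ev Z (proj₁ t) → (proj₁ t ^ j * p) * m ≈ ev (shift j Z) (proj₁ t)
      common t j Z e = trans (*-assoc _ _ _) (trans (*-congˡ e) (sym (ev-shift j Z (proj₁ t))))

  open RealStructure public

  -- The points φ̃(a) and φ̃(b) lie at infinity

  module Extension where
    open _∥_

    det-∥ : ∀ {a b x y} → (a ∷ b ∷ []) ∥ (x ∷ y ∷ []) → det a b x y ≈ 0#
    det-∥ {a} {b} {x} {y} (proportional (c , _ , e)) = trans (+-cong (*-congʳ (e zero)) (*-congʳ (-‿cong (e (suc zero)))))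
      (solve 3 (λ c x y → (c :* x) :* y :+ (:- (c :* y)) :* x := con (+ 0)) refl c x y)

    private
      scalar : ∀ {a b x y} → x ≉ 0# → ¬ (a ≈ 0# × b ≈ 0#) → a * y ≈ b * x → ∃ λ c → c ≉ 0# × a ≈ c * x × b ≈ c * y
      scalar {a} {b} {x} {y} x≉0 ab≉0 e = a * x ⁻¹ , *≉0 a≉0 (⁻¹≉0 x≉0) , first , *-cancelˡ x≉0 (begin
          x * b                ≈⟨ *-comm x b ⟩
          b * x                ≈⟨ e ⟨
          a * y                ≈⟨ *-congʳ first ⟩
          (a * x ⁻¹ * x) * y   ≈⟨ solve 4 (λ a i x y → ((a :* i) :* x) :* y := x :* ((a :* i) :* y)) refl a (x ⁻¹) x y ⟩
          x * (a * x ⁻¹ * y)   ∎)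
        where
        a≉0 : a ≉ 0#
        a≉0 z = ab≉0 (z , *-cancelˡ x≉0 (trans (*-comm x b) (trans (sym e) (trans (*-congʳ z) (trans (zeroˡ y) (sym (zeroʳ x)))))))
        first : a ≈ a * x ⁻¹ * x
        first = sym (trans (*-assoc a (x ⁻¹) x) (trans (*-congˡ (trans (*-comm _ _) (⁻¹-inverse x≉0))) (*-identityʳ a)))

    det≈0⇒scalar : ∀ {a b x y} → ¬ (a ≈ 0# × b ≈ 0#) → ¬ (x ≈ 0# × y ≈ 0#) → det a b x y ≈ 0# →
                   ∃ λ c → c ≉ 0# × a ≈ c * x × b ≈ c * y
    det≈0⇒scalar {a} {b} {x} {y} ab≉0 xy≉0 e = by (x ≟ 0#)
      where
      cross : a * y ≈ b * x
      cross = x-y≈0⇒x≈y (trans (+-congˡ (solve 2 (λ b x → :- (b :* x) := (:- b) :* x) refl b x)) e)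
      by : Dec (x ≈ 0#) → ∃ λ c → c ≉ 0# × a ≈ c * x × b ≈ c * y
      by (no x≉0)  = scalar x≉0 ab≉0 cross
      by (yes x≈0) = let (c , c≉0 , p , q) = scalar {b} {a} {y} {x} (λ y≈0 → xy≉0 (x≈0 , y≈0)) (λ (p , q) → ab≉0 (q , p)) (sym cross)
                     in c , c≉0 , q , p

    nonzero₂ : ∀ {a b} → NonZeroVec (a ∷ b ∷ []) → ¬ (a ≈ 0# × b ≈ 0#)
    nonzero₂ (zero , nz)     (p , _) = nz p
    nonzero₂ (suc zero , nz) (_ , q) = nz q

    module _ {k : Pred ℂ 0ℓ} {F : Poly ℚ 2} (T : TopForm F) (a b : ℙ 1)
             (φ : Isomorphism k (ℙ¹∖ a b) (Curve (mapCoeff coefficient F)))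
             (φ̃ : Morphism k {1} {2} U U)
             (extends : ∀ (p : ∃ (ℙ¹∖ a b)) → Morphism.apply φ̃ (proj₁ p , tt) ∼ Morphism.apply (Isomorphism.morphism φ) p) where
      private
        module φ = Isomorphism φ
        module f = Morphism φ.morphism
        module g = Morphism φ.inverse
        module φ̃ = Morphism φ̃
      open TopForm T
      open Covering T 0# using (Hc; Hc-cong)

      vec : ∀ {n} {X : Subset n} → ∃ X → Vec ℂ (suc n)
      vec p = proj₁ (proj₁ p)

      private
        coordinate : ℙ 1 → ℂ × ℂ
        coordinate (x ∷ y ∷ [] , _) = x , y

        coordinate-nonzero : ∀ p → ¬ (proj₁ (coordinate p) ≈ 0# × proj₂ (coordinate p) ≈ 0#)
        coordinate-nonzero (x ∷ y ∷ [] , nz) = nonzero₂ nz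

      -- e stands for a or for b, both of which the domain of φ avoids.
      module AtEnd (e₁ e₂ : ℂ) (nz : NonZeroVec (e₁ ∷ e₂ ∷ []))
                   (avoided : ∀ (p : ∃ (ℙ¹∖ a b)) → ¬ (vec p ∥ (e₁ ∷ e₂ ∷ []))) where
        end : ∃ {A = ℙ 1} U
        end = (e₁ ∷ e₂ ∷ [] , nz) , tt

        Conclusion : Set
        Conclusion = ∃₂ λ p₁ p₂ → vec (φ̃.to end) ∥ (p₁ ∷ p₂ ∷ 0# ∷ []) × ¬ (p₁ ≈ 0# × p₂ ≈ 0#) × Hc p₁ p₂ 0# ≈ 0#

        -- The line e + s h gives an affine parameter s around e, with e at s = 0. A limit at e
        -- becomes a polynomial identity in s, evaluated at 0.
        module Transversal (h₁ h₂ : ℂ) (δ≉0 : det e₁ e₂ h₁ h₂ ≉ 0#) where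
          ℓ₁ ℓ₂ : ℂ → ℂ
          ℓ₁ s = e₁ + s * h₁
          ℓ₂ s = e₂ + s * h₂

          ℓ₁-poly : IsPoly ℓ₁
          ℓ₁-poly = plus (const e₁) (times isPoly-var (const h₁))
            where open IsSubalgebra isPoly-isSubalgebra
          ℓ₂-poly : IsPoly ℓ₂
          ℓ₂-poly = plus (const e₂) (times isPoly-var (const h₂))
            where open IsSubalgebra isPoly-isSubalgebra

          ℓ-det : ∀ s → det (ℓ₁ s) (ℓ₂ s) h₁ h₂ ≈ det e₁ e₂ h₁ h₂
          ℓ-det s = solve 5 (λ e f h k s → (e :+ s :* h) :* k :+ (:- (f :+ s :* k)) :* h := e :* k :+ (:- f) :* h) refl e₁ e₂ h₁ h₂ s

          ℓ-nonzero : ∀ s → NonZeroVec (ℓ₁ s ∷ ℓ₂ s ∷ [])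
          ℓ-nonzero s = decidable-stable em λ ¬nz → δ≉0 (trans (sym (ℓ-det s)) (trans
            (+-cong (*-congʳ (decidable-stable em (λ p → ¬nz (zero , p))))
                    (*-congʳ (-‿cong (decidable-stable em (λ p → ¬nz (suc zero , p))))))
            (solve 2 (λ h k → con (+ 0) :* k :+ (:- con (+ 0)) :* h := con (+ 0)) refl h₁ h₂)))

          ℓ-point : ℂ → ℙ 1
          ℓ-point s = ℓ₁ s ∷ ℓ₂ s ∷ [] , ℓ-nonzero s

          -- The determinant of p with ℓ(s), a polynomial in s whose nonvanishing keeps ℓ(s) away
          -- from p.
          away : ℙ 1 → ℂ → ℂ
          away p s = proj₁ (coordinate p) * ℓ₂ s + (- proj₂ (coordinate p)) * ℓ₁ s

          away-poly : ∀ p → IsPoly (away p)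
          away-poly p = plus (times (const _) ℓ₂-poly) (times (const _) ℓ₁-poly)
            where open IsSubalgebra isPoly-isSubalgebra

          -- If the determinant vanished at s = 0 and s = 1, then p would have determinant 0 with
          -- the independent vectors e and e + h, hence be 0.
          away-nonzero : ∀ p → ∃ λ s → away p s ≉ 0#
          away-nonzero p = decidable-stable em λ none →
            let at0 = decidable-stable em (λ q → none (0# , q))
                at1 = decidable-stable em (λ q → none (1# , q))
                x = proj₁ (coordinate p)
                y = proj₂ (coordinate p)
                zero-if : ∀ {m} → m * det e₁ e₂ h₁ h₂ ≈ 0# → m ≈ 0#
                zero-if q = [ (λ z → z) , (λ z → ⊥-elim (δ≉0 z)) ]′ (*-integral q)
            in coordinate-nonzero p
              ( zero-if (trans (solve 6 (λ x y e f h k →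
                    x :* (e :* k :+ (:- f) :* h) := e :* ((x :* (f :+ con (+ 1) :* k) :+ (:- y) :* (e :+ con (+ 1) :* h)) :- (x :* (f :+ con (+ 0) :* k) :+ (:- y) :* (e :+ con (+ 0) :* h)))
                                                     :- h :* (x :* (f :+ con (+ 0) :* k) :+ (:- y) :* (e :+ con (+ 0) :* h))) refl x y e₁ e₂ h₁ h₂)
                  (vanish e₁ h₁ at0 at1))
              , zero-if (trans (solve 6 (λ x y e f h k →
                    y :* (e :* k :+ (:- f) :* h) := f :* ((x :* (f :+ con (+ 1) :* k) :+ (:- y) :* (e :+ con (+ 1) :* h)) :- (x :* (f :+ con (+ 0) :* k) :+ (:- y) :* (e :+ con (+ 0) :* h)))
                                                     :- k :* (x :* (f :+ con (+ 0) :* k) :+ (:- y) :* (e :+ con (+ 0) :* h))) refl x y e₁ e₂ h₁ h₂)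
                  (vanish e₂ h₂ at0 at1)))
            where
            vanish : ∀ m n {u v} → u ≈ 0# → v ≈ 0# → m * (v - u) - n * u ≈ 0#
            vanish m n p q = trans (+-cong (*-congˡ (+-cong q (-‿cong p))) (-‿cong (*-congˡ p)))
              (solve 2 (λ m n → m :* (con (+ 0) :- con (+ 0)) :- n :* con (+ 0) := con (+ 0)) refl m n)

          good : ℂ → ℂ
          good s = away a s * away b s

          away⇒≁ : ∀ p s → away p s ≉ 0# → ¬ (ℓ-point s ∼ p)
          away⇒≁ (x ∷ y ∷ [] , _) s nz e = nz (trans (solve 4 (λ x y u v → x :* v :+ (:- y) :* u := :- (u :* y :+ (:- v) :* x)) refl x y (ℓ₁ s) (ℓ₂ s))
            (trans (-‿cong (det-∥ (proportional {v = ℓ₁ s ∷ ℓ₂ s ∷ []} {w = x ∷ y ∷ []} e))) (solve 0 (:- con (+ 0) := con (+ 0)) refl)))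

          on-line : ∀ s → good s ≉ 0# → ∃ (ℙ¹∖ a b)
          on-line s nz = ℓ-point s , away⇒≁ a s (λ z → nz (trans (*-congʳ z) (zeroˡ _))) , away⇒≁ b s (λ z → nz (trans (*-congˡ z) (zeroʳ _)))

          module Local (G₀ G₁ G₂ : Poly ℂ 2)
                       (nz₀ : NonZeroVec (eval G₀ (e₁ ∷ e₂ ∷ []) ∷ eval G₁ (e₁ ∷ e₂ ∷ []) ∷ eval G₂ (e₁ ∷ e₂ ∷ []) ∷ []))
                       (rep : ∀ (y : ∃ {A = ℙ 1} U) → NonZeroVec (eval G₀ (vec y) ∷ eval G₁ (vec y) ∷ eval G₂ (vec y) ∷ []) →
                              vec (φ̃.to y) ∥ (eval G₀ (vec y) ∷ eval G₁ (vec y) ∷ eval G₂ (vec y) ∷ [])) where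
            G : Fin 3 → Poly ℂ 2
            G i = lookup (G₀ ∷ G₁ ∷ G₂ ∷ []) i

            γ : Fin 3 → ℂ → ℂ
            γ i s = eval (G i) (ℓ₁ s ∷ ℓ₂ s ∷ [])

            γ-poly : ∀ i → IsPoly (γ i)
            γ-poly i = eval-closed isPoly-isSubalgebra (G i) {ℓ₁ ∷ ℓ₂ ∷ []} (ℓ₁-poly ∷ ℓ₂-poly ∷ [])

            γ₀ γ₁ γ₂ : ℂ → ℂ
            γ₀ = γ zero
            γ₁ = γ (suc zero)
            γ₂ = γ (suc (suc zero))

            γ-at-0 : ∀ i → γ i 0# ≈ eval (G i) (e₁ ∷ e₂ ∷ [])
            γ-at-0 i = eval-cong (G i) (solve 2 (λ e h → e :+ con (+ 0) :* h := e) refl e₁ h₁ ∷ solve 2 (λ e h → e :+ con (+ 0) :* h := e) refl e₂ h₂ ∷ [])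

            index : ∃ λ i → γ i 0# ≉ 0#
            index = as-γ nz₀
              where
              as-γ : NonZeroVec (eval G₀ (e₁ ∷ e₂ ∷ []) ∷ eval G₁ (e₁ ∷ e₂ ∷ []) ∷ eval G₂ (e₁ ∷ e₂ ∷ []) ∷ []) → ∃ λ i → γ i 0# ≉ 0#
              as-γ (zero , nz)             = zero , λ z → nz (trans (sym (γ-at-0 zero)) z)
              as-γ (suc zero , nz)         = suc zero , λ z → nz (trans (sym (γ-at-0 (suc zero))) z)
              as-γ (suc (suc zero) , nz)   = suc (suc zero) , λ z → nz (trans (sym (γ-at-0 (suc (suc zero)))) z)

            ι₀ : Fin 3
            ι₀ = proj₁ index

            -- Where this is nonzero, ℓ(s) lies in the domain of φ and the tuple chosen at e
            -- represents φ̃ at ℓ(s).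
            test : ℂ → ℂ
            test s = good s * γ ι₀ s

            test-poly : IsPoly test
            test-poly = times (times (away-poly a) (away-poly b)) (γ-poly ι₀)
              where open IsSubalgebra isPoly-isSubalgebra

            test-nonzero : ∃ λ s → test s ≉ 0#
            test-nonzero =
              let (Ba , na) = bound (away-poly a) (away-nonzero a)
                  (Bb , nb) = bound (away-poly b) (away-nonzero b)
                  (Bγ , nγ) = bound (γ-poly ι₀) (0# , proj₂ index)
                  (s , Ba<s , Bb<s) = above Ba Bb
                  (r , s<r , Bγ<r) = above s Bγ
              in ι r , *≉0 (*≉0 (na r (<-trans Ba<s s<r)) (nb r (<-trans Bb<s s<r))) (nγ r Bγ<r)
              where
              bound : ∀ {f} → IsPoly f → (∃ λ s → f s ≉ 0#) → ∃ λ B → ∀ x → B < x → f (ι x) ≉ 0#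
              bound (p , e) (s , nz) = let (B , q) = nonzero-bound p s (λ z → nz (trans (e s) z)) in
                B , λ x B<x z → q x B<x (trans (sym (e (ι x))) z)

            γ-vec : ℂ → Vec ℂ 3
            γ-vec s = γ₀ s ∷ γ₁ s ∷ γ₂ s ∷ []

            test⇒good : ∀ s → test s ≉ 0# → good s ≉ 0#
            test⇒good s t z = t (trans (*-congʳ z) (zeroˡ _))

            γ-nonzero : ∀ s → test s ≉ 0# → NonZeroVec (γ-vec s)
            γ-nonzero s t = at-index ι₀ (λ z → t (trans (*-congˡ z) (zeroʳ _)))
              where
              at-index : ∀ i → γ i s ≉ 0# → NonZeroVec (γ-vec s)
              at-index zero             nz = zero , nz
              at-index (suc zero)       nz = suc zero , nz
              at-index (suc (suc zero)) nz = suc (suc zero) , nz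

            γ-∥-φ : ∀ s (t : test s ≉ 0#) → γ-vec s ∥ vec (f.to (on-line s (test⇒good s t)))
            γ-∥-φ s t = ∥-trans (∥-sym (rep (ℓ-point s , tt) (γ-nonzero s t)))
              (proportional (extends (on-line s (test⇒good s t))))

            φ-x φ-y : ∀ s → good s ≉ 0# → ℂ
            φ-x s t = proj₁ (proj₂ (f.to (on-line s t)))
            φ-y s t = proj₁ (proj₂ (proj₂ (f.to (on-line s t))))

            γ-affine : ∀ s (t : test s ≉ 0#) → γ-vec s ∥ (φ-x s (test⇒good s t) ∷ φ-y s (test⇒good s t) ∷ 1# ∷ [])
            γ-affine s t = ∥-trans (γ-∥-φ s t) (proportional (proj₂ (proj₂ (proj₂ (proj₂ (f.to (on-line s (test⇒good s t))))))))

            -- Wherever `test` is nonzero, γ(s) is an affine point of the curve. The homogeneous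
            -- equation is polynomial in s, so it persists at all s and in particular at the end s =
            -- 0.
            H-γ : ∀ s → Hc (γ₀ s) (γ₁ s) (γ₂ s) ≈ 0#
            H-γ = isPoly-density (polynomial-in H (γ-poly zero) (γ-poly (suc zero)) (γ-poly (suc (suc zero)))) test-poly
                (proj₁ test-nonzero) (proj₂ test-nonzero) λ s t → off s t (∥-affine₂ (γ-affine s t))
              where
              off : ∀ s (t : test s ≉ 0#) → γ₂ s ≉ 0# × γ₂ s * φ-x s (test⇒good s t) ≈ γ₀ s × γ₂ s * φ-y s (test⇒good s t) ≈ γ₁ s →
                    Hc (γ₀ s) (γ₁ s) (γ₂ s) ≈ 0#
              off s t (_ , p , q) = trans (Hc-cong (sym p) (sym q) (sym (*-identityʳ _))) (trans (homogeneous (γ₂ s) _ _ 1#)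
                (trans (*-congˡ (trans (dehomogenise _ _) (proj₁ (proj₂ (proj₂ (proj₂ (f.to (on-line s (test⇒good s t)))))))))
                  (zeroʳ _)))

            φ̃-end : vec (φ̃.to end) ∥ γ-vec 0#
            φ̃-end = ∥-trans (rep end nz₀) (proportional (1# , 1≉0 , λ
              { zero → trans (sym (γ-at-0 zero)) (sym (*-identityˡ _)) ; (suc zero) → trans (sym (γ-at-0 (suc zero))) (sym (*-identityˡ _))
              ; (suc (suc zero)) → trans (sym (γ-at-0 (suc (suc zero)))) (sym (*-identityˡ _)) }))

            γ-curve : ∀ s x y → evalℂ F (x ∷ y ∷ []) ≈ 0# → γ-vec s ∥ (x ∷ y ∷ 1# ∷ []) → NonZeroVec (γ-vec s) → ∃ (Curve (mapCoeff coefficient F))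
            γ-curve s x y e p nz = (γ-vec s , nz) , x , y , e , unwrap p

            -- If γ(0) were an affine point, it would lie on the curve and φ⁻¹ would be defined
            -- there. Off finitely many s the value of φ⁻¹ at γ(s) is ℓ(s), so at s = 0 it would be
            -- e, which the domain of φ avoids.
            module Finite (γ₂≉0 : γ₂ 0# ≉ 0#) where
              i = γ₂ 0# ⁻¹
              x₀ = i * γ₀ 0#
              y₀ = i * γ₁ 0#

              on-curve : evalℂ F (x₀ ∷ y₀ ∷ []) ≈ 0#
              on-curve = trans (sym (dehomogenise x₀ y₀)) (trans (Hc-cong refl refl (sym (trans (*-comm i (γ₂ 0#)) (⁻¹-inverse γ₂≉0))))
                (trans (homogeneous i _ _ _) (trans (*-congˡ (H-γ 0#)) (zeroʳ _))))

              affine : γ-vec 0# ∥ (x₀ ∷ y₀ ∷ 1# ∷ [])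
              affine = proportional (γ₂ 0# , γ₂≉0 , λ { zero → cancel (γ₀ 0#) ; (suc zero) → cancel (γ₁ 0#) ; (suc (suc zero)) → sym (*-identityʳ _) })
                where
                cancel : ∀ m → m ≈ γ₂ 0# * (i * m)
                cancel m = sym (trans (sym (*-assoc _ _ _)) (trans (*-congʳ (⁻¹-inverse γ₂≉0)) (*-identityˡ m)))

              q₀ : ∃ (Curve (mapCoeff coefficient F))
              q₀ = γ-curve 0# x₀ y₀ on-curve affine (suc (suc zero) , γ₂≉0)

              module _ (A B : Poly ℂ 3) (nzAB : NonZeroVec (eval A (γ-vec 0#) ∷ eval B (γ-vec 0#) ∷ []))
                       (repAB : ∀ q → NonZeroVec (eval A (vec q) ∷ eval B (vec q) ∷ []) → vec (g.to q) ∥ (eval A (vec q) ∷ eval B (vec q) ∷ [])) where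
                α β : ℂ → ℂ
                α s = eval A (γ-vec s)
                β s = eval B (γ-vec s)

                -- The determinant of ℓ(s) with (α, β)(s), the local representation of φ⁻¹ along γ.
                -- It vanishes because φ⁻¹ undoes φ.
                m : ℂ → ℂ
                m s = ℓ₁ s * β s + (- 1#) * (ℓ₂ s * α s)

                m-poly : IsPoly m
                m-poly = plus (times ℓ₁-poly (composed B)) (times (const (- 1#)) (times ℓ₂-poly (composed A)))
                  where
                  open IsSubalgebra isPoly-isSubalgebra
                  composed : ∀ C → IsPoly (λ s → eval C (γ-vec s))
                  composed C = eval-closed isPoly-isSubalgebra C {γ₀ ∷ γ₁ ∷ γ₂ ∷ []} (γ-poly zero ∷ γ-poly (suc zero) ∷ γ-poly (suc (suc zero)) ∷ [])

                as-det : ∀ s → m s ≈ det (ℓ₁ s) (ℓ₂ s) (α s) (β s)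
                as-det s = solve 4 (λ l k a b → l :* b :+ (:- con (+ 1)) :* (k :* a) := l :* b :+ (:- k) :* a) refl (ℓ₁ s) (ℓ₂ s) (α s) (β s)

                off : ∀ s → test s ≉ 0# → m s ≈ 0#
                off s t = by em
                  where
                  on : ∃ (ℙ¹∖ a b)
                  on = on-line s (test⇒good s t)
                  q : ∃ (Curve (mapCoeff coefficient F))
                  q = γ-curve s _ _ (proj₁ (proj₂ (proj₂ (proj₂ (f.to on))))) (γ-affine s t) (γ-nonzero s t)
                  by : Dec (NonZeroVec (α s ∷ β s ∷ [])) → m s ≈ 0#
                  by (yes nz) = trans (as-det s) (det-∥ (∥-sym (∥-trans (∥-sym (repAB q nz))
                    (∥-trans (proportional {w = vec (g.to (f.to on))} (g.cong q (f.to on) (unwrap (γ-∥-φ s t)))) (proportional (φ.inverseʳ on))))))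
                  by (no ¬nz) = trans (+-cong (*-congˡ (decidable-stable em (λ p → ¬nz (suc zero , p)))) (*-congˡ (*-congˡ (decidable-stable em (λ p → ¬nz (zero , p))))))
                    (solve 2 (λ l k → l :* con (+ 0) :+ (:- con (+ 1)) :* (k :* con (+ 0)) := con (+ 0)) refl (ℓ₁ s) (ℓ₂ s))

                at-end : det e₁ e₂ (α 0#) (β 0#) ≈ 0#
                at-end = trans (solve 6 (λ e f h k a b → e :* b :+ (:- f) :* a := (e :+ con (+ 0) :* h) :* b :+ (:- (f :+ con (+ 0) :* k)) :* a) refl e₁ e₂ h₁ h₂ (α 0#) (β 0#))
                  (trans (sym (as-det 0#)) (isPoly-density m-poly test-poly (proj₁ test-nonzero) (proj₂ test-nonzero) off 0#))

                impossible : ⊥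
                impossible = avoided (g.to q₀) (∥-trans (repAB q₀ nzAB) (∥-sym (proportional
                  (let (c , c≉0 , p , q) = det≈0⇒scalar (nonzero₂ nz) (nonzero₂ nzAB) at-end in
                   c , c≉0 , λ { zero → p ; (suc zero) → q }))))

              contradiction : ⊥
              contradiction = let (C , _ , _ , _ , nzC , repC) = g.regular q₀ in local C nzC repC
                where
                local : (C : Vec (Poly ℂ 3) 2) → NonZeroVec (Vec.map (λ h → eval h (γ-vec 0#)) C) →
                  (∀ (q : ∃ (Curve (mapCoeff coefficient F))) (nz : NonZeroVec (Vec.map (λ h → eval h (vec q)) C)) →
                     proj₁ (g.to q) ∼ (Vec.map (λ h → eval h (vec q)) C , nz)) → ⊥
                local (A ∷ B ∷ []) nzC repC = impossible A B nzC (λ q nz → proportional (repC q nz))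

            at-infinity : Conclusion
            at-infinity = by (γ₂ 0# ≟ 0#)
              where
              by : Dec (γ₂ 0# ≈ 0#) → Conclusion
              by (no γ₂≉0)  = ⊥-elim (Finite.contradiction γ₂≉0)
              by (yes γ₂≈0) = γ₀ 0# , γ₁ 0# ,
                ∥-trans φ̃-end (proportional (1# , 1≉0 , λ { zero → sym (*-identityˡ _) ; (suc zero) → sym (*-identityˡ _)
                                                          ; (suc (suc zero)) → trans γ₂≈0 (sym (*-identityˡ _)) })) ,
                (λ (p , q) → proj₂ index (all-zero p q (proj₁ index))) ,
                trans (Hc-cong refl refl (sym γ₂≈0)) (H-γ 0#)
                where
                all-zero : γ₀ 0# ≈ 0# → γ₁ 0# ≈ 0# → ∀ i → γ i 0# ≈ 0#
                all-zero p q zero             = p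
                all-zero p q (suc zero)       = q
                all-zero p q (suc (suc zero)) = γ₂≈0

          conclusion : Conclusion
          conclusion = let (G , _ , _ , _ , nzG , repG) = φ̃.regular end in local G nzG repG
            where
            local : (G : Vec (Poly ℂ 2) 3) → NonZeroVec (Vec.map (λ h → eval h (e₁ ∷ e₂ ∷ [])) G) →
              (∀ (y : ∃ {A = ℙ 1} U) (nz : NonZeroVec (Vec.map (λ h → eval h (vec y)) G)) →
                 proj₁ (φ̃.to y) ∼ (Vec.map (λ h → eval h (vec y)) G , nz)) → Conclusion
            local (G₀ ∷ G₁ ∷ G₂ ∷ []) nzG repG = Local.at-infinity G₀ G₁ G₂ nzG (λ y nz → proportional (repG y nz))

        end-at-infinity : Conclusion
        end-at-infinity = by (e₁ ≟ 0#)
          where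
          by : Dec (e₁ ≈ 0#) → Conclusion
          by (no e₁≉0)  = Transversal.conclusion 0# 1# (λ z → e₁≉0 (trans (solve 2 (λ e f → e := e :* con (+ 1) :+ (:- f) :* con (+ 0)) refl e₁ e₂) z))
          by (yes e₁≈0) = Transversal.conclusion 1# 0# (λ z → nonzero₂ nz (e₁≈0 ,
            trans (solve 2 (λ e f → f := :- (e :* con (+ 0) :+ (:- f) :* con (+ 1))) refl e₁ e₂) (trans (-‿cong z) (solve 0 (:- con (+ 0) := con (+ 0)) refl))))

    module _ {k : Pred ℂ 0ℓ} {F : Poly ℚ 2} (T : TopForm F) (a b : ℙ 1)
             (φ : Isomorphism k (ℙ¹∖ a b) (Curve (mapCoeff coefficient F)))
             (φ̃ : Morphism k {1} {2} U U)
             (extends : ∀ (p : ∃ (ℙ¹∖ a b)) → Morphism.apply φ̃ (proj₁ p , tt) ∼ Morphism.apply (Isomorphism.morphism φ) p)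
             (distinct : ¬ (Morphism.apply φ̃ (a , tt) ∼ Morphism.apply φ̃ (b , tt))) where
      open Covering T 0# using (Hc)

      -- Proportional directions would make φ̃(a) and φ̃(b) the same point of the line at infinity.
      two-zeros : ∃₂ λ p₁ p₂ → ∃₂ λ q₁ q₂ → Hc p₁ p₂ 0# ≈ 0# × Hc q₁ q₂ 0# ≈ 0# × det p₁ p₂ q₁ q₂ ≉ 0#
      two-zeros = combine (ends a (λ p e → proj₁ (proj₂ p) e)) (ends b (λ p e → proj₂ (proj₂ p) e))
        where
        End′ : ℙ 1 → Set
        End′ e = ∃₂ λ p₁ p₂ → proj₁ (Morphism.apply φ̃ (e , tt)) ∥ (p₁ ∷ p₂ ∷ 0# ∷ []) × ¬ (p₁ ≈ 0# × p₂ ≈ 0#) × Hc p₁ p₂ 0# ≈ 0#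
        ends : ∀ e → (∀ (p : ∃ (ℙ¹∖ a b)) → ¬ (proj₁ p ∼ e)) → End′ e
        ends (e₁ ∷ e₂ ∷ [] , nz) avoided = AtEnd.end-at-infinity T a b φ φ̃ extends e₁ e₂ nz (λ p e → avoided p (unwrap e))
        combine : End′ a → End′ b → _
        combine (p₁ , p₂ , p∥ , p≉0 , Tp) (q₁ , q₂ , q∥ , q≉0 , Tq) = p₁ , p₂ , q₁ , q₂ , Tp , Tq , λ d≈0 →
          let (c , c≉0 , e , e′) = det≈0⇒scalar p≉0 q≉0 d≈0
              p∥q : (p₁ ∷ p₂ ∷ 0# ∷ []) ∥ (q₁ ∷ q₂ ∷ 0# ∷ [])
              p∥q = proportional (c , c≉0 , λ { zero → e ; (suc zero) → e′ ; (suc (suc zero)) → sym (zeroʳ c) })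
          in distinct (unwrap (∥-trans p∥ (∥-trans p∥q (∥-sym q∥))))

  open Extension public

  -- Real values of F along rays and lines

  module RealCurves where
    module RealTopForm {F : Poly ℚ 2} (T : TopForm F) where
      open TopForm T

      FR : ℝ → ℝ → ℝ
      FR x y = evalℝ F (x ∷ y ∷ [])

      HR : ℝ → ℝ → ℝ → ℝ
      HR x y z = evalℝ H (x ∷ y ∷ z ∷ [])

      HR-ι : ∀ x y z → ι (HR x y z) ≈ evalℂ H (ι x ∷ ι y ∷ ι z ∷ [])
      HR-ι x y z = evalℂ-ι H (x ∷ y ∷ z ∷ [])

      FR-ι : ∀ x y → ι (FR x y) ≈ evalℂ F (ι x ∷ ι y ∷ [])
      FR-ι x y = evalℂ-ι F (x ∷ y ∷ [])

      FR-cong : ∀ {x y x′ y′} → x ≈ᴿ x′ → y ≈ᴿ y′ → FR x y ≈ᴿ FR x′ y′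
      FR-cong p q = RE.eval-cong (mapCoeff ℚ→ℝ F) (p ∷ q ∷ [])

      HR-cong : ∀ {x y z x′ y′ z′} → x ≈ᴿ x′ → y ≈ᴿ y′ → z ≈ᴿ z′ → HR x y z ≈ᴿ HR x′ y′ z′
      HR-cong p q r = RE.eval-cong (mapCoeff ℚ→ℝ H) (p ∷ q ∷ r ∷ [])

      dehomogeniseᴿ : ∀ x y → HR x y 1ᴿ ≈ᴿ FR x y
      dehomogeniseᴿ x y = ι-injective (trans (HR-ι x y 1ᴿ) (trans (evalℂ-cong H (refl ∷ refl ∷ ι-1 ∷ []))
        (trans (dehomogenise (ι x) (ι y)) (sym (FR-ι x y)))))

      homogeneousᴿ : ∀ s x y z → HR (s *ᴿ x) (s *ᴿ y) (s *ᴿ z) ≈ᴿ s ^ᴿ d *ᴿ HR x y z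
      homogeneousᴿ s x y z = ι-injective (begin
        ι (HR (s *ᴿ x) (s *ᴿ y) (s *ᴿ z))                        ≈⟨ HR-ι _ _ _ ⟩
        evalℂ H (ι (s *ᴿ x) ∷ ι (s *ᴿ y) ∷ ι (s *ᴿ z) ∷ [])     ≈⟨ evalℂ-cong H (ι-* s x ∷ ι-* s y ∷ ι-* s z ∷ []) ⟩
        evalℂ H (ι s * ι x ∷ ι s * ι y ∷ ι s * ι z ∷ [])         ≈⟨ homogeneous (ι s) (ι x) (ι y) (ι z) ⟩
        ι s ^ d * evalℂ H (ι x ∷ ι y ∷ ι z ∷ [])                 ≈⟨ *-cong (ι-^ s d) (sym (HR-ι x y z)) ⟩
        ι (s ^ᴿ d) * ι (HR x y z)                                ≈⟨ ι-* _ _ ⟨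
        ι (s ^ᴿ d *ᴿ HR x y z)                                   ∎)

      top-ι : ∀ x y → ι (HR x y 0ᴿ) ≈ evalℂ H (ι x ∷ ι y ∷ 0# ∷ [])
      top-ι x y = trans (HR-ι x y 0ᴿ) (evalℂ-cong H (refl ∷ refl ∷ ι-0 ∷ []))

      HR-continuous : ∀ u v → Limits.Tends (nhds 0ᴿ) (HR u v) (HR u v 0ᴿ)
      HR-continuous u v = RE.eval-closed S (mapCoeff ℚ→ℝ H) {(λ _ → u) ∷ (λ _ → v) ∷ (λ z → z) ∷ []}
          (IsSubalgebra.const S u ∷ IsSubalgebra.const S v ∷ tends-id 0ᴿ ∷ [])
        where S = tends-isSubalgebra (nhds 0ᴿ) 0ᴿ

      FR-continuous : ∀ (f g : ℝ → ℝ) s → Continuous-at f s → Continuous-at g s → Continuous-at (λ x → FR (f x) (g x)) s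
      FR-continuous f g s p q = RE.eval-closed (tends-isSubalgebra (nhds s) s) (mapCoeff ℚ→ℝ F) {f ∷ g ∷ []} (p ∷ q ∷ [])

      -- F(su, sv) = s^d H(u, v, 1/s), and H(u, v, z) stays positive for |z| < δ; hence the
      -- threshold r = 1/δ.
      ray-positive : ∀ u v → 0ᴿ < HR u v 0ᴿ → ∃ λ r → 0ᴿ < r × (∀ s → r < s → 0ᴿ < FR (s *ᴿ u) (s *ᴿ v))
      ray-positive u v 0<H = r , proj₁ (proj₂ inverse) , positive
        where
        near : ∃ λ δ → 0ᴿ < δ × (∀ z → (z -ᴿ 0ᴿ) ⊲ δ → 0ᴿ < HR u v z)
        near = Limits.tends-pos (nhds 0ᴿ) {HR u v} (HR-continuous u v) 0<H
        δ = proj₁ near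
        inverse : ∃ λ r → 0ᴿ < r × r *ᴿ δ ≈ᴿ 1ᴿ
        inverse = divide 0<1 (proj₁ (proj₂ near))
        r = proj₁ inverse
        positive : ∀ s → r < s → 0ᴿ < FR (s *ᴿ u) (s *ᴿ v)
        positive s r<s = <-resp R.refl value (R.*-positive (^-pos d 0<s) (proj₂ (proj₂ near) z z-small))
          where
          0<s : 0ᴿ < s
          0<s = <-trans (proj₁ (proj₂ inverse)) r<s
          z = s R.⁻¹
          0<z : 0ᴿ < z
          0<z = ⁻¹-pos 0<s
          sz≈1 : s *ᴿ z ≈ᴿ 1ᴿ
          sz≈1 = R.⁻¹-inverseʳ (0<⇒≉0 0<s)
          z<δ : z < δ
          z<δ = 0<-⇒< (R.*-positive (R.*-positive 0<z (proj₁ (proj₂ near))) (<⇒0<- r<s))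
            (R.trans (solveᴾ 4 (λ z d s r → (z *ᴾ d) *ᴾ (s -ᴾ r) =ᴾ (s *ᴾ z) *ᴾ d -ᴾ z *ᴾ (r *ᴾ d)) R.refl z δ s r)
            (R.trans (R.+-cong (R.*-congʳ sz≈1) (R.-‿cong (R.*-congˡ (proj₂ (proj₂ inverse)))))
              (solveᴾ 2 (λ d z → conᴾ (+ 1) *ᴾ d -ᴾ z *ᴾ conᴾ (+ 1) =ᴾ d -ᴾ z) R.refl δ z)))
          z-small : (z -ᴿ 0ᴿ) ⊲ δ
          z-small = ⊲-resp (solveᴾ 1 (λ z → z =ᴾ z -ᴾ conᴾ (+ 0)) R.refl z) R.refl (within (<-trans (0<⇒-<0 (proj₁ (proj₂ near))) 0<z) z<δ)
          value : s ^ᴿ d *ᴿ HR u v z ≈ᴿ FR (s *ᴿ u) (s *ᴿ v)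
          value = R.trans (R.sym (homogeneousᴿ s u v z)) (R.trans (HR-cong R.refl R.refl sz≈1) (dehomogeniseᴿ _ _))

      -- F is polynomial in bounded functions, so F² ≤ M for some M. Then F ≥ -(M + 1), a bound that
      -- avoids the square root of M.
      bounded-below : ∀ {A : Set} (f g : A → ℝ) → BoundedOn (λ a → ι (f a)) → BoundedOn (λ a → ι (g a)) → ∃ λ B → ∀ a → B ≤ FR (f a) (g a)
      bounded-below f g bf bg = -ᴿ (M +ᴿ 1ᴿ) , λ a FR< → bound a (FR (f a) (g a)) (N≤ a) FR<
        where
        bounded : BoundedOn (λ a → evalℂ F (ι (f a) ∷ ι (g a) ∷ []))
        bounded = eval-closed boundedOn-isSubalgebra (mapCoeff coefficient F) {(λ a → ι (f a)) ∷ (λ a → ι (g a)) ∷ []} (bf ∷ bg ∷ [])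
        M = proj₁ bounded
        N≤ : ∀ a → FR (f a) (g a) *ᴿ FR (f a) (g a) ≤ M
        N≤ a = ≤-resp (R.trans (N-cong (sym (FR-ι _ _))) (N-ι _)) R.refl (proj₂ (proj₂ bounded) a)
        bound : ∀ a x → x *ᴿ x ≤ M → ¬ (x < -ᴿ (M +ᴿ 1ᴿ))
        bound a x x²≤M x< = x²≤M (0<-⇒< (+-pos-nonneg (R.*-positive 0<gap 0<sum) 0≤rest)
          (solveᴾ 2 (λ x m → ((-ᴾ (m +ᴾ conᴾ (+ 1))) -ᴾ x) *ᴾ ((m +ᴾ conᴾ (+ 1)) -ᴾ x) +ᴾ (m *ᴾ m +ᴾ (m +ᴾ conᴾ (+ 1))) =ᴾ x *ᴾ x -ᴾ m) R.refl x M))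
          where
          0≤M = proj₁ (proj₂ bounded)
          0<M+1 : 0ᴿ < M +ᴿ 1ᴿ
          0<M+1 = <-resp R.refl (R.+-comm 1ᴿ M) (+-pos-nonneg 0<1 0≤M)
          0<gap : 0ᴿ < (-ᴿ (M +ᴿ 1ᴿ)) -ᴿ x
          0<gap = <⇒0<- x<
          0<sum : 0ᴿ < (M +ᴿ 1ᴿ) -ᴿ x
          0<sum = +-pos 0<M+1 (<0⇒0<- (<-trans x< (0<⇒-<0 0<M+1)))
          0≤rest : 0ᴿ ≤ M *ᴿ M +ᴿ (M +ᴿ 1ᴿ)
          0≤rest = +-nonneg (sq-nonneg M) (<⇒≤ 0<M+1)

      SmallSquare : ℝ → Set
      SmallSquare r = Σ ℝ λ s → s *ᴿ s ≤ r *ᴿ r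

      small-bounded : ∀ r → BoundedOn {SmallSquare r} (λ (s , _) → ι s)
      small-bounded r = r *ᴿ r , sq-nonneg r , λ (s , p) → ≤-resp (R.sym (N-ι s)) R.refl p

      module _ (nonnegative : ∀ u v → 0ᴿ ≤ HR u v 0ᴿ) where

        positive-if-nonzero : ∀ u v → ¬ (HR u v 0ᴿ ≈ᴿ 0ᴿ) → 0ᴿ < HR u v 0ᴿ
        positive-if-nonzero u v nz = [ (λ p → p) , (λ e → ⊥-elim (nz (R.sym e))) ]′ (≤⇒<⊎≈ (nonnegative u v))

        -- F is positive far out in both directions, since T(-w) = (-1)^d T(w) is nonzero as well
        -- and hence positive. On the segment in between F is bounded.
        line-bounded-below : ∀ u v → ¬ (HR u v 0ᴿ ≈ᴿ 0ᴿ) → ∃ λ B → ∀ s → B ≤ FR (s *ᴿ u) (s *ᴿ v)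
        line-bounded-below u v nz = B , bound
          where
          neg : ℝ → ℝ
          neg x = (-ᴿ 1ᴿ) *ᴿ x
          -1^≉0 : ∀ n → ¬ ((-ᴿ 1ᴿ) ^ᴿ n ≈ᴿ 0ᴿ)
          -1^≉0 zero    e = R.0#≉1# (R.sym e)
          -1^≉0 (suc n)   = *-≉0 (λ e → R.0#≉1# (R.trans (solveᴾ 0 (conᴾ (+ 0) =ᴾ -ᴾ conᴾ (+ 0)) R.refl) (R.trans (R.-‿cong (R.sym e)) (solveᴾ 0 (-ᴾ (-ᴾ conᴾ (+ 1)) =ᴾ conᴾ (+ 1)) R.refl)))) (-1^≉0 n)
          nz′ : ¬ (HR (neg u) (neg v) 0ᴿ ≈ᴿ 0ᴿ)
          nz′ e = *-≉0 (-1^≉0 d) nz (R.trans (R.sym (homogeneousᴿ (-ᴿ 1ᴿ) u v 0ᴿ)) (R.trans (HR-cong R.refl R.refl (R.zeroʳ _)) e))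
          ray⁺ : ∃ λ r → 0ᴿ < r × (∀ s → r < s → 0ᴿ < FR (s *ᴿ u) (s *ᴿ v))
          ray⁺ = ray-positive u v (positive-if-nonzero u v nz)
          ray⁻ : ∃ λ r → 0ᴿ < r × (∀ s → r < s → 0ᴿ < FR (s *ᴿ neg u) (s *ᴿ neg v))
          ray⁻ = ray-positive (neg u) (neg v) (positive-if-nonzero (neg u) (neg v) nz′)
          r = proj₁ ray⁺ +ᴿ proj₁ ray⁻
          0<r : 0ᴿ < r
          0<r = +-pos (proj₁ (proj₂ ray⁺)) (proj₁ (proj₂ ray⁻))
          middle : ∃ λ B → ∀ (a : SmallSquare r) → B ≤ FR (proj₁ a *ᴿ u) (proj₁ a *ᴿ v)
          middle = bounded-below (λ a → proj₁ a *ᴿ u) (λ a → proj₁ a *ᴿ v) (scaled u) (scaled v)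
            where
            scaled : ∀ w → BoundedOn {SmallSquare r} (λ a → ι (proj₁ a *ᴿ w))
            scaled w = resp (λ a → sym (ι-* (proj₁ a) w)) (times (small-bounded r) (const (ι w)))
              where open IsSubalgebra (boundedOn-isSubalgebra {SmallSquare r})
          smaller : ∃ λ B → B ≤ proj₁ middle × B ≤ 0ᴿ
          smaller = [ (λ p → proj₁ middle , ≈⇒≤ R.refl , <⇒≤ p) , (λ p → 0ᴿ , p , ≈⇒≤ R.refl) ]′ (<-≤-connex (proj₁ middle) 0ᴿ)
          B = proj₁ smaller
          by : ∀ s → Dec (s *ᴿ s ≤ r *ᴿ r) → B ≤ FR (s *ᴿ u) (s *ᴿ v)
          by s (yes p) = ≤-trans (proj₁ (proj₂ smaller)) (proj₂ middle (s , p))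
          by s (no ¬p) = ≤-trans (proj₂ (proj₂ smaller)) (<⇒≤ (side (<-≤-connex s 0ᴿ)))
            where
            r²<s² : r *ᴿ r < s *ᴿ s
            r²<s² = decidable-stable em ¬p
            beyond : ∀ {x} → 0ᴿ ≤ x → r *ᴿ r < x *ᴿ x → r < x
            beyond {x} 0≤x lt = decidable-stable em λ ¬r<x → lt-absurd (≤-trans (*-monoˡ-≤ x 0≤x ¬r<x) (≤-resp (R.*-comm _ r) R.refl (*-monoˡ-≤ r (<⇒≤ 0<r) ¬r<x))) lt
              where
              lt-absurd : x *ᴿ x ≤ r *ᴿ r → ¬ (r *ᴿ r < x *ᴿ x)
              lt-absurd p q = p q
            side : s < 0ᴿ ⊎ 0ᴿ ≤ s → 0ᴿ < FR (s *ᴿ u) (s *ᴿ v)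
            side (inj₂ 0≤s) = proj₂ (proj₂ ray⁺) s (<-trans (0<-⇒< (proj₁ (proj₂ ray⁻)) (solveᴾ 2 (λ a b → b =ᴾ (a +ᴾ b) -ᴾ a) R.refl (proj₁ ray⁺) (proj₁ ray⁻))) (beyond 0≤s r²<s²))
            side (inj₁ s<0) = <-resp R.refl (FR-cong (flip u) (flip v)) (proj₂ (proj₂ ray⁻) (-ᴿ s)
                (<-trans (0<-⇒< (proj₁ (proj₂ ray⁺)) (solveᴾ 2 (λ a b → a =ᴾ (a +ᴾ b) -ᴾ b) R.refl (proj₁ ray⁺) (proj₁ ray⁻)))
                  (beyond (<⇒≤ (<0⇒0<- s<0)) (<-resp R.refl (solveᴾ 1 (λ s → s *ᴾ s =ᴾ (-ᴾ s) *ᴾ (-ᴾ s)) R.refl s) r²<s²))))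
              where
              flip : ∀ w → (-ᴿ s) *ᴿ neg w ≈ᴿ s *ᴿ w
              flip w = solveᴾ 2 (λ s w → (-ᴾ s) *ᴾ ((-ᴾ conᴾ (+ 1)) *ᴾ w) =ᴾ s *ᴾ w) R.refl s w
          bound : ∀ s → B ≤ FR (s *ᴿ u) (s *ᴿ v)
          bound s = by s em

      -- Otherwise the intermediate value theorem produces the value c between x and y; it is
      -- applied to f - c if x < y and to c - f if y ≤ x.
      constant-sign : ∀ (f : ℝ → ℝ) c → (∀ s → Continuous-at f s) → (∀ s → ¬ (f s ≈ᴿ c)) → ∀ x y → f x < c → f y < c
      constant-sign f c cts avoids x y fx<c = decidable-stable em λ ¬fy<c →
        let c<fy : c < f y
            c<fy = [ (λ p → p) , (λ e → ⊥-elim (avoids y (R.sym e))) ]′ (≤⇒<⊎≈ ¬fy<c)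
        in [ (λ x<y → hit (ivt g x y (<⇒≤ x<y) (λ s _ _ → g-cts s) (below fx<c) (<⇒0<- c<fy)))
           , (λ y≤x → hit⁻ (ivt g⁻ y x y≤x (λ s _ _ → Limits.tends-neg (nhds s) {g} (g-cts s)) (0<⇒-<0 (<⇒0<- c<fy)) (<0⇒0<- (below fx<c)))) ]′
           (<-≤-connex x y)
        where
        g g⁻ : ℝ → ℝ
        g s = f s +ᴿ -ᴿ c
        g⁻ s = -ᴿ g s
        g-cts : ∀ s → Continuous-at g s
        g-cts s = Limits.tends-+ (nhds s) {f} {λ _ → -ᴿ c} (cts s) (Limits.tends-const (nhds s) (-ᴿ c))
        below : ∀ {v} → v < c → v +ᴿ -ᴿ c < 0ᴿ
        below {v} p = 0<-⇒< (<⇒0<- p) (solveᴾ 2 (λ c v → c -ᴾ v =ᴾ conᴾ (+ 0) -ᴾ (v -ᴾ c)) R.refl c v)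
        equal : ∀ s → g s ≈ᴿ 0ᴿ → f s ≈ᴿ c
        equal s e = R.trans (solveᴾ 2 (λ v c → v =ᴾ (v -ᴾ c) +ᴾ c) R.refl (f s) c) (R.trans (R.+-congʳ e) (R.+-identityˡ c))
        hit : (∃ λ s → x ≤ s × s ≤ y × g s ≈ᴿ 0ᴿ) → ⊥
        hit (s , _ , _ , e) = avoids s (equal s e)
        hit⁻ : (∃ λ s → y ≤ s × s ≤ x × g⁻ s ≈ᴿ 0ᴿ) → ⊥
        hit⁻ (s , _ , _ , e) = avoids s (equal s (R.trans (solveᴾ 1 (λ x → x =ᴾ -ᴾ (-ᴾ x)) R.refl (g s)) (R.trans (R.-‿cong e) (solveᴾ 0 (-ᴾ conᴾ (+ 0) =ᴾ conᴾ (+ 0)) R.refl))))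

  open RealCurves public

  -- The contradiction from a nonnegative top form

  module Contradiction where
    detᴿ : ℝ → ℝ → ℝ → ℝ → ℝ
    detᴿ a b x y = a *ᴿ y -ᴿ b *ᴿ x

    det-ι : ∀ a b x y → det (ι a) (ι b) (ι x) (ι y) ≈ ι (detᴿ a b x y)
    det-ι a b x y = sym (trans (ι-+ _ _) (+-cong (ι-* a y) (trans (ι-neg _) (trans (-‿cong (ι-* b x)) (solve 2 (λ b x → :- (b :* x) := (:- b) :* x) refl (ι b) (ι x))))))

    detᴿ-combination : ∀ a b c d ε x y → detᴿ (a +ᴿ ε *ᴿ c) (b +ᴿ ε *ᴿ d) x y ≈ᴿ detᴿ a b x y +ᴿ ε *ᴿ detᴿ c d x y
    detᴿ-combination a b c d ε x y = solveᴾ 7 (λ a b c d e x y → (a +ᴾ e *ᴾ c) *ᴾ y -ᴾ (b +ᴾ e *ᴾ d) *ᴾ x =ᴾ (a *ᴾ y -ᴾ b *ᴾ x) +ᴾ e *ᴾ (c *ᴾ y -ᴾ d *ᴾ x)) R.refl a b c d ε x y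

    detᴿ-neg : ∀ u v x y → -ᴿ detᴿ u v x y ≈ᴿ detᴿ (-ᴿ u) (-ᴿ v) x y
    detᴿ-neg u v x y = solveᴾ 4 (λ u v x y → -ᴾ (u *ᴾ y -ᴾ v *ᴾ x) =ᴾ (-ᴾ u) *ᴾ y -ᴾ (-ᴾ v) *ᴾ x) R.refl u v x y

    detᴿ-self : ∀ u v → detᴿ u v u v ≈ᴿ 0ᴿ
    detᴿ-self u v = solveᴾ 2 (λ u v → u *ᴾ v -ᴾ v *ᴾ u =ᴾ conᴾ (+ 0)) R.refl u v

    detᴿ-swap≉0 : ∀ a b x y → ¬ (detᴿ a b x y ≈ᴿ 0ᴿ) → ¬ (detᴿ x y a b ≈ᴿ 0ᴿ)
    detᴿ-swap≉0 a b x y nz z = nz (R.trans (solveᴾ 4 (λ a b x y → a *ᴾ y -ᴾ b *ᴾ x =ᴾ -ᴾ (x *ᴾ b -ᴾ y *ᴾ a)) R.refl a b x y)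
      (R.trans (R.-‿cong z) (solveᴾ 0 (-ᴾ conᴾ (+ 0) =ᴾ conᴾ (+ 0)) R.refl)))

    detᴿ-zeroˡ : ∀ u v x y → u ≈ᴿ 0ᴿ × v ≈ᴿ 0ᴿ → detᴿ u v x y ≈ᴿ 0ᴿ
    detᴿ-zeroˡ u v x y (p , q) = R.trans (R.+-cong (R.*-congʳ p) (R.-‿cong (R.*-congʳ q)))
      (solveᴾ 2 (λ x y → conᴾ (+ 0) *ᴾ y -ᴾ conᴾ (+ 0) *ᴾ x =ᴾ conᴾ (+ 0)) R.refl x y)

    -- Cramer's rule: (r, s) is determined by its determinants with two independent vectors, and two
    -- zero determinants would make it 0.
    independent : ∀ a b x y r s → ¬ (detᴿ a b x y ≈ᴿ 0ᴿ) → ¬ (r ≈ᴿ 0ᴿ × s ≈ᴿ 0ᴿ) → detᴿ a b r s ≈ᴿ 0ᴿ → ¬ (detᴿ x y r s ≈ᴿ 0ᴿ)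
    independent a b x y r s abxy≉0 rs≉0 e f = rs≉0
      ( zero-if (R.trans (solveᴾ 6 (λ a b x y r s → r *ᴾ (a *ᴾ y -ᴾ b *ᴾ x) =ᴾ x *ᴾ (a *ᴾ s -ᴾ b *ᴾ r) -ᴾ a *ᴾ (x *ᴾ s -ᴾ y *ᴾ r)) R.refl a b x y r s) (vanish x a))
      , zero-if (R.trans (solveᴾ 6 (λ a b x y r s → s *ᴾ (a *ᴾ y -ᴾ b *ᴾ x) =ᴾ y *ᴾ (a *ᴾ s -ᴾ b *ᴾ r) -ᴾ b *ᴾ (x *ᴾ s -ᴾ y *ᴾ r)) R.refl a b x y r s) (vanish y b)) )
      where
      vanish : ∀ m n → m *ᴿ detᴿ a b r s -ᴿ n *ᴿ detᴿ x y r s ≈ᴿ 0ᴿ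
      vanish m n = R.trans (R.+-cong (R.*-congˡ e) (R.-‿cong (R.*-congˡ f))) (solveᴾ 2 (λ m n → m *ᴾ conᴾ (+ 0) -ᴾ n *ᴾ conᴾ (+ 0) =ᴾ conᴾ (+ 0)) R.refl m n)
      zero-if : ∀ {m} → m *ᴿ detᴿ a b x y ≈ᴿ 0ᴿ → m ≈ᴿ 0ᴿ
      zero-if g = [ (λ z → z) , (λ z → ⊥-elim (abxy≉0 z)) ]′ (integral g)

    module _ {F : Poly ℚ 2} (T : TopForm F)
             (surjectiveᴿ : ∀ c → ∃₂ λ x y → evalℝ F (x ∷ y ∷ []) ≈ᴿ c)
             (nonnegative : ∀ u v → 0ᴿ ≤ RealTopForm.HR T u v 0ᴿ)
             (p₁ p₂ q₁ q₂ : ℂ) (T[p]≈0 : evalℂ (TopForm.H T) (p₁ ∷ p₂ ∷ 0# ∷ []) ≈ 0#) (T[q]≈0 : evalℂ (TopForm.H T) (q₁ ∷ q₂ ∷ 0# ∷ []) ≈ 0#)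
             (pq≉0 : det p₁ p₂ q₁ q₂ ≉ 0#) where
      open TopForm T
      open RealTopForm T

      private
        w₁ w₂ : ℝ
        w₁ = proj₁ nonzero
        w₂ = proj₁ (proj₂ nonzero)

        T[w]≉0 : ¬ (HR w₁ w₂ 0ᴿ ≈ᴿ 0ᴿ)
        T[w]≉0 e = proj₂ (proj₂ nonzero) (trans (sym (top-ι w₁ w₂)) (trans (ι-cong e) ι-0))

        0^d≈0 : 0# ^ d ≈ 0#
        0^d≈0 = Covering.AtZero.0^d T 0# p₁ p₂ T[p]≈0

        w≉0 : ¬ (w₁ ≈ᴿ 0ᴿ × w₂ ≈ᴿ 0ᴿ)
        w≉0 (a , b) = proj₂ (proj₂ nonzero) (begin
          evalℂ H (ι w₁ ∷ ι w₂ ∷ 0# ∷ [])             ≈⟨ evalℂ-cong H (trans (ι-cong a) ι-0 ∷ trans (ι-cong b) ι-0 ∷ refl ∷ []) ⟩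
          evalℂ H (0# ∷ 0# ∷ 0# ∷ [])                 ≈⟨ evalℂ-cong H (zeroˡ 0# ∷ zeroˡ 0# ∷ zeroˡ 0# ∷ []) ⟨
          evalℂ H (0# * 0# ∷ 0# * 0# ∷ 0# * 0# ∷ [])  ≈⟨ homogeneous 0# 0# 0# 0# ⟩
          0# ^ d * evalℂ H (0# ∷ 0# ∷ 0# ∷ [])        ≈⟨ *-congʳ 0^d≈0 ⟩
          0# * _                                       ≈⟨ zeroˡ _ ⟩
          0#                                           ∎)

      -- If the real points of F = c lie in a box, F − c has constant sign outside
      -- of it; the sign is negative since F is unbounded below, but F tends to +∞
      -- along the direction w.
      module BoundedCase (c : ℝ) (c<0 : c < 0ᴿ) (bounded : BoundedRealPoints F c) where
        private
          M = proj₁ bounded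
          -- m exceeds both 1 and M, so that m² > m > M.
          size : ∃ λ m → 0ᴿ < m × M < m *ᴿ m
          size = let (B , within _ M<B) = ⊲-exists M
                     (m , B<m , 1<m) = above B 1ᴿ
                     0<m = <-trans 0<1 1<m in
            m , 0<m , <-trans (<-trans M<B B<m) (0<-⇒< (R.*-positive 0<m (<⇒0<- 1<m)) (solveᴾ 1 (λ m → m *ᴾ (m -ᴾ conᴾ (+ 1)) =ᴾ m *ᴾ m -ᴾ m) R.refl m))
          m = proj₁ size

          Outside : ℝ → Set
          Outside x = m *ᴿ m ≤ x *ᴿ x

          m-outside : Outside m
          m-outside = ≈⇒≤ R.refl

          off-curve : ∀ x y → Outside x ⊎ Outside y → ¬ (FR x y ≈ᴿ c)
          off-curve x y (inj₁ o) e = o (≤-<-trans (proj₁ (proj₂ bounded x y (trans (sym (FR-ι x y)) (ι-cong e)))) (proj₂ (proj₂ size)))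
          off-curve x y (inj₂ o) e = o (≤-<-trans (proj₂ (proj₂ bounded x y (trans (sym (FR-ι x y)) (ι-cong e)))) (proj₂ (proj₂ size)))

          const-cts : ∀ x s → Continuous-at (λ _ → x) s
          const-cts x s = Limits.tends-const (nhds s) x

          vertical : ∀ x → Outside x → ∀ y y′ → FR x y < c → FR x y′ < c
          vertical x o = constant-sign (λ y → FR x y) c (λ s → FR-continuous (λ _ → x) (λ y → y) s (const-cts x s) (tends-id s)) (λ y → off-curve x y (inj₁ o))

          horizontal : ∀ y → Outside y → ∀ x x′ → FR x y < c → FR x′ y < c
          horizontal y o = constant-sign (λ x → FR x y) c (λ s → FR-continuous (λ x → x) (λ _ → y) s (tends-id s) (const-cts y s)) (λ x → off-curve x y (inj₂ o))

          -- Horizontal and vertical lines outside the box miss the fibre, so F - c keeps its sign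
          -- along them. Two such lines connect (m, m) to any outside point.
          corner : FR m m < c → ∀ x y → Outside x ⊎ Outside y → FR x y < c
          corner mm x y (inj₁ o) = vertical x o m y (horizontal m m-outside m x mm)
          corner mm x y (inj₂ o) = horizontal y o m x (vertical m m-outside m y mm)

          Box : Set
          Box = SmallSquare m × SmallSquare m

          box-bound : ∃ λ B → ∀ (a : Box) → B ≤ FR (proj₁ (proj₁ a)) (proj₁ (proj₂ a))
          box-bound = bounded-below (λ a → proj₁ (proj₁ a)) (λ a → proj₁ (proj₂ a))
            (let (b , 0≤b , f) = small-bounded m in b , 0≤b , λ a → f (proj₁ a))
            (let (b , 0≤b , f) = small-bounded m in b , 0≤b , λ a → f (proj₂ a))

          -- A value that F does not take in the box. It is taken somewhere, hence outside, and this
          -- gives one outside point with F < c.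
          below : ∃ λ c′ → c′ < c × c′ < proj₁ box-bound
          below = let (z , a , b) = above (-ᴿ c) (-ᴿ proj₁ box-bound) in -ᴿ z , flip a , flip b
            where
            flip : ∀ {x z} → -ᴿ x < z → -ᴿ z < x
            flip {x} {z} p = 0<-⇒< (<⇒0<- p) (solveᴾ 2 (λ x z → z -ᴾ (-ᴾ x) =ᴾ x -ᴾ (-ᴾ z)) R.refl x z)

          point : ∃₂ λ x y → FR x y ≈ᴿ proj₁ below
          point = surjectiveᴿ (proj₁ below)
          x = proj₁ point
          y = proj₁ (proj₂ point)

          FR<c : FR x y < c
          FR<c = <-resp (R.sym (proj₂ (proj₂ point))) R.refl (proj₁ (proj₂ below))

          mm<c : FR m m < c
          mm<c = by (<-≤-connex (m *ᴿ m) (x *ᴿ x)) (<-≤-connex (m *ᴿ m) (y *ᴿ y))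
            where
            by : m *ᴿ m < x *ᴿ x ⊎ x *ᴿ x ≤ m *ᴿ m → m *ᴿ m < y *ᴿ y ⊎ y *ᴿ y ≤ m *ᴿ m → FR m m < c
            by (inj₁ o) _        = horizontal m m-outside x m (vertical x (<⇒≤ o) y m FR<c)
            by (inj₂ _) (inj₁ o) = vertical m m-outside y m (horizontal y (<⇒≤ o) x m FR<c)
            by (inj₂ p) (inj₂ q) = ⊥-elim (proj₂ box-bound ((x , p) , (y , q)) (<-resp (R.sym (proj₂ (proj₂ point))) R.refl (proj₂ (proj₂ below))))

          ray : ∃ λ r → 0ᴿ < r × (∀ s → r < s → 0ᴿ < FR (s *ᴿ w₁) (s *ᴿ w₂))
          ray = ray-positive w₁ w₂ (positive-if-nonzero nonnegative w₁ w₂ T[w]≉0)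
          r = proj₁ ray

          far : ∀ {w} → ¬ (w ≈ᴿ 0ᴿ) → ∃ λ s → r < s × Outside (s *ᴿ w)
          far {w} w≉0 = s , proj₂ (proj₂ chosen) , <⇒≤ (<-resp (proj₂ (proj₂ quotient)) (solveᴾ 2 (λ s w → (s *ᴾ s) *ᴾ (w *ᴾ w) =ᴾ (s *ᴾ w) *ᴾ (s *ᴾ w)) R.refl s w)
              (0<-⇒< (R.*-positive (<⇒0<- q<s²) (sq-pos w≉0)) (solveᴾ 3 (λ s q w → (s -ᴾ q) *ᴾ w =ᴾ s *ᴾ w -ᴾ q *ᴾ w) R.refl (s *ᴿ s) (proj₁ quotient) (w *ᴿ w))))
            where
            quotient : ∃ λ q → 0ᴿ < q × q *ᴿ (w *ᴿ w) ≈ᴿ m *ᴿ m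
            quotient = divide (R.*-positive (proj₁ (proj₂ size)) (proj₁ (proj₂ size))) (sq-pos w≉0)
            chosen : ∃ λ s → proj₁ quotient +ᴿ 1ᴿ < s × r < s
            chosen = above (proj₁ quotient +ᴿ 1ᴿ) r
            s = proj₁ chosen
            1<s : 1ᴿ < s
            1<s = <-trans (0<-⇒< (proj₁ (proj₂ quotient)) (solveᴾ 1 (λ q → q =ᴾ (q +ᴾ conᴾ (+ 1)) -ᴾ conᴾ (+ 1)) R.refl (proj₁ quotient))) (proj₁ (proj₂ chosen))
            q<s² : proj₁ quotient < s *ᴿ s
            q<s² = <-trans (<-trans (0<-⇒< 0<1 (solveᴾ 1 (λ q → conᴾ (+ 1) =ᴾ (q +ᴾ conᴾ (+ 1)) -ᴾ q) R.refl (proj₁ quotient))) (proj₁ (proj₂ chosen)))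
              (0<-⇒< (R.*-positive (<-trans 0<1 1<s) (<⇒0<- 1<s)) (solveᴾ 1 (λ m → m *ᴾ (m -ᴾ conᴾ (+ 1)) =ᴾ m *ᴾ m -ᴾ m) R.refl s))

          absurd : ∀ s → r < s → Outside (s *ᴿ w₁) ⊎ Outside (s *ᴿ w₂) → ⊥
          absurd s r<s o = <⇒≤ (<-trans (proj₂ (proj₂ ray) s r<s) (corner mm<c (s *ᴿ w₁) (s *ᴿ w₂) o)) c<0

        impossible : ⊥
        impossible with em {w₁ ≈ᴿ 0ᴿ}
        ... | no  w₁≉0 = let (s , r<s , o) = far w₁≉0 in absurd s r<s (inj₁ o)
        ... | yes w₁≈0 = let (s , r<s , o) = far (λ w₂≈0 → w≉0 (w₁≈0 , w₂≈0)) in absurd s r<s (inj₂ o)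

      -- What is kept of a real fibre: the directions P and Q of its ends, that every zero of T is
      -- parallel to one of them, and that the fibre meets a line ℝ(u, v) with P and Q on opposite
      -- sides, the side being the sign of the determinant with (u, v).
      record Ends (c : ℝ) : Set where
        field
          P₁ P₂ Q₁ Q₂ : ℝ
          P≉0      : ¬ (P₁ ≈ᴿ 0ᴿ × P₂ ≈ᴿ 0ᴿ)
          Q≉0      : ¬ (Q₁ ≈ᴿ 0ᴿ × Q₂ ≈ᴿ 0ᴿ)
          cover    : ∀ v₁ v₂ → evalℂ H (v₁ ∷ v₂ ∷ 0# ∷ []) ≈ 0# → ¬ (v₁ ≈ 0# × v₂ ≈ 0#) →
                     det v₁ v₂ (ι P₁) (ι P₂) ≈ 0# ⊎ det v₁ v₂ (ι Q₁) (ι Q₂) ≈ 0#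
          crossing : ∀ u v → detᴿ u v P₁ P₂ < 0ᴿ → 0ᴿ < detᴿ u v Q₁ Q₂ → ∃ λ s → FR (s *ᴿ u) (s *ᴿ v) ≈ᴿ c

      module _ (c : ℝ) (RP : RealParam F c) where
        open RealParam RP
        private
          E₀ : End _≈_ X Y
          E₀ = low-end X Y nontrivial
          E∞ : End (λ t s → t * s ≈ 1#) X Y
          E∞ = high-end X Y nontrivial
          module E₀ = End E₀
          module E∞ = End E∞

          -- Z and its complex conjugate agree on the positive reals, hence also at 0.
          real-at-0 : ∀ Z → (∀ x → 0ᴿ < x → ∃ λ ρ → ev Z (ι x) ≈ ι ρ) → ev Z 0# ≈ ι (re (ev Z 0#))
          real-at-0 Z real = im≈0⇒ι (conj-fixed⇒im≈0 (x-y≈0⇒x≈y (trans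
              (+-cong (trans (ev-conj Z 0#) (ev-cong (List.map conj Z) conj-0)) (solve 1 (λ x → :- x := (:- con (+ 1)) :* x) refl (ev Z 0#)))
              (isPoly-identity difference 0ᴿ vanish 0#))))
            where
            difference : IsPoly (λ t → ev (List.map conj Z) t + (- 1#) * ev Z t)
            difference = plus (isPoly-ev (List.map conj Z)) (times (const (- 1#)) (isPoly-ev Z))
              where open IsSubalgebra isPoly-isSubalgebra
            vanish : ∀ x → 0ᴿ < x → ev (List.map conj Z) (ι x) + (- 1#) * ev Z (ι x) ≈ 0#
            vanish x 0<x = let (ρ , e) = real x 0<x in
              trans (+-congʳ (trans (ev-cong (List.map conj Z) (sym (conj-ι x))) (trans (sym (ev-conj Z (ι x))) (trans (conj-cong e) (trans (conj-ι ρ) (sym e))))))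
                (solve 1 (λ x → x :+ (:- con (+ 1)) :* x := con (+ 0)) refl (ev Z (ι x)))

          -- `partner` turns a positive local parameter x into a positive r: r = x at the low end
          -- and r = 1/x at the high end.
          module RealEnd {Q : ℂ → ℂ → Set} (E : End Q X Y)
                         (partner : ∀ x → 0ᴿ < x → ∃ λ r → 0ᴿ < r × Q (ι r) (ι x)) where
            open End E hiding (nonzero)

            divided : ∀ {z z′ r ρ} → 0ᴿ < r → z ≈ ι r ^ exponent * z′ → z ≈ ι ρ → ∃ λ ρ′ → z′ ≈ ι ρ′
            divided {z} {z′} {r} {ρ} 0<r e f = ρ *ᴿ (r ^ᴿ exponent) R.⁻¹ , *-cancelˡ (^≉0 exponent (ι≉0 (0<⇒≉0 0<r)))
              (trans (sym e) (trans f (trans (ι-cong value) (trans (ι-* _ _) (*-congʳ (sym (ι-^ r exponent)))))))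
              where
              value : ρ ≈ᴿ r ^ᴿ exponent *ᴿ (ρ *ᴿ (r ^ᴿ exponent) R.⁻¹)
              value = R.sym (R.trans (solveᴾ 3 (λ a b c → a *ᴾ (b *ᴾ c) =ᴾ b *ᴾ (a *ᴾ c)) R.refl (r ^ᴿ exponent) ρ ((r ^ᴿ exponent) R.⁻¹))
                (R.trans (R.*-congˡ (R.⁻¹-inverseʳ (0<⇒≉0 (^-pos exponent 0<r)))) (R.*-identityʳ ρ)))

            X′-real : ev X′ 0# ≈ ι (re (ev X′ 0#))
            X′-real = real-at-0 X′ (λ x 0<x → let (r , 0<r , q) = partner x 0<x ; (_ , _ , _ , e , _) = real r 0<r in
              divided 0<r (X-eq (ι r) (ι x) q) e)

            Y′-real : ev Y′ 0# ≈ ι (re (ev Y′ 0#))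
            Y′-real = real-at-0 Y′ (λ x 0<x → let (r , 0<r , q) = partner x 0<x ; (_ , _ , _ , _ , e) = real r 0<r in
              divided 0<r (Y-eq (ι r) (ι x) q) e)

            end-nonzero : ¬ (re (ev X′ 0#) ≈ᴿ 0ᴿ × re (ev Y′ 0#) ≈ᴿ 0ᴿ)
            end-nonzero (p , q) = End.nonzero E (trans X′-real (trans (ι-cong p) ι-0) , trans Y′-real (trans (ι-cong q) ι-0))

            module _ (u v : ℝ) where
              -- Determinants of (u, v) with the curve and with its normalisation at the end. They
              -- differ by the positive factor r^exponent, so they have the same sign.
              g g′ : ℝ → ℝ
              g r = u *ᴿ re (ev Y (ι r)) +ᴿ -ᴿ (v *ᴿ re (ev X (ι r)))
              g′ x = u *ᴿ re (ev Y′ (ι x)) +ᴿ -ᴿ (v *ᴿ re (ev X′ (ι x)))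

              re-scaled : ∀ {z z′ r} → z ≈ ι r ^ exponent * z′ → re z ≈ᴿ r ^ᴿ exponent *ᴿ re z′
              re-scaled {z} {z′} {r} e = R.trans (re-cong (trans e (*-congʳ (ι-^ r exponent)))) (R.trans (re-* _ _)
                (R.trans (R.+-cong (R.*-congʳ (re-mk _ _)) (R.-‿cong (R.*-congʳ (im-mk _ _))))
                  (solveᴾ 3 (λ s u v → s *ᴾ u -ᴾ conᴾ (+ 0) *ᴾ v =ᴾ s *ᴾ u) R.refl (r ^ᴿ exponent) (re z′) (im z′))))

              g-scaled : ∀ r x → Q (ι r) (ι x) → g r ≈ᴿ r ^ᴿ exponent *ᴿ g′ x
              g-scaled r x q = R.trans (R.+-cong (R.*-congˡ (re-scaled (Y-eq (ι r) (ι x) q))) (R.-‿cong (R.*-congˡ (re-scaled (X-eq (ι r) (ι x) q)))))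
                (solveᴾ 5 (λ u v s a b → u *ᴾ (s *ᴾ a) +ᴾ -ᴾ (v *ᴾ (s *ᴾ b)) =ᴾ s *ᴾ (u *ᴾ a +ᴾ -ᴾ (v *ᴾ b))) R.refl u v (r ^ᴿ exponent) (re (ev Y′ (ι x))) (re (ev X′ (ι x))))

              g′-tends : Limits.Tends (nhds 0ᴿ) g′ (g′ 0ᴿ)
              g′-tends = tends-+ (tends-* (tends-const u) (tends-re (cts Y′))) (tends-neg (tends-* (tends-const v) (tends-re (cts X′))))
                where
                open ComplexLimits (nhds 0ᴿ)
                cts : ∀ Z → Tendsℂ (λ x → ev Z (ι x)) (ev Z (ι 0ᴿ))
                cts Z = ev-closed (Tendsℂ-isSubalgebra 0ᴿ) Z (Tendsℂ-ι 0ᴿ)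

              g′-at-0 : g′ 0ᴿ ≈ᴿ detᴿ u v (re (ev X′ 0#)) (re (ev Y′ 0#))
              g′-at-0 = R.+-cong (R.*-congˡ (re-cong (ev-cong Y′ ι-0))) (R.-‿cong (R.*-congˡ (re-cong (ev-cong X′ ι-0))))

              near-end : ∀ B → 0ᴿ < B → (∃ λ δ → 0ᴿ < δ × (∀ x → (x -ᴿ 0ᴿ) ⊲ δ → 0ᴿ < g′ x) ) → ∃ λ x → 0ᴿ < x × x < B × 0ᴿ < g′ x
              near-end B 0<B (δ , 0<δ , p) =
                let (m , 0<m , m≤δ , m≤B) = minimum 0<δ 0<B
                    (x , 0<x , x<m) = half 0<m in
                x , 0<x , <-≤-trans x<m m≤B , p x (⊲-resp (solveᴾ 1 (λ x → x =ᴾ x -ᴾ conᴾ (+ 0)) R.refl x) R.refl (within (<-trans (0<⇒-<0 0<δ) 0<x) (<-≤-trans x<m m≤δ)))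

              positive-near : 0ᴿ < detᴿ u v (re (ev X′ 0#)) (re (ev Y′ 0#)) → ∃ λ x → 0ᴿ < x × x < 1ᴿ × 0ᴿ < g′ x
              positive-near 0<D = near-end 1ᴿ 0<1 (Limits.tends-pos (nhds 0ᴿ) {g′} g′-tends (<-resp R.refl (R.sym g′-at-0) 0<D))

          module Low = RealEnd E₀ (λ x 0<x → x , 0<x , refl)
          module High = RealEnd E∞ (λ x 0<x → x R.⁻¹ , ⁻¹-pos 0<x , trans (sym (ι-* _ _)) (trans (ι-cong (R.trans (R.*-comm _ _) (R.⁻¹-inverseʳ (0<⇒≉0 0<x)))) ι-1))

          P₁ P₂ Q₁ Q₂ : ℝ
          P₁ = re (ev E₀.X′ 0#)
          P₂ = re (ev E₀.Y′ 0#)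
          Q₁ = re (ev E∞.X′ 0#)
          Q₂ = re (ev E∞.Y′ 0#)

          g : ℝ → ℝ → ℝ → ℝ
          g u v r = u *ᴿ re (ev Y (ι r)) +ᴿ -ᴿ (v *ᴿ re (ev X (ι r)))

          g-cts : ∀ u v s → Continuous-at (g u v) s
          g-cts u v s = tends-+ (tends-* (tends-const u) (tends-re (cts Y))) (tends-neg (tends-* (tends-const v) (tends-re (cts X))))
            where
            open ComplexLimits (nhds s)
            cts : ∀ Z → Tendsℂ (λ x → ev Z (ι x)) (ev Z (ι s))
            cts Z = ev-closed (Tendsℂ-isSubalgebra s) Z (Tendsℂ-ι s)

          -- Up to the positive factor r^k, g is the determinant of (u, v) with the real point (ξ,
          -- η); when it is 0 the point lies on the line.
          on-line : ∀ u v → ¬ (u ≈ᴿ 0ᴿ × v ≈ᴿ 0ᴿ) → ∀ r → 0ᴿ < r → g u v r ≈ᴿ 0ᴿ → ∃ λ s → FR (s *ᴿ u) (s *ᴿ v) ≈ᴿ c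
          on-line u v uv≉0 r 0<r g≈0 = by em
            where
            ξ = proj₁ (real r 0<r)
            η = proj₁ (proj₂ (real r 0<r))
            FR≈c : FR ξ η ≈ᴿ c
            FR≈c = ι-injective (trans (FR-ι ξ η) (proj₁ (proj₂ (proj₂ (real r 0<r)))))
            X≈ : re (ev X (ι r)) ≈ᴿ r ^ᴿ k *ᴿ ξ
            X≈ = R.trans (re-cong (proj₁ (proj₂ (proj₂ (proj₂ (real r 0<r)))))) (re-mk _ _)
            Y≈ : re (ev Y (ι r)) ≈ᴿ r ^ᴿ k *ᴿ η
            Y≈ = R.trans (re-cong (proj₂ (proj₂ (proj₂ (proj₂ (real r 0<r)))))) (re-mk _ _)
            parallel : u *ᴿ η -ᴿ v *ᴿ ξ ≈ᴿ 0ᴿ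
            parallel = [ (λ z → ⊥-elim (0<⇒≉0 (^-pos k 0<r) z)) , (λ z → z) ]′ (integral (R.trans
              (solveᴾ 5 (λ p u v x y → p *ᴾ (u *ᴾ y -ᴾ v *ᴾ x) =ᴾ u *ᴾ (p *ᴾ y) +ᴾ -ᴾ (v *ᴾ (p *ᴾ x))) R.refl (r ^ᴿ k) u v ξ η)
              (R.trans (R.+-cong (R.*-congˡ (R.sym Y≈)) (R.-‿cong (R.*-congˡ (R.sym X≈)))) g≈0)))
            undo : ∀ {a} b → ¬ (a ≈ᴿ 0ᴿ) → b *ᴿ a R.⁻¹ *ᴿ a ≈ᴿ b
            undo {a} b a≉0 = R.trans (R.*-assoc _ _ _) (R.trans (R.*-congˡ (R.trans (R.*-comm _ _) (R.⁻¹-inverseʳ a≉0))) (R.*-identityʳ b))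
            by : Dec (u ≈ᴿ 0ᴿ) → ∃ λ s → FR (s *ᴿ u) (s *ᴿ v) ≈ᴿ c
            by (no u≉0) = ξ *ᴿ u R.⁻¹ , R.trans (FR-cong (undo ξ u≉0) second) FR≈c
              where
              second : ξ *ᴿ u R.⁻¹ *ᴿ v ≈ᴿ η
              second = R.trans (solveᴾ 5 (λ x i v u y → (x *ᴾ i) *ᴾ v =ᴾ (y *ᴾ i) *ᴾ u -ᴾ i *ᴾ (u *ᴾ y -ᴾ v *ᴾ x)) R.refl ξ (u R.⁻¹) v u η)
                (R.trans (R.+-cong (undo η u≉0) (R.-‿cong (R.trans (R.*-congˡ parallel) (R.zeroʳ _)))) (solveᴾ 1 (λ x → x -ᴾ conᴾ (+ 0) =ᴾ x) R.refl η))
            by (yes u≈0) = η *ᴿ v R.⁻¹ , R.trans (FR-cong first (undo η v≉0)) FR≈c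
              where
              v≉0 : ¬ (v ≈ᴿ 0ᴿ)
              v≉0 z = uv≉0 (u≈0 , z)
              first : η *ᴿ v R.⁻¹ *ᴿ u ≈ᴿ ξ
              first = R.trans (solveᴾ 5 (λ x i v u y → (y *ᴾ i) *ᴾ u =ᴾ (x *ᴾ i) *ᴾ v +ᴾ i *ᴾ (u *ᴾ y -ᴾ v *ᴾ x)) R.refl ξ (v R.⁻¹) v u η)
                (R.trans (R.+-cong (undo ξ v≉0) (R.trans (R.*-congˡ parallel) (R.zeroʳ _))) (R.+-identityʳ ξ))

          -- The determinant with (u, v) is negative at some r₁ < 1 near the low end and positive at
          -- some r₂ > 1 near the high end, so it has a zero in between.
          crossing : ∀ u v → detᴿ u v P₁ P₂ < 0ᴿ → 0ᴿ < detᴿ u v Q₁ Q₂ → ∃ λ s → FR (s *ᴿ u) (s *ᴿ v) ≈ᴿ c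
          crossing u v P<0 0<Q =
            let (s , r₁≤s , _ , e) = ivt (g u v) r₁ r₂ (<⇒≤ (<-trans r₁<1 1<r₂)) (λ s _ _ → g-cts u v s) negative positive
            in on-line u v uv≉0 s (<-≤-trans 0<r₁ r₁≤s) e
            where
            uv≉0 : ¬ (u ≈ᴿ 0ᴿ × v ≈ᴿ 0ᴿ)
            uv≉0 (p , q) = <⇒≉ 0<Q (R.sym (R.trans (R.+-cong (R.*-congʳ p) (R.-‿cong (R.*-congʳ q)))
              (solveᴾ 2 (λ x y → conᴾ (+ 0) *ᴾ y -ᴾ conᴾ (+ 0) *ᴾ x =ᴾ conᴾ (+ 0)) R.refl Q₁ Q₂)))
            -- The low end for the opposite direction, so that positivity near the end applies.
            low : ∃ λ x → 0ᴿ < x × x < 1ᴿ × 0ᴿ < Low.g′ (-ᴿ u) (-ᴿ v) x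
            low = Low.positive-near (-ᴿ u) (-ᴿ v) (<-resp R.refl (solveᴾ 4 (λ u v p q → -ᴾ (u *ᴾ q -ᴾ v *ᴾ p) =ᴾ (-ᴾ u) *ᴾ q -ᴾ (-ᴾ v) *ᴾ p) R.refl u v P₁ P₂) (<0⇒0<- P<0))
            high : ∃ λ x → 0ᴿ < x × x < 1ᴿ × 0ᴿ < High.g′ u v x
            high = High.positive-near u v 0<Q
            r₁ r₂ : ℝ
            r₁ = proj₁ low
            r₂ = proj₁ high R.⁻¹
            0<r₁ : 0ᴿ < r₁
            0<r₁ = proj₁ (proj₂ low)
            r₁<1 : r₁ < 1ᴿ
            r₁<1 = proj₁ (proj₂ (proj₂ low))
            0<x = proj₁ (proj₂ high)
            r₂x≈1 : r₂ *ᴿ proj₁ high ≈ᴿ 1ᴿ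
            r₂x≈1 = R.trans (R.*-comm _ _) (R.⁻¹-inverseʳ (0<⇒≉0 0<x))
            1<r₂ : 1ᴿ < r₂
            1<r₂ = 0<-⇒< (R.*-positive (⁻¹-pos 0<x) (<⇒0<- (proj₁ (proj₂ (proj₂ high)))))
              (R.trans (solveᴾ 2 (λ r x → r *ᴾ (conᴾ (+ 1) -ᴾ x) =ᴾ r -ᴾ r *ᴾ x) R.refl r₂ (proj₁ high)) (R.+-congˡ (R.-‿cong r₂x≈1)))
            negative : g u v r₁ < 0ᴿ
            negative = 0<-⇒< (R.*-positive (^-pos E₀.exponent 0<r₁) (proj₂ (proj₂ (proj₂ low))))
              (R.trans (R.sym (Low.g-scaled (-ᴿ u) (-ᴿ v) r₁ r₁ refl))
                (solveᴾ 4 (λ u v a b → (-ᴾ u) *ᴾ a +ᴾ -ᴾ ((-ᴾ v) *ᴾ b) =ᴾ conᴾ (+ 0) -ᴾ (u *ᴾ a +ᴾ -ᴾ (v *ᴾ b))) R.refl u v (re (ev Y (ι r₁))) (re (ev X (ι r₁)))))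
            positive : 0ᴿ < g u v r₂
            positive = <-resp R.refl (R.sym (High.g-scaled u v r₂ (proj₁ high) (trans (sym (ι-* _ _)) (trans (ι-cong r₂x≈1) ι-1))))
              (R.*-positive (^-pos E∞.exponent (⁻¹-pos 0<x)) (proj₂ (proj₂ (proj₂ high))))

        ends : Ends c
        ends = record
          { P₁ = P₁ ; P₂ = P₂ ; Q₁ = Q₁ ; Q₂ = Q₂
          ; P≉0 = Low.end-nonzero ; Q≉0 = High.end-nonzero
          ; cover = λ v₁ v₂ T[v]≈0 v≉0 →
              [ (λ e → inj₁ (trans (det-cong v₁ v₂ (sym Low.X′-real) (sym Low.Y′-real)) e))
              , (λ e → inj₂ (trans (det-cong v₁ v₂ (sym High.X′-real) (sym High.Y′-real)) e)) ]′
              (Covering.covering T (ι c) {k} surjective E₀ E∞ v₁ v₂ T[v]≈0 v≉0)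
          ; crossing = crossing }
          where
          det-cong : ∀ a b {x y x′ y′} → x ≈ x′ → y ≈ y′ → det a b x y ≈ det a b x′ y′
          det-cong a b p q = +-cong (*-congˡ q) (*-congˡ p)

      private
        p≉0 : ¬ (p₁ ≈ 0# × p₂ ≈ 0#)
        p≉0 (a , b) = pq≉0 (trans (+-cong (*-congʳ a) (*-congʳ (-‿cong b))) (solve 2 (λ x y → con (+ 0) :* y :+ (:- con (+ 0)) :* x := con (+ 0)) refl q₁ q₂))

        q≉0 : ¬ (q₁ ≈ 0# × q₂ ≈ 0#)
        q≉0 (a , b) = pq≉0 (trans (+-cong (*-congˡ b) (*-congˡ a)) (solve 2 (λ x y → x :* con (+ 0) :+ (:- y) :* con (+ 0) := con (+ 0)) refl p₁ p₂))

        ι-nonzero : ∀ {x y} → ¬ (x ≈ᴿ 0ᴿ × y ≈ᴿ 0ᴿ) → ¬ (ι x ≈ 0# × ι y ≈ 0#)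
        ι-nonzero nz (a , b) = nz (ι-injective (trans a (sym ι-0)) , ι-injective (trans b (sym ι-0)))

        top-scaled : ∀ {x y u v s} → s ≉ 0# → x ≈ s * u → y ≈ s * v → evalℂ H (x ∷ y ∷ 0# ∷ []) ≈ 0# → evalℂ H (u ∷ v ∷ 0# ∷ []) ≈ 0#
        top-scaled {s = s} s≉0 a b e = *-cancelˡ (^≉0 d s≉0) (trans (sym (homogeneous s _ _ 0#))
          (trans (evalℂ-cong H (sym a ∷ sym b ∷ zeroʳ s ∷ [])) (trans e (sym (zeroʳ _)))))

        det-scaled : ∀ {x y u v x′ y′ u′ v′ s s′} → x ≈ s * u → y ≈ s * v → x′ ≈ s′ * u′ → y′ ≈ s′ * v′ → det x y x′ y′ ≈ (s * s′) * det u v u′ v′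
        det-scaled {u = u} {v} {u′ = u′} {v′} {s} {s′} a b a′ b′ = trans (+-cong (*-cong a b′) (*-cong (-‿cong b) a′))
          (solve 6 (λ s t u v w x → (s :* u) :* (t :* x) :+ (:- (s :* v)) :* (t :* w) := (s :* t) :* (u :* x :+ (:- v) :* w)) refl s s′ u v u′ v′)

        det-self : ∀ u v → det u v u v ≈ 0#
        det-self u v = solve 2 (λ u v → u :* v :+ (:- v) :* u := con (+ 0)) refl u v

        Zeros : ℝ → ℝ → ℝ → ℝ → Set
        Zeros a b x y = evalℂ H (ι a ∷ ι b ∷ 0# ∷ []) ≈ 0# × evalℂ H (ι x ∷ ι y ∷ 0# ∷ []) ≈ 0# × det (ι a) (ι b) (ι x) (ι y) ≉ 0#

        -- Each of the complex zeros p and q is a multiple of a real vector. By homogeneity these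
        -- real vectors are zeros of T too, and they remain independent.
        matched : ∀ {a b x y} → ¬ (a ≈ᴿ 0ᴿ × b ≈ᴿ 0ᴿ) → ¬ (x ≈ᴿ 0ᴿ × y ≈ᴿ 0ᴿ) →
                  det p₁ p₂ (ι a) (ι b) ≈ 0# → det q₁ q₂ (ι x) (ι y) ≈ 0# → Zeros a b x y
        matched ab≉0 xy≉0 e f =
          let (s , s≉0 , i , j) = det≈0⇒scalar p≉0 (ι-nonzero ab≉0) e
              (t , t≉0 , i′ , j′) = det≈0⇒scalar q≉0 (ι-nonzero xy≉0) f
          in top-scaled s≉0 i j T[p]≈0 , top-scaled t≉0 i′ j′ T[q]≈0 ,
             λ z → pq≉0 (trans (det-scaled i j i′ j′) (trans (*-congˡ z) (zeroʳ _)))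

        same : ∀ {a b} → ¬ (a ≈ᴿ 0ᴿ × b ≈ᴿ 0ᴿ) → det p₁ p₂ (ι a) (ι b) ≈ 0# → det q₁ q₂ (ι a) (ι b) ≈ 0# → ⊥
        same {a} {b} ab≉0 e f = proj₂ (proj₂ (matched ab≉0 ab≉0 e f)) (det-self (ι a) (ι b))

      module FirstCurve {c₁ : ℝ} (E₁ : Ends c₁) where
        open Ends E₁ using (P₁; P₂; Q₁; Q₂; P≉0; Q≉0; cover)

        -- p and q cannot be parallel to the same end, so the two ends match them in one order or
        -- the other.
        zeros : Zeros P₁ P₂ Q₁ Q₂
        zeros = by (cover p₁ p₂ T[p]≈0 p≉0) (cover q₁ q₂ T[q]≈0 q≉0)
          where
          by : det p₁ p₂ (ι P₁) (ι P₂) ≈ 0# ⊎ det p₁ p₂ (ι Q₁) (ι Q₂) ≈ 0# → det q₁ q₂ (ι P₁) (ι P₂) ≈ 0# ⊎ det q₁ q₂ (ι Q₁) (ι Q₂) ≈ 0# → Zeros P₁ P₂ Q₁ Q₂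
          by (inj₁ e) (inj₂ f) = matched P≉0 Q≉0 e f
          by (inj₁ e) (inj₁ f) = ⊥-elim (same P≉0 e f)
          by (inj₂ e) (inj₂ f) = ⊥-elim (same Q≉0 e f)
          by (inj₂ e) (inj₁ f) = let (T[Q] , T[P] , nz) = matched Q≉0 P≉0 e f in T[P] , T[Q] ,
            λ z → nz (trans (solve 4 (λ a b x y → x :* b :+ (:- y) :* a := :- (a :* y :+ (:- b) :* x)) refl (ι P₁) (ι P₂) (ι Q₁) (ι Q₂))
                      (trans (-‿cong z) (solve 0 (:- con (+ 0) := con (+ 0)) refl)))

        PQ≉0 : ¬ (detᴿ P₁ P₂ Q₁ Q₂ ≈ᴿ 0ᴿ)
        PQ≉0 z = proj₂ (proj₂ zeros) (trans (det-ι P₁ P₂ Q₁ Q₂) (trans (ι-cong z) ι-0))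

        QP≉0 : ¬ (detᴿ Q₁ Q₂ P₁ P₂ ≈ᴿ 0ᴿ)
        QP≉0 = detᴿ-swap≉0 P₁ P₂ Q₁ Q₂ PQ≉0

        -- For w = P + εQ the determinants with P and Q are ε det(Q, P) and det(P, Q). Both are
        -- nonzero, so w is parallel to neither end and T(w) ≠ 0. It is applied with ε = 1 and ε =
        -- -1.
        module Line (ε : ℝ) (ε≉0 : ¬ (ε ≈ᴿ 0ᴿ)) where
          u v : ℝ
          u = P₁ +ᴿ ε *ᴿ Q₁
          v = P₂ +ᴿ ε *ᴿ Q₂

          det-w : ∀ x y → detᴿ u v x y ≈ᴿ detᴿ P₁ P₂ x y +ᴿ ε *ᴿ detᴿ Q₁ Q₂ x y
          det-w x y = detᴿ-combination P₁ P₂ Q₁ Q₂ ε x y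

          wP≉0 : ¬ (detᴿ u v P₁ P₂ ≈ᴿ 0ᴿ)
          wP≉0 z = *-≉0 ε≉0 QP≉0 (R.trans (R.sym (R.+-identityˡ _)) (R.trans (R.+-congʳ (R.sym (detᴿ-self P₁ P₂))) (R.trans (R.sym (det-w P₁ P₂)) z)))

          wQ≉0 : ¬ (detᴿ u v Q₁ Q₂ ≈ᴿ 0ᴿ)
          wQ≉0 z = PQ≉0 (R.trans (R.sym (R.+-identityʳ _)) (R.trans (R.+-congˡ (R.sym (R.trans (R.*-congˡ (detᴿ-self Q₁ Q₂)) (R.zeroʳ ε))))
            (R.trans (R.sym (det-w Q₁ Q₂)) z)))

          top-nonzero : ¬ (HR u v 0ᴿ ≈ᴿ 0ᴿ)
          top-nonzero z = [ (λ e → wP≉0 (ι-injective (trans (sym (det-ι u v P₁ P₂)) (trans e (sym ι-0)))))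
                          , (λ e → wQ≉0 (ι-injective (trans (sym (det-ι u v Q₁ Q₂)) (trans e (sym ι-0))))) ]′
            (cover (ι u) (ι v) (trans (sym (top-ι u v)) (trans (ι-cong z) ι-0)) (ι-nonzero (λ e → wQ≉0 (detᴿ-zeroˡ u v Q₁ Q₂ e))))

          abstract
            bound : ∃ λ B → ∀ s → B ≤ FR (s *ᴿ u) (s *ᴿ v)
            bound = line-bounded-below nonnegative u v top-nonzero

        -1≉0 : ¬ (-ᴿ 1ᴿ ≈ᴿ 0ᴿ)
        -1≉0 e = <⇒≉ (0<⇒-<0 0<1) e

        1≉0ᴿ : ¬ (1ᴿ ≈ᴿ 0ᴿ)
        1≉0ᴿ = 0<⇒≉0 0<1

        bound⁺ bound⁻ : ℝ
        bound⁺ = proj₁ (Line.bound 1ᴿ 1≉0ᴿ)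
        bound⁻ = proj₁ (Line.bound (-ᴿ 1ᴿ) -1≉0)

      -- A negative product places the two ends on opposite sides of the line, which is then met at
      -- level c < B. `crossing` wants P on the negative side; otherwise (u, v) is replaced by its
      -- opposite, which spans the same line.
      no-crossing : ∀ {c} (E : Ends c) u v B → (∀ s → B ≤ FR (s *ᴿ u) (s *ᴿ v)) → c < B →
                    ¬ (detᴿ u v (Ends.P₁ E) (Ends.P₂ E) *ᴿ detᴿ u v (Ends.Q₁ E) (Ends.Q₂ E) < 0ᴿ)
      no-crossing {c} E u v B bound c<B lt = by (ST.compare DP 0ᴿ)
        where
        open Ends E
        DP DQ : ℝ
        DP = detᴿ u v P₁ P₂
        DQ = detᴿ u v Q₁ Q₂
        0<-PQ : 0ᴿ < -ᴿ (DP *ᴿ DQ)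
        0<-PQ = <0⇒0<- lt
        moved : ∀ s w → (-ᴿ s) *ᴿ w ≈ᴿ s *ᴿ (-ᴿ w)
        moved s w = solveᴾ 2 (λ s w → (-ᴾ s) *ᴾ w =ᴾ s *ᴾ (-ᴾ w)) R.refl s w
        by : Tri (DP < 0ᴿ) (DP ≈ᴿ 0ᴿ) (0ᴿ < DP) → ⊥
        by (tri≈ _ z _)   = <⇒≉ lt (R.trans (R.*-congʳ z) (R.zeroˡ DQ))
        by (tri< P<0 _ _) =
          let (s , e) = crossing u v P<0 (*-cancelʳ-pos (<0⇒0<- P<0) (<-resp R.refl (solveᴾ 2 (λ a b → -ᴾ (a *ᴾ b) =ᴾ b *ᴾ (-ᴾ a)) R.refl DP DQ) 0<-PQ))
          in bound s (<-resp (R.sym e) R.refl c<B)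
        by (tri> _ _ 0<P) =
          let (s , e) = crossing (-ᴿ u) (-ᴿ v)
                (<-resp (detᴿ-neg u v P₁ P₂) R.refl (0<⇒-<0 0<P))
                (<-resp R.refl (detᴿ-neg u v Q₁ Q₂)
                  (*-cancelʳ-pos 0<P (<-resp R.refl (solveᴾ 2 (λ a b → -ᴾ (a *ᴾ b) =ᴾ (-ᴾ b) *ᴾ a) R.refl DP DQ) 0<-PQ)))
          in bound (-ᴿ s) (<-resp (R.sym (R.trans (FR-cong (moved s u) (moved s v)) e)) R.refl c<B)

      module SecondCurve {c₁ c₂ : ℝ} (E₁ : Ends c₁) (E₂ : Ends c₂)
                         (c₂<⁺ : c₂ < FirstCurve.bound⁺ E₁) (c₂<⁻ : c₂ < FirstCurve.bound⁻ E₁) where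
        open FirstCurve E₁
        open Ends E₁ using (P₁; P₂; Q₁; Q₂; P≉0; Q≉0)
        private module E₂ = Ends E₂

        -- On one of the lines through P + Q and P − Q the signs at the two ends differ.
        decide : ∀ K → ¬ (K ≈ᴿ 0ᴿ) →
                 (∀ ε (ε≉0 : ¬ (ε ≈ᴿ 0ᴿ)) → detᴿ (Line.u ε ε≉0) (Line.v ε ε≉0) E₂.P₁ E₂.P₂ *ᴿ detᴿ (Line.u ε ε≉0) (Line.v ε ε≉0) E₂.Q₁ E₂.Q₂ ≈ᴿ ε *ᴿ K) → ⊥
        decide K K≉0 product = by (ST.compare K 0ᴿ)
          where
          by : Tri (K < 0ᴿ) (K ≈ᴿ 0ᴿ) (0ᴿ < K) → ⊥
          by (tri≈ _ z _)   = K≉0 z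
          by (tri< K<0 _ _) = no-crossing E₂ _ _ _ (proj₂ (Line.bound 1ᴿ 1≉0ᴿ)) c₂<⁺
                (<-resp (R.sym (R.trans (product 1ᴿ 1≉0ᴿ) (R.*-identityˡ K))) R.refl K<0)
          by (tri> _ _ 0<K) = no-crossing E₂ _ _ _ (proj₂ (Line.bound (-ᴿ 1ᴿ) -1≉0)) c₂<⁻
                (<-resp (R.sym (R.trans (product (-ᴿ 1ᴿ) -1≉0) (solveᴾ 1 (λ k → (-ᴾ conᴾ (+ 1)) *ᴾ k =ᴾ -ᴾ k) R.refl K))) R.refl (0<⇒-<0 0<K))

        coverᴿ : ∀ a b → evalℂ H (ι a ∷ ι b ∷ 0# ∷ []) ≈ 0# → ¬ (a ≈ᴿ 0ᴿ × b ≈ᴿ 0ᴿ) → detᴿ a b E₂.P₁ E₂.P₂ ≈ᴿ 0ᴿ ⊎ detᴿ a b E₂.Q₁ E₂.Q₂ ≈ᴿ 0ᴿ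
        coverᴿ a b e nz = [ (λ z → inj₁ (ι-injective (trans (sym (det-ι a b E₂.P₁ E₂.P₂)) (trans z (sym ι-0)))))
                          , (λ z → inj₂ (ι-injective (trans (sym (det-ι a b E₂.Q₁ E₂.Q₂)) (trans z (sym ι-0))))) ]′ (E₂.cover (ι a) (ι b) e (ι-nonzero nz))

        -- P and Q are parallel to the ends of the second fibre in one of two orders. In either
        -- order the product of the determinants of P + εQ with these ends is ε times a nonzero
        -- constant.
        absurd : ⊥
        absurd = by (coverᴿ P₁ P₂ (proj₁ zeros) P≉0) (coverᴿ Q₁ Q₂ (proj₁ (proj₂ zeros)) Q≉0)
          where
          by : detᴿ P₁ P₂ E₂.P₁ E₂.P₂ ≈ᴿ 0ᴿ ⊎ detᴿ P₁ P₂ E₂.Q₁ E₂.Q₂ ≈ᴿ 0ᴿ → detᴿ Q₁ Q₂ E₂.P₁ E₂.P₂ ≈ᴿ 0ᴿ ⊎ detᴿ Q₁ Q₂ E₂.Q₁ E₂.Q₂ ≈ᴿ 0ᴿ → ⊥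
          by (inj₁ e) (inj₁ f) = independent P₁ P₂ Q₁ Q₂ E₂.P₁ E₂.P₂ PQ≉0 E₂.P≉0 e f
          by (inj₂ e) (inj₂ f) = independent P₁ P₂ Q₁ Q₂ E₂.Q₁ E₂.Q₂ PQ≉0 E₂.Q≉0 e f
          by (inj₁ e) (inj₂ f) = decide (detᴿ Q₁ Q₂ E₂.P₁ E₂.P₂ *ᴿ detᴿ P₁ P₂ E₂.Q₁ E₂.Q₂)
            (*-≉0 (independent P₁ P₂ Q₁ Q₂ E₂.P₁ E₂.P₂ PQ≉0 E₂.P≉0 e) (independent Q₁ Q₂ P₁ P₂ E₂.Q₁ E₂.Q₂ QP≉0 E₂.Q≉0 f)) λ ε ε≉0 →
            R.trans (R.*-cong (R.trans (Line.det-w ε ε≉0 E₂.P₁ E₂.P₂) (R.+-congʳ e)) (R.trans (Line.det-w ε ε≉0 E₂.Q₁ E₂.Q₂) (R.+-congˡ (R.*-congˡ f))))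
              (solveᴾ 3 (λ e a b → (conᴾ (+ 0) +ᴾ e *ᴾ a) *ᴾ (b +ᴾ e *ᴾ conᴾ (+ 0)) =ᴾ e *ᴾ (a *ᴾ b)) R.refl ε (detᴿ Q₁ Q₂ E₂.P₁ E₂.P₂) (detᴿ P₁ P₂ E₂.Q₁ E₂.Q₂))
          by (inj₂ e) (inj₁ f) = decide (detᴿ P₁ P₂ E₂.P₁ E₂.P₂ *ᴿ detᴿ Q₁ Q₂ E₂.Q₁ E₂.Q₂)
            (*-≉0 (independent Q₁ Q₂ P₁ P₂ E₂.P₁ E₂.P₂ QP≉0 E₂.P≉0 f) (independent P₁ P₂ Q₁ Q₂ E₂.Q₁ E₂.Q₂ PQ≉0 E₂.Q≉0 e)) λ ε ε≉0 →
            R.trans (R.*-cong (R.trans (Line.det-w ε ε≉0 E₂.P₁ E₂.P₂) (R.+-congˡ (R.*-congˡ f))) (R.trans (Line.det-w ε ε≉0 E₂.Q₁ E₂.Q₂) (R.+-congʳ e)))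
              (solveᴾ 3 (λ e a b → (a +ᴾ e *ᴾ conᴾ (+ 0)) *ᴾ (conᴾ (+ 0) +ᴾ e *ᴾ b) =ᴾ e *ᴾ (a *ᴾ b)) R.refl ε (detᴿ P₁ P₂ E₂.P₁ E₂.P₂) (detᴿ Q₁ Q₂ E₂.Q₁ E₂.Q₂))

      module _ (B₀ : ℝ) (param : ∀ c → c < B₀ → CurveParam F (ι c)) where
        private
          ends-at : ∀ c → c < B₀ → c < 0ᴿ → Ends c
          ends-at c c<B₀ c<0 =
            let (ξ , η , e) = surjectiveᴿ c in
            [ (λ bounded → ⊥-elim (BoundedCase.impossible c c<0 bounded)) , ends c ]′
            (dichotomy F c (param c c<B₀) ξ η (trans (sym (FR-ι ξ η)) (ι-cong e)))

          below-two : ∀ x y → ∃ λ z → z < x × z < y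
          below-two x y = let (z , -x<z , -y<z) = above (-ᴿ x) (-ᴿ y) in -ᴿ z , flip -x<z , flip -y<z
            where
            flip : ∀ {x z} → -ᴿ x < z → -ᴿ z < x
            flip {x} {z} p = 0<-⇒< (<⇒0<- p) (solveᴾ 2 (λ x z → z -ᴾ (-ᴾ x) =ᴾ x -ᴾ (-ᴾ z)) R.refl x z)

          -- The new level is below both line bounds, below 0 as the bounded case demands, and below
          -- the exceptional values.
          second-curve : ∀ {c₁} → Ends c₁ → ⊥
          second-curve E₁ =
            let (b , b<⁺ , b<⁻) = below-two (FirstCurve.bound⁺ E₁) (FirstCurve.bound⁻ E₁)
                (b′ , b′<B₀ , b′<0) = below-two B₀ 0ᴿ
                (c , c<b , c<b′) = below-two b b′
            in SecondCurve.absurd E₁ (ends-at c (<-trans c<b′ b′<B₀) (<-trans c<b′ b′<0)) (<-trans c<b b<⁺) (<-trans c<b b<⁻)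

        contradiction : ⊥
        contradiction = let (c , c<B₀ , c<0) = below-two B₀ 0ᴿ in second-curve (ends-at c c<B₀ c<0)

  open Contradiction public

-- Pairs of reals as a model of ℂ

module ComplexNumbers (𝓡 : CompleteOrderedField) where
  open CompleteOrderedField 𝓡
  open RealComplex 𝓡
  open IntegerCoefficients.Solver commutativeRing using (solve; _:+_; _:*_; _:-_; :-_; _:=_; con)

  ℂ-commutativeRing : CommutativeRing 0ℓ 0ℓ
  ℂ-commutativeRing = record
    { Carrier = ℂ ; _≈_ = _≈ℂ_
    ; _+_ = RawRing._+_ ℂ-rawRing ; _*_ = RawRing._*_ ℂ-rawRing ; -_ = RawRing.-_ ℂ-rawRing
    ; 0# = RawRing.0# ℂ-rawRing ; 1# = RawRing.1# ℂ-rawRing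
    ; isCommutativeRing = record
      { isRing = record
        { +-isAbelianGroup = record
          { isGroup = record
            { isMonoid = record
              { isSemigroup = record
                { isMagma = record
                  { isEquivalence = record
                    { refl = refl , refl ; sym = λ (p , q) → sym p , sym q ; trans = λ (p , q) (r , s) → trans p r , trans q s }
                  ; ∙-cong = λ (p , q) (r , s) → +-cong p r , +-cong q s }
                ; assoc = λ (a , b) (c , d) (e , f) → +-assoc a c e , +-assoc b d f }
              ; identity = (λ (a , b) → +-identityˡ a , +-identityˡ b) , (λ (a , b) → +-identityʳ a , +-identityʳ b) }
            ; inverse = (λ (a , b) → -‿inverseˡ a , -‿inverseˡ b) , (λ (a , b) → -‿inverseʳ a , -‿inverseʳ b)
            ; ⁻¹-cong = λ (p , q) → -‿cong p , -‿cong q }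
          ; comm = λ (a , b) (c , d) → +-comm a c , +-comm b d }
        ; *-cong = λ (p , q) (r , s) → +-cong (*-cong p r) (-‿cong (*-cong q s)) , +-cong (*-cong p s) (*-cong q r)
        ; *-assoc = λ (a , b) (c , d) (e , f) →
            solve 6 (λ a b c d e f → (a :* c :- b :* d) :* e :- (a :* d :+ b :* c) :* f := a :* (c :* e :- d :* f) :- b :* (c :* f :+ d :* e)) refl a b c d e f ,
            solve 6 (λ a b c d e f → (a :* c :- b :* d) :* f :+ (a :* d :+ b :* c) :* e := a :* (c :* f :+ d :* e) :+ b :* (c :* e :- d :* f)) refl a b c d e f
        ; *-identity =
            (λ (a , b) → solve 2 (λ a b → con (+ 1) :* a :- con (+ 0) :* b := a) refl a b , solve 2 (λ a b → con (+ 1) :* b :+ con (+ 0) :* a := b) refl a b) ,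
            (λ (a , b) → solve 2 (λ a b → a :* con (+ 1) :- b :* con (+ 0) := a) refl a b , solve 2 (λ a b → a :* con (+ 0) :+ b :* con (+ 1) := b) refl a b)
        ; distrib =
            (λ (a , b) (c , d) (e , f) →
              solve 6 (λ a b c d e f → a :* (c :+ e) :- b :* (d :+ f) := (a :* c :- b :* d) :+ (a :* e :- b :* f)) refl a b c d e f ,
              solve 6 (λ a b c d e f → a :* (d :+ f) :+ b :* (c :+ e) := (a :* d :+ b :* c) :+ (a :* f :+ b :* e)) refl a b c d e f) ,
            (λ (a , b) (c , d) (e , f) →
              solve 6 (λ a b c d e f → (c :+ e) :* a :- (d :+ f) :* b := (c :* a :- d :* b) :+ (e :* a :- f :* b)) refl a b c d e f ,
              solve 6 (λ a b c d e f → (c :+ e) :* b :+ (d :+ f) :* a := (c :* b :+ d :* a) :+ (e :* b :+ f :* a)) refl a b c d e f) }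
      ; *-comm = λ (a , b) (c , d) →
          solve 4 (λ a b c d → a :* c :- b :* d := c :* a :- d :* b) refl a b c d ,
          solve 4 (λ a b c d → a :* d :+ b :* c := c :* b :+ d :* a) refl a b c d } }

  complexStructure : ComplexStructure 𝓡
  complexStructure = record
    { commutativeRing = ℂ-commutativeRing
    ; re = proj₁ ; im = proj₂ ; mk = _,_ ; re-cong = proj₁ ; im-cong = proj₂ ; ext = _,_
    ; re-mk = λ _ _ → refl ; im-mk = λ _ _ → refl
    ; re-0 = refl ; im-0 = refl ; re-1 = refl ; im-1 = refl
    ; re-neg = λ _ → refl ; im-neg = λ _ → refl
    ; re-+ = λ _ _ → refl ; im-+ = λ _ _ → refl ; re-* = λ _ _ → refl ; im-* = λ _ _ → refl }

-- Avoiding the exceptional fibres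

module ExceptionalValues (em : ExcludedMiddle 0ℓ) (𝓡 : CompleteOrderedField) where
  open CompleteOrderedField 𝓡 using (0#; _<_)
  open Real em 𝓡
  open RealComplex 𝓡

  -- B is the least of 0 and the real parts of the list; a real c below it differs from every entry
  -- already in the real part.
  below-list : (S : List ℂ) → ∃ λ B → ∀ c → c < B → ¬ Any ((c , 0#) ≈ℂ_) S
  below-list []       = 0# , λ _ _ ()
  below-list (s ∷ S) = let (B , p) = below-list S in
    [ (λ B<s → B , λ { c c<B (here (e , _)) → <⇒≉ (<-trans c<B B<s) e ; c c<B (there a) → p c c<B a })
    , (λ s≤B → proj₁ s , λ { c c<s (here (e , _)) → <⇒≉ c<s e ; c c<s (there a) → p c (<-≤-trans c<s s≤B) a })
    ]′ (<-≤-connex B (proj₁ s))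

open import Data.Rational.Base using (_<_)

mainTheorem14 : ExcludedMiddle 0ℓ →
    (𝓡 : CompleteOrderedField) →
    let open RealComplex 𝓡 in
    (F : Poly ℚ 2) →
    (∀ (c : ℝ) → ∃₂ λ x y → evalℝ F (x ∷ y ∷ []) ≈ℝ c) →
    (Σ (List ℂ) λ S → ∀ (c : ℂ) → ¬ Any (c ≈ℂ_) S →
    Smooth ((F ⊗ℂ) -const c) × Isomorphism allℂ 𝔸¹⋆ (Curve ((F ⊗ℂ) -const c))) →
    Smooth (F ⊗ℂ) →
    Isomorphism ℚ̄ 𝔸¹⋆ (Curve (F ⊗ℂ)) →
    (a b : ℙ 1) → IsRealPoint a → IsRealPoint b →
    (φ : Isomorphism ℚ̄ (ℙ¹∖ a b) (Curve (F ⊗ℂ))) →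
    (φ̃ : Morphism ℚ̄ (fullℙ 1) (fullℙ 2)) →
    Extends φ̃ (Isomorphism.morphism φ) →
    ¬ (Morphism.apply φ̃ (a , tt) ∼ Morphism.apply φ̃ (b , tt)) →
    WeakApproximation (λ x y → evalℚ F (x ∷ y ∷ []) < 0ℚ)
mainTheorem14 em 𝓡 F surjective (S , fibre) _ _ a b _ _ φ φ̃ extends distinct =
  [ (λ vanishing → ⊥-elim (nonconstant vanishing)) , from-top-form ]′ (topForm F)
  where
  open RealComplex 𝓡
  module R = CompleteOrderedField 𝓡
  𝓒 = ComplexNumbers.complexStructure 𝓡
  open ExceptionalValues em 𝓡
  open Complex em 𝓡 𝓒 hiding (module R; ℂ)

  -- F takes the value 1, so it is not the zero function and a top form exists.
  nonconstant : ¬ (∀ x y → evalℂ F (x ∷ y ∷ []) ≈ℂ (R.0# , R.0#))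
  nonconstant vanishing = let (x , y , e) = surjective R.1# in
    R.0#≉1# (R.trans (R.sym (proj₁ (vanishing (ι x) (ι y)))) (R.trans (R.sym (proj₁ (evalℂ-ι F (x ∷ y ∷ [])))) e))

  param : ∀ c → c R.< proj₁ (below-list S) → CurveParam F (ι c)
  param c c<B = curveParam F (ι c) (proj₂ (fibre (ι c) (proj₂ (below-list S) c c<B)))

  from-top-form : TopForm F → WeakApproximation (λ x y → evalℚ F (x ∷ y ∷ []) < 0ℚ)
  from-top-form T = by em
    where
    open RealTopForm T
    by : Dec (∃₂ λ u v → HR u v R.0# R.< R.0#) → WeakApproximation (λ x y → evalℚ F (x ∷ y ∷ []) < 0ℚ)
    by (yes (u , v , H<0)) = Real.NegativeDirection.weak-approximation em 𝓡 F (TopForm.d T) (TopForm.H T) dehomogeniseᴿ homogeneousᴿ u v H<0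
    by (no nonnegative) =
      let (p₁ , p₂ , q₁ , q₂ , T[p] , T[q] , pq≉0) = two-zeros T a b φ φ̃ extends distinct
      in ⊥-elim (contradiction T surjective (λ u v H<0 → nonnegative (u , v , H<0)) p₁ p₂ q₁ q₂ T[p] T[q] pq≉0
                   (proj₁ (below-list S)) param)
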